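{- Let $D=\{(x,y)\in\mathbb Z_{>0}^2 : x>y\}$, and consider lines $l:y=kx+b$ with $k,b\in\mathbb Q$ and $l\cap D\neq\emptyset$. (1) If $k\in\mathbb Q$ and $k\ge -\dfrac{\ln\frac{3(2+\sqrt2)}{4}}{\ln\frac{2(2+\sqrt2)}{3}}\ (\approx -1.1432)$, then the generalized Markov numbers increase with $x$ along every line $l:y=kx+b$. (2) If $k\in\mathbb Q$ and $k\le -\dfrac{2\ln\left(\frac{1+\sqrt5}{2}\right)}{\ln\left(\frac{3(1+\sqrt5)}{2\sqrt5}\right)}\ (\approx -1.2417)$, then the generalized Markov numbers decrease with $x$ along every line $l:y=kx+b$. (3) If $k\in\mathbb Q$ and $-\dfrac{2\ln\left(\frac{1+\sqrt5}{2}\right)}{\ln\left(\frac{3(1+\sqrt5)}{2\sqrt5}\right)}<k<-\dfrac{\ln\frac{3(2+\sqrt2)}{4}}{\ln\frac{2(2+\sqrt2)}{3}}$, then for all but finitely many $b\in\mathbb Q$ such that the line $y=kx+b$ meets $D$, the generalized Markov numbers are not monotonic along the line $y=kx+b$ (that is, they neither increase nor decrease with $x$ along it). (4) Along any line $l$ along which the generalized Markov numbers are not monotonic, as the $x$-coordinate increases the generalized Markov numbers first decrease and then increase. (5) Let $l$ have slope $k<0$ and contain at least two points of $D$. Then the generalized Markov numbers are not monotonic along $l$ if and only if $r_l(u_l,v_l)<1$ and $r_l(z_l,w_l)>1$.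
   Context: Generalized Markov numbers. For $A=(x,y)\in\mathbb Z_{\ge0}^2$ with $y\le x$, $m_{x,y}=|OA|$ is the Markov distance from $O=(0,0)$ to $A$: the positive integer obtained from the element of the once-punctured torus cluster algebra attached to the left deformation of the segment $OA$ by specializing the three initial cluster variables to $1$. Concretely, for coprime $(x,y)$ the number $m_{x,y}$ is the Markov number attached to the Farey fraction $y/x$: $m_{1,0}=m_{0,1}=1$, $m_{1,1}=2$, and whenever $(a,b),(c,d)\in\mathbb Z_{\ge0}^2$ satisfy $|ad-bc|=1$ and $\{(a,b),(c,d)\}\ne\{(1,0),(0,1)\}$, $m_{a+c,b+d}=3m_{a,b}m_{c,d}-m_{|a-c|,|b-d|}$ (e.g. $m_{2,1}=5$, $m_{3,1}=13$, $m_{3,2}=29$). For non-coprime points: if $q,p$ are coprime and $f_n=m_{nq,np}$, then $f_0=0$, $f_1=m_{q,p}$, $f_n=3f_1f_{n-1}-f_{n-2}$ for $n\ge2$. For $(x,y)\in D$ the number $m_{x,y}$ is called a generalized Markov number. Lines. For a line $l:y=kx+b$ with $k,b\in\mathbb Q$, list the points of $D\cap l$ as $(x_1,y_1),(x_2,y_2),\dots$ with $x_1<x_2<\cdots$. The ratio along $l$ at $(x_i,y_i)$ (when $(x_{i+1},y_{i+1})$ exists) is $r_l(x_i,y_i)=m_{x_{i+1},y_{i+1}}/m_{x_i,y_i}$. The generalized Markov numbers increase (resp. decrease) with $x$ along $l$ if $r_l(x_i,y_i)\ge1$ (resp. $\le1$) for all $i$; they are monotonic along $l$ if they increase or decrease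 along $l$. "First decrease and then increase" means that there is an index $i_0$ such that $m_{x_i,y_i}\ge m_{x_{i+1},y_{i+1}}$ for $i<i_0$ and $m_{x_i,y_i}\le m_{x_{i+1},y_{i+1}}$ for $i\ge i_0$. $(u_l,v_l),(u'_l,v'_l)$ denote the first two points of $D\cap l$; if $k<0$, $(z_l,w_l),(z'_l,w'_l)$ denote the last two points of $D\cap l$ (so $(z_l,w_l)$ is the next-to-last point). -}

module Defs where

open import Data.Nat as ℕ using (ℕ; zero; suc; ∣_-_∣)
open import Data.Nat.Coprimality using (Coprime)
import Data.Nat.Properties as ℕP
import Data.Nat.Tactic.RingSolver as ℕR
open import Data.Integer as ℤ using (ℤ; +_)
import Data.Integer.Properties as ℤP
import Data.Integer.Tactic.RingSolver as ℤR
open import Data.Rational as ℚ using (ℚ; 0ℚ; 1ℚ; _≟_; ≢-nonZero)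
open import Data.Nat.Divisibility using (∣m∣n⇒∣m+n; ∣-refl; _∣0)
open import Data.Product using (_×_; _,_; proj₁; proj₂; ∃-syntax)
open import Data.Sum using (_⊎_; inj₁; inj₂)
open import Data.Empty using (⊥; ⊥-elim)
open import Relation.Nullary using (¬_; yes; no)
open import Relation.Binary.PropositionalEquality
  using (_≡_; _≢_; refl; sym; trans; cong; cong₂; subst; module ≡-Reasoning)

fromℤ : ℤ → ℚ
fromℤ i = i ℚ./ 1

-- Total division, with the junk value x ⊘ 0 = 0.
infixl 7 _⊘_
_⊘_ : ℚ → ℚ → ℚ
x ⊘ y with y ≟ 0ℚ
... | yes _   = 0ℚ
... | no  y≢0 = ℚ._÷_ x y {{≢-nonZero y≢0}}

sumBelow : ℕ → (ℕ → ℚ) → ℚ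
sumBelow zero    f = 0ℚ
sumBelow (suc n) f = sumBelow n f ℚ.+ f n

-- Real numbers, presented by sequences of rationals converging to them.
--
-- Arithmetic is termwise.  The type does not carry a proof of convergence:
-- the operations below turn convergent sequences into convergent sequences,
-- with the expected limit, provided that radicands and arguments of ln are
-- positive and divisors are nonzero in the limit.

ℝ : Set
ℝ = ℕ → ℚ

fromℚ : ℚ → ℝ
fromℚ q _ = q

real : ℕ → ℝ
real n = fromℚ (fromℤ (+ n))

infixl 6 _⊕_
infixl 7 _⊗_ _⊘ʳ_
infix  8 ⊖_

_⊕_ _⊗_ _⊘ʳ_ : ℝ → ℝ → ℝ
(x ⊕ y)  n = x n ℚ.+ y n
(x ⊗ y)  n = x n ℚ.* y n
(x ⊘ʳ y) n = x n ⊘ y n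

⊖_ : ℝ → ℝ
(⊖ x) n = ℚ.- (x n)

-- Heron's iteration s ↦ (s + a / s) / 2, started at s = a; for a > 0 it
-- converges to the positive square root of a.
√ : ℚ → ℝ
√ a zero    = a
√ a (suc n) = (√ a n ℚ.+ a ⊘ √ a n) ℚ.* ℚ.½

-- ln x = ∫₁ˣ dt / t: the n-th term is the Riemann sum of 1 / t over the
-- n equal subintervals of [1 , xₙ], evaluated at their endpoints nearer to 1.
ln : ℝ → ℝ
ln x n = sumBelow n λ i → h ⊘ (1ℚ ℚ.+ fromℤ (+ i) ℚ.* h)
  where
  h : ℚ
  h = (x n ℚ.- 1ℚ) ⊘ fromℤ (+ n)

-- The order of the limits.
infix 4 _<ʳ_ _≤ʳ_

_<ʳ_ : ℝ → ℝ → Set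
x <ʳ y = ∃[ ε ] (0ℚ ℚ.< ε × ∃[ N ] (∀ n → N ℕ.≤ n → x n ℚ.+ ε ℚ.≤ y n))

_≤ʳ_ : ℝ → ℝ → Set
x ≤ʳ y = ∀ ε → 0ℚ ℚ.< ε → ∃[ N ] (∀ n → N ℕ.≤ n → x n ℚ.≤ y n ℚ.+ ε)

√2 √5 : ℝ
√2 = √ (fromℤ (+ 2))
√5 = √ (fromℤ (+ 5))

-- ≈ -1.1432
κ₁ : ℝ
κ₁ = ⊖ (ln (real 3 ⊗ (real 2 ⊕ √2) ⊘ʳ real 4) ⊘ʳ
        ln (real 2 ⊗ (real 2 ⊕ √2) ⊘ʳ real 3))

-- ≈ -1.2417
κ₂ : ℝ
κ₂ = ⊖ (real 2 ⊗ ln ((real 1 ⊕ √5) ⊘ʳ real 2) ⊘ʳ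
        ln (real 3 ⊗ (real 1 ⊕ √5) ⊘ʳ (real 2 ⊗ √5)))

Point : Set
Point = ℕ × ℕ

-- These equations determine m uniquely; markov at the end of this
-- file is a solution.
record IsMarkov (m : ℕ → ℕ → ℤ) : Set where
  field
    m-1-0 : m 1 0 ≡ + 1
    m-0-1 : m 0 1 ≡ + 1
    m-1-1 : m 1 1 ≡ + 2
    farey : ∀ a b c d → ∣ a ℕ.* d - b ℕ.* c ∣ ≡ 1 →
            ¬ ((a , b) ≡ (1 , 0) × (c , d) ≡ (0 , 1)) →
            ¬ ((a , b) ≡ (0 , 1) × (c , d) ≡ (1 , 0)) →
            m (a ℕ.+ c) (b ℕ.+ d)
              ≡ + 3 ℤ.* m a b ℤ.* m c d ℤ.- m ∣ a - c ∣ ∣ b - d ∣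
    m-0-0 : m 0 0 ≡ + 0
    multiple : ∀ q p → Coprime q p → ∀ n →
            m ((2 ℕ.+ n) ℕ.* q) ((2 ℕ.+ n) ℕ.* p)
              ≡ + 3 ℤ.* m q p ℤ.* m ((1 ℕ.+ n) ℕ.* q) ((1 ℕ.+ n) ℕ.* p)
                ℤ.- m (n ℕ.* q) (n ℕ.* p)

InD : Point → Set
InD (x , y) = 0 ℕ.< y × y ℕ.< x

OnLine : ℚ → ℚ → Point → Set
OnLine k b (x , y) = fromℤ (+ y) ≡ k ℚ.* fromℤ (+ x) ℚ.+ b

InD∩l : ℚ → ℚ → Point → Set
InD∩l k b P = InD P × OnLine k b P

MeetsD : ℚ → ℚ → Set
MeetsD k b = ∃[ P ] InD∩l k b P

MeetsDTwice : ℚ → ℚ → Set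
MeetsDTwice k b = ∃[ P ] ∃[ Q ] (P ≢ Q × InD∩l k b P × InD∩l k b Q)

-- P and Q are (xᵢ , yᵢ) and (xᵢ₊₁ , yᵢ₊₁) for some i.
record Consecutive (k b : ℚ) (P Q : Point) : Set where
  field
    left    : InD∩l k b P
    right   : InD∩l k b Q
    ordered : proj₁ P ℕ.< proj₁ Q
    noneBetween : ∀ R → InD∩l k b R →
                  proj₁ R ℕ.≤ proj₁ P ⊎ proj₁ Q ℕ.≤ proj₁ R

IsFirst IsLast : ℚ → ℚ → Point → Set
IsFirst k b P = InD∩l k b P × (∀ R → InD∩l k b R → proj₁ P ℕ.≤ proj₁ R)
IsLast  k b P = InD∩l k b P × (∀ R → InD∩l k b R → proj₁ R ℕ.≤ proj₁ P)

FirstTwo LastTwo : ℚ → ℚ → Point → Point → Set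
FirstTwo k b P Q = IsFirst k b P × Consecutive k b P Q
LastTwo  k b P Q = Consecutive k b P Q × IsLast k b Q

module _ (m : ℕ → ℕ → ℤ) where

  -- The ratio at P along a line on which P and Q are consecutive.
  ratio : Point → Point → ℚ
  ratio (x , y) (x′ , y′) = fromℤ (m x′ y′) ⊘ fromℤ (m x y)

  IncreaseAlong DecreaseAlong MonotonicAlong : ℚ → ℚ → Set
  IncreaseAlong k b = ∀ P Q → Consecutive k b P Q → 1ℚ ℚ.≤ ratio P Q
  DecreaseAlong k b = ∀ P Q → Consecutive k b P Q → ratio P Q ℚ.≤ 1ℚ
  MonotonicAlong k b = IncreaseAlong k b ⊎ DecreaseAlong k b

  -- The index i₀ is represented by the point T = (x_{i₀} , y_{i₀}), so that
  -- i < i₀ reads xᵢ < x_{i₀}.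
  FirstDecreaseThenIncrease : ℚ → ℚ → Set
  FirstDecreaseThenIncrease k b =
    ∃[ T ] (InD∩l k b T ×
      (∀ P Q → Consecutive k b P Q →
        (proj₁ P ℕ.< proj₁ T → value Q ℤ.≤ value P) ×
        (proj₁ T ℕ.≤ proj₁ P → value P ℤ.≤ value Q)))
    where
    value : Point → ℤ
    value (x , y) = m x y

-- The sequence f₀ = 0, f₁ = l, fₙ = 3 f₁ fₙ₋₁ - fₙ₋₂.
cheb : ℤ → ℕ → ℤ
cheb l 0             = + 0
cheb l 1             = l
cheb l (suc (suc n)) = + 3 ℤ.* l ℤ.* cheb l (suc n) ℤ.- cheb l n

-- euclid n s t l r d is the value at s L + t R, where L and R are Farey
-- neighbours with values l and r, and d is the value at ± (L - R).  The
-- first argument bounds the number of steps of the subtractive algorithm.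
euclid : ℕ → ℕ → ℕ → ℤ → ℤ → ℤ → ℤ
euclid _       s       zero    l r d = cheb l s
euclid _       zero    (suc t) l r d = cheb r (suc t)
euclid zero    (suc s) (suc t) l r d = + 0
euclid (suc n) (suc s) (suc t) l r d with t ℕ.≤? s
... | yes _ = euclid n (s ℕ.∸ t) (suc t) l (+ 3 ℤ.* l ℤ.* r ℤ.- d) r
... | no  _ = euclid n (suc s) (t ℕ.∸ s) (+ 3 ℤ.* l ℤ.* r ℤ.- d) r l

-- The initial d = 1 makes the value at (1 , 1) equal to 3 · 1 · 1 - 1 = 2.
markov : ℕ → ℕ → ℤ
markov x y = euclid (x ℕ.+ y) x y (+ 1) (+ 1) (+ 1)

private
  E : ℕ → ℕ → ℤ → ℤ → ℤ → ℤ
  E s t = euclid (s ℕ.+ t) s t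

  M : ℤ → ℤ → ℤ → ℤ
  M l r d = + 3 ℤ.* l ℤ.* r ℤ.- d

  fuel-suc : ∀ n s t l r d → s ℕ.+ t ℕ.≤ n →
             euclid (suc n) s t l r d ≡ euclid n s t l r d
  fuel-suc n s zero l r d _ = refl
  fuel-suc n zero (suc t) l r d _ = refl
  fuel-suc (suc n) (suc s) (suc t) l r d (ℕ.s≤s le) with t ℕ.≤? s
  ... | yes t≤s = fuel-suc n (s ℕ.∸ t) (suc t) l (M l r d) r
          (ℕP.≤-trans (ℕP.+-monoˡ-≤ (suc t) (ℕP.m∸n≤m s t)) le)
  ... | no  _   = fuel-suc n (suc s) (t ℕ.∸ s) (M l r d) r l
          (ℕP.≤-trans (ℕP.+-monoʳ-≤ (suc s) (ℕP.m∸n≤m t s))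
            (subst (ℕ._≤ n) (ℕP.+-suc s t) le))

  fuel-+ : ∀ j s t l r d → euclid (j ℕ.+ (s ℕ.+ t)) s t l r d ≡ E s t l r d
  fuel-+ zero    s t l r d = refl
  fuel-+ (suc j) s t l r d = trans
    (fuel-suc (j ℕ.+ (s ℕ.+ t)) s t l r d (ℕP.m≤n+m (s ℕ.+ t) j))
    (fuel-+ j s t l r d)

  fuel-≥ : ∀ n s t l r d → s ℕ.+ t ℕ.≤ n → euclid n s t l r d ≡ E s t l r d
  fuel-≥ n s t l r d le = trans
    (cong (λ k → euclid k s t l r d) (sym (ℕP.m∸n+n≡m le)))
    (fuel-+ (n ℕ.∸ (s ℕ.+ t)) s t l r d)

  E-zeroˡ : ∀ t l r d → E 0 t l r d ≡ cheb r t
  E-zeroˡ zero    l r d = refl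
  E-zeroˡ (suc t) l r d = refl

  stepˡ : ∀ s t l r d → E (t ℕ.+ s) t l r d ≡ E s t l (M l r d) r
  stepˡ s zero    l r d = refl
  stepˡ s (suc t) l r d with t ℕ.≤? t ℕ.+ s
  ... | no  t≰  = ⊥-elim (t≰ (ℕP.m≤m+n t s))
  ... | yes _ rewrite ℕP.m+n∸m≡n t s =
          fuel-≥ (t ℕ.+ s ℕ.+ suc t) s (suc t) l (M l r d) r
            (ℕP.+-monoˡ-≤ (suc t) (ℕP.m≤n+m s t))

  stepʳ : ∀ s t l r d → E s (s ℕ.+ t) l r d ≡ E s t (M l r d) r l
  stepʳ zero    t l r d = trans (E-zeroˡ t l r d) (sym (E-zeroˡ t (M l r d) r l))
  stepʳ (suc s) zero l r d rewrite ℕP.+-identityʳ s =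
    subst (λ k → E k (suc s) l r d ≡ cheb (M l r d) (suc s))
      (cong suc (ℕP.+-identityʳ s)) (stepˡ 0 (suc s) l r d)
  stepʳ (suc s) (suc t) l r d with s ℕ.+ suc t ℕ.≤? s
  ... | yes le = ⊥-elim (ℕP.m+1+n≰m s le)
  ... | no _ rewrite ℕP.m+n∸m≡n s (suc t) =
          fuel-≥ (s ℕ.+ suc (s ℕ.+ suc t)) (suc s) (suc t) (M l r d) r l
            (subst (ℕ._≤ s ℕ.+ suc (s ℕ.+ suc t)) (ℕP.+-suc s (suc t))
              (ℕP.+-monoʳ-≤ s (ℕ.s≤s (ℕP.m≤n+m (suc t) s))))

  stepˡ≡ : ∀ {x} s t → x ≡ t ℕ.+ s → ∀ l r d →
           E x t l r d ≡ E s t l (M l r d) r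
  stepˡ≡ s t refl = stepˡ s t

  stepʳ≡ : ∀ {y} s t → y ≡ s ℕ.+ t → ∀ l r d →
           E s y l r d ≡ E s t (M l r d) r l
  stepʳ≡ s t refl = stepʳ s t

  Unimodular : ℕ → ℕ → ℕ → ℕ → Set
  Unimodular a b e f = a ℕ.* f ≡ suc (b ℕ.* e) ⊎ b ℕ.* e ≡ suc (a ℕ.* f)

  unimodular-swap : ∀ a b e f → Unimodular a b e f → Unimodular b a f e
  unimodular-swap a b e f (inj₁ p) = inj₂ p
  unimodular-swap a b e f (inj₂ p) = inj₁ p

  unimodular-flip : ∀ a b e f → Unimodular a b e f → Unimodular e f a b
  unimodular-flip a b e f (inj₁ p) =
    inj₂ (trans (ℕP.*-comm f a) (trans p (cong suc (ℕP.*-comm b e))))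
  unimodular-flip a b e f (inj₂ p) =
    inj₁ (trans (ℕP.*-comm e b) (trans p (cong suc (ℕP.*-comm a f))))

  unimodular-shear : ∀ a b e f → Unimodular (b ℕ.+ a) b (f ℕ.+ e) f →
                     Unimodular a b e f
  unimodular-shear a b e f (inj₁ p) = inj₁ (ℕP.+-cancelˡ-≡ (b ℕ.* f) _ _
    (trans (i₁ a b f) (trans p (i₂ b e f))))
    where
    i₁ : ∀ a b f → b ℕ.* f ℕ.+ a ℕ.* f ≡ (b ℕ.+ a) ℕ.* f
    i₁ = ℕR.solve-∀
    i₂ : ∀ b e f → suc (b ℕ.* (f ℕ.+ e)) ≡ b ℕ.* f ℕ.+ suc (b ℕ.* e)
    i₂ = ℕR.solve-∀
  unimodular-shear a b e f (inj₂ p) = inj₂ (ℕP.+-cancelˡ-≡ (b ℕ.* f) _ _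
    (trans (i₁ b e f) (trans p (i₂ a b f))))
    where
    i₁ : ∀ b e f → b ℕ.* f ℕ.+ b ℕ.* e ≡ b ℕ.* (f ℕ.+ e)
    i₁ = ℕR.solve-∀
    i₂ : ∀ a b f → suc ((b ℕ.+ a) ℕ.* f) ≡ b ℕ.* f ℕ.+ suc (a ℕ.* f)
    i₂ = ℕR.solve-∀

  -- If a > b and e < f then only (a , b) = (1 , 0), (e , f) = (0 , 1) remain.
  unimodular-opposite : ∀ b i e j →
    Unimodular (suc b ℕ.+ i) b e (suc e ℕ.+ j) →
    (b ≡ 0 × i ≡ 0) × (e ≡ 0 × j ≡ 0)
  unimodular-opposite b i e j u = split u
    where
    rest : ℕ
    rest = b ℕ.* j ℕ.+ i ℕ.* e ℕ.+ i ℕ.* j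
    expand : ∀ b i e j → (suc b ℕ.+ i) ℕ.* (suc e ℕ.+ j)
      ≡ suc (b ℕ.* e ℕ.+ ((b ℕ.+ i) ℕ.+ (e ℕ.+ j)
          ℕ.+ (b ℕ.* j ℕ.+ i ℕ.* e ℕ.+ i ℕ.* j)))
    expand = ℕR.solve-∀
    split : Unimodular (suc b ℕ.+ i) b e (suc e ℕ.+ j) →
            (b ≡ 0 × i ≡ 0) × (e ≡ 0 × j ≡ 0)
    split (inj₂ p) = ⊥-elim (ℕP.m+1+n≢m (b ℕ.* e)
      (sym (trans p (trans (cong suc (expand b i e j))
        (sym (trans (ℕP.+-suc (b ℕ.* e) _)
          (cong suc (ℕP.+-suc (b ℕ.* e) _))))))))
    split (inj₁ p) = (ℕP.m+n≡0⇒m≡0 b bi , ℕP.m+n≡0⇒n≡0 b bi)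
                   , (ℕP.m+n≡0⇒m≡0 e ej , ℕP.m+n≡0⇒n≡0 e ej)
      where
      all0 : (b ℕ.+ i) ℕ.+ (e ℕ.+ j) ℕ.+ rest ≡ 0
      all0 = ℕP.+-cancelˡ-≡ (b ℕ.* e) _ _
        (trans (ℕP.suc-injective (trans (sym (expand b i e j)) p))
          (sym (ℕP.+-identityʳ (b ℕ.* e))))
      bi : b ℕ.+ i ≡ 0
      bi = ℕP.m+n≡0⇒m≡0 (b ℕ.+ i) (ℕP.m+n≡0⇒m≡0 ((b ℕ.+ i) ℕ.+ (e ℕ.+ j)) all0)
      ej : e ℕ.+ j ≡ 0
      ej = ℕP.m+n≡0⇒n≡0 (b ℕ.+ i) (ℕP.m+n≡0⇒m≡0 ((b ℕ.+ i) ℕ.+ (e ℕ.+ j)) all0)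

  data Sides : ℕ → ℕ → ℕ → ℕ → Set where
    below : ∀ a b e f → Sides (b ℕ.+ a) b (f ℕ.+ e) f
    above : ∀ a b e f → Sides a (a ℕ.+ b) e (e ℕ.+ f)
    apart₁ : ∀ b i e j → Sides (suc b ℕ.+ i) b e (suc e ℕ.+ j)
    apart₂ : ∀ a i f j → Sides a (suc a ℕ.+ i) (suc f ℕ.+ j) f

  sides : ∀ a b e f → Sides a b e f
  sides a b e f with ℕP.≤-total b a | ℕP.≤-total f e
  ... | inj₁ p | inj₁ q
    rewrite sym (ℕP.m+[n∸m]≡n p) | sym (ℕP.m+[n∸m]≡n q) = below _ b _ f
  ... | inj₂ p | inj₂ q
    rewrite sym (ℕP.m+[n∸m]≡n p) | sym (ℕP.m+[n∸m]≡n q) = above a _ e _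
  ... | inj₁ p | inj₂ q with ℕP.m≤n⇒m<n∨m≡n p | ℕP.m≤n⇒m<n∨m≡n q
  ...   | inj₂ refl | _ rewrite sym (ℕP.m+[n∸m]≡n q) =
          subst (λ k → Sides b k e (e ℕ.+ (f ℕ.∸ e))) (ℕP.+-identityʳ b)
            (above b 0 e (f ℕ.∸ e))
  ...   | inj₁ _ | inj₂ refl rewrite sym (ℕP.m+[n∸m]≡n p) =
          subst (λ k → Sides (b ℕ.+ (a ℕ.∸ b)) b k e) (ℕP.+-identityʳ e)
            (below (a ℕ.∸ b) b 0 e)
  ...   | inj₁ b<a | inj₁ e<f
    rewrite sym (ℕP.m+[n∸m]≡n b<a) | sym (ℕP.m+[n∸m]≡n e<f) = apart₁ b _ e _
  sides a b e f | inj₂ p | inj₁ q with ℕP.m≤n⇒m<n∨m≡n p | ℕP.m≤n⇒m<n∨m≡n q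
  ...   | inj₂ refl | _ rewrite sym (ℕP.m+[n∸m]≡n q) =
          subst (λ k → Sides k a (f ℕ.+ (e ℕ.∸ f)) f) (ℕP.+-identityʳ a)
            (below 0 a (e ℕ.∸ f) f)
  ...   | inj₁ _ | inj₂ refl rewrite sym (ℕP.m+[n∸m]≡n p) =
          subst (λ k → Sides a (a ℕ.+ (b ℕ.∸ a)) f k) (ℕP.+-identityʳ f)
            (above a (b ℕ.∸ a) f 0)
  ...   | inj₁ a<b | inj₁ f<e
    rewrite sym (ℕP.m+[n∸m]≡n a<b) | sym (ℕP.m+[n∸m]≡n f<e) = apart₂ a _ f _

  descend : ∀ a b e f n → Unimodular a b e f →
            (b ℕ.+ a) ℕ.+ b ℕ.+ ((f ℕ.+ e) ℕ.+ f) ℕ.≤ suc n →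
            a ℕ.+ b ℕ.+ (e ℕ.+ f) ℕ.≤ n
  descend a zero e zero n (inj₁ p) le
    with () ← trans (sym p) (ℕP.*-zeroʳ a)
  descend a zero e zero n (inj₂ ()) le
  descend a (suc b) e f n u le = ℕ.s≤s⁻¹ (ℕP.≤-trans
    (subst (suc (a ℕ.+ suc b ℕ.+ (e ℕ.+ f)) ℕ.≤_) (i₁ a b e f)
      (ℕP.m≤m+n (suc (a ℕ.+ suc b ℕ.+ (e ℕ.+ f))) (b ℕ.+ f))) le)
    where
    i₁ : ∀ a b e f → suc (a ℕ.+ suc b ℕ.+ (e ℕ.+ f)) ℕ.+ (b ℕ.+ f)
       ≡ (suc b ℕ.+ a) ℕ.+ suc b ℕ.+ ((f ℕ.+ e) ℕ.+ f)
    i₁ = ℕR.solve-∀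
  descend a zero e (suc f) n u le = ℕ.s≤s⁻¹ (ℕP.≤-trans
    (subst (suc (a ℕ.+ 0 ℕ.+ (e ℕ.+ suc f)) ℕ.≤_) (i₁ a e f)
      (ℕP.m≤m+n (suc (a ℕ.+ 0 ℕ.+ (e ℕ.+ suc f))) f)) le)
    where
    i₁ : ∀ a e f → suc (a ℕ.+ 0 ℕ.+ (e ℕ.+ suc f)) ℕ.+ f
       ≡ a ℕ.+ 0 ℕ.+ ((suc f ℕ.+ e) ℕ.+ suc f)
    i₁ = ℕR.solve-∀

  combine : ∀ {x x′ y y′ z z′ w w′ : ℤ} → x ≡ x′ → y ≡ y′ → z ≡ z′ → w ≡ w′ →
            x′ ≡ + 3 ℤ.* y′ ℤ.* z′ ℤ.- w′ → x ≡ + 3 ℤ.* y ℤ.* z ℤ.- w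
  combine refl refl refl refl p = p

  doubling : ∀ n a b e f → a ℕ.+ b ℕ.+ (e ℕ.+ f) ℕ.≤ n →
    Unimodular a b e f → ∀ l r d →
    E (a ℕ.+ (a ℕ.+ e)) (b ℕ.+ (b ℕ.+ f)) l r d
      ≡ + 3 ℤ.* E a b l r d ℤ.* E (a ℕ.+ e) (b ℕ.+ f) l r d ℤ.- E e f l r d
  doubling zero zero zero zero zero _ (inj₁ ())
  doubling zero zero zero zero zero _ (inj₂ ())
  doubling (suc n) a b e f le u l r d with sides a b e f
  ... | below a′ _ e′ _ = combine
          (stepˡ≡ (a′ ℕ.+ (a′ ℕ.+ e′)) (b ℕ.+ (b ℕ.+ f)) (i₁ a′ b e′ f) l r d)
          (stepˡ a′ b l r d)
          (stepˡ≡ (a′ ℕ.+ e′) (b ℕ.+ f) (i₂ a′ b e′ f) l r d)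
          (stepˡ e′ f l r d)
          (doubling n a′ b e′ f (descend a′ b e′ f n u′ le) u′ l (M l r d) r)
    where
    u′ : Unimodular a′ b e′ f
    u′ = unimodular-shear a′ b e′ f u
    i₁ : ∀ a b e f → b ℕ.+ a ℕ.+ (b ℕ.+ a ℕ.+ (f ℕ.+ e))
       ≡ b ℕ.+ (b ℕ.+ f) ℕ.+ (a ℕ.+ (a ℕ.+ e))
    i₁ = ℕR.solve-∀
    i₂ : ∀ a b e f → b ℕ.+ a ℕ.+ (f ℕ.+ e) ≡ b ℕ.+ f ℕ.+ (a ℕ.+ e)
    i₂ = ℕR.solve-∀
  ... | above _ b′ _ f′ = combine
          (stepʳ≡ (a ℕ.+ (a ℕ.+ e)) (b′ ℕ.+ (b′ ℕ.+ f′)) (i₁ a b′ e f′) l r d)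
          (stepʳ a b′ l r d)
          (stepʳ≡ (a ℕ.+ e) (b′ ℕ.+ f′) (i₂ a b′ e f′) l r d)
          (stepʳ e f′ l r d)
          (doubling n a b′ e f′
            (subst (ℕ._≤ n) (i₄ a b′ e f′)
              (descend b′ a f′ e n (unimodular-swap a b′ e f′ u′)
                (subst (ℕ._≤ suc n) (i₃ a b′ e f′) le)))
            u′ (M l r d) r l)
    where
    u′ : Unimodular a b′ e f′
    u′ = unimodular-swap b′ a f′ e
      (unimodular-shear b′ a f′ e (unimodular-swap a (a ℕ.+ b′) e (e ℕ.+ f′) u))
    i₁ : ∀ a b e f → a ℕ.+ b ℕ.+ (a ℕ.+ b ℕ.+ (e ℕ.+ f))
       ≡ a ℕ.+ (a ℕ.+ e) ℕ.+ (b ℕ.+ (b ℕ.+ f))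
    i₁ = ℕR.solve-∀
    i₂ : ∀ a b e f → a ℕ.+ b ℕ.+ (e ℕ.+ f) ≡ a ℕ.+ e ℕ.+ (b ℕ.+ f)
    i₂ = ℕR.solve-∀
    i₃ : ∀ a b e f → a ℕ.+ (a ℕ.+ b) ℕ.+ (e ℕ.+ (e ℕ.+ f))
       ≡ (a ℕ.+ b) ℕ.+ a ℕ.+ ((e ℕ.+ f) ℕ.+ e)
    i₃ = ℕR.solve-∀
    i₄ : ∀ a b e f → b ℕ.+ a ℕ.+ (f ℕ.+ e) ≡ a ℕ.+ b ℕ.+ (e ℕ.+ f)
    i₄ = ℕR.solve-∀
  ... | apart₁ _ i _ j with unimodular-opposite b i e j u
  ...   | (refl , refl) , (refl , refl) = i₁ l r d
    where
    i₁ : ∀ l r d → + 3 ℤ.* l ℤ.* (+ 3 ℤ.* l ℤ.* r ℤ.- d) ℤ.- r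
       ≡ + 3 ℤ.* l ℤ.* (+ 3 ℤ.* l ℤ.* r ℤ.- d) ℤ.- r
    i₁ l r d = refl
  doubling (suc n) a b e f le u l r d | apart₂ _ i _ j
    with unimodular-opposite a i f j (unimodular-swap a b e f u)
  ...   | (refl , refl) , (refl , refl) = i₁ (M l r d) r l
    where
    i₁ : ∀ m r l → + 3 ℤ.* m ℤ.* r ℤ.- l ≡ + 3 ℤ.* r ℤ.* m ℤ.- l
    i₁ = ℤR.solve-∀

  open ≡-Reasoning

  distinct : ∀ m n → ∣ m - n ∣ ≡ 1 → m ≡ suc n ⊎ n ≡ suc m
  distinct zero          (suc zero)    _ = inj₂ refl
  distinct (suc zero)    zero          _ = inj₁ refl
  distinct (suc m) (suc n) p with distinct m n p
  ... | inj₁ q = inj₁ (cong suc q)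
  ... | inj₂ q = inj₂ (cong suc q)

  unimodular : ∀ a b c d → ∣ a ℕ.* d - b ℕ.* c ∣ ≡ 1 → Unimodular a b c d
  unimodular a b c d = distinct (a ℕ.* d) (b ℕ.* c)

  E-farey : ∀ a b c d → Unimodular a b c d →
    ¬ ((a , b) ≡ (1 , 0) × (c , d) ≡ (0 , 1)) →
    ¬ ((a , b) ≡ (0 , 1) × (c , d) ≡ (1 , 0)) → ∀ l r δ →
    E (a ℕ.+ c) (b ℕ.+ d) l r δ
      ≡ + 3 ℤ.* E a b l r δ ℤ.* E c d l r δ ℤ.- E ∣ a - c ∣ ∣ b - d ∣ l r δ
  E-farey a b c d u n₁ n₂ l r δ with sides a c b d
  ... | apart₁ _ i _ j = ⊥-elim (bad (unimodular-opposite′ c i b j u))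
    where
    unimodular-opposite′ : ∀ c i b j →
      Unimodular (suc c ℕ.+ i) b c (suc b ℕ.+ j) →
      (c ≡ 0 × i ≡ 0) × (b ≡ 0 × j ≡ 0)
    unimodular-opposite′ c i b j (inj₁ p) =
      unimodular-opposite c i b j (inj₁ (trans p (cong suc (ℕP.*-comm b c))))
    unimodular-opposite′ c i b j (inj₂ p) =
      unimodular-opposite c i b j (inj₂ (trans (ℕP.*-comm c b) p))
    bad : (c ≡ 0 × i ≡ 0) × (b ≡ 0 × j ≡ 0) → ⊥
    bad ((refl , refl) , (refl , refl)) = n₁ (refl , refl)
  ... | apart₂ _ i _ j = ⊥-elim (bad (unimodular-opposite″ a i d j u))
    where
    unimodular-opposite″ : ∀ a i d j →
      Unimodular a (suc d ℕ.+ j) (suc a ℕ.+ i) d →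
      (a ≡ 0 × i ≡ 0) × (d ≡ 0 × j ≡ 0)
    unimodular-opposite″ a i d j (inj₁ p) = unimodular-opposite a i d j
      (inj₂ (trans p (cong suc (ℕP.*-comm (suc d ℕ.+ j) (suc a ℕ.+ i)))))
    unimodular-opposite″ a i d j (inj₂ p) = unimodular-opposite a i d j
      (inj₁ (trans (ℕP.*-comm (suc a ℕ.+ i) (suc d ℕ.+ j)) p))
    bad : (a ≡ 0 × i ≡ 0) × (d ≡ 0 × j ≡ 0) → ⊥
    bad ((refl , refl) , (refl , refl)) = n₂ (refl , refl)
  ... | below e _ f _ = begin
      E (c ℕ.+ e ℕ.+ c) (d ℕ.+ f ℕ.+ d) l r δ
        ≡⟨ cong₂ (λ x y → E x y l r δ) (ℕP.+-comm (c ℕ.+ e) c) (ℕP.+-comm (d ℕ.+ f) d) ⟩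
      E (c ℕ.+ (c ℕ.+ e)) (d ℕ.+ (d ℕ.+ f)) l r δ
        ≡⟨ doubling _ c d e f ℕP.≤-refl
             (difference c d e f (unimodular-flip _ _ c d u)) l r δ ⟩
      + 3 ℤ.* E c d l r δ ℤ.* E (c ℕ.+ e) (d ℕ.+ f) l r δ ℤ.- E e f l r δ
        ≡⟨ cong₂ ℤ._-_ (swap (E c d l r δ) (E (c ℕ.+ e) (d ℕ.+ f) l r δ))
             (cong₂ (λ x y → E x y l r δ) (sym (dist c e)) (sym (dist d f))) ⟩
      + 3 ℤ.* E (c ℕ.+ e) (d ℕ.+ f) l r δ ℤ.* E c d l r δ
        ℤ.- E ∣ c ℕ.+ e - c ∣ ∣ d ℕ.+ f - d ∣ l r δ ∎
    where
    swap : ∀ x y → + 3 ℤ.* x ℤ.* y ≡ + 3 ℤ.* y ℤ.* x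
    swap = ℤR.solve-∀
    dist : ∀ m n → ∣ m ℕ.+ n - m ∣ ≡ n
    dist m n = trans (ℕP.∣-∣-comm (m ℕ.+ n) m) (ℕP.∣m-m+n∣≡n m n)
    difference : ∀ c d e f → Unimodular c d (c ℕ.+ e) (d ℕ.+ f) → Unimodular c d e f
    difference c d e f (inj₁ p) = inj₁ (ℕP.+-cancelˡ-≡ (c ℕ.* d) _ _
      (trans (sym (ℕP.*-distribˡ-+ c d f)) (trans p (i₁ c d e))))
      where
      i₁ : ∀ c d e → suc (d ℕ.* (c ℕ.+ e)) ≡ c ℕ.* d ℕ.+ suc (d ℕ.* e)
      i₁ = ℕR.solve-∀
    difference c d e f (inj₂ p) = inj₂ (ℕP.+-cancelˡ-≡ (d ℕ.* c) _ _
      (trans (sym (ℕP.*-distribˡ-+ d c e)) (trans p (i₁ c d f))))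
      where
      i₁ : ∀ c d f → suc (c ℕ.* (d ℕ.+ f)) ≡ d ℕ.* c ℕ.+ suc (c ℕ.* f)
      i₁ = ℕR.solve-∀
  ... | above _ e _ f = begin
      E (a ℕ.+ (a ℕ.+ e)) (b ℕ.+ (b ℕ.+ f)) l r δ
        ≡⟨ doubling _ a b e f ℕP.≤-refl (difference a b e f u) l r δ ⟩
      + 3 ℤ.* E a b l r δ ℤ.* E (a ℕ.+ e) (b ℕ.+ f) l r δ ℤ.- E e f l r δ
        ≡⟨ cong₂ (λ x y → + 3 ℤ.* E a b l r δ ℤ.* E (a ℕ.+ e) (b ℕ.+ f) l r δ
             ℤ.- E x y l r δ) (sym (ℕP.∣m-m+n∣≡n a e)) (sym (ℕP.∣m-m+n∣≡n b f)) ⟩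
      + 3 ℤ.* E a b l r δ ℤ.* E (a ℕ.+ e) (b ℕ.+ f) l r δ
        ℤ.- E ∣ a - a ℕ.+ e ∣ ∣ b - b ℕ.+ f ∣ l r δ ∎
    where
    difference : ∀ c d e f → Unimodular c d (c ℕ.+ e) (d ℕ.+ f) → Unimodular c d e f
    difference c d e f (inj₁ p) = inj₁ (ℕP.+-cancelˡ-≡ (c ℕ.* d) _ _
      (trans (sym (ℕP.*-distribˡ-+ c d f)) (trans p (i₁ c d e))))
      where
      i₁ : ∀ c d e → suc (d ℕ.* (c ℕ.+ e)) ≡ c ℕ.* d ℕ.+ suc (d ℕ.* e)
      i₁ = ℕR.solve-∀
    difference c d e f (inj₂ p) = inj₂ (ℕP.+-cancelˡ-≡ (d ℕ.* c) _ _
      (trans (sym (ℕP.*-distribˡ-+ d c e)) (trans p (i₁ c d f))))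
      where
      i₁ : ∀ c d f → suc (c ℕ.* (d ℕ.+ f)) ≡ d ℕ.* c ℕ.+ suc (c ℕ.* f)
      i₁ = ℕR.solve-∀

  coprime-shearˡ : ∀ q p → Coprime (p ℕ.+ q) p → Coprime q p
  coprime-shearˡ q p co (x , y) = co (∣m∣n⇒∣m+n y x , y)

  coprime-shearʳ : ∀ q p → Coprime q (q ℕ.+ p) → Coprime q p
  coprime-shearʳ q p co (x , y) = co (x , ∣m∣n⇒∣m+n x y)

  E-multiple : ∀ k q p → q ℕ.+ p ℕ.≤ k → Coprime q p → ∀ n l r d →
    E (n ℕ.* q) (n ℕ.* p) l r d ≡ cheb (E q p l r d) n
  E-multiple k q zero le co n l r d
    with refl ← co (∣-refl {q} , q ∣0)
    rewrite ℕP.*-identityʳ n | ℕP.*-zeroʳ n = refl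
  E-multiple k zero (suc p) le co n l r d
    with refl ← co (suc p ∣0 , ∣-refl {suc p})
    rewrite ℕP.*-identityʳ n | ℕP.*-zeroʳ n = E-zeroˡ n l r d
  E-multiple (suc k) (suc q) (suc p) (ℕ.s≤s le) co n l r d
    with ℕP.≤-total (suc p) (suc q)
  ... | inj₁ p≤q = shear (ℕP.m+[n∸m]≡n p≤q)
    where
    s = suc q ℕ.∸ suc p
    shear : suc p ℕ.+ s ≡ suc q → _
    shear eq = trans
      (stepˡ≡ (n ℕ.* s) (n ℕ.* suc p)
        (trans (cong (n ℕ.*_) (sym eq)) (ℕP.*-distribˡ-+ n (suc p) s)) l r d)
      (trans
        (E-multiple k s (suc p)
          (ℕP.≤-trans (ℕP.+-monoˡ-≤ (suc p) (ℕP.m∸n≤m q p)) le)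
          (coprime-shearˡ s (suc p) (subst (λ z → Coprime z (suc p)) (sym eq) co))
          n l (M l r d) r)
        (cong (λ z → cheb z n) (sym (stepˡ≡ s (suc p) (sym eq) l r d))))
  ... | inj₂ q≤p = shear (ℕP.m+[n∸m]≡n q≤p)
    where
    s = suc p ℕ.∸ suc q
    shear : suc q ℕ.+ s ≡ suc p → _
    shear eq = trans
      (stepʳ≡ (n ℕ.* suc q) (n ℕ.* s)
        (trans (cong (n ℕ.*_) (sym eq)) (ℕP.*-distribˡ-+ n (suc q) s)) l r d)
      (trans
        (E-multiple k (suc q) s
          (ℕP.≤-trans (ℕP.+-monoʳ-≤ (suc q) (ℕP.m∸n≤m p q))
            (subst (ℕ._≤ k) (ℕP.+-suc q p) le))
          (coprime-shearʳ (suc q) s (subst (Coprime (suc q)) (sym eq) co))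
          n (M l r d) r l)
        (cong (λ z → cheb z n) (sym (stepʳ≡ (suc q) s (sym eq) l r d))))

markov-isMarkov : IsMarkov markov
markov-isMarkov = record
  { m-1-0 = refl
  ; m-0-1 = refl
  ; m-1-1 = refl
  ; farey = λ a b c d u n₁ n₂ →
      E-farey a b c d (unimodular a b c d u) n₁ n₂ (+ 1) (+ 1) (+ 1)
  ; m-0-0 = refl
  ; multiple = λ q p co n → combine {y = markov q p}
      (E-multiple _ q p ℕP.≤-refl co (2 ℕ.+ n) (+ 1) (+ 1) (+ 1)) refl
      (E-multiple _ q p ℕP.≤-refl co (1 ℕ.+ n) (+ 1) (+ 1) (+ 1))
      (E-multiple _ q p ℕP.≤-refl co n (+ 1) (+ 1) (+ 1)) refl
  }

{-# OPTIONS --safe #-}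
module Submission where

-- T = 3 m extends to an even function on ℤ² with T(P + R) + T(P - R) = T(P) T(R)
-- for every basis P, R of ℤ².  Let u be primitive, τ = T(u) and Δ = τ² - 4.  Over
-- ℤ[√Δ], and up to scaling, the values of T on the cone spanned by a basis u, w are
-- traces of words in two matrices A, B with nonnegative entries, where A is diagonal
-- with first entry λ = (τ + √Δ) / 2.  Hence T(i u + j w) ≥ λⁱ γʲ, where γ is the first
-- entry of B.  Applied to u and to -u this gives T(Q + v) T(Q - v) ≥ T(Q)² for all Q
-- and v that are not parallel.  So m is log-convex, and therefore unimodal, along every
-- line of negative slope, which settles (4) and (5).
--
-- Among the points n u + j w, j ≥ 1, a step by u multiplies T by at most λ and a step
-- by w by at least γ, with asymptotic equality as n grows.  The line of slope -p/q is
-- decided near the diagonal (u = (1,1), w = (1,0)) and near the x-axis (u = (1,0),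
-- w = (0,1)), where a step amounts to comparing a power of γ with a power of λ; the two
-- thresholds are the corresponding quotients of logarithms.  Powers are compared with
-- the Riemann sums defining ln through (1 - s/N)⁻ᴺ and (1 + z/N)ᴺ.

open import Defs
open import Data.Nat using (ℕ)
open import Data.Integer using (ℤ)
open import Data.Rational using (ℚ; 0ℚ; 1ℚ; _<_)
open import Data.List using (List)
open import Data.List.Membership.Propositional using (_∉_)
open import Data.Product using (Σ; _×_)
open import Function.Bundles using (_⇔_)
open import Relation.Nullary using (¬_)

open import Algebra.Bundles using (CommutativeRing)
open import Data.Empty using (⊥; ⊥-elim)
open import Data.Fin using (Fin; zero; suc)
open import Data.Integer as ℤ using (+_; -[1+_]; +0)
import Data.Integer.Properties as ℤP
import Data.Integer.Tactic.RingSolver as ℤR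
open import Data.List using (cartesianProductWith; upTo)
open import Data.List.Membership.Propositional using (_∈_)
open import Data.List.Membership.Propositional.Properties using (∈-cartesianProductWith⁺; ∈-upTo⁺)
open import Data.Maybe using (Maybe; just; nothing)
open import Data.Nat as ℕ using (zero; suc; NonZero)
open import Data.Nat.Coprimality as Coprimality using (Coprime)
import Data.Nat.DivMod as ℕD
open import Data.Nat.Divisibility using (divides; ∣1⇒≡1)
import Data.Nat.Properties as ℕP
import Data.Nat.Tactic.RingSolver as ℕR
open import Data.Product using (_,_; proj₁; proj₂; ∃-syntax)
open import Data.Rational as ℚ using (mkℚ; ½; *≤*; *<*)
import Data.Rational.Properties as ℚP
import Data.Rational.Unnormalised as ℚᵘ
import Data.Rational.Unnormalised.Properties as ℚᵘP
open import Data.Sum using (_⊎_; inj₁; inj₂)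
open import Function.Bundles using (mk⇔)
open import Level using (0ℓ)
open import Relation.Binary.Definitions using (tri<; tri≈; tri>)
open import Relation.Binary.PropositionalEquality
  using (_≡_; _≢_; refl; sym; trans; cong; cong₂; subst; subst₂; isEquivalence)
open import Relation.Nullary using (Dec; yes; no)
import Tactic.RingSolver as RingSolver
import Tactic.RingSolver.Core.AlmostCommutativeRing as ACR

-- The even extension to ℤ²

Vec² : Set
Vec² = ℤ × ℤ

infixl 6 _⊞_ _⊟_
infixl 7 _·_
_⊞_ _⊟_ : Vec² → Vec² → Vec²
(a , b) ⊞ (c , d) = a ℤ.+ c , b ℤ.+ d
(a , b) ⊟ (c , d) = a ℤ.- c , b ℤ.- d

neg : Vec² → Vec²
neg (a , b) = ℤ.- a , ℤ.- b

_·_ : ℕ → Vec² → Vec²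
n · (a , b) = + n ℤ.* a , + n ℤ.* b

det : Vec² → Vec² → ℤ
det (a , b) (c , d) = a ℤ.* d ℤ.- b ℤ.* c

Unimodular : Vec² → Vec² → Set
Unimodular P R = ℤ.∣ det P R ∣ ≡ 1

unimodular-negˡ : ∀ P R → Unimodular P R → Unimodular (neg P) R
unimodular-negˡ (a , b) (c , d) u =
  trans (trans (cong ℤ.∣_∣ (i₁ a b c d)) (ℤP.∣-i∣≡∣i∣ (a ℤ.* d ℤ.- b ℤ.* c))) u
  where
  i₁ : ∀ a b c d → ℤ.- a ℤ.* d ℤ.- ℤ.- b ℤ.* c ≡ ℤ.- (a ℤ.* d ℤ.- b ℤ.* c)
  i₁ = ℤR.solve-∀

unimodular-swap : ∀ P R → Unimodular P R → Unimodular R P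
unimodular-swap (a , b) (c , d) u =
  trans (trans (cong ℤ.∣_∣ (i₁ a b c d)) (ℤP.∣-i∣≡∣i∣ (a ℤ.* d ℤ.- b ℤ.* c))) u
  where
  i₁ : ∀ a b c d → c ℤ.* b ℤ.- d ℤ.* a ≡ ℤ.- (a ℤ.* d ℤ.- b ℤ.* c)
  i₁ = ℤR.solve-∀

unimodular-shear : ∀ P R → Unimodular P R → Unimodular P (P ⊞ R)
unimodular-shear (a , b) (c , d) u = trans (cong ℤ.∣_∣ (i₁ a b c d)) u
  where
  i₁ : ∀ a b c d → a ℤ.* (b ℤ.+ d) ℤ.- b ℤ.* (a ℤ.+ c) ≡ a ℤ.* d ℤ.- b ℤ.* c
  i₁ = ℤR.solve-∀

neg-neg : ∀ P → neg (neg P) ≡ P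
neg-neg (a , b) = cong₂ _,_ (ℤP.neg-involutive a) (ℤP.neg-involutive b)

⊞-comm : ∀ P R → P ⊞ R ≡ R ⊞ P
⊞-comm (a , b) (c , d) = cong₂ _,_ (ℤP.+-comm a c) (ℤP.+-comm b d)

neg-⊟ : ∀ P R → neg (P ⊟ R) ≡ R ⊟ P
neg-⊟ (a , b) (c , d) = cong₂ _,_ (i₁ a c) (i₁ b d)
  where
  i₁ : ∀ a c → ℤ.- (a ℤ.- c) ≡ c ℤ.- a
  i₁ = ℤR.solve-∀

neg-⊞ : ∀ P R → neg P ⊞ R ≡ R ⊟ P
neg-⊞ (a , b) (c , d) = cong₂ _,_ (ℤP.+-comm (ℤ.- a) c) (ℤP.+-comm (ℤ.- b) d)

⊟-neg : ∀ P R → P ⊟ neg R ≡ P ⊞ R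
⊟-neg (a , b) (c , d) = cong₂ _,_ (i₁ a c) (i₁ b d)
  where
  i₁ : ∀ a c → a ℤ.- ℤ.- c ≡ a ℤ.+ c
  i₁ = ℤR.solve-∀

module FareyFunction (f : Vec² → ℤ) (even : ∀ P → f (neg P) ≡ f P) where

  Farey : Vec² → Vec² → Set
  Farey P R = f (P ⊞ R) ℤ.+ f (P ⊟ R) ≡ + 3 ℤ.* (f P ℤ.* f R)

  farey-swap : ∀ P R → Farey P R → Farey R P
  farey-swap P R p = trans
    (cong₂ ℤ._+_ (cong f (⊞-comm R P)) (trans (cong f (sym (neg-⊟ P R))) (even (P ⊟ R))))
    (trans p (cong (+ 3 ℤ.*_) (ℤP.*-comm (f P) (f R))))

  farey-negˡ : ∀ P R → Farey P R → Farey (neg P) R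
  farey-negˡ P R p = trans
    (cong₂ ℤ._+_
      (trans (cong f (trans (neg-⊞ P R) (sym (neg-⊟ P R)))) (even (P ⊟ R)))
      (trans (sym (even (neg P ⊟ R)))
        (cong f (trans (neg-⊟ (neg P) R) (trans (⊟-neg R P) (⊞-comm R P))))))
    (trans (ℤP.+-comm (f (P ⊟ R)) (f (P ⊞ R)))
      (trans p (cong (λ z → + 3 ℤ.* (z ℤ.* f R)) (sym (even P)))))

  farey-negʳ : ∀ P R → Farey P R → Farey P (neg R)
  farey-negʳ P R p = farey-swap (neg R) P (farey-negˡ R P (farey-swap P R p))

-- m extends to an even function on ℤ²: the three cones spanned by
-- consecutive vectors of (0,1), (1,0), (1,-1), (0,-1) all carry a copy of m.
module Extension (m : ℕ → ℕ → ℤ) (M : IsMarkov m) where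
  open IsMarkov M

  axes : ∀ n → m n 0 ≡ m 0 n
  axes n = proj₁ (both n)
    where
    recurrence : ∀ n → m (suc (suc n)) 0 ≡ + 3 ℤ.* m (suc n) 0 ℤ.- m n 0
    recurrence n = trans (cong₂ m (sym (ℕP.*-identityʳ (2 ℕ.+ n))) (sym (ℕP.*-zeroʳ (2 ℕ.+ n))))
      (trans (multiple 1 0 (λ { (d , _) → ∣1⇒≡1 d }) n)
        (cong₂ ℤ._-_
          (cong₂ ℤ._*_ (cong (+ 3 ℤ.*_) m-1-0) (cong₂ m (ℕP.*-identityʳ (1 ℕ.+ n)) (ℕP.*-zeroʳ (1 ℕ.+ n))))
          (cong₂ m (ℕP.*-identityʳ n) (ℕP.*-zeroʳ n))))
    recurrence′ : ∀ n → m 0 (suc (suc n)) ≡ + 3 ℤ.* m 0 (suc n) ℤ.- m 0 n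
    recurrence′ n = trans (cong₂ m (sym (ℕP.*-zeroʳ (2 ℕ.+ n))) (sym (ℕP.*-identityʳ (2 ℕ.+ n))))
      (trans (multiple 0 1 (λ { (_ , d) → ∣1⇒≡1 d }) n)
        (cong₂ ℤ._-_
          (cong₂ ℤ._*_ (cong (+ 3 ℤ.*_) m-0-1) (cong₂ m (ℕP.*-zeroʳ (1 ℕ.+ n)) (ℕP.*-identityʳ (1 ℕ.+ n))))
          (cong₂ m (ℕP.*-zeroʳ n) (ℕP.*-identityʳ n))))
    both : ∀ n → m n 0 ≡ m 0 n × m (suc n) 0 ≡ m 0 (suc n)
    both zero    = refl , trans m-1-0 (sym m-0-1)
    both (suc n) with p , q ← both n = q ,
      trans (recurrence n) (trans (cong₂ (λ x y → + 3 ℤ.* x ℤ.- y) q p) (sym (recurrence′ n)))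

  -- The value at ± (x , -y).
  skew : ℕ → ℕ → ℤ
  skew x y with y ℕ.≤? x
  ... | yes _ = m (x ℕ.∸ y) y
  ... | no  _ = m x (y ℕ.∸ x)

  skew-below : ∀ s t → skew (s ℕ.+ t) t ≡ m s t
  skew-below s t with t ℕ.≤? s ℕ.+ t
  ... | yes _ = cong (λ z → m z t) (ℕP.m+n∸n≡m s t)
  ... | no ¬p = ⊥-elim (¬p (ℕP.m≤n+m t s))

  skew-above : ∀ s t → skew s (s ℕ.+ t) ≡ m s t
  skew-above s t with s ℕ.+ t ℕ.≤? s
  ... | no _ = cong (m s) (ℕP.m+n∸m≡n s t)
  skew-above s zero | yes _ rewrite ℕP.+-identityʳ s | ℕP.n∸n≡0 s = sym (axes s)
  skew-above s (suc t) | yes p = ⊥-elim (ℕP.m+1+n≰m s p)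

  skew-axis : ∀ s → skew s 0 ≡ m s 0
  skew-axis s with 0 ℕ.≤? s
  ... | yes _ = refl
  ... | no ¬p = ⊥-elim (¬p ℕ.z≤n)

  ext : Vec² → ℤ
  ext (+ x , + y)           = m x y
  ext (+ x , -[1+ y ])      = skew x (suc y)
  ext (-[1+ x ] , + y)      = skew (suc x) y
  ext (-[1+ x ] , -[1+ y ]) = m (suc x) (suc y)

  ext-even : ∀ P → ext (neg P) ≡ ext P
  ext-even (+ zero , + zero)   = refl
  ext-even (+ zero , + suc y)  = skew-above 0 (suc y)
  ext-even (+ suc x , + zero)  = skew-axis (suc x)
  ext-even (+ suc x , + suc y) = refl
  ext-even (+ zero , -[1+ y ]) = sym (skew-above 0 (suc y))
  ext-even (+ suc x , -[1+ y ]) = refl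
  ext-even (-[1+ x ] , + zero)  = sym (skew-axis (suc x))
  ext-even (-[1+ x ] , + suc y) = refl
  ext-even (-[1+ x ] , -[1+ y ]) = refl

  open FareyFunction ext ext-even

  G : Fin 3 → Vec² → Vec²
  G zero             (s , t) = s , t
  G (suc zero)       (s , t) = s ℤ.+ t , ℤ.- t
  G (suc (suc zero)) (s , t) = s , ℤ.- (s ℤ.+ t)

  pos : ℕ → ℕ → Vec²
  pos s t = + s , + t

  ext-G : ∀ i s t → ext (G i (pos s t)) ≡ m s t
  ext-G zero s t = refl
  ext-G (suc zero) s zero rewrite ℕP.+-identityʳ s = refl
  ext-G (suc zero) s (suc t) = skew-below s (suc t)
  ext-G (suc (suc zero)) zero zero = refl
  ext-G (suc (suc zero)) zero (suc t) = skew-above 0 (suc t)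
  ext-G (suc (suc zero)) (suc s) t = skew-above (suc s) t

  G-⊞ : ∀ i P R → G i (P ⊞ R) ≡ G i P ⊞ G i R
  G-⊞ zero (a , b) (c , d) = refl
  G-⊞ (suc zero) (a , b) (c , d) = cong₂ _,_ (i₁ a b c d) (i₂ b d)
    where
    i₁ : ∀ a b c d → (a ℤ.+ c) ℤ.+ (b ℤ.+ d) ≡ (a ℤ.+ b) ℤ.+ (c ℤ.+ d)
    i₁ = ℤR.solve-∀
    i₂ : ∀ b d → ℤ.- (b ℤ.+ d) ≡ ℤ.- b ℤ.+ ℤ.- d
    i₂ = ℤR.solve-∀
  G-⊞ (suc (suc zero)) (a , b) (c , d) = cong₂ _,_ refl (i₁ a b c d)
    where
    i₁ : ∀ a b c d → ℤ.- ((a ℤ.+ c) ℤ.+ (b ℤ.+ d)) ≡ ℤ.- (a ℤ.+ b) ℤ.+ ℤ.- (c ℤ.+ d)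
    i₁ = ℤR.solve-∀

  G-neg : ∀ i P → G i (neg P) ≡ neg (G i P)
  G-neg zero (a , b) = refl
  G-neg (suc zero) (a , b) = cong₂ _,_ (sym (ℤP.neg-distrib-+ a b)) refl
  G-neg (suc (suc zero)) (a , b) = cong₂ _,_ refl (cong ℤ.-_ (sym (ℤP.neg-distrib-+ a b)))

  G-det : ∀ i P R → ℤ.∣ det (G i P) (G i R) ∣ ≡ ℤ.∣ det P R ∣
  G-det zero P R = refl
  G-det (suc zero) (a , b) (c , d) = trans (cong ℤ.∣_∣ (i₁ a b c d)) (ℤP.∣-i∣≡∣i∣ (a ℤ.* d ℤ.- b ℤ.* c))
    where
    i₁ : ∀ a b c d → (a ℤ.+ b) ℤ.* ℤ.- d ℤ.- ℤ.- b ℤ.* (c ℤ.+ d) ≡ ℤ.- (a ℤ.* d ℤ.- b ℤ.* c)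
    i₁ = ℤR.solve-∀
  G-det (suc (suc zero)) (a , b) (c , d) = trans (cong ℤ.∣_∣ (i₁ a b c d)) (ℤP.∣-i∣≡∣i∣ (a ℤ.* d ℤ.- b ℤ.* c))
    where
    i₁ : ∀ a b c d → a ℤ.* ℤ.- (c ℤ.+ d) ℤ.- ℤ.- (a ℤ.+ b) ℤ.* c ≡ ℤ.- (a ℤ.* d ℤ.- b ℤ.* c)
    i₁ = ℤR.solve-∀

  ∣det∣-pos : ∀ a b c d → ℤ.∣ det (pos a b) (pos c d) ∣ ≡ ℕ.∣ a ℕ.* d - b ℕ.* c ∣
  ∣det∣-pos a b c d = trans
    (cong₂ (λ x y → ℤ.∣ x ℤ.- y ∣) (sym (ℤP.pos-* a d)) (sym (ℤP.pos-* b c)))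
    (trans (cong ℤ.∣_∣ (ℤP.m-n≡m⊖n (a ℕ.* d) (b ℕ.* c))) (abs-⊖ (a ℕ.* d) (b ℕ.* c)))
    where
    abs-⊖ : ∀ m n → ℤ.∣ m ℤ.⊖ n ∣ ≡ ℕ.∣ m - n ∣
    abs-⊖ m n with ℕP.≤-total m n
    ... | inj₁ p = trans (ℤP.∣⊖∣-≤ p) (sym (ℕP.m≤n⇒∣m-n∣≡n∸m p))
    ... | inj₂ p = trans (cong ℤ.∣_∣ (ℤP.⊖-≥ p))
                     (sym (trans (ℕP.∣-∣-comm m n) (ℕP.m≤n⇒∣m-n∣≡n∸m p)))

  -- Unimodular pairs whose difference has entries of opposite signs.
  opposite : ∀ a b i j → ℕ.∣ (suc a ℕ.+ i) ℕ.* (suc b ℕ.+ j) - b ℕ.* a ∣ ≡ 1 →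
             (a ≡ 0 × i ≡ 0) × (b ≡ 0 × j ≡ 0)
  opposite a b i j u = (ℕP.m+n≡0⇒m≡0 a ai , ℕP.m+n≡0⇒n≡0 a ai)
                     , (ℕP.m+n≡0⇒m≡0 b bj , ℕP.m+n≡0⇒n≡0 b bj)
    where
    rest = (a ℕ.+ i) ℕ.+ (b ℕ.+ j) ℕ.+ (a ℕ.* j ℕ.+ i ℕ.* b ℕ.+ i ℕ.* j)
    expand : ∀ a b i j → (suc a ℕ.+ i) ℕ.* (suc b ℕ.+ j)
      ≡ b ℕ.* a ℕ.+ suc ((a ℕ.+ i) ℕ.+ (b ℕ.+ j) ℕ.+ (a ℕ.* j ℕ.+ i ℕ.* b ℕ.+ i ℕ.* j))
    expand = ℕR.solve-∀
    r0 : rest ≡ 0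
    r0 = ℕP.suc-injective (trans (sym (trans (cong (λ z → ℕ.∣ z - b ℕ.* a ∣) (expand a b i j))
      (trans (ℕP.∣-∣-comm _ (b ℕ.* a)) (ℕP.∣m-m+n∣≡n (b ℕ.* a) (suc rest))))) u)
    ai : a ℕ.+ i ≡ 0
    ai = ℕP.m+n≡0⇒m≡0 (a ℕ.+ i) (ℕP.m+n≡0⇒m≡0 ((a ℕ.+ i) ℕ.+ (b ℕ.+ j)) r0)
    bj : b ℕ.+ j ≡ 0
    bj = ℕP.m+n≡0⇒n≡0 (a ℕ.+ i) (ℕP.m+n≡0⇒m≡0 ((a ℕ.+ i) ℕ.+ (b ℕ.+ j)) r0)

  module Quadrant (g : Vec² → ℤ) (g-pos : ∀ s t → g (pos s t) ≡ m s t)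
                  (g-even : ∀ P → g (neg P) ≡ g P) (g-skew : g (+ 1 , -[1+ 0 ]) ≡ + 1) where
    open FareyFunction g g-even renaming (Farey to Fareyᵍ; farey-swap to swapᵍ)

    differing : ∀ a b e f → ℕ.∣ (a ℕ.+ e) ℕ.* b - (b ℕ.+ f) ℕ.* a ∣ ≡ 1 →
      Fareyᵍ (pos (a ℕ.+ e) (b ℕ.+ f)) (pos a b)
    differing a b e f u = trans
      (cong₂ ℤ._+_ (trans (g-pos _ _) (farey (a ℕ.+ e) (b ℕ.+ f) a b u ¬1 ¬2))
        (trans (cong g (cong₂ _,_ (i₁ (+ a) (+ e)) (i₁ (+ b) (+ f)))) (g-pos e f)))
      (trans
        (cong₂ (λ x y → + 3 ℤ.* m (a ℕ.+ e) (b ℕ.+ f) ℤ.* m a b ℤ.- m x y ℤ.+ m e f)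
          (dist a e) (dist b f))
        (trans (i₂ (m (a ℕ.+ e) (b ℕ.+ f)) (m a b) (m e f))
          (cong₂ (λ x y → + 3 ℤ.* (x ℤ.* y)) (sym (g-pos _ _)) (sym (g-pos _ _)))))
      where
      dist : ∀ m n → ℕ.∣ m ℕ.+ n - m ∣ ≡ n
      dist m n = trans (ℕP.∣-∣-comm (m ℕ.+ n) m) (ℕP.∣m-m+n∣≡n m n)
      ¬1 : ¬ ((a ℕ.+ e , b ℕ.+ f) ≡ (1 , 0) × (a , b) ≡ (0 , 1))
      ¬1 (() , refl)
      ¬2 : ¬ ((a ℕ.+ e , b ℕ.+ f) ≡ (0 , 1) × (a , b) ≡ (1 , 0))
      ¬2 (() , refl)
      i₁ : ∀ a e → a ℤ.+ e ℤ.- a ≡ e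
      i₁ = ℤR.solve-∀
      i₂ : ∀ x y z → + 3 ℤ.* x ℤ.* y ℤ.- z ℤ.+ z ≡ + 3 ℤ.* (x ℤ.* y)
      i₂ = ℤR.solve-∀

    units : Fareyᵍ (pos 1 0) (pos 0 1)
    units = cong₂ ℤ._+_ (trans (g-pos 1 1) m-1-1) g-skew ∙
      sym (cong₂ (λ x y → + 3 ℤ.* (x ℤ.* y)) (trans (g-pos 1 0) m-1-0) (trans (g-pos 0 1) m-0-1))
      where
      _∙_ : ∀ {x y : ℤ} → x ≡ + 3 → + 3 ≡ y → x ≡ y
      _∙_ = trans

    flip : ∀ a b c d → ℕ.∣ a ℕ.* d - b ℕ.* c ∣ ≡ ℕ.∣ c ℕ.* b - d ℕ.* a ∣
    flip a b c d = trans (ℕP.∣-∣-comm (a ℕ.* d) (b ℕ.* c))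
      (cong₂ ℕ.∣_-_∣ (ℕP.*-comm b c) (ℕP.*-comm a d))

    comparable : ∀ {a b c d} → a ℕ.≤ c → b ℕ.≤ d → ℕ.∣ c ℕ.* b - d ℕ.* a ∣ ≡ 1 → Fareyᵍ (pos c d) (pos a b)
    comparable {a} {b} p q u with e , refl ← ℕP.m≤n⇒∃[o]m+o≡n p | f , refl ← ℕP.m≤n⇒∃[o]m+o≡n q =
      differing a b e f u

    crossing : ∀ {a b c d} → a ℕ.< c → d ℕ.< b → ℕ.∣ c ℕ.* b - d ℕ.* a ∣ ≡ 1 → Fareyᵍ (pos a b) (pos c d)
    crossing {a} {_} {_} {d} p q u
      with i , refl ← ℕP.m≤n⇒∃[o]m+o≡n p | j , refl ← ℕP.m≤n⇒∃[o]m+o≡n q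
      with (refl , refl) , (refl , refl) ← opposite a d i j u = swapᵍ (pos 1 0) (pos 0 1) units

    quadrant : ∀ a b c d → ℕ.∣ a ℕ.* d - b ℕ.* c ∣ ≡ 1 → Fareyᵍ (pos a b) (pos c d)
    quadrant a b c d u = by-order (ℕP.≤-total a c) (ℕP.≤-total b d)
      where
      u′ : ℕ.∣ c ℕ.* b - d ℕ.* a ∣ ≡ 1
      u′ = trans (sym (flip a b c d)) u
      below : a ℕ.≤ c → b ℕ.≤ d → Fareyᵍ (pos a b) (pos c d)
      below p q = swapᵍ (pos c d) (pos a b) (comparable p q u′)
      above : c ℕ.≤ a → d ℕ.≤ b → Fareyᵍ (pos a b) (pos c d)
      above p q = comparable p q u
      left-of : a ℕ.< c ⊎ a ≡ c → d ℕ.< b ⊎ d ≡ b → d ℕ.≤ b → Fareyᵍ (pos a b) (pos c d)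
      left-of (inj₁ p)  (inj₁ q)  _ = crossing p q u′
      left-of (inj₁ p)  (inj₂ eq) _ = below (ℕP.<⇒≤ p) (ℕP.≤-reflexive (sym eq))
      left-of (inj₂ eq) _         q = above (ℕP.≤-reflexive (sym eq)) q
      right-of : c ℕ.< a ⊎ c ≡ a → b ℕ.< d ⊎ b ≡ d → b ℕ.≤ d → Fareyᵍ (pos a b) (pos c d)
      right-of (inj₁ p)  (inj₁ q)  _ = swapᵍ (pos c d) (pos a b) (crossing p q u)
      right-of (inj₁ p)  (inj₂ eq) _ = above (ℕP.<⇒≤ p) (ℕP.≤-reflexive (sym eq))
      right-of (inj₂ eq) _         q = below (ℕP.≤-reflexive (sym eq)) q
      by-order : a ℕ.≤ c ⊎ c ℕ.≤ a → b ℕ.≤ d ⊎ d ℕ.≤ b → Fareyᵍ (pos a b) (pos c d)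
      by-order (inj₁ p) (inj₁ q) = below p q
      by-order (inj₂ p) (inj₂ q) = above p q
      by-order (inj₁ p) (inj₂ q) = left-of (ℕP.m≤n⇒m<n∨m≡n p) (ℕP.m≤n⇒m<n∨m≡n q) q
      by-order (inj₂ p) (inj₁ q) = right-of (ℕP.m≤n⇒m<n∨m≡n p) (ℕP.m≤n⇒m<n∨m≡n q) q

  cone : ∀ i s t s′ t′ → Unimodular (G i (pos s t)) (G i (pos s′ t′)) →
         Farey (G i (pos s t)) (G i (pos s′ t′))
  cone i s t s′ t′ u = trans
    (cong₂ ℤ._+_ (cong ext (sym (G-⊞ i _ _)))
      (cong ext (sym (trans (G-⊞ i (pos s t) (neg (pos s′ t′))) (cong (G i (pos s t) ⊞_) (G-neg i _))))))
    (Quadrant.quadrant (λ P → ext (G i P)) (ext-G i)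
      (λ P → trans (cong ext (G-neg i P)) (ext-even (G i P))) (skew-1 i) s t s′ t′
      (trans (sym (∣det∣-pos s t s′ t′)) (trans (sym (G-det i (pos s t) (pos s′ t′))) u)))
    where
    skew-1 : ∀ i → ext (G i (+ 1 , -[1+ 0 ])) ≡ + 1
    skew-1 zero             = trans (skew-below 0 1) m-0-1
    skew-1 (suc zero)       = m-0-1
    skew-1 (suc (suc zero)) = m-1-0

  product-one : ∀ a b → a ℕ.* b ≡ 1 → a ≡ 1 × b ≡ 1
  product-one a b p = ℕP.m*n≡1⇒m≡1 a b p , ℕP.m*n≡1⇒n≡1 a b p

  *1≡0 : ∀ a → a ℕ.* 1 ≡ 0 → a ≡ 0
  *1≡0 a p = trans (sym (ℕP.*-identityʳ a)) p

  1*≡0 : ∀ a → 1 ℕ.* a ≡ 0 → a ≡ 0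
  1*≡0 a p = trans (sym (ℕP.*-identityˡ a)) p

  data OneOfThree : ℕ → ℕ → ℕ → Set where
    1st : OneOfThree 1 0 0
    2nd : OneOfThree 0 1 0
    3rd : OneOfThree 0 0 1

  one-of-three : ∀ x y z → x ℕ.+ y ℕ.+ z ≡ 1 → OneOfThree x y z
  one-of-three zero zero z refl = 3rd
  one-of-three zero (suc zero) zero p = 2nd
  one-of-three (suc zero) zero zero p = 1st

  negated-sum : ∀ {d} a b a′ b′ a″ b″ → ℤ.∣ d ∣ ≡ 1 →
    d ≡ ℤ.- (+ a ℤ.* + b ℤ.+ + a′ ℤ.* + b′ ℤ.+ + a″ ℤ.* + b″) →
    OneOfThree (a ℕ.* b) (a′ ℕ.* b′) (a″ ℕ.* b″)
  negated-sum {d} a b a′ b′ a″ b″ u p = one-of-three _ _ _ (trans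
    (sym (cong ℤ.∣_∣ (trans (cong ℤ._+_ (cong₂ ℤ._+_ (sym (ℤP.pos-* a b)) (sym (ℤP.pos-* a′ b′))) ∙
      sym (ℤP.pos-* a″ b″)) refl)))
    (trans (sym (ℤP.∣-i∣≡∣i∣ S)) (trans (cong ℤ.∣_∣ (sym p)) u)))
    where
    S = + a ℤ.* + b ℤ.+ + a′ ℤ.* + b′ ℤ.+ + a″ ℤ.* + b″
    _∙_ : ∀ {f g : ℤ → ℤ} {x y : ℤ} → f ≡ g → x ≡ y → f x ≡ g y
    refl ∙ refl = refl

  -- Vectors of different cones form a basis only if one of them lies on a common ray.
  cones₀₁ : ∀ a b s t → Unimodular (G zero (pos a b)) (G (suc zero) (pos s t)) →
            Farey (pos a b) (G (suc zero) (pos s t))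
  cones₀₁ a b s t u with a ℕ.* t in p | b ℕ.* s in q | b ℕ.* t in r
                       | negated-sum a t b s b t u (i₁ (+ a) (+ b) (+ s) (+ t))
    where
    i₁ : ∀ a b s t → a ℤ.* ℤ.- t ℤ.- b ℤ.* (s ℤ.+ t) ≡ ℤ.- (a ℤ.* t ℤ.+ b ℤ.* s ℤ.+ b ℤ.* t)
    i₁ = ℤR.solve-∀
  ... | _ | _ | _ | 1st with refl , refl ← product-one a t p with refl ← *1≡0 b r =
        cone (suc zero) 1 0 s 1 u
  ... | _ | _ | _ | 2nd with refl , refl ← product-one b s q with refl ← 1*≡0 t r =
        cone zero a 1 1 0 u
  ... | _ | _ | _ | 3rd with refl , refl ← product-one b t r
        with refl ← *1≡0 a p | refl ← 1*≡0 s q =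
        farey-negˡ (+ 0 , -[1+ 0 ]) (+ 1 , -[1+ 0 ]) (cone (suc (suc zero)) 0 1 1 0 refl)

  cones₀₂ : ∀ a b s t → Unimodular (G zero (pos a b)) (G (suc (suc zero)) (pos s t)) →
            Farey (pos a b) (G (suc (suc zero)) (pos s t))
  cones₀₂ a b s t u with a ℕ.* s in p | a ℕ.* t in q | b ℕ.* s in r
                       | negated-sum a s a t b s u (i₁ (+ a) (+ b) (+ s) (+ t))
    where
    i₁ : ∀ a b s t → a ℤ.* ℤ.- (s ℤ.+ t) ℤ.- b ℤ.* s ≡ ℤ.- (a ℤ.* s ℤ.+ a ℤ.* t ℤ.+ b ℤ.* s)
    i₁ = ℤR.solve-∀
  ... | _ | _ | _ | 1st with refl , refl ← product-one a s p
        with refl ← 1*≡0 t q | refl ← *1≡0 b r =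
        cone (suc zero) 1 0 0 1 refl
  ... | _ | _ | _ | 2nd with refl , refl ← product-one a t q with refl ← 1*≡0 s p =
        farey-negʳ (pos 1 b) (pos 0 1) (cone zero 1 b 0 1
          (unimodular-swap (pos 0 1) (pos 1 b) (unimodular-negˡ (+ 0 , -[1+ 0 ]) (pos 1 b)
            (unimodular-swap (pos 1 b) (+ 0 , -[1+ 0 ]) u))))
  ... | _ | _ | _ | 3rd with refl , refl ← product-one b s r with refl ← *1≡0 a p =
        farey-negˡ (+ 0 , -[1+ 0 ]) (G (suc (suc zero)) (pos 1 t))
          (cone (suc (suc zero)) 0 1 1 t
            (unimodular-negˡ (pos 0 1) (G (suc (suc zero)) (pos 1 t)) u))

  cones₁₂ : ∀ a b s t → Unimodular (G (suc zero) (pos a b)) (G (suc (suc zero)) (pos s t)) →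
            Farey (G (suc zero) (pos a b)) (G (suc (suc zero)) (pos s t))
  cones₁₂ a b s t u with a ℕ.* s in p | a ℕ.* t in q | b ℕ.* t in r
                       | negated-sum a s a t b t u (i₁ (+ a) (+ b) (+ s) (+ t))
    where
    i₁ : ∀ a b s t → (a ℤ.+ b) ℤ.* ℤ.- (s ℤ.+ t) ℤ.- ℤ.- b ℤ.* s
       ≡ ℤ.- (a ℤ.* s ℤ.+ a ℤ.* t ℤ.+ b ℤ.* t)
    i₁ = ℤR.solve-∀
  ... | _ | _ | _ | 1st with refl , refl ← product-one a s p with refl ← 1*≡0 t q =
        cone (suc zero) 1 b 0 1 u
  ... | _ | _ | _ | 2nd with refl , refl ← product-one a t q
        with refl ← 1*≡0 s p | refl ← *1≡0 b r =
        farey-negʳ (pos 1 0) (pos 0 1) (cone zero 1 0 0 1 refl)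
  ... | _ | _ | _ | 3rd with refl , refl ← product-one b t r with refl ← *1≡0 a q =
        cone (suc (suc zero)) 1 0 s 1 u

  cones : ∀ i s t j s′ t′ → Unimodular (G i (pos s t)) (G j (pos s′ t′)) →
          Farey (G i (pos s t)) (G j (pos s′ t′))
  cones zero s t zero s′ t′ = cone zero s t s′ t′
  cones zero s t (suc zero) s′ t′ = cones₀₁ s t s′ t′
  cones zero s t (suc (suc zero)) s′ t′ = cones₀₂ s t s′ t′
  cones (suc zero) s t (suc zero) s′ t′ = cone (suc zero) s t s′ t′
  cones (suc zero) s t (suc (suc zero)) s′ t′ = cones₁₂ s t s′ t′
  cones (suc (suc zero)) s t (suc (suc zero)) s′ t′ = cone (suc (suc zero)) s t s′ t′
  cones (suc zero) s t zero s′ t′ u =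
    farey-swap (pos s′ t′) (G (suc zero) (pos s t)) (cones₀₁ s′ t′ s t
      (unimodular-swap (G (suc zero) (pos s t)) (pos s′ t′) u))
  cones (suc (suc zero)) s t zero s′ t′ u =
    farey-swap (pos s′ t′) (G (suc (suc zero)) (pos s t)) (cones₀₂ s′ t′ s t
      (unimodular-swap (G (suc (suc zero)) (pos s t)) (pos s′ t′) u))
  cones (suc (suc zero)) s t (suc zero) s′ t′ u =
    farey-swap (G (suc zero) (pos s′ t′)) (G (suc (suc zero)) (pos s t)) (cones₁₂ s′ t′ s t
      (unimodular-swap (G (suc (suc zero)) (pos s t)) (G (suc zero) (pos s′ t′)) u))

  data InCone : Vec² → Set where
    plus  : ∀ i s t → InCone (G i (pos s t))
    minus : ∀ i s t → InCone (neg (G i (pos s t)))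

  neg-inCone : ∀ {P} → InCone P → InCone (neg P)
  neg-inCone (plus i s t)  = minus i s t
  neg-inCone (minus i s t) = subst InCone (sym (neg-neg (G i (pos s t)))) (plus i s t)

  inCone : ∀ P → InCone P
  inCone (+ x , + y) = plus zero x y
  inCone (+ x , -[1+ y ]) = lower x y
    where
    lower : ∀ x y → InCone (+ x , -[1+ y ])
    lower x y with ℕP.≤-total (suc y) x
    ... | inj₁ p with e , refl ← ℕP.m≤n⇒∃[o]m+o≡n p =
          subst (λ z → InCone (+ z , -[1+ y ])) (ℕP.+-comm e (suc y)) (plus (suc zero) e (suc y))
    ... | inj₂ p with e , q ← ℕP.m≤n⇒∃[o]m+o≡n p =
          subst (λ z → InCone (+ x , ℤ.- (+ z))) q (plus (suc (suc zero)) x e)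
  inCone (-[1+ x ] , + zero)  = minus zero (suc x) 0
  inCone (-[1+ x ] , + suc y) = neg-inCone (inCone (+ suc x , -[1+ y ]))
  inCone (-[1+ x ] , -[1+ y ]) = minus zero (suc x) (suc y)

  ext-farey : ∀ P R → Unimodular P R → Farey P R
  ext-farey P R = by-cones (inCone P) (inCone R)
    where
    left : ∀ {Q} i s t → InCone Q → Unimodular (G i (pos s t)) Q → Farey (G i (pos s t)) Q
    left i s t (plus j s′ t′) u = cones i s t j s′ t′ u
    left i s t (minus j s′ t′) u =
      farey-negʳ Q′ Q (cones i s t j s′ t′
        (unimodular-swap Q Q′ (subst (λ Q → Unimodular Q Q′) (neg-neg Q)
          (unimodular-negˡ (neg Q) Q′ (unimodular-swap Q′ (neg Q) u)))))
      where
      Q  = G j (pos s′ t′)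
      Q′ = G i (pos s t)
    by-cones : ∀ {P Q} → InCone P → InCone Q → Unimodular P Q → Farey P Q
    by-cones (plus i s t) r u = left i s t r u
    by-cones {Q = Q} (minus i s t) r u = farey-negˡ (G i (pos s t)) Q (left i s t r
      (subst (λ P → Unimodular P Q) (neg-neg (G i (pos s t))) (unimodular-negˡ (neg (G i (pos s t))) Q u)))

  G-· : ∀ i n s t → n · G i (pos s t) ≡ G i (pos (n ℕ.* s) (n ℕ.* t))
  G-· zero n s t = cong₂ _,_ (sym (ℤP.pos-* n s)) (sym (ℤP.pos-* n t))
  G-· (suc zero) n s t = cong₂ _,_
    (trans (ℤP.*-distribˡ-+ (+ n) (+ s) (+ t)) (cong₂ ℤ._+_ (sym (ℤP.pos-* n s)) (sym (ℤP.pos-* n t))))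
    (trans (sym (ℤP.neg-distribʳ-* (+ n) (+ t))) (cong ℤ.-_ (sym (ℤP.pos-* n t))))
  G-· (suc (suc zero)) n s t = cong₂ _,_ (sym (ℤP.pos-* n s))
    (trans (sym (ℤP.neg-distribʳ-* (+ n) (+ s ℤ.+ + t)))
      (cong ℤ.-_ (trans (ℤP.*-distribˡ-+ (+ n) (+ s) (+ t)) (cong₂ ℤ._+_ (sym (ℤP.pos-* n s)) (sym (ℤP.pos-* n t))))))

  ·-neg : ∀ n P → n · neg P ≡ neg (n · P)
  ·-neg n (a , b) = cong₂ _,_ (sym (ℤP.neg-distribʳ-* (+ n) a)) (sym (ℤP.neg-distribʳ-* (+ n) b))

  Multiples : Vec² → Set
  Multiples P = ∀ n → ext ((2 ℕ.+ n) · P) ≡ + 3 ℤ.* ext P ℤ.* ext ((1 ℕ.+ n) · P) ℤ.- ext (n · P)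

  ext-multiple : ∀ P R → Unimodular P R → Multiples P
  ext-multiple P R = by-cone (inCone P)
    where
    on-cone : ∀ i s t → Unimodular (G i (pos s t)) R → Multiples (G i (pos s t))
    on-cone i s t u n = trans (at (2 ℕ.+ n)) (trans (multiple s t coprime n)
      (sym (cong₂ ℤ._-_ (cong₂ ℤ._*_ (cong (+ 3 ℤ.*_) (ext-G i s t)) (at (1 ℕ.+ n))) (at n))))
      where
      at : ∀ n → ext (n · G i (pos s t)) ≡ m (n ℕ.* s) (n ℕ.* t)
      at n = trans (cong ext (G-· i n s t)) (ext-G i (n ℕ.* s) (n ℕ.* t))
      det-· : ∀ d P R → ℤ.∣ det (d · P) R ∣ ≡ d ℕ.* ℤ.∣ det P R ∣
      det-· d (a , b) (a′ , b′) = trans (cong ℤ.∣_∣ (i₁ (+ d) a b a′ b′))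
        (ℤP.abs-* (+ d) (det (a , b) (a′ , b′)))
        where
        i₁ : ∀ d a b a′ b′ → d ℤ.* a ℤ.* b′ ℤ.- d ℤ.* b ℤ.* a′ ≡ d ℤ.* (a ℤ.* b′ ℤ.- b ℤ.* a′)
        i₁ = ℤR.solve-∀
      coprime : Coprime s t
      coprime {d} (divides s′ p , divides t′ q) = ℕP.m*n≡1⇒m≡1 d _ (trans
        (sym (det-· d (G i (pos s′ t′)) R))
        (trans (cong (λ P → ℤ.∣ det P R ∣) (trans (G-· i d s′ t′)
          (cong₂ (λ x y → G i (pos x y)) (trans (ℕP.*-comm d s′) (sym p)) (trans (ℕP.*-comm d t′) (sym q))))) u))
    by-cone : ∀ {P} → InCone P → Unimodular P R → Multiples P
    by-cone (plus i s t) u n = on-cone i s t u n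
    by-cone (minus i s t) u n = trans (at (2 ℕ.+ n)) (trans
      (on-cone i s t (subst (λ P → Unimodular P R) (neg-neg (G i (pos s t)))
        (unimodular-negˡ (neg (G i (pos s t))) R u)) n)
      (sym (cong₂ ℤ._-_ (cong₂ ℤ._*_ (cong (+ 3 ℤ.*_) (ext-even (G i (pos s t)))) (at (1 ℕ.+ n))) (at n))))
      where
      at : ∀ n → ext (n · neg (G i (pos s t))) ≡ ext (n · G i (pos s t))
      at n = trans (cong ext (·-neg n (G i (pos s t)))) (ext-even (n · G i (pos s t)))

-- Satisfied by the even extension to ℤ² of T = 3 m.
record IsTrace (T : Vec² → ℤ) : Set where
  field
    even     : ∀ P → T (neg P) ≡ T P
    farey    : ∀ P R → Unimodular P R → T (P ⊞ R) ℤ.+ T (P ⊟ R) ≡ T P ℤ.* T R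
    multiple : ∀ P R → Unimodular P R → ∀ n →
               T ((2 ℕ.+ n) · P) ℤ.+ T (n · P) ≡ T P ℤ.* T ((1 ℕ.+ n) · P)
    T-0   : T (+ 0 , + 0) ≡ + 0
    T-e₁  : T (+ 1 , + 0) ≡ + 3
    T-e₂  : T (+ 0 , + 1) ≡ + 3
    T-e₁₂ : T (+ 1 , + 1) ≡ + 6

module _ (m : ℕ → ℕ → ℤ) (M : IsMarkov m) where
  open Extension m M

  trace : Vec² → ℤ
  trace P = + 3 ℤ.* ext P

  trace-isTrace : IsTrace trace
  trace-isTrace = record
    { even = λ P → cong (+ 3 ℤ.*_) (ext-even P)
    ; farey = λ P R u → trans (sym (ℤP.*-distribˡ-+ (+ 3) (ext (P ⊞ R)) (ext (P ⊟ R))))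
        (trans (cong (+ 3 ℤ.*_) (ext-farey P R u)) (i₁ (ext P) (ext R)))
    ; multiple = λ P R u n → trans
        (cong (λ z → + 3 ℤ.* z ℤ.+ + 3 ℤ.* ext (n · P)) (ext-multiple P R u n))
        (i₂ (ext P) (ext ((1 ℕ.+ n) · P)) (ext (n · P)))
    ; T-0 = cong (+ 3 ℤ.*_) m-0-0
    ; T-e₁ = cong (+ 3 ℤ.*_) m-1-0
    ; T-e₂ = cong (+ 3 ℤ.*_) m-0-1
    ; T-e₁₂ = cong (+ 3 ℤ.*_) m-1-1
    }
    where
    open IsMarkov M
    i₁ : ∀ x y → + 3 ℤ.* (+ 3 ℤ.* (x ℤ.* y)) ≡ + 3 ℤ.* x ℤ.* (+ 3 ℤ.* y)
    i₁ = ℤR.solve-∀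
    i₂ : ∀ x y z → + 3 ℤ.* (+ 3 ℤ.* x ℤ.* y ℤ.- z) ℤ.+ + 3 ℤ.* z ≡ + 3 ℤ.* x ℤ.* (+ 3 ℤ.* y)
    i₂ = ℤR.solve-∀

module Integers where

  0≤-* : ∀ {i j} → + 0 ℤ.≤ i → + 0 ℤ.≤ j → + 0 ℤ.≤ i ℤ.* j
  0≤-* {+ i} {+ j} _ _ = subst (+ 0 ℤ.≤_) (ℤP.pos-* i j) (ℤ.+≤+ ℕ.z≤n)

  0≤-+ : ∀ {i j} → + 0 ℤ.≤ i → + 0 ℤ.≤ j → + 0 ℤ.≤ i ℤ.+ j
  0≤-+ = ℤP.+-mono-≤

  ≤-by : ∀ {i j k} → + 0 ℤ.≤ k → j ≡ i ℤ.+ k → i ℤ.≤ j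
  ≤-by {i} {_} {k} 0≤k refl = subst (ℤ._≤ i ℤ.+ k) (ℤP.+-identityʳ i) (ℤP.+-monoʳ-≤ i 0≤k)

  0≤-diff : ∀ {i j} → i ℤ.≤ j → + 0 ℤ.≤ j ℤ.- i
  0≤-diff = ℤP.i≤j⇒0≤j-i

  0<-* : ∀ {i j} → + 0 ℤ.< i → + 0 ℤ.< j → + 0 ℤ.< i ℤ.* j
  0<-* {i} {j} p q = subst (ℤ._< i ℤ.* j) (ℤP.*-zeroʳ i) (ℤP.*-monoˡ-<-pos i {{ℤ.positive p}} q)

  0<-cancel : ∀ {i j} → + 0 ℤ.≤ i → + 0 ℤ.< i ℤ.* j → + 0 ℤ.< j
  0<-cancel {i} {j} p q = ℤP.*-cancelˡ-<-nonNeg i {{ℤ.nonNegative p}} (subst (ℤ._< i ℤ.* j) (sym (ℤP.*-zeroʳ i)) q)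

  0≤-cancel : ∀ {i j} → + 0 ℤ.< i → + 0 ℤ.≤ i ℤ.* j → + 0 ℤ.≤ j
  0≤-cancel {i} {j} p q = ℤP.*-cancelˡ-≤-pos (+ 0) j i {{ℤ.positive p}} (subst (ℤ._≤ i ℤ.* j) (sym (ℤP.*-zeroʳ i)) q)

  0≤-square : ∀ i → + 0 ℤ.≤ i ℤ.* i
  0≤-square (+ i)    = 0≤-* {+ i} {+ i} (ℤ.+≤+ ℕ.z≤n) (ℤ.+≤+ ℕ.z≤n)
  0≤-square -[1+ i ] = ℤ.+≤+ ℕ.z≤n

  1≤-0< : ∀ {i} → + 0 ℤ.< i → + 1 ℤ.≤ i
  1≤-0< = ℤP.i<j⇒suc[i]≤j

  0≤ℕ : ∀ {n} → + 0 ℤ.≤ + n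
  0≤ℕ = ℤ.+≤+ ℕ.z≤n

  0≤i+∣i∣ : ∀ i → + 0 ℤ.≤ i ℤ.+ + ℤ.∣ i ∣
  0≤i+∣i∣ (+ i) = 0≤-+ {+ i} {+ i} 0≤ℕ 0≤ℕ
  0≤i+∣i∣ -[1+ i ] = ℤP.≤-reflexive (sym (ℤP.+-inverseˡ (+ suc i)))

⊟-⊞ : ∀ P Q → P ⊟ (P ⊞ Q) ≡ neg Q
⊟-⊞ (a , b) (c , d) = cong₂ _,_ (i₁ a c) (i₁ b d)
  where
  i₁ : ∀ a c → a ℤ.- (a ℤ.+ c) ≡ ℤ.- c
  i₁ = ℤR.solve-∀

⊞-⊟ : ∀ P Q → P ⊞ Q ⊟ Q ≡ P
⊞-⊟ (a , b) (c , d) = cong₂ _,_ (i₁ a c) (i₁ b d)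
  where
  i₁ : ∀ a c → a ℤ.+ c ℤ.- c ≡ a
  i₁ = ℤR.solve-∀

·-⊞-left : ∀ s t L R → s · L ⊞ t · (L ⊞ R) ≡ (s ℕ.+ t) · L ⊞ t · R
·-⊞-left s t (a , b) (c , d) = cong₂ _,_
  (trans (i₁ (+ s) (+ t) a c) (cong (λ z → z ℤ.* a ℤ.+ + t ℤ.* c) (sym (ℤP.pos-+ s t))))
  (trans (i₁ (+ s) (+ t) b d) (cong (λ z → z ℤ.* b ℤ.+ + t ℤ.* d) (sym (ℤP.pos-+ s t))))
  where
  i₁ : ∀ s t a c → s ℤ.* a ℤ.+ t ℤ.* (a ℤ.+ c) ≡ (s ℤ.+ t) ℤ.* a ℤ.+ t ℤ.* c
  i₁ = ℤR.solve-∀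

·-⊞-right : ∀ s t L R → s · (L ⊞ R) ⊞ t · R ≡ s · L ⊞ (s ℕ.+ t) · R
·-⊞-right s t (a , b) (c , d) = cong₂ _,_
  (trans (i₁ (+ s) (+ t) a c) (cong (λ z → + s ℤ.* a ℤ.+ z ℤ.* c) (sym (ℤP.pos-+ s t))))
  (trans (i₁ (+ s) (+ t) b d) (cong (λ z → + s ℤ.* b ℤ.+ z ℤ.* d) (sym (ℤP.pos-+ s t))))
  where
  i₁ : ∀ s t a c → s ℤ.* (a ℤ.+ c) ℤ.+ t ℤ.* c ≡ s ℤ.* a ℤ.+ (s ℤ.+ t) ℤ.* c
  i₁ = ℤR.solve-∀

⊞-0ˡ : ∀ L t R → 0 · L ⊞ t · R ≡ t · R
⊞-0ˡ (a , b) t (c , d) = cong₂ _,_ (ℤP.+-identityˡ _) (ℤP.+-identityˡ _)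

⊞-0ʳ : ∀ L s R → s · L ⊞ 0 · R ≡ s · L
⊞-0ʳ (a , b) s (c , d) = cong₂ _,_ (ℤP.+-identityʳ _) (ℤP.+-identityʳ _)

module TraceFunction (T : Vec² → ℤ) (isTrace : IsTrace T) where
  open IsTrace isTrace
  open Integers

  -- A basis on which T takes the values of a positive Markov triple.
  record Good (u w : Vec²) : Set where
    field
      unimod : Unimodular u w
      posˡ  : + 0 ℤ.< T u
      posʳ  : + 0 ℤ.< T w
      pos⁺  : + 0 ℤ.< T (u ⊞ w)
      triple : T u ℤ.* T u ℤ.+ T w ℤ.* T w ℤ.+ T (u ⊞ w) ℤ.* T (u ⊞ w)
             ≡ T u ℤ.* T w ℤ.* T (u ⊞ w)
  open Good public

  unimodular-negʳ : ∀ u w → Unimodular u w → Unimodular u (neg w)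
  unimodular-negʳ u w p = unimodular-swap (neg w) u (unimodular-negˡ w u (unimodular-swap u w p))

  good-swap : ∀ {u w} → Good u w → Good w u
  good-swap {u} {w} g = record
    { unimod = unimodular-swap u w (unimod g) ; posˡ = posʳ g ; posʳ = posˡ g
    ; pos⁺ = subst (λ z → + 0 ℤ.< T z) (⊞-comm u w) (pos⁺ g)
    ; triple = subst (λ z → T w ℤ.* T w ℤ.+ T u ℤ.* T u ℤ.+ T z ℤ.* T z ≡ T w ℤ.* T u ℤ.* T z) (⊞-comm u w)
        (trans (i₁ (T w) (T u) (T (u ⊞ w))) (trans (triple g) (i₂ (T w) (T u) (T (u ⊞ w))))) }
    where
    i₁ : ∀ x y z → x ℤ.* x ℤ.+ y ℤ.* y ℤ.+ z ℤ.* z ≡ y ℤ.* y ℤ.+ x ℤ.* x ℤ.+ z ℤ.* z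
    i₁ = ℤR.solve-∀
    i₂ : ∀ x y z → y ℤ.* x ℤ.* z ≡ x ℤ.* y ℤ.* z
    i₂ = ℤR.solve-∀

  -- Vieta jumping: the two values at u ± w have sum T u T w and product T u² + T w².
  good-neg : ∀ {u w} → Good u w → Good u (neg w)
  good-neg {u} {w} g = record
    { unimod = unimodular-negʳ u w (unimod g) ; posˡ = posˡ g
    ; posʳ = subst (+ 0 ℤ.<_) (sym (even w)) (posʳ g)
    ; pos⁺ = 0<d
    ; triple = subst (λ z → x ℤ.* x ℤ.+ z ℤ.* z ℤ.+ d ℤ.* d ≡ x ℤ.* z ℤ.* d) (sym (even w)) eq }
    where
    x y z d : ℤ
    x = T u
    y = T w
    z = T (u ⊞ w)
    d = T (u ⊟ w)
    i₁ : ∀ x y z d → z ℤ.* d ≡ z ℤ.* (z ℤ.+ d) ℤ.- z ℤ.* z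
    i₁ = ℤR.solve-∀
    i₂ : ∀ x y z → z ℤ.* (x ℤ.* y) ℤ.- z ℤ.* z ≡ x ℤ.* y ℤ.* z ℤ.- z ℤ.* z
    i₂ = ℤR.solve-∀
    i₃ : ∀ x y z → x ℤ.* x ℤ.+ y ℤ.* y ℤ.+ z ℤ.* z ℤ.- z ℤ.* z ≡ x ℤ.* x ℤ.+ y ℤ.* y
    i₃ = ℤR.solve-∀
    product : z ℤ.* d ≡ x ℤ.* x ℤ.+ y ℤ.* y
    product = trans (i₁ x y z d) (trans (cong (λ t → z ℤ.* t ℤ.- z ℤ.* z) (farey u w (unimod g)))
      (trans (i₂ x y z) (trans (cong (ℤ._- z ℤ.* z) (sym (triple g))) (i₃ x y z))))
    0<d : + 0 ℤ.< d
    0<d = 0<-cancel (ℤP.<⇒≤ (pos⁺ g)) (subst (+ 0 ℤ.<_) (sym product)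
      (ℤP.+-mono-<-≤ (0<-* (posˡ g) (posˡ g)) (0≤-square y)))
    i₄ : ∀ z d → z ℤ.* d ℤ.+ d ℤ.* d ≡ (z ℤ.+ d) ℤ.* d
    i₄ = ℤR.solve-∀
    eq : x ℤ.* x ℤ.+ y ℤ.* y ℤ.+ d ℤ.* d ≡ x ℤ.* y ℤ.* d
    eq = trans (cong (ℤ._+ d ℤ.* d) (sym product)) (trans (i₄ z d) (cong (ℤ._* d) (farey u w (unimod g))))

  good-neg-swap : ∀ {u w} → Good u w → Good (neg u) w
  good-neg-swap g = good-swap (good-neg (good-swap g))

  ⊞-neg-⊞ : ∀ P Q → P ⊞ neg (P ⊞ Q) ≡ neg Q
  ⊞-neg-⊞ (a , b) (c , d) = cong₂ _,_ (i₁ a c) (i₁ b d)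
    where
    i₁ : ∀ a c → a ℤ.+ ℤ.- (a ℤ.+ c) ≡ ℤ.- c
    i₁ = ℤR.solve-∀

  good-add : ∀ {u w} → Good u w → Good u (u ⊞ w)
  good-add {u} {w} g = subst (Good u) (neg-neg (u ⊞ w)) (good-neg (record
    { unimod = unimodular-negʳ u (u ⊞ w) (unimodular-shear u w (unimod g)) ; posˡ = posˡ g
    ; posʳ = subst (+ 0 ℤ.<_) (sym (even (u ⊞ w))) (pos⁺ g)
    ; pos⁺ = subst (+ 0 ℤ.<_) (sym back) (posʳ g)
    ; triple = subst₂ (λ y z → T u ℤ.* T u ℤ.+ y ℤ.* y ℤ.+ z ℤ.* z ≡ T u ℤ.* y ℤ.* z)
        (sym (even (u ⊞ w))) (sym back)
        (trans (i₁ (T u) (T w) (T (u ⊞ w))) (trans (triple g) (i₂ (T u) (T w) (T (u ⊞ w))))) }))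
    where
    back : T (u ⊞ neg (u ⊞ w)) ≡ T w
    back = trans (cong T (⊞-neg-⊞ u w)) (even w)
    i₁ : ∀ x y z → x ℤ.* x ℤ.+ z ℤ.* z ℤ.+ y ℤ.* y ≡ x ℤ.* x ℤ.+ y ℤ.* y ℤ.+ z ℤ.* z
    i₁ = ℤR.solve-∀
    i₂ : ∀ x y z → x ℤ.* y ℤ.* z ≡ x ℤ.* z ℤ.* y
    i₂ = ℤR.solve-∀

  good-units : Good (+ 1 , + 0) (+ 0 , + 1)
  good-units = record
    { unimod = refl ; posˡ = subst (+ 0 ℤ.<_) (sym T-e₁) 0<3 ; posʳ = subst (+ 0 ℤ.<_) (sym T-e₂) 0<3
    ; pos⁺ = subst (+ 0 ℤ.<_) (sym T-e₁₂) (ℤ.+<+ (ℕ.s≤s ℕ.z≤n))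
    ; triple = trans (cong₂ ℤ._+_ (cong₂ ℤ._+_ (cong₂ ℤ._*_ T-e₁ T-e₁) (cong₂ ℤ._*_ T-e₂ T-e₂)) (cong₂ ℤ._*_ T-e₁₂ T-e₁₂))
        (sym (cong₂ ℤ._*_ (cong₂ ℤ._*_ T-e₁ T-e₂) T-e₁₂)) }
    where
    0<3 : + 0 ℤ.< + 3
    0<3 = ℤ.+<+ (ℕ.s≤s ℕ.z≤n)

  good-iterate : ∀ {u w} c → Good u w → Good u (c · u ⊞ w)
  good-iterate {u} {w} zero g = subst (Good u) (sym (trans (⊞-comm (0 · u) w) (zeroʳ w u))) g
    where
    zeroʳ : ∀ w u → w ⊞ 0 · u ≡ w
    zeroʳ (a , b) (c , d) = cong₂ _,_ (ℤP.+-identityʳ a) (ℤP.+-identityʳ b)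
  good-iterate {u} {w} (suc c) g = subst (Good u) (step u w) (good-add (good-iterate c g))
    where
    i₁ : ∀ c a b → a ℤ.+ (c ℤ.* a ℤ.+ b) ≡ (+ 1 ℤ.+ c) ℤ.* a ℤ.+ b
    i₁ = ℤR.solve-∀
    step : ∀ u w → u ⊞ (c · u ⊞ w) ≡ suc c · u ⊞ w
    step (a , b) (a′ , b′) = cong₂ _,_ (i₁ (+ c) a a′) (i₁ (+ c) b b′)

  3≤T : ∀ {u w} → Good u w → + 3 ℤ.≤ T u
  3≤T {u} {w} g = subst (+ 3 ℤ.≤_) (i₂ (T u)) (ℤP.+-monoˡ-≤ (+ 2) (1≤-0<
    (0<-cancel {T w ℤ.* T (u ⊞ w)} (ℤP.<⇒≤ (0<-* (posʳ g) (pos⁺ g)))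
      (subst (+ 0 ℤ.<_) (trans (i₁ (T u) (T w) (T (u ⊞ w))) (trans
          (cong (ℤ._- + 2 ℤ.* T w ℤ.* T (u ⊞ w)) (triple g)) (i₃ (T u) (T w) (T (u ⊞ w)))))
        (ℤP.+-mono-<-≤ (0<-* (posˡ g) (posˡ g)) (0≤-square (T w ℤ.- T (u ⊞ w))))))))
    where
    i₁ : ∀ x y z → x ℤ.* x ℤ.+ (y ℤ.- z) ℤ.* (y ℤ.- z)
       ≡ x ℤ.* x ℤ.+ y ℤ.* y ℤ.+ z ℤ.* z ℤ.- + 2 ℤ.* y ℤ.* z
    i₁ = ℤR.solve-∀
    i₂ : ∀ x → x ℤ.- + 2 ℤ.+ + 2 ≡ x
    i₂ = ℤR.solve-∀
    i₃ : ∀ x y z → x ℤ.* y ℤ.* z ℤ.- + 2 ℤ.* y ℤ.* z ≡ y ℤ.* z ℤ.* (x ℤ.- + 2)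
    i₃ = ℤR.solve-∀

  2≤T : ∀ {u w} → Good u w → + 2 ℤ.≤ T u
  2≤T g = ℤP.≤-trans (ℤ.+≤+ (ℕ.s≤s (ℕ.s≤s ℕ.z≤n))) (3≤T g)

  ladder-0 : ∀ u w → T (0 · u ⊞ w) ≡ T w
  ladder-0 (a , b) (c , d) = cong T (cong₂ _,_ (ℤP.+-identityˡ c) (ℤP.+-identityˡ d))

  ladder-1 : ∀ u w → T (1 · u ⊞ w) ≡ T (u ⊞ w)
  ladder-1 (a , b) (c , d) = cong T (cong₂ _,_ (cong (ℤ._+ c) (ℤP.*-identityˡ a)) (cong (ℤ._+ d) (ℤP.*-identityˡ b)))

  ladder-rec : ∀ {u w} → Good u w → ∀ k →
    T ((2 ℕ.+ k) · u ⊞ w) ≡ T u ℤ.* T ((1 ℕ.+ k) · u ⊞ w) ℤ.- T (k · u ⊞ w)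
  ladder-rec {u} {w} g k = trans (i₀ _ (T (k · u ⊞ w))) (cong (ℤ._- T (k · u ⊞ w))
    (trans (cong₂ ℤ._+_ (cong T (up u w)) (trans (sym (even (k · u ⊞ w))) (cong T (down u w))))
      (farey u ((1 ℕ.+ k) · u ⊞ w) (unimod (good-iterate (1 ℕ.+ k) g)))))
    where
    i₀ : ∀ x y → x ≡ x ℤ.+ y ℤ.- y
    i₀ = ℤR.solve-∀
    i₁ : ∀ k a b → (+ 2 ℤ.+ k) ℤ.* a ℤ.+ b ≡ a ℤ.+ ((+ 1 ℤ.+ k) ℤ.* a ℤ.+ b)
    i₁ = ℤR.solve-∀
    up : ∀ u w → (2 ℕ.+ k) · u ⊞ w ≡ u ⊞ ((1 ℕ.+ k) · u ⊞ w)
    up (a , b) (c , d) = cong₂ _,_ (i₁ (+ k) a c) (i₁ (+ k) b d)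
    i₂ : ∀ k a b → ℤ.- (k ℤ.* a ℤ.+ b) ≡ a ℤ.- ((+ 1 ℤ.+ k) ℤ.* a ℤ.+ b)
    i₂ = ℤR.solve-∀
    down : ∀ u w → neg (k · u ⊞ w) ≡ u ⊟ ((1 ℕ.+ k) · u ⊞ w)
    down (a , b) (c , d) = cong₂ _,_ (i₂ (+ k) a c) (i₂ (+ k) b d)

-- Positive matrices over ℤ[√Δ]

-- ℤ[δ] with δ² = Δ = τ² - 4; (a , b) stands for a + b δ.
module Quadratic (τ : ℤ) (2≤τ : + 2 ℤ.≤ τ) where
  open Integers

  Δ : ℤ
  Δ = τ ℤ.* τ ℤ.- + 4

  K : Set
  K = ℤ × ℤ

  infixl 6 _+_ _-_
  infixl 7 _*_
  infix  8 -_
  infixr 9 _^_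
  _+_ _*_ : K → K → K
  (a , b) + (c , d) = a ℤ.+ c , b ℤ.+ d
  (a , b) * (c , d) = a ℤ.* c ℤ.+ b ℤ.* d ℤ.* Δ , a ℤ.* d ℤ.+ b ℤ.* c
  -_ : K → K
  -_ = λ x → ℤ.- proj₁ x , ℤ.- proj₂ x
  _-_ : K → K → K
  x - y = x + (- y)

  ι : ℤ → K
  ι c = c , + 0

  0K 1K δ : K
  0K = ι (+ 0)
  1K = ι (+ 1)
  δ  = + 0 , + 1

  _^_ : K → ℕ → K
  x ^ zero  = 1K
  x ^ suc n = x * x ^ n

  private
    +-asc : ∀ a b c → a ℤ.+ b ℤ.+ c ≡ a ℤ.+ (b ℤ.+ c)
    +-asc = ℤR.solve-∀
    asc₁ : ∀ a b c d e f Δ → (a ℤ.* c ℤ.+ b ℤ.* d ℤ.* Δ) ℤ.* e ℤ.+ (a ℤ.* d ℤ.+ b ℤ.* c) ℤ.* f ℤ.* Δ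
      ≡ a ℤ.* (c ℤ.* e ℤ.+ d ℤ.* f ℤ.* Δ) ℤ.+ b ℤ.* (c ℤ.* f ℤ.+ d ℤ.* e) ℤ.* Δ
    asc₁ = ℤR.solve-∀
    asc₂ : ∀ a b c d e f Δ → (a ℤ.* c ℤ.+ b ℤ.* d ℤ.* Δ) ℤ.* f ℤ.+ (a ℤ.* d ℤ.+ b ℤ.* c) ℤ.* e
      ≡ a ℤ.* (c ℤ.* f ℤ.+ d ℤ.* e) ℤ.+ b ℤ.* (c ℤ.* e ℤ.+ d ℤ.* f ℤ.* Δ)
    asc₂ = ℤR.solve-∀
    com₁ : ∀ a b c d Δ → a ℤ.* c ℤ.+ b ℤ.* d ℤ.* Δ ≡ c ℤ.* a ℤ.+ d ℤ.* b ℤ.* Δ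
    com₁ = ℤR.solve-∀
    com₂ : ∀ a b c d → a ℤ.* d ℤ.+ b ℤ.* c ≡ c ℤ.* b ℤ.+ d ℤ.* a
    com₂ = ℤR.solve-∀
    id₁ : ∀ a b Δ → + 1 ℤ.* a ℤ.+ + 0 ℤ.* b ℤ.* Δ ≡ a
    id₁ = ℤR.solve-∀
    id₂ : ∀ a b → + 1 ℤ.* b ℤ.+ + 0 ℤ.* a ≡ b
    id₂ = ℤR.solve-∀
    dist₁ : ∀ a b c d e f Δ → a ℤ.* (c ℤ.+ e) ℤ.+ b ℤ.* (d ℤ.+ f) ℤ.* Δ
      ≡ (a ℤ.* c ℤ.+ b ℤ.* d ℤ.* Δ) ℤ.+ (a ℤ.* e ℤ.+ b ℤ.* f ℤ.* Δ)
    dist₁ = ℤR.solve-∀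
    dist₂ : ∀ a b c d e f → a ℤ.* (d ℤ.+ f) ℤ.+ b ℤ.* (c ℤ.+ e)
      ≡ (a ℤ.* d ℤ.+ b ℤ.* c) ℤ.+ (a ℤ.* f ℤ.+ b ℤ.* e)
    dist₂ = ℤR.solve-∀

  *-comm : ∀ x y → x * y ≡ y * x
  *-comm (a , b) (c , d) = cong₂ _,_ (com₁ a b c d Δ) (com₂ a b c d)

  *-identityˡ : ∀ x → 1K * x ≡ x
  *-identityˡ (a , b) = cong₂ _,_ (id₁ a b Δ) (id₂ a b)

  *-distribˡ-+ : ∀ x y z → x * (y + z) ≡ x * y + x * z
  *-distribˡ-+ (a , b) (c , d) (e , f) = cong₂ _,_ (dist₁ a b c d e f Δ) (dist₂ a b c d e f)

  +-comm : ∀ x y → x + y ≡ y + x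
  +-comm (a , b) (c , d) = cong₂ _,_ (ℤP.+-comm a c) (ℤP.+-comm b d)

  commutativeRing : CommutativeRing 0ℓ 0ℓ
  commutativeRing = record
    { Carrier = K ; _≈_ = _≡_ ; _+_ = _+_ ; _*_ = _*_ ; -_ = -_ ; 0# = 0K ; 1# = 1K
    ; isCommutativeRing = record
      { isRing = record
        { +-isAbelianGroup = record
          { isGroup = record
            { isMonoid = record
              { isSemigroup = record
                { isMagma = record { isEquivalence = isEquivalence ; ∙-cong = cong₂ _+_ }
                ; assoc = λ { (a , b) (c , d) (e , f) → cong₂ _,_ (+-asc a c e) (+-asc b d f) } }
              ; identity = (λ { (a , b) → cong₂ _,_ (ℤP.+-identityˡ a) (ℤP.+-identityˡ b) })
                         , (λ { (a , b) → cong₂ _,_ (ℤP.+-identityʳ a) (ℤP.+-identityʳ b) }) }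
            ; inverse = (λ { (a , b) → cong₂ _,_ (ℤP.+-inverseˡ a) (ℤP.+-inverseˡ b) })
                      , (λ { (a , b) → cong₂ _,_ (ℤP.+-inverseʳ a) (ℤP.+-inverseʳ b) })
            ; ⁻¹-cong = cong (-_) }
          ; comm = +-comm }
        ; *-cong = cong₂ _*_
        ; *-assoc = λ { (a , b) (c , d) (e , f) → cong₂ _,_ (asc₁ a b c d e f Δ) (asc₂ a b c d e f Δ) }
        ; *-identity = *-identityˡ , λ x → trans (*-comm x 1K) (*-identityˡ x)
        ; distrib = *-distribˡ-+ , λ x y z → trans (*-comm (y + z) x)
            (trans (*-distribˡ-+ x y z) (cong₂ _+_ (*-comm x y) (*-comm x z))) }
      ; *-comm = *-comm } }

  ring : ACR.AlmostCommutativeRing 0ℓ 0ℓ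
  ring = ACR.fromCommutativeRing commutativeRing λ { (+0 , +0) → just refl ; _ → nothing }

  ι-* : ∀ x y → ι (x ℤ.* y) ≡ ι x * ι y
  ι-* x y = cong₂ _,_ (i₁ x y Δ) (i₂ x y)
    where
    i₁ : ∀ x y Δ → x ℤ.* y ≡ x ℤ.* y ℤ.+ + 0 ℤ.* + 0 ℤ.* Δ
    i₁ = ℤR.solve-∀
    i₂ : ∀ x y → + 0 ≡ x ℤ.* + 0 ℤ.+ + 0 ℤ.* y
    i₂ = ℤR.solve-∀

  *-identityʳ : ∀ x → x * 1K ≡ x
  *-identityʳ x = trans (*-comm x 1K) (*-identityˡ x)

  ^-+ : ∀ x m n → x ^ (m ℕ.+ n) ≡ x ^ m * x ^ n
  ^-+ x zero n = sym (*-identityˡ (x ^ n))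
  ^-+ x (suc m) n = trans (cong (x *_) (^-+ x m n)) (i₁ x (x ^ m) (x ^ n))
    where
    i₁ : ∀ x y z → x * (y * z) ≡ x * y * z
    i₁ = RingSolver.solve-∀ ring

  ^-* : ∀ x y n → (x * y) ^ n ≡ x ^ n * y ^ n
  ^-* x y zero = sym (*-identityˡ 1K)
  ^-* x y (suc n) = trans (cong (x * y *_) (^-* x y n)) (i₁ x y (x ^ n) (y ^ n))
    where
    i₁ : ∀ x y z w → x * y * (z * w) ≡ x * z * (y * w)
    i₁ = RingSolver.solve-∀ ring

  C₀ : K → Set
  C₀ (a , b) = + 0 ℤ.≤ a × + 0 ℤ.≤ b

  0≤Δ : + 0 ℤ.≤ Δ
  0≤Δ = subst (+ 0 ℤ.≤_) (i₁ τ)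
    (0≤-* (0≤-diff 2≤τ) (0≤-+ (ℤP.≤-trans (ℤ.+≤+ ℕ.z≤n) 2≤τ) (ℤ.+≤+ {n = 2} ℕ.z≤n)))
    where
    i₁ : ∀ τ → (τ ℤ.- + 2) ℤ.* (τ ℤ.+ + 2) ≡ τ ℤ.* τ ℤ.- + 4
    i₁ = ℤR.solve-∀

  C₀-+ : ∀ {x y} → C₀ x → C₀ y → C₀ (x + y)
  C₀-+ (p , q) (r , s) = 0≤-+ p r , 0≤-+ q s

  C₀-* : ∀ {x y} → C₀ x → C₀ y → C₀ (x * y)
  C₀-* (p , q) (r , s) = 0≤-+ (0≤-* p r) (0≤-* (0≤-* q s) 0≤Δ) , 0≤-+ (0≤-* p s) (0≤-* q r)

  C₀-ι : ∀ {c} → + 0 ℤ.≤ c → C₀ (ι c)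
  C₀-ι p = p , ℤP.≤-refl

  C₀-δ : C₀ δ
  C₀-δ = ℤP.≤-refl , ℤ.+≤+ ℕ.z≤n

  Λ Λ̄ : K
  Λ = τ , + 1
  Λ̄ = τ , -[1+ 0 ]

  0≤τ : + 0 ℤ.≤ τ
  0≤τ = ℤP.≤-trans (ℤ.+≤+ ℕ.z≤n) 2≤τ

  C₀-Λ : C₀ Λ
  C₀-Λ = 0≤τ , ℤ.+≤+ ℕ.z≤n

  C₀-^ : ∀ {x} n → C₀ x → C₀ (x ^ n)
  C₀-^ zero    p = C₀-ι (ℤ.+≤+ ℕ.z≤n)
  C₀-^ (suc n) p = C₀-* p (C₀-^ n p)

  -- The nonnegative elements of the ordered ring ℤ[√Δ]: multiplication by
  -- powers of Λ = τ + √Δ makes both coordinates of a positive element positive.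
  infix 1 _#_
  record N (x : K) : Set where
    constructor _#_
    field
      exponent : ℕ
      in-C₀    : C₀ (Λ ^ exponent * x)

  N-C₀ : ∀ {x} → C₀ x → N x
  N-C₀ {x} p = 0 # subst C₀ (sym (*-identityˡ x)) p

  N-resp : ∀ {x y} → x ≡ y → N x → N y
  N-resp = subst N

  N-+ : ∀ {x y} → N x → N y → N (x + y)
  N-+ {x} {y} (k # p) (l # q) = k ℕ.+ l # subst C₀
    (trans (i₁ (Λ ^ k) (Λ ^ l) x y) (cong (_* (x + y)) (sym (^-+ Λ k l))))
    (C₀-+ (C₀-* (C₀-^ l C₀-Λ) p) (C₀-* (C₀-^ k C₀-Λ) q))
    where
    i₁ : ∀ a b x y → b * (a * x) + a * (b * y) ≡ a * b * (x + y)
    i₁ = RingSolver.solve-∀ ring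

  N-* : ∀ {x y} → N x → N y → N (x * y)
  N-* {x} {y} (k # p) (l # q) = k ℕ.+ l # subst C₀
    (trans (i₁ (Λ ^ k) (Λ ^ l) x y) (cong (_* (x * y)) (sym (^-+ Λ k l))))
    (C₀-* p q)
    where
    i₁ : ∀ a b x y → a * x * (b * y) ≡ a * b * (x * y)
    i₁ = RingSolver.solve-∀ ring

  N-ι : ∀ {c} → + 0 ℤ.≤ c → N (ι c)
  N-ι p = N-C₀ (C₀-ι p)

  N-1 : N 1K
  N-1 = N-ι (ℤ.+≤+ ℕ.z≤n)

  N-^ : ∀ {x} n → N x → N (x ^ n)
  N-^ zero    p = N-1
  N-^ (suc n) p = N-* p (N-^ n p)

  ΛΛ̄ : Λ * Λ̄ ≡ ι (+ 4)
  ΛΛ̄ = cong₂ _,_ (i₁ τ) (i₂ τ)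
    where
    i₁ : ∀ τ → τ ℤ.* τ ℤ.+ + 1 ℤ.* -[1+ 0 ] ℤ.* (τ ℤ.* τ ℤ.- + 4) ≡ + 4
    i₁ = ℤR.solve-∀
    i₂ : ∀ τ → τ ℤ.* -[1+ 0 ] ℤ.+ + 1 ℤ.* τ ≡ + 0
    i₂ = ℤR.solve-∀

  N-Λ : N Λ
  N-Λ = N-C₀ C₀-Λ

  N-Λ̄ : N Λ̄
  N-Λ̄ = 1 # subst C₀ (trans (sym ΛΛ̄) (cong (_* Λ̄) (sym (trans (*-comm Λ 1K) (*-identityˡ Λ)))))
    (C₀-ι (ℤ.+≤+ ℕ.z≤n))

  N-δ : N δ
  N-δ = N-C₀ C₀-δ

  N⇒0≤ : ∀ {c} → N (ι c) → + 0 ℤ.≤ c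
  N⇒0≤ {c} (k # (p , _)) = ℤP.*-cancelˡ-≤-pos (+ 0) c (proj₁ (Λ ^ k)) {{ℤ.positive (1≤ k)}}
    (subst₂ ℤ._≤_ (sym (ℤP.*-zeroʳ (proj₁ (Λ ^ k)))) (i₁ (proj₁ (Λ ^ k)) (proj₂ (Λ ^ k)) c Δ) p)
    where
    i₁ : ∀ p q c Δ → p ℤ.* c ℤ.+ q ℤ.* + 0 ℤ.* Δ ≡ p ℤ.* c
    i₁ = ℤR.solve-∀
    1≤ : ∀ k → + 0 ℤ.< proj₁ (Λ ^ k)
    1≤ zero = ℤ.+<+ (ℕ.s≤s ℕ.z≤n)
    1≤ (suc k) = ℤP.<-≤-trans (1≤ k) (≤-by
      (0≤-+ (0≤-* (ℤP.≤-trans (ℤ.+≤+ {m = 0} {n = 1} ℕ.z≤n) (0≤-1 )) (ℤP.<⇒≤ (1≤ k)))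
        (0≤-* (proj₂ (C₀-^ k C₀-Λ)) 0≤Δ))
      (i₂ τ (proj₁ (Λ ^ k)) (proj₂ (Λ ^ k)) Δ))
      where
      0≤-1 : + 1 ℤ.≤ τ ℤ.- + 1
      0≤-1 = ℤP.+-monoˡ-≤ (-[1+ 0 ]) 2≤τ
      i₂ : ∀ τ p q Δ → τ ℤ.* p ℤ.+ + 1 ℤ.* q ℤ.* Δ ≡ p ℤ.+ ((τ ℤ.- + 1) ℤ.* p ℤ.+ q ℤ.* Δ)
      i₂ = ℤR.solve-∀

  infix 4 _≼_
  record _≼_ (x y : K) : Set where
    constructor le
    field
      difference : N (y - x)

  ≼-trans : ∀ {x y z} → x ≼ y → y ≼ z → x ≼ z
  ≼-trans {x} {y} {z} (le p) (le q) = le (N-resp (i₁ x y z) (N-+ p q))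
    where
    i₁ : ∀ x y z → y - x + (z - y) ≡ z - x
    i₁ = RingSolver.solve-∀ ring

  ≼-reflexive : ∀ {x y} → x ≡ y → x ≼ y
  ≼-reflexive {x} refl = le (N-resp (i₁ x) (N-ι ℤP.≤-refl))
    where
    i₁ : ∀ x → 0K ≡ x - x
    i₁ = RingSolver.solve-∀ ring

  ≼-* : ∀ {x y z w} → N x → N w → x ≼ y → z ≼ w → x * z ≼ y * w
  ≼-* {x} {y} {z} {w} Nx Nw (le p) (le q) = le (N-resp (i₁ x y z w) (N-+ (N-* p Nw) (N-* Nx q)))
    where
    i₁ : ∀ x y z w → (y - x) * w + x * (w - z) ≡ y * w - x * z
    i₁ = RingSolver.solve-∀ ring

  0≼ : ∀ {x y} → N x → x ≼ y → N y
  0≼ {x} {y} p (le q) = N-resp (i₁ x y) (N-+ p q)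
    where
    i₁ : ∀ x y → x + (y - x) ≡ y
    i₁ = RingSolver.solve-∀ ring

  ≼-^ : ∀ {x y} n → N x → x ≼ y → x ^ n ≼ y ^ n
  ≼-^ zero p q = ≼-reflexive refl
  ≼-^ (suc n) p q = ≼-* p (N-^ n (0≼ p q)) q (≼-^ n p q)

  record Mat : Set where
    constructor mat
    field
      m₁₁ m₁₂ m₂₁ m₂₂ : K
  open Mat public

  infixl 7 _⊙_
  _⊙_ : Mat → Mat → Mat
  A ⊙ B = mat (m₁₁ A * m₁₁ B + m₁₂ A * m₂₁ B) (m₁₁ A * m₁₂ B + m₁₂ A * m₂₂ B)
              (m₂₁ A * m₁₁ B + m₂₂ A * m₂₁ B) (m₂₁ A * m₁₂ B + m₂₂ A * m₂₂ B)

  tr detM : Mat → K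
  tr A = m₁₁ A + m₂₂ A
  detM A = m₁₁ A * m₂₂ A - m₁₂ A * m₂₁ A

  record NMat (A : Mat) : Set where
    field
      n₁₁ : N (m₁₁ A)
      n₁₂ : N (m₁₂ A)
      n₂₁ : N (m₂₁ A)
      n₂₂ : N (m₂₂ A)
  open NMat public

  NMat-⊙ : ∀ {A B} → NMat A → NMat B → NMat (A ⊙ B)
  NMat-⊙ a b = record
    { n₁₁ = N-+ (N-* (n₁₁ a) (n₁₁ b)) (N-* (n₁₂ a) (n₂₁ b))
    ; n₁₂ = N-+ (N-* (n₁₁ a) (n₁₂ b)) (N-* (n₁₂ a) (n₂₂ b))
    ; n₂₁ = N-+ (N-* (n₂₁ a) (n₁₁ b)) (N-* (n₂₂ a) (n₂₁ b))
    ; n₂₂ = N-+ (N-* (n₂₁ a) (n₁₂ b)) (N-* (n₂₂ a) (n₂₂ b)) }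

  detM-⊙ : ∀ A B → detM (A ⊙ B) ≡ detM A * detM B
  detM-⊙ A B = i₁ (m₁₁ A) (m₁₂ A) (m₂₁ A) (m₂₂ A) (m₁₁ B) (m₁₂ B) (m₂₁ B) (m₂₂ B)
    where
    i₁ : ∀ a b c d e f g h → (a * e + b * g) * (c * f + d * h) - (a * f + b * h) * (c * e + d * g)
       ≡ (a * d - b * c) * (e * h - f * g)
    i₁ = RingSolver.solve-∀ ring

  tr-AAB : ∀ A B → tr (A ⊙ (A ⊙ B)) ≡ tr A * tr (A ⊙ B) - detM A * tr B
  tr-AAB A B = i₁ (m₁₁ A) (m₁₂ A) (m₂₁ A) (m₂₂ A) (m₁₁ B) (m₁₂ B) (m₂₁ B) (m₂₂ B)
    where
    i₁ : ∀ a b c d e f g h →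
         (a * (a * e + b * g) + b * (c * e + d * g)) + (c * (a * f + b * h) + d * (c * f + d * h))
       ≡ (a + d) * ((a * e + b * g) + (c * f + d * h)) - (a * d - b * c) * (e + h)
    i₁ = RingSolver.solve-∀ ring

  tr-ABB : ∀ A B → tr ((A ⊙ B) ⊙ B) ≡ tr (A ⊙ B) * tr B - detM B * tr A
  tr-ABB A B = i₁ (m₁₁ A) (m₁₂ A) (m₂₁ A) (m₂₂ A) (m₁₁ B) (m₁₂ B) (m₂₁ B) (m₂₂ B)
    where
    i₁ : ∀ a b c d e f g h →
         ((a * e + b * g) * e + (a * f + b * h) * g) + ((c * e + d * g) * f + (c * f + d * h) * h)
       ≡ ((a * e + b * g) + (c * f + d * h)) * (e + h) - (e * h - f * g) * (a + d)
    i₁ = RingSolver.solve-∀ ring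

  module _ (T : Vec² → ℤ) (isTrace : IsTrace T) where
    open IsTrace isTrace
    open TraceFunction T isTrace

    ·-1 : ∀ L → 1 · L ≡ L
    ·-1 (a , b) = cong₂ _,_ (ℤP.*-identityˡ a) (ℤP.*-identityˡ b)

    module Powers (L R : Vec²) (A : Mat) (a : K) (u : Unimodular L R) (nA : NMat A)
                  (trA : tr A ≡ a * ι (T L)) (dA : detM A ≡ a * a) where

      h : ℕ → K
      h n = a ^ n * ι (T (n · L))

      h-0 : h 0 ≡ 0K
      h-0 = trans (*-identityˡ _) (cong ι T-0)

      h-1 : h 1 ≡ tr A
      h-1 = trans (cong₂ (λ x y → x * ι (T y)) (trans (*-comm a 1K) (*-identityˡ a)) (·-1 L)) (sym trA)

      h-rec : ∀ n → h (2 ℕ.+ n) ≡ tr A * h (1 ℕ.+ n) - detM A * h n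
      h-rec n = trans (i₁ a (a ^ n) (ι (T ((2 ℕ.+ n) · L))) (ι (T (n · L))))
        (trans (cong (λ z → a * (a * a ^ n) * z - a * a * (a ^ n * ι (T (n · L))))
            (trans (cong ι (multiple L R u n)) (ι-* (T L) (T ((1 ℕ.+ n) · L)))))
          (trans (i₂ a (a ^ n) (ι (T L)) (ι (T ((1 ℕ.+ n) · L))) (ι (T (n · L))))
            (cong₂ (λ x y → x * h (1 ℕ.+ n) - y * h n) (sym trA) (sym dA))))
        where
        i₁ : ∀ a p x y → a * (a * p) * x ≡ a * (a * p) * (x + y) - a * a * (p * y)
        i₁ = RingSolver.solve-∀ ring
        i₂ : ∀ a p l x y → a * (a * p) * (l * x) - a * a * (p * y)
           ≡ a * l * (a * p * x) - a * a * (p * y)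
        i₂ = RingSolver.solve-∀ ring

      growth : ∀ n → N (h n) × m₁₁ A * h n ≼ h (suc n)
      growth zero = N-resp (sym h-0) (N-ι ℤP.≤-refl) ,
        le (N-resp (sym (trans (cong₂ (λ x y → x - m₁₁ A * y) h-1 h-0) (i₁ (m₁₁ A) (m₂₂ A))))
          (N-+ (n₁₁ nA) (n₂₂ nA)))
        where
        i₁ : ∀ p s → p + s - p * 0K ≡ p + s
        i₁ = RingSolver.solve-∀ ring
      growth (suc n) with Nh , le d ← growth n = 0≼ (N-* (n₁₁ nA) Nh) (le d) ,
        le (N-resp (sym (trans (cong (_- m₁₁ A * h (suc n)) (h-rec n))
            (i₁ (m₁₁ A) (m₁₂ A) (m₂₁ A) (m₂₂ A) (h (suc n)) (h n))))
          (N-+ (N-* (n₂₂ nA) d) (N-* (N-* (n₁₂ nA) (n₂₁ nA)) Nh)))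
        where
        i₁ : ∀ p q r s x y → (p + s) * x - (p * s - q * r) * y - p * x ≡ s * (x - p * y) + q * r * y
        i₁ = RingSolver.solve-∀ ring

      power-bound : ∀ {α} → N α → α ≼ m₁₁ A → ∀ n → α ^ suc n ≼ h (suc n)
      power-bound {α} Nα p zero = ≼-trans (≼-reflexive (trans (*-comm α 1K) (*-identityˡ α)))
        (≼-trans p (le (N-resp (trans (i₁ (m₁₁ A) (m₂₂ A)) (cong (_- m₁₁ A) (sym h-1))) (n₂₂ nA))))
        where
        i₁ : ∀ p s → s ≡ p + s - p
        i₁ = RingSolver.solve-∀ ring
      power-bound Nα p (suc n) = ≼-trans
        (≼-* Nα (proj₁ (growth (suc n))) p (power-bound Nα p n)) (proj₂ (growth (suc n)))

    -- Scaled matrices in SL₂ whose traces are the values of T at a basis and its sum;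
    -- words in A and B then represent all of the cone spanned by L and R.
    record Rep (L R : Vec²) (A B : Mat) (a b : K) : Set where
      field
        basis : Unimodular L R
        tr-A  : tr A ≡ a * ι (T L)
        tr-B  : tr B ≡ b * ι (T R)
        tr-AB : tr (A ⊙ B) ≡ a * b * ι (T (L ⊞ R))
        det-A : detM A ≡ a * a
        det-B : detM B ≡ b * b
        nn-A  : NMat A
        nn-B  : NMat B
        nn-a  : N a
        nn-b  : N b

    det-AB : ∀ {L R A B a b} → Rep L R A B a b → detM (A ⊙ B) ≡ a * b * (a * b)
    det-AB {A = A} {B} {a} {b} r = trans (detM-⊙ A B)
      (trans (cong₂ _*_ (Rep.det-A r) (Rep.det-B r)) (i₁ a b))
      where
      i₁ : ∀ a b → a * a * (b * b) ≡ a * b * (a * b)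
      i₁ = RingSolver.solve-∀ ring

    sum-minus : ∀ x y z w → x ℤ.+ y ≡ z ℤ.* w → ι x ≡ ι z * ι w - ι y
    sum-minus x y z w p = trans (i₁ (ι x) (ι y))
      (cong (_- ι y) (trans (cong ι p) (ι-* z w)))
      where
      i₁ : ∀ x y → x ≡ x + y - y
      i₁ = RingSolver.solve-∀ ring

    unimodular-⊞ : ∀ L R → Unimodular L R → Unimodular (L ⊞ R) R
    unimodular-⊞ (a , b) (c , d) u = trans (cong ℤ.∣_∣ (i₁ a b c d)) u
      where
      i₁ : ∀ a b c d → (a ℤ.+ c) ℤ.* d ℤ.- (b ℤ.+ d) ℤ.* c ≡ a ℤ.* d ℤ.- b ℤ.* c
      i₁ = ℤR.solve-∀

    rep-left : ∀ {L R A B a b} → Rep L R A B a b → Rep L (L ⊞ R) A (A ⊙ B) a (a * b)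
    rep-left {L} {R} {A} {B} {a} {b} r = record
      { basis = unimodular-shear L R basis ; tr-A = tr-A ; tr-B = tr-AB
      ; tr-AB = trans (tr-AAB A B) (trans
          (cong₂ _-_ (cong₂ _*_ tr-A tr-AB) (cong₂ _*_ det-A tr-B))
          (trans (i₁ a b (ι (T L)) (ι (T (L ⊞ R))) (ι (T R))) (cong (a * (a * b) *_) (sym values))))
      ; det-A = det-A ; det-B = det-AB r
      ; nn-A = nn-A ; nn-B = NMat-⊙ nn-A nn-B ; nn-a = nn-a ; nn-b = N-* nn-a nn-b }
      where
      open Rep r
      i₁ : ∀ a b l x r → a * l * (a * b * x) - a * a * (b * r) ≡ a * (a * b) * (l * x - r)
      i₁ = RingSolver.solve-∀ ring
      values : ι (T (L ⊞ (L ⊞ R))) ≡ ι (T L) * ι (T (L ⊞ R)) - ι (T R)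
      values = trans (sum-minus _ (T (L ⊟ (L ⊞ R))) (T L) (T (L ⊞ R)) (farey L (L ⊞ R) (unimodular-shear L R basis)))
        (cong (λ z → ι (T L) * ι (T (L ⊞ R)) - ι z) (trans (cong T (⊟-⊞ L R)) (even R)))

    rep-right : ∀ {L R A B a b} → Rep L R A B a b → Rep (L ⊞ R) R (A ⊙ B) B (a * b) b
    rep-right {L} {R} {A} {B} {a} {b} r = record
      { basis = unimodular-⊞ L R basis ; tr-A = tr-AB ; tr-B = tr-B
      ; tr-AB = trans (tr-ABB A B) (trans
          (cong₂ _-_ (cong₂ _*_ tr-AB tr-B) (cong₂ _*_ det-B tr-A))
          (trans (i₁ a b (ι (T L)) (ι (T (L ⊞ R))) (ι (T R))) (cong (a * b * b *_) (sym values))))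
      ; det-A = det-AB r ; det-B = det-B
      ; nn-A = NMat-⊙ nn-A nn-B ; nn-B = nn-B ; nn-a = N-* nn-a nn-b ; nn-b = nn-b }
      where
      open Rep r
      i₁ : ∀ a b l x r → a * b * x * (b * r) - b * b * (a * l) ≡ a * b * b * (x * r - l)
      i₁ = RingSolver.solve-∀ ring
      values : ι (T (L ⊞ R ⊞ R)) ≡ ι (T (L ⊞ R)) * ι (T R) - ι (T L)
      values = trans (sum-minus _ (T (L ⊞ R ⊟ R)) (T (L ⊞ R)) (T R) (farey (L ⊞ R) R (unimodular-⊞ L R basis)))
        (cong (λ z → ι (T (L ⊞ R)) * ι (T R) - ι (T z)) (⊞-⊟ L R))

    shear-powers : ∀ x y s t → x ^ s * (x * y) ^ t ≡ x ^ (s ℕ.+ t) * y ^ t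
    shear-powers x y s t = trans (cong (x ^ s *_) (^-* x y t))
      (trans (i₁ (x ^ s) (x ^ t) (y ^ t)) (cong (_* y ^ t) (sym (^-+ x s t))))
      where
      i₁ : ∀ a b c → a * (b * c) ≡ a * b * c
      i₁ = RingSolver.solve-∀ ring

    shear-powers′ : ∀ x y s t → (x * y) ^ s * y ^ t ≡ x ^ s * y ^ (s ℕ.+ t)
    shear-powers′ x y s t = trans (cong (_* y ^ t) (^-* x y s))
      (trans (i₁ (x ^ s) (y ^ s) (y ^ t)) (cong (x ^ s *_) (sym (^-+ y s t))))
      where
      i₁ : ∀ a b c → a * b * c ≡ a * (b * c)
      i₁ = RingSolver.solve-∀ ring

    -- All entries are nonnegative, so the (1,1) entry of a word is at least the
    -- product of the (1,1) entries of its letters.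
    word-bound : ∀ n s t → s ℕ.+ t ℕ.≤ n → 1 ℕ.≤ s ℕ.+ t → ∀ {L R A B a b α β} →
      Rep L R A B a b → N α → N β → α ≼ m₁₁ A → β ≼ m₁₁ B →
      α ^ s * β ^ t ≼ a ^ s * b ^ t * ι (T (s · L ⊞ t · R))
    word-bound n (suc s) zero _ _ {L} {R} {A} {B} {a} {b} {α} {β} r Nα Nβ p q = subst₂ _≼_
      (sym (*-identityʳ (α ^ suc s)))
      (cong₂ (λ x y → x * ι (T y)) (sym (*-identityʳ (a ^ suc s))) (sym (⊞-0ʳ L (suc s) R)))
      (Powers.power-bound L R A a basis nn-A tr-A det-A Nα p s)
      where open Rep r
    word-bound n zero (suc t) _ _ {L} {R} {A} {B} {a} {b} {α} {β} r Nα Nβ p q = subst₂ _≼_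
      (sym (*-identityˡ (β ^ suc t)))
      (cong₂ (λ x y → x * ι (T y)) (sym (*-identityˡ (b ^ suc t))) (sym (⊞-0ˡ L (suc t) R)))
      (Powers.power-bound R L B b (unimodular-swap L R basis) nn-B tr-B det-B Nβ q t)
      where open Rep r
    word-bound (suc n) (suc s) (suc t) le₁ _ {L} {R} {A} {B} {a} {b} {α} {β} r Nα Nβ p q
      with ℕP.≤-total (suc t) (suc s)
    ... | inj₁ t≤s with k , eq ← ℕP.m≤n⇒∃[o]m+o≡n t≤s = subst (λ z →
          α ^ z * β ^ suc t ≼ a ^ z * b ^ suc t * ι (T (z · L ⊞ suc t · R)))
          (trans (ℕP.+-comm k (suc t)) eq)
          (subst₂ _≼_ (shear-powers α β k (suc t))
            (cong₂ (λ x y → x * ι (T y)) (shear-powers a b k (suc t)) (·-⊞-left k (suc t) L R))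
            (word-bound n k (suc t)
              (ℕP.≤-trans (ℕP.≤-reflexive (trans (ℕP.+-comm k (suc t)) eq))
                (ℕP.≤-trans (ℕP.m≤m+n (suc s) t) (subst (ℕ._≤ n) (ℕP.+-suc s t) (ℕP.≤-pred le₁))))
              (ℕP.≤-trans (ℕ.s≤s ℕ.z≤n) (ℕP.m≤n+m (suc t) k))
              (rep-left r) Nα (N-* Nα Nβ) p (≼-trans (≼-* Nα (n₁₁ (Rep.nn-B r)) p q) entry)))
      where
      entry : m₁₁ A * m₁₁ B ≼ m₁₁ (A ⊙ B)
      entry = le (N-resp (i₁ (m₁₁ A * m₁₁ B) (m₁₂ A * m₂₁ B)) (N-* (n₁₂ (Rep.nn-A r)) (n₂₁ (Rep.nn-B r))))
        where
        i₁ : ∀ x y → y ≡ x + y - x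
        i₁ = RingSolver.solve-∀ ring
    ... | inj₂ s≤t with k , eq ← ℕP.m≤n⇒∃[o]m+o≡n s≤t = subst (λ z →
          α ^ suc s * β ^ z ≼ a ^ suc s * b ^ z * ι (T (suc s · L ⊞ z · R)))
          eq
          (subst₂ _≼_ (shear-powers′ α β (suc s) k)
            (cong₂ (λ x y → x * ι (T y)) (shear-powers′ a b (suc s) k) (·-⊞-right (suc s) k L R))
            (word-bound n (suc s) k
              (ℕP.≤-trans (ℕP.≤-reflexive eq)
                (ℕP.≤-trans (ℕP.m≤n+m (suc t) s) (ℕP.≤-pred le₁)))
              (ℕ.s≤s ℕ.z≤n)
              (rep-right r) (N-* Nα Nβ) Nβ (≼-trans (≼-* Nα (n₁₁ (Rep.nn-B r)) p q) entry) q))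
      where
      entry : m₁₁ A * m₁₁ B ≼ m₁₁ (A ⊙ B)
      entry = le (N-resp (i₁ (m₁₁ A * m₁₁ B) (m₁₂ A * m₂₁ B)) (N-* (n₁₂ (Rep.nn-A r)) (n₂₁ (Rep.nn-B r))))
        where
        i₁ : ∀ x y → y ≡ x + y - x
        i₁ = RingSolver.solve-∀ ring

    -- Everything on the side of w of the line through u is seen in the eigenbasis of u.
    module Eigenbasis {u w : Vec²} (g : Good u w) (Tu≡τ : T u ≡ τ) (3≤τ : + 3 ℤ.≤ τ) where

      x₀ x₁ y₀ : ℤ
      x₀ = T w
      x₁ = T (u ⊞ w)
      y₀ = + 2 ℤ.* x₁ ℤ.- τ ℤ.* x₀

      0<τ : + 0 ℤ.< τ
      0<τ = ℤP.<-≤-trans (ℤ.+<+ (ℕ.s≤s ℕ.z≤n)) 3≤τ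

      triple′ : τ ℤ.* τ ℤ.+ x₀ ℤ.* x₀ ℤ.+ x₁ ℤ.* x₁ ≡ τ ℤ.* x₀ ℤ.* x₁
      triple′ = subst (λ t → t ℤ.* t ℤ.+ x₀ ℤ.* x₀ ℤ.+ x₁ ℤ.* x₁ ≡ t ℤ.* x₀ ℤ.* x₁) Tu≡τ (triple g)

      Γ Γ̄ : K
      Γ  = y₀ , x₀
      Γ̄  = ℤ.- y₀ , x₀

      0<Δ : + 0 ℤ.< Δ
      0<Δ = subst (+ 0 ℤ.<_) (i₁ τ) (0<-* (ℤP.suc[i]≤j⇒i<j (ℤP.+-monoˡ-≤ (-[1+ 1 ]) 3≤τ))
        (ℤP.<-≤-trans 0<τ (≤-by (0≤ℕ {2}) refl)))
        where
        i₁ : ∀ τ → (τ ℤ.- + 2) ℤ.* (τ ℤ.+ + 2) ≡ τ ℤ.* τ ℤ.- + 4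
        i₁ = ℤR.solve-∀

      norm : x₀ ℤ.* x₀ ℤ.* Δ ℤ.- y₀ ℤ.* y₀ ≡ + 4 ℤ.* (τ ℤ.* τ)
      norm = trans (i₁ τ x₀ x₁) (trans (cong (λ z → + 4 ℤ.* (z ℤ.- x₀ ℤ.* x₀ ℤ.- x₁ ℤ.* x₁)) (sym triple′))
        (i₂ τ x₀ x₁))
        where
        i₁ : ∀ τ x y → x ℤ.* x ℤ.* (τ ℤ.* τ ℤ.- + 4)
               ℤ.- (+ 2 ℤ.* y ℤ.- τ ℤ.* x) ℤ.* (+ 2 ℤ.* y ℤ.- τ ℤ.* x)
           ≡ + 4 ℤ.* (τ ℤ.* x ℤ.* y ℤ.- x ℤ.* x ℤ.- y ℤ.* y)
        i₁ = ℤR.solve-∀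
        i₂ : ∀ τ x y → + 4 ℤ.* (τ ℤ.* τ ℤ.+ x ℤ.* x ℤ.+ y ℤ.* y ℤ.- x ℤ.* x ℤ.- y ℤ.* y) ≡ + 4 ℤ.* (τ ℤ.* τ)
        i₂ = ℤR.solve-∀

      ΓΓ̄ : Γ * Γ̄ ≡ ι (+ 4 ℤ.* (τ ℤ.* τ))
      ΓΓ̄ = cong₂ _,_ (trans (i₁ x₀ y₀ Δ) norm) (i₂ x₀ y₀)
        where
        i₁ : ∀ x y Δ → y ℤ.* (ℤ.- y) ℤ.+ x ℤ.* x ℤ.* Δ ≡ x ℤ.* x ℤ.* Δ ℤ.- y ℤ.* y
        i₁ = ℤR.solve-∀
        i₂ : ∀ x y → y ℤ.* x ℤ.+ x ℤ.* (ℤ.- y) ≡ + 0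
        i₂ = ℤR.solve-∀

      ΛΓ : ∀ x y → Λ * (+ 2 ℤ.* y ℤ.- τ ℤ.* x , x) ≡ ι (+ 2) * (+ 2 ℤ.* (τ ℤ.* y ℤ.- x) ℤ.- τ ℤ.* y , y)
      ΛΓ x y = cong₂ _,_ (i₁ τ x y) (i₂ τ x y)
        where
        i₁ : ∀ τ x y → τ ℤ.* (+ 2 ℤ.* y ℤ.- τ ℤ.* x) ℤ.+ + 1 ℤ.* x ℤ.* (τ ℤ.* τ ℤ.- + 4)
          ≡ + 2 ℤ.* (+ 2 ℤ.* (τ ℤ.* y ℤ.- x) ℤ.- τ ℤ.* y) ℤ.+ + 0 ℤ.* y ℤ.* (τ ℤ.* τ ℤ.- + 4)
        i₁ = ℤR.solve-∀
        i₂ : ∀ τ x y → τ ℤ.* x ℤ.+ + 1 ℤ.* (+ 2 ℤ.* y ℤ.- τ ℤ.* x)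
          ≡ + 2 ℤ.* y ℤ.+ + 0 ℤ.* (+ 2 ℤ.* (τ ℤ.* y ℤ.- x) ℤ.- τ ℤ.* y)
        i₂ = ℤR.solve-∀

      N-back : ∀ {x y} → Λ * x ≡ ι (+ 2) * y → N y → N x
      N-back {x} {y} p (k # c) = suc k # subst C₀
        (trans (i₁ (Λ ^ k) y (ι (+ 2))) (trans (cong (Λ ^ k *_) (sym p)) (i₂ (Λ ^ k) Λ x)))
        (C₀-* (C₀-ι (0≤ℕ {2})) c)
        where
        i₁ : ∀ a b c → c * (a * b) ≡ a * (c * b)
        i₁ = RingSolver.solve-∀ ring
        i₂ : ∀ a b c → a * (b * c) ≡ b * a * c
        i₂ = RingSolver.solve-∀ ring

      -- f bounds the number of further steps for which the solution can decrease.
      positive-solution : (x : ℕ → ℤ) → (∀ k → + 0 ℤ.< x k) →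
        (∀ k → x (2 ℕ.+ k) ≡ τ ℤ.* x (1 ℕ.+ k) ℤ.- x k) → ∀ f k →
        + 0 ℤ.≤ x (1 ℕ.+ k) ℤ.- x k ℤ.+ + f → N (+ 2 ℤ.* x (1 ℕ.+ k) ℤ.- τ ℤ.* x k , x k)
      positive-solution x 0<x rec zero k p = N-back
        (subst (λ z → Λ * (+ 2 ℤ.* x (1 ℕ.+ k) ℤ.- τ ℤ.* x k , x k)
            ≡ ι (+ 2) * (+ 2 ℤ.* z ℤ.- τ ℤ.* x (1 ℕ.+ k) , x (1 ℕ.+ k))) (sym (rec k)) (ΛΓ (x k) (x (1 ℕ.+ k))))
        (N-C₀ (subst (+ 0 ℤ.≤_) (trans (i₁ τ (x k) (x (1 ℕ.+ k)))
              (cong (λ z → + 2 ℤ.* z ℤ.- τ ℤ.* x (1 ℕ.+ k)) (sym (rec k))))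
            (0≤-+ (0≤-+ p p) (0≤-* (0≤-diff 2≤τ) (ℤP.<⇒≤ (0<x (1 ℕ.+ k)))))
          , ℤP.<⇒≤ (0<x (1 ℕ.+ k))))
        where
        i₁ : ∀ τ a b → b ℤ.- a ℤ.+ + 0 ℤ.+ (b ℤ.- a ℤ.+ + 0) ℤ.+ (τ ℤ.- + 2) ℤ.* b
          ≡ + 2 ℤ.* (τ ℤ.* b ℤ.- a) ℤ.- τ ℤ.* b
        i₁ = ℤR.solve-∀
      positive-solution x 0<x rec (suc f) k p = N-back
        (subst (λ z → Λ * (+ 2 ℤ.* x (1 ℕ.+ k) ℤ.- τ ℤ.* x k , x k)
            ≡ ι (+ 2) * (+ 2 ℤ.* z ℤ.- τ ℤ.* x (1 ℕ.+ k) , x (1 ℕ.+ k))) (sym (rec k)) (ΛΓ (x k) (x (1 ℕ.+ k))))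
        (positive-solution x 0<x rec f (suc k) (subst (+ 0 ℤ.≤_)
          (trans (i₁ τ (x k) (x (1 ℕ.+ k)) (+ f)) (cong (λ z → z ℤ.- x (1 ℕ.+ k) ℤ.+ + f) (sym (rec k))))
          (0≤-+ p (0≤-+ (0≤-* (0≤-diff 3≤τ) (ℤP.<⇒≤ (0<x (1 ℕ.+ k)))) (0≤-diff (1≤-0< (0<x (1 ℕ.+ k))))))))
        where
        i₁ : ∀ τ a b f → b ℤ.- a ℤ.+ (+ 1 ℤ.+ f) ℤ.+ ((τ ℤ.- + 3) ℤ.* b ℤ.+ (b ℤ.- + 1))
          ≡ τ ℤ.* b ℤ.- a ℤ.- b ℤ.+ f
        i₁ = ℤR.solve-∀

      N-Γ : N Γ
      N-Γ = subst₂ (λ a b → N (+ 2 ℤ.* b ℤ.- τ ℤ.* a , a)) (ladder-0 u w) (ladder-1 u w)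
        (positive-solution (λ k → T (k · u ⊞ w)) (λ k → posʳ (good-iterate k g)) (λ k → trans (ladder-rec g k) (cong (λ z → z ℤ.* T ((1 ℕ.+ k) · u ⊞ w) ℤ.- T (k · u ⊞ w)) Tu≡τ))
          ℤ.∣ T (1 · u ⊞ w) ℤ.- T (0 · u ⊞ w) ∣ 0 (0≤i+∣i∣ (T (1 · u ⊞ w) ℤ.- T (0 · u ⊞ w))))

      private
        g⁻ : Good (neg u) w
        g⁻ = good-neg-swap g
        x₋ : ℕ → ℤ
        x₋ k = T (k · neg u ⊞ w)

      N-Γ̄ : N Γ̄
      N-Γ̄ = subst N (cong₂ _,_ y-neg (ladder-0 (neg u) w))
        (positive-solution x₋ (λ k → posʳ (good-iterate k g⁻))
          (λ k → trans (ladder-rec g⁻ k) (cong (λ z → z ℤ.* x₋ (1 ℕ.+ k) ℤ.- x₋ k) (trans (even u) Tu≡τ)))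
          ℤ.∣ x₋ 1 ℤ.- x₋ 0 ∣ 0 (0≤i+∣i∣ (x₋ 1 ℤ.- x₋ 0)))
        where
        i₁ : ∀ τ x y z → + 2 ℤ.* z ℤ.- τ ℤ.* x ≡ + 2 ℤ.* (y ℤ.+ z ℤ.- τ ℤ.* x) ℤ.- (+ 2 ℤ.* y ℤ.- τ ℤ.* x)
        i₁ = ℤR.solve-∀
        i₂ : ∀ t y → + 2 ℤ.* (t ℤ.- t) ℤ.- y ≡ ℤ.- y
        i₂ = ℤR.solve-∀
        at-1 : x₋ 1 ≡ T (u ⊟ w)
        at-1 = trans (ladder-1 (neg u) w) (trans (cong T (trans (neg-⊞ u w) (sym (neg-⊟ u w)))) (even (u ⊟ w)))
        y-neg : + 2 ℤ.* x₋ 1 ℤ.- τ ℤ.* x₋ 0 ≡ ℤ.- y₀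
        y-neg = trans (cong₂ (λ a b → + 2 ℤ.* a ℤ.- τ ℤ.* b) at-1 (ladder-0 (neg u) w))
          (trans (i₁ τ x₀ x₁ (T (u ⊟ w)))
            (trans (cong (λ z → + 2 ℤ.* (z ℤ.- τ ℤ.* x₀) ℤ.- y₀) (trans (farey u w (unimod g)) (cong (ℤ._* x₀) Tu≡τ))) (i₂ (τ ℤ.* x₀) y₀)))

      a b : K
      a = ι (+ 2)
      b = ι (+ 2) * δ

      A Ā B B̄ : Mat
      A = mat Λ 0K 0K Λ̄
      Ā = mat Λ̄ 0K 0K Λ
      B = mat Γ (ι (+ 4)) (ι (+ 4)) Γ̄
      B̄ = mat Γ̄ (ι (+ 4)) (ι (+ 4)) Γ

      private
        t₁ : tr A ≡ a * ι τ
        t₁ = cong₂ _,_ (i₁ τ) (i₂ τ)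
          where
          i₁ : ∀ τ → τ ℤ.+ τ ≡ + 2 ℤ.* τ ℤ.+ + 0 ℤ.* + 0 ℤ.* (τ ℤ.* τ ℤ.- + 4)
          i₁ = ℤR.solve-∀
          i₂ : ∀ τ → + 0 ≡ + 2 ℤ.* + 0 ℤ.+ + 0 ℤ.* τ
          i₂ = ℤR.solve-∀
        t₂ : tr B ≡ b * ι x₀
        t₂ = cong₂ _,_ (i₁ y₀ x₀) (i₂ x₀)
          where
          i₁ : ∀ y x → y ℤ.+ ℤ.- y ≡ + 0 ℤ.* x ℤ.+ + 2 ℤ.* + 0 ℤ.* Δ
          i₁ y x = ℤP.+-inverseʳ y
          i₂ : ∀ x → x ℤ.+ x ≡ + 0 ℤ.* + 0 ℤ.+ + 2 ℤ.* x
          i₂ = ℤR.solve-∀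
        t₃ : tr (A ⊙ B) ≡ a * b * ι x₁
        t₃ = cong₂ _,_ (i₁ τ x₀ x₁ (τ ℤ.* τ ℤ.- + 4)) (i₂ τ x₀ x₁)
          where
          i₁ : ∀ τ x z Δ → (τ ℤ.* (+ 2 ℤ.* z ℤ.- τ ℤ.* x) ℤ.+ + 1 ℤ.* x ℤ.* Δ ℤ.+ (+ 0 ℤ.* + 4 ℤ.+ + 0 ℤ.* + 0 ℤ.* Δ))
               ℤ.+ ((+ 0 ℤ.* + 4 ℤ.+ + 0 ℤ.* + 0 ℤ.* Δ) ℤ.+ (τ ℤ.* (ℤ.- (+ 2 ℤ.* z ℤ.- τ ℤ.* x)) ℤ.+ -[1+ 0 ] ℤ.* x ℤ.* Δ))
             ≡ + 0 ℤ.* z ℤ.+ + 4 ℤ.* + 0 ℤ.* Δ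
          i₁ = ℤR.solve-∀
          i₂ : ∀ τ x z → (τ ℤ.* x ℤ.+ + 1 ℤ.* (+ 2 ℤ.* z ℤ.- τ ℤ.* x) ℤ.+ + 0)
               ℤ.+ (+ 0 ℤ.+ (τ ℤ.* x ℤ.+ -[1+ 0 ] ℤ.* (ℤ.- (+ 2 ℤ.* z ℤ.- τ ℤ.* x))))
             ≡ + 0 ℤ.* + 0 ℤ.+ + 4 ℤ.* z
          i₂ = ℤR.solve-∀
        d₁ : detM A ≡ a * a
        d₁ = trans (i₁ Λ Λ̄) ΛΛ̄
          where
          i₁ : ∀ x y → x * y - 0K * 0K ≡ x * y
          i₁ = RingSolver.solve-∀ ring
        bb : b * b ≡ ι (+ 4 ℤ.* Δ)
        bb = cong₂ _,_ (i₁ Δ) refl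
          where
          i₁ : ∀ Δ → + 0 ℤ.+ + 4 ℤ.* Δ ≡ + 4 ℤ.* Δ
          i₁ = ℤR.solve-∀
        d₂ : detM B ≡ b * b
        d₂ = trans (cong (_- ι (+ 4) * ι (+ 4)) ΓΓ̄) (trans (cong ι (i₁ τ)) (sym bb))
          where
          i₁ : ∀ τ → + 4 ℤ.* (τ ℤ.* τ) ℤ.+ ℤ.- + 16 ≡ + 4 ℤ.* (τ ℤ.* τ ℤ.- + 4)
          i₁ = ℤR.solve-∀
        N-4 : N (ι (+ 4))
        N-4 = N-ι (0≤ℕ {4})
        N-0 : N 0K
        N-0 = N-ι (0≤ℕ {0})

      N-a : N a
      N-a = N-ι (0≤ℕ {2})

      N-b : N b
      N-b = N-* N-a N-δ

      rep : Rep u w A B a b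
      rep = record
        { basis = unimod g ; tr-A = trans t₁ (cong (λ t → a * ι t) (sym Tu≡τ)) ; tr-B = t₂ ; tr-AB = t₃ ; det-A = d₁ ; det-B = d₂
        ; nn-A = record { n₁₁ = N-Λ ; n₁₂ = N-0 ; n₂₁ = N-0 ; n₂₂ = N-Λ̄ }
        ; nn-B = record { n₁₁ = N-Γ ; n₁₂ = N-4 ; n₂₁ = N-4 ; n₂₂ = N-Γ̄ }
        ; nn-a = N-a ; nn-b = N-b }

      rep̄ : Rep u w Ā B̄ a b
      rep̄ = record
        { basis = unimod g ; tr-A = trans (+-comm Λ̄ Λ) (trans t₁ (cong (λ t → a * ι t) (sym Tu≡τ))) ; tr-B = trans (+-comm Γ̄ Γ) t₂
        ; tr-AB = trans (i₁ Λ Λ̄ Γ Γ̄ (ι (+ 4))) t₃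
        ; det-A = trans (i₂ Λ Λ̄ 0K) d₁ ; det-B = trans (i₂ Γ Γ̄ (ι (+ 4))) d₂
        ; nn-A = record { n₁₁ = N-Λ̄ ; n₁₂ = N-0 ; n₂₁ = N-0 ; n₂₂ = N-Λ }
        ; nn-B = record { n₁₁ = N-Γ̄ ; n₁₂ = N-4 ; n₂₁ = N-4 ; n₂₂ = N-Γ }
        ; nn-a = N-a ; nn-b = N-b }
        where
        i₁ : ∀ l m x y q → m * y + 0K * q + (0K * q + l * x) ≡ l * x + 0K * q + (0K * q + m * y)
        i₁ = RingSolver.solve-∀ ring
        i₂ : ∀ x y z → y * x - z * z ≡ x * y - z * z
        i₂ = RingSolver.solve-∀ ring

      lower : ∀ i j → 1 ℕ.≤ j → Λ ^ i * Γ ^ j ≼ a ^ i * b ^ j * ι (T (i · u ⊞ j · w))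
      lower i j 1≤j = word-bound (i ℕ.+ j) i j ℕP.≤-refl (ℕP.≤-trans 1≤j (ℕP.m≤n+m j i)) rep
        N-Λ N-Γ (≼-reflexive refl) (≼-reflexive refl)

      lower̄ : ∀ i j → 1 ℕ.≤ j → Λ̄ ^ i * Γ̄ ^ j ≼ a ^ i * b ^ j * ι (T (i · u ⊞ j · w))
      lower̄ i j 1≤j = word-bound (i ℕ.+ j) i j ℕP.≤-refl (ℕP.≤-trans 1≤j (ℕP.m≤n+m j i)) rep̄
        N-Λ̄ N-Γ̄ (≼-reflexive refl) (≼-reflexive refl)

      two-step : (f f′ : ℕ → K) → ∀ p q → f 0 ≡ f′ 0 → f 1 ≡ f′ 1 →
        (∀ n → f (2 ℕ.+ n) ≡ p * f (1 ℕ.+ n) - q * f n) →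
        (∀ n → f′ (2 ℕ.+ n) ≡ p * f′ (1 ℕ.+ n) - q * f′ n) → ∀ n → f n ≡ f′ n
      two-step f f′ p q e₀ e₁ r r′ n = proj₁ (both n)
        where
        both : ∀ n → f n ≡ f′ n × f (suc n) ≡ f′ (suc n)
        both zero = e₀ , e₁
        both (suc n) with x , y ← both n = y ,
          trans (r n) (trans (cong₂ (λ u v → p * u - q * v) y x) (sym (r′ n)))

      ΛΛ : Λ * Λ ≡ a * ι τ * Λ - ι (+ 4)
      ΛΛ = cong₂ _,_ (i₁ τ) (i₂ τ)
        where
        i₁ : ∀ τ → τ ℤ.* τ ℤ.+ + 1 ℤ.* + 1 ℤ.* (τ ℤ.* τ ℤ.- + 4)
          ≡ (+ 2 ℤ.* τ ℤ.+ + 0 ℤ.* + 0 ℤ.* (τ ℤ.* τ ℤ.- + 4)) ℤ.* τ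
            ℤ.+ (+ 2 ℤ.* + 0 ℤ.+ + 0 ℤ.* τ) ℤ.* + 1 ℤ.* (τ ℤ.* τ ℤ.- + 4) ℤ.+ ℤ.- + 4
        i₁ = ℤR.solve-∀
        i₂ : ∀ τ → τ ℤ.* + 1 ℤ.+ + 1 ℤ.* τ
          ≡ (+ 2 ℤ.* τ ℤ.+ + 0 ℤ.* + 0 ℤ.* (τ ℤ.* τ ℤ.- + 4)) ℤ.* + 1
            ℤ.+ (+ 2 ℤ.* + 0 ℤ.+ + 0 ℤ.* τ) ℤ.* τ ℤ.+ + 0
        i₂ = ℤR.solve-∀

      Λ̄≡ : Λ̄ ≡ a * ι τ - Λ
      Λ̄≡ = cong₂ _,_ (i₁ τ) (i₂ τ)
        where
        i₁ : ∀ τ → τ ≡ (+ 2 ℤ.* τ ℤ.+ + 0 ℤ.* + 0 ℤ.* (τ ℤ.* τ ℤ.- + 4)) ℤ.+ ℤ.- τ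
        i₁ = ℤR.solve-∀
        i₂ : ∀ τ → -[1+ 0 ] ≡ + 2 ℤ.* + 0 ℤ.+ + 0 ℤ.* τ ℤ.+ -[1+ 0 ]
        i₂ = ℤR.solve-∀

      Λ̄Λ̄ : Λ̄ * Λ̄ ≡ a * ι τ * Λ̄ - ι (+ 4)
      Λ̄Λ̄ = trans (cong (λ z → z * z) Λ̄≡) (trans (i₁ (a * ι τ) Λ)
        (trans (cong (λ z → a * ι τ * (a * ι τ) - a * ι τ * Λ - a * ι τ * Λ + z) ΛΛ)
          (trans (i₂ (a * ι τ) Λ (ι (+ 4))) (cong (λ z → a * ι τ * z - ι (+ 4)) (sym Λ̄≡)))))
        where
        i₁ : ∀ p l → (p - l) * (p - l) ≡ p * p - p * l - p * l + l * l
        i₁ = RingSolver.solve-∀ ring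
        i₂ : ∀ p l q → p * p - p * l - p * l + (p * l - q) ≡ p * (p - l) - q
        i₂ = RingSolver.solve-∀ ring

      closed : ∀ c d → ∀ n → c * Λ ^ (2 ℕ.+ n) + d * Λ̄ ^ (2 ℕ.+ n)
        ≡ a * ι τ * (c * Λ ^ (1 ℕ.+ n) + d * Λ̄ ^ (1 ℕ.+ n)) - ι (+ 4) * (c * Λ ^ n + d * Λ̄ ^ n)
      closed c d n = trans (i₁ c d Λ Λ̄ (Λ ^ n) (Λ̄ ^ n))
        (trans (cong₂ (λ x y → c * (x * Λ ^ n) + d * (y * Λ̄ ^ n)) ΛΛ Λ̄Λ̄)
          (i₂ c d Λ Λ̄ (Λ ^ n) (Λ̄ ^ n) (a * ι τ) (ι (+ 4))))
        where
        i₁ : ∀ c d l m x y → c * (l * (l * x)) + d * (m * (m * y)) ≡ c * (l * l * x) + d * (m * m * y)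
        i₁ = RingSolver.solve-∀ ring
        i₂ : ∀ c d l m x y p q → c * ((p * l - q) * x) + d * ((p * m - q) * y)
           ≡ p * (c * (l * x) + d * (m * y)) - q * (c * x + d * y)
        i₂ = RingSolver.solve-∀ ring

      module U = Powers u w A a (unimod g) (Rep.nn-A rep) (Rep.tr-A rep) (Rep.det-A rep)

      multiples-closed : ∀ n → δ * U.h n ≡ ι τ * Λ ^ n + - ι τ * Λ̄ ^ n
      multiples-closed = two-step (λ n → δ * U.h n) _ (a * ι τ) (ι (+ 4))
        (trans (cong (δ *_) U.h-0) (i₀ δ (ι τ)))
        (trans (cong (δ *_) (trans U.h-1 t₁)) (trans (i₁ δ (ι τ)) (cong (ι τ *_) ΛmΛ̄) ∙ i₂ (ι τ) Λ Λ̄))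
        (λ n → trans (cong (δ *_) (U.h-rec n)) (trans
          (cong₂ (λ x y → δ * (x * U.h (1 ℕ.+ n) - y * U.h n)) t₁ d₁) (i₃ δ (a * ι τ) (ι (+ 4)) (U.h (1 ℕ.+ n)) (U.h n))))
        (closed (ι τ) (- ι τ))
        where
        _∙_ : ∀ {x y z : K} → x ≡ y → y ≡ z → x ≡ z
        _∙_ = trans
        i₀ : ∀ d t → d * 0K ≡ t * 1K + - t * 1K
        i₀ = RingSolver.solve-∀ ring
        i₁ : ∀ d t → d * (ι (+ 2) * t) ≡ t * (ι (+ 2) * d)
        i₁ d t = j₁ d t (ι (+ 2))
          where
          j₁ : ∀ d t c → d * (c * t) ≡ t * (c * d)
          j₁ = RingSolver.solve-∀ ring
        ΛmΛ̄ : ι (+ 2) * δ ≡ Λ - Λ̄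
        ΛmΛ̄ = cong₂ _,_ (sym (ℤP.+-inverseʳ τ)) refl
        i₂ : ∀ t l m → t * (l - m) ≡ t * (l * 1K) + - t * (m * 1K)
        i₂ = RingSolver.solve-∀ ring
        i₃ : ∀ d p q x y → d * (p * x - q * y) ≡ p * (d * x) - q * (d * y)
        i₃ = RingSolver.solve-∀ ring

      multiples-upper : ∀ n → δ * U.h n ≼ ι τ * Λ ^ n
      multiples-upper n = le (N-resp (trans (i₁ (ι τ) (Λ ^ n) (Λ̄ ^ n))
          (cong (λ z → ι τ * Λ ^ n - z) (sym (multiples-closed n))))
        (N-* (N-ι 0≤τ) (N-^ n N-Λ̄)))
        where
        i₁ : ∀ t x y → t * y ≡ t * x - (t * x + - t * y)
        i₁ = RingSolver.solve-∀ ring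

      record ιPos (x : K) : Set where
        constructor ιpos
        field
          value : ℤ
          value>0 : + 0 ℤ.< value
          is-ι  : x ≡ ι value

      ιPos-* : ∀ {x y} → ιPos x → ιPos y → ιPos (x * y)
      ιPos-* (ιpos c p refl) (ιpos d q refl) = ιpos (c ℤ.* d) (0<-* p q) (sym (ι-* c d))

      ιPos-^ : ∀ {x} n → ιPos x → ιPos (x ^ n)
      ιPos-^ zero p = ιpos (+ 1) (ℤ.+<+ (ℕ.s≤s ℕ.z≤n)) refl
      ιPos-^ (suc n) p = ιPos-* p (ιPos-^ n p)

      ιPos-cancel : ∀ {x c d} → ιPos x → x * ι c ≼ x * ι d → c ℤ.≤ d
      ιPos-cancel {c = c} {d} (ιpos e p refl) (le q) = ℤP.0≤i-j⇒j≤i (0≤-cancel {e} {d ℤ.- c} p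
        (N⇒0≤ (N-resp (trans (i₁ (ι e) (ι c) (ι d)) (sym (ι-* e (d ℤ.- c)))) q)))
        where
        i₁ : ∀ e c d → e * d - e * c ≡ e * (d - c)
        i₁ = RingSolver.solve-∀ ring

      D : K
      D = ι Δ

      δδ : δ * δ ≡ D
      δδ = cong₂ _,_ (i₁ Δ) refl
        where
        i₁ : ∀ Δ → + 0 ℤ.+ + 1 ℤ.* Δ ≡ Δ
        i₁ = ℤR.solve-∀

      -- Both points lie on the side of w and straddle n u symmetrically as seen
      -- from ± u; the scale factors of the two lower bounds multiply to coth² per
      -- unit of j, which already pays for the excess of T (n u) over the n-th power.
      core : ∀ k n j → T (n · u) ℤ.* T (n · u)
           ℤ.≤ T ((k ℕ.+ (n ℕ.+ n)) · u ⊞ suc j · w) ℤ.* T (k · u ⊞ suc j · w)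
      core k n j = ιPos-cancel E>0 (≼-trans (≼-reflexive (sym X≡)) (≼-trans X≼Y
        (≼-trans (≼-reflexive Y≡) (≼-trans bounds (≼-reflexive Z≡)))))
        where
        s = k ℕ.+ (n ℕ.+ n)
        t T₊ T₋ : ℤ
        t  = T (n · u)
        T₊ = T (s · u ⊞ suc j · w)
        T₋ = T (k · u ⊞ suc j · w)
        four tt : K
        four = ι (+ 4)
        tt = ι τ * ι τ
        E X Y : K
        E = four ^ k * (a ^ n * a ^ n) * (four * D) ^ suc j
        X = four ^ k * (δ * U.h n * (δ * U.h n)) * (four * D) ^ j * four
        Y = four ^ k * (ι τ * Λ ^ n * (ι τ * Λ ^ n)) * (four * tt) ^ j * four
        4>0 : ιPos four
        4>0 = ιpos (+ 4) (ℤ.+<+ (ℕ.s≤s ℕ.z≤n)) refl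
        E>0 : ιPos E
        E>0 = ιPos-* (ιPos-* (ιPos-^ k 4>0) (ιPos-* (ιPos-^ n 2>0) (ιPos-^ n 2>0)))
          (ιPos-^ (suc j) (ιPos-* 4>0 (ιpos Δ 0<Δ refl)))
          where
          2>0 : ιPos a
          2>0 = ιpos (+ 2) (ℤ.+<+ (ℕ.s≤s ℕ.z≤n)) refl
        N4 : N four
        N4 = N-ι (0≤ℕ {4})
        NS : N (δ * U.h n)
        NS = N-* N-δ (proj₁ (U.growth n))
        ND : N D
        ND = N-ι (ℤP.<⇒≤ 0<Δ)
        NτΛ : N (ι τ * Λ ^ n)
        NτΛ = N-* (N-ι 0≤τ) (N-^ n N-Λ)
        D≼tt : D ≼ tt
        D≼tt = le (N-resp (trans (cong ι (i₁ τ)) (cong (_- D) (ι-* τ τ))) N4)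
          where
          i₁ : ∀ τ → + 4 ≡ τ ℤ.* τ ℤ.+ ℤ.- (τ ℤ.* τ ℤ.- + 4)
          i₁ = ℤR.solve-∀
        Ntt : N tt
        Ntt = 0≼ ND D≼tt
        X≼Y : X ≼ Y
        X≼Y = ≼-* (N-* (N-* (N-^ k N4) (N-* NS NS)) (N-^ j (N-* N4 ND))) N4
          (≼-* (N-* (N-^ k N4) (N-* NS NS)) (N-^ j (N-* N4 Ntt))
            (≼-* (N-^ k N4) (N-* NτΛ NτΛ) (≼-reflexive refl)
              (≼-* NS NτΛ (multiples-upper n) (multiples-upper n)))
            (≼-^ j (N-* N4 ND) (≼-* N4 Ntt (≼-reflexive refl) D≼tt)))
          (≼-reflexive refl)
        bounds : (Λ ^ s * Γ ^ suc j) * (Λ̄ ^ k * Γ̄ ^ suc j)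
               ≼ (a ^ s * b ^ suc j * ι T₊) * (a ^ k * b ^ suc j * ι T₋)
        bounds = ≼-* (N-* (N-^ s N-Λ) (N-^ (suc j) N-Γ))
          (0≼ (N-* (N-^ k N-Λ̄) (N-^ (suc j) N-Γ̄)) (lower̄ k (suc j) (ℕ.s≤s ℕ.z≤n)))
          (lower s (suc j) (ℕ.s≤s ℕ.z≤n)) (lower̄ k (suc j) (ℕ.s≤s ℕ.z≤n))
        X≡ : X ≡ E * ι (t ℤ.* t)
        X≡ = trans (cong (λ h → four ^ k * (δ * h * (δ * h)) * (four * D) ^ j * four) h≡)
          (trans (rearrange (four ^ k) δ (a ^ n) (ι t) ((four * D) ^ j) four D δδ) (cong (λ z → E * z) (sym (ι-* t t))))
          where
          h≡ : U.h n ≡ a ^ n * ι t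
          h≡ = refl
          i₁ : ∀ d p t → d * (p * t) * (d * (p * t)) ≡ d * d * (p * p) * (t * t)
          i₁ = RingSolver.solve-∀ ring
          i₂ : ∀ f e p t q v → f * (e * p * t) * q * v ≡ f * p * (v * e * q) * t
          i₂ = RingSolver.solve-∀ ring
          rearrange : ∀ f d p t q v e → d * d ≡ e →
            f * (d * (p * t) * (d * (p * t))) * q * v ≡ f * (p * p) * (v * e * q) * (t * t)
          rearrange f d p t q v .(d * d) refl = trans (cong (λ z → f * z * q * v) (i₁ d p t)) (i₂ f (d * d) (p * p) (t * t) q v)
        Z≡ : (a ^ s * b ^ suc j * ι T₊) * (a ^ k * b ^ suc j * ι T₋) ≡ E * ι (T₊ ℤ.* T₋)
        Z≡ = trans (cong (λ z → (z * b ^ suc j * ι T₊) * (a ^ k * b ^ suc j * ι T₋))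
            (trans (^-+ a k (n ℕ.+ n)) (cong (a ^ k *_) (^-+ a n n))))
          (trans (i₁ (a ^ k) (a ^ n) (b ^ suc j) (ι T₊) (ι T₋))
            (cong₂ _*_ (cong₂ (λ x y → x * (a ^ n * a ^ n) * y) (sym (^-* a a k))
              (trans (sym (^-* b b (suc j))) (cong (_^ suc j) (trans bb (ι-* (+ 4) Δ))))) (sym (ι-* T₊ T₋))))
          where
          i₁ : ∀ p q r x y → (p * (q * q) * r * x) * (p * r * y) ≡ p * p * (q * q) * (r * r) * (x * y)
          i₁ = RingSolver.solve-∀ ring
        Y≡ : Y ≡ (Λ ^ s * Γ ^ suc j) * (Λ̄ ^ k * Γ̄ ^ suc j)
        Y≡ = trans (i₁ (four ^ k) (ι τ) (Λ ^ n) ((four * tt) ^ j) four)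
          (trans (cong₂ (λ x y → x * (Λ ^ n * Λ ^ n) * y)
              (trans (cong (_^ k) (sym ΛΛ̄)) (^-* Λ Λ̄ k))
              (trans (cong (_^ suc j) (sym (trans ΓΓ̄ (trans (ι-* (+ 4) (τ ℤ.* τ)) (cong (four *_) (ι-* τ τ))))))
                (^-* Γ Γ̄ (suc j))))
            (trans (i₂ (Λ ^ k) (Λ̄ ^ k) (Λ ^ n) (Γ ^ suc j) (Γ̄ ^ suc j))
              (cong (λ z → (z * Γ ^ suc j) * (Λ̄ ^ k * Γ̄ ^ suc j))
                (sym (trans (^-+ Λ k (n ℕ.+ n)) (cong (Λ ^ k *_) (^-+ Λ n n)))))))
          where
          i₁ : ∀ f t l q v → f * (t * l * (t * l)) * q * v ≡ f * (l * l) * (v * (t * t) * q)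
          i₁ = RingSolver.solve-∀ ring
          i₂ : ∀ p p̄ l c c̄ → p * p̄ * (l * l) * (c * c̄) ≡ (p * (l * l) * c) * (p̄ * c̄)
          i₂ = RingSolver.solve-∀ ring

      ladder : ℕ → ℤ
      ladder n = T (n · u ⊞ w)

      ladder-closed : ∀ n → b * (a ^ n * ι (ladder n)) ≡ Γ * Λ ^ n + Γ̄ * Λ̄ ^ n
      ladder-closed = two-step (λ n → b * (a ^ n * ι (ladder n))) _ (a * ι τ) (ι (+ 4))
        (trans (cong (b *_) (trans (*-identityˡ (ι (ladder 0))) (cong ι (ladder-0 u w)))) (trans (sym t₂)
          (sym (cong₂ _+_ (*-identityʳ Γ) (*-identityʳ Γ̄)))))
        (trans (cong (b *_) (cong₂ _*_ (*-identityʳ a) (cong ι (ladder-1 u w))))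
          (trans (i₁ a b (ι x₁)) (trans (sym t₃) (i₂ Γ Γ̄ Λ Λ̄ (ι (+ 4))))))
        (λ n → trans (cong (λ z → b * (a ^ (2 ℕ.+ n) * z)) (trans (cong ι (rec n))
            (cong (_- ι (ladder n)) (ι-* τ (ladder (1 ℕ.+ n))))))
          (i₃ a b (ι τ) (ι (ladder (1 ℕ.+ n))) (ι (ladder n)) (a ^ n)))
        (closed Γ Γ̄)
        where
        rec : ∀ n → ladder (2 ℕ.+ n) ≡ τ ℤ.* ladder (1 ℕ.+ n) ℤ.- ladder n
        rec n = trans (ladder-rec g n) (cong (λ z → z ℤ.* ladder (1 ℕ.+ n) ℤ.- ladder n) Tu≡τ)
        i₁ : ∀ a b x → b * (a * x) ≡ a * b * x
        i₁ = RingSolver.solve-∀ ring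
        i₂ : ∀ c d l m q → l * c + 0K * q + (0K * q + m * d) ≡ c * (l * 1K) + d * (m * 1K)
        i₂ = RingSolver.solve-∀ ring
        i₃ : ∀ a b t x y p → b * (a * (a * p) * (t * x - y)) ≡ a * t * (b * (a * p * x)) - a * a * (b * (p * y))
        i₃ = RingSolver.solve-∀ ring

      N-cancel-ι : ∀ {x} → ιPos x → ∀ {y} → N (x * y) → N y
      N-cancel-ι (ιpos c 0<c refl) {y} (k # (p , q)) = k #
        ( 0≤-cancel 0<c (subst (+ 0 ℤ.≤_) (cong proj₁ (shift (Λ ^ k))) p)
        , 0≤-cancel 0<c (subst (+ 0 ℤ.≤_) (cong proj₂ (shift (Λ ^ k))) q))
        where
        i₁ : ∀ l c y → l * (c * y) ≡ c * (l * y)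
        i₁ = RingSolver.solve-∀ ring
        ι-scale : ∀ z → ι c * z ≡ (c ℤ.* proj₁ z , c ℤ.* proj₂ z)
        ι-scale (p , q) = cong₂ _,_ (i₂ c p q Δ) (i₃ c p q)
          where
          i₂ : ∀ c p q Δ → c ℤ.* p ℤ.+ + 0 ℤ.* q ℤ.* Δ ≡ c ℤ.* p
          i₂ = ℤR.solve-∀
          i₃ : ∀ c p q → c ℤ.* q ℤ.+ + 0 ℤ.* p ≡ c ℤ.* q
          i₃ = ℤR.solve-∀
        shift : ∀ l → l * (ι c * y) ≡ (c ℤ.* proj₁ (l * y) , c ℤ.* proj₂ (l * y))
        shift l = trans (i₁ l (ι c) y) (ι-scale (l * y))

      N-cancel-δ : ∀ {y} → N (δ * y) → N y
      N-cancel-δ {y} p = N-cancel-ι (ιpos Δ 0<Δ refl)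
        (N-resp (trans (i₁ δ y) (cong (_* y) δδ)) (N-* N-δ p))
        where
        i₁ : ∀ d y → d * (d * y) ≡ d * d * y
        i₁ = RingSolver.solve-∀ ring

      2>0 : ιPos a
      2>0 = ιpos (+ 2) (ℤ.+<+ (ℕ.s≤s ℕ.z≤n)) refl

      N-cancel-b : ∀ {y} → N (b * y) → N y
      N-cancel-b {y} p = N-cancel-ι 2>0 (N-cancel-δ (N-resp (i₁ a δ y) p))
        where
        i₁ : ∀ a d y → a * d * y ≡ d * (a * y)
        i₁ = RingSolver.solve-∀ ring

      Λ̄≼Λ : Λ̄ ≼ Λ
      Λ̄≼Λ = le (N-resp (cong₂ _,_ (sym (ℤP.+-inverseʳ τ)) refl) N-b)

      Λ̄^≼Λ^ : ∀ k → Λ̄ ^ k ≼ Λ ^ k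
      Λ̄^≼Λ^ k = ≼-^ k N-Λ̄ Λ̄≼Λ

      private
        double-even : ∀ k → T ((k ℕ.+ k) · u ⊞ 2 · w) ≡ ladder k ℤ.* ladder k
        double-even k = trans (cong T (i₂ u w)) (trans (i₀ (T (2 · P)))
          (trans (cong (λ z → T (2 · P) ℤ.+ z) (sym T-0))
            (trans (multiple P u (unimodular-swap u P (unimod (good-iterate k g))) 0)
              (cong (λ z → T P ℤ.* T z) (·-1 P)))))
          where
          P = k · u ⊞ w
          i₀ : ∀ x → x ≡ x ℤ.+ + 0
          i₀ = ℤR.solve-∀
          i₁ : ∀ k a c → (k ℤ.+ k) ℤ.* a ℤ.+ + 2 ℤ.* c ≡ + 2 ℤ.* (k ℤ.* a ℤ.+ c)
          i₁ = ℤR.solve-∀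
          i₂ : ∀ u w → (k ℕ.+ k) · u ⊞ 2 · w ≡ 2 · (k · u ⊞ w)
          i₂ (a , b) (c , d) = cong₂ _,_ (i₁ (+ k) a c) (i₁ (+ k) b d)

        double-odd : ∀ k → T ((1 ℕ.+ (k ℕ.+ k)) · u ⊞ 2 · w) ≡ ladder (1 ℕ.+ k) ℤ.* ladder k ℤ.- τ
        double-odd k = trans (i₀ _ τ) (cong (ℤ._- τ)
          (trans (cong₂ ℤ._+_ (cong T (i₂ u w)) (trans (sym Tu≡τ) (cong T (i₄ u w))))
            (farey P′ P (subst (λ z → Unimodular z P) (i₆ u w) (unimodular-⊞ u P (unimod (good-iterate k g)))))))
          where
          P = k · u ⊞ w
          P′ = (1 ℕ.+ k) · u ⊞ w
          i₀ : ∀ x t → x ≡ x ℤ.+ t ℤ.- t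
          i₀ = ℤR.solve-∀
          i₁ : ∀ k a c → (+ 1 ℤ.+ (k ℤ.+ k)) ℤ.* a ℤ.+ + 2 ℤ.* c ≡ ((+ 1 ℤ.+ k) ℤ.* a ℤ.+ c) ℤ.+ (k ℤ.* a ℤ.+ c)
          i₁ = ℤR.solve-∀
          i₂ : ∀ u w → (1 ℕ.+ (k ℕ.+ k)) · u ⊞ 2 · w ≡ ((1 ℕ.+ k) · u ⊞ w) ⊞ (k · u ⊞ w)
          i₂ (a , b) (c , d) = cong₂ _,_ (i₁ (+ k) a c) (i₁ (+ k) b d)
          i₃ : ∀ k a c → a ≡ ((+ 1 ℤ.+ k) ℤ.* a ℤ.+ c) ℤ.- (k ℤ.* a ℤ.+ c)
          i₃ = ℤR.solve-∀
          i₄ : ∀ u w → u ≡ ((1 ℕ.+ k) · u ⊞ w) ⊟ (k · u ⊞ w)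
          i₄ (a , b) (c , d) = cong₂ _,_ (i₃ (+ k) a c) (i₃ (+ k) b d)
          i₅ : ∀ k a c → a ℤ.+ (k ℤ.* a ℤ.+ c) ≡ (+ 1 ℤ.+ k) ℤ.* a ℤ.+ c
          i₅ = ℤR.solve-∀
          i₆ : ∀ u w → u ⊞ (k · u ⊞ w) ≡ (1 ℕ.+ k) · u ⊞ w
          i₆ (a , b) (c , d) = cong₂ _,_ (i₅ (+ k) a c) (i₅ (+ k) b d)

        first-even : ∀ k → Γ * ι (ladder (k ℕ.+ k)) ≼ b * ι (T ((k ℕ.+ k) · u ⊞ 2 · w))
        first-even k = le (N-cancel-b (N-cancel-ι (ιPos-^ (k ℕ.+ k) 2>0)
          (N-resp (sym rewriting) (N-+ (N-* (N-* N-Γ N-Γ̄) (N-* Ny (N-+ d Nx))) (N-* (N-* N-Γ̄ N-Γ̄) (N-* Ny Ny))))))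
          where
          x = Λ ^ k
          y = Λ̄ ^ k
          Nx = N-^ k N-Λ
          Ny = N-^ k N-Λ̄
          d = _≼_.difference (Λ̄^≼Λ^ k)
          i₁ : ∀ p b z c l → p * (b * (b * z - c * l)) ≡ b * b * p * z - c * (b * (p * l))
          i₁ = RingSolver.solve-∀ ring
          i₂ : ∀ p b t → b * b * (p * p) * (t * t) ≡ b * (p * t) * (b * (p * t))
          i₂ = RingSolver.solve-∀ ring
          i₃ : ∀ c c̄ x y → (c * x + c̄ * y) * (c * x + c̄ * y) - c * (c * (x * x) + c̄ * (y * y))
             ≡ c * c̄ * (y * (x - y + x)) + c̄ * c̄ * (y * y)
          i₃ = RingSolver.solve-∀ ring
          rewriting : a ^ (k ℕ.+ k) * (b * (b * ι (T ((k ℕ.+ k) · u ⊞ 2 · w)) - Γ * ι (ladder (k ℕ.+ k))))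
            ≡ Γ * Γ̄ * (y * (x - y + x)) + Γ̄ * Γ̄ * (y * y)
          rewriting = trans (i₁ (a ^ (k ℕ.+ k)) b (ι (T ((k ℕ.+ k) · u ⊞ 2 · w))) Γ (ι (ladder (k ℕ.+ k))))
            (trans (cong₂ _-_
                (trans (cong₂ (λ p z → b * b * p * z) (^-+ a k k) (trans (cong ι (double-even k)) (ι-* (ladder k) (ladder k))))
                  (trans (i₂ (a ^ k) b (ι (ladder k))) (cong₂ _*_ (ladder-closed k) (ladder-closed k))))
                (cong (Γ *_) (trans (ladder-closed (k ℕ.+ k))
                  (cong₂ (λ p q → Γ * p + Γ̄ * q) (^-+ Λ k k) (^-+ Λ̄ k k)))))
              (i₃ Γ Γ̄ x y))

        first-odd : ∀ k → Γ * ι (ladder (1 ℕ.+ (k ℕ.+ k))) ≼ b * ι (T ((1 ℕ.+ (k ℕ.+ k)) · u ⊞ 2 · w))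
        first-odd k = le (N-cancel-b (N-cancel-ι (ιPos-^ (1 ℕ.+ (k ℕ.+ k)) 2>0)
          (N-resp (sym rewriting) (N-+ (N-* (N-* N-Γ̄ N-Γ̄) (N-* N-Λ̄ (N-* Ny Ny)))
            (N-* (N-* (N-ι (0≤ℕ {4})) (N-ι 0≤τ)) (N-* Ny (N-+ (N-* (N-ι (0≤ℕ {8})) d) (N-* N8 Ny))))))))
          where
          x = Λ ^ k
          y = Λ̄ ^ k
          Ny = N-^ k N-Λ̄
          d = _≼_.difference (Λ̄^≼Λ^ k)
          eight : K
          eight = ι (+ 8)
          four : K
          four = ι (+ 4)
          N8 : N (eight - ι τ * Λ̄)
          N8 = 1 # subst C₀ (cong₂ _,_ (j₁ τ) (j₂ τ))
            (C₀-+ {ι (+ 4 ℤ.* τ)} {ι (+ 8) * δ} (C₀-ι (0≤-* {+ 4} 0≤ℕ 0≤τ)) (C₀-* (C₀-ι (0≤ℕ {8})) C₀-δ))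
            where
            j₁ : ∀ τ → + 4 ℤ.* τ ℤ.+ (+ 0 ℤ.+ + 0 ℤ.* + 1 ℤ.* (τ ℤ.* τ ℤ.- + 4))
              ≡ (τ ℤ.* + 1 ℤ.+ + 1 ℤ.* + 0 ℤ.* (τ ℤ.* τ ℤ.- + 4))
                  ℤ.* (+ 8 ℤ.+ ℤ.- (τ ℤ.* τ ℤ.+ + 0 ℤ.* -[1+ 0 ] ℤ.* (τ ℤ.* τ ℤ.- + 4)))
                ℤ.+ (τ ℤ.* + 0 ℤ.+ + 1 ℤ.* + 1) ℤ.* (+ 0 ℤ.+ ℤ.- (τ ℤ.* -[1+ 0 ] ℤ.+ + 0 ℤ.* τ)) ℤ.* (τ ℤ.* τ ℤ.- + 4)
            j₁ = ℤR.solve-∀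
            j₂ : ∀ τ → + 8
              ≡ (τ ℤ.* + 1 ℤ.+ + 1 ℤ.* + 0 ℤ.* (τ ℤ.* τ ℤ.- + 4)) ℤ.* (+ 0 ℤ.+ ℤ.- (τ ℤ.* -[1+ 0 ] ℤ.+ + 0 ℤ.* τ))
                ℤ.+ (τ ℤ.* + 0 ℤ.+ + 1 ℤ.* + 1) ℤ.* (+ 8 ℤ.+ ℤ.- (τ ℤ.* τ ℤ.+ + 0 ℤ.* -[1+ 0 ] ℤ.* (τ ℤ.* τ ℤ.- + 4)))
            j₂ = ℤR.solve-∀
          i₁ : ∀ p b z c l → p * (b * (b * z - c * l)) ≡ b * b * p * z - c * (b * (p * l))
          i₁ = RingSolver.solve-∀ ring
          i₂ : ∀ a p b t t′ v → b * b * (a * (p * p)) * (t′ * t - v)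
             ≡ b * (a * p * t′) * (b * (p * t)) - b * b * (a * (p * p)) * v
          i₂ = RingSolver.solve-∀ ring
          i₃ : ∀ c c̄ l l̄ x y → (c * (l * x) + c̄ * (l̄ * y)) * (c * x + c̄ * y)
               - c * (c * (l * (x * x)) + c̄ * (l̄ * (y * y)))
             ≡ c̄ * c̄ * (l̄ * (y * y)) + c * c̄ * (l + l̄) * (x * y) - c * c̄ * l̄ * (y * y)
          i₃ = RingSolver.solve-∀ ring
          i₄ : ∀ u v w → u - v - w ≡ u - w - v
          i₄ = RingSolver.solve-∀ ring
          rewriting : a ^ (1 ℕ.+ (k ℕ.+ k)) * (b * (b * ι (T ((1 ℕ.+ (k ℕ.+ k)) · u ⊞ 2 · w)) - Γ * ι (ladder (1 ℕ.+ (k ℕ.+ k)))))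
            ≡ Γ̄ * Γ̄ * (Λ̄ * (y * y)) + four * ι τ * (y * (eight * (x - y) + (eight - ι τ * Λ̄) * y))
          rewriting = trans (i₁ (a ^ (1 ℕ.+ (k ℕ.+ k))) b (ι (T ((1 ℕ.+ (k ℕ.+ k)) · u ⊞ 2 · w))) Γ (ι (ladder (1 ℕ.+ (k ℕ.+ k)))))
            (trans (cong₂ _-_
                (trans (cong₂ (λ p z → b * b * (a * p) * z) (^-+ a k k)
                    (trans (cong ι (double-odd k)) (cong (_- ι τ) (ι-* (ladder (1 ℕ.+ k)) (ladder k)))))
                  (trans (i₂ a (a ^ k) b (ι (ladder k)) (ι (ladder (1 ℕ.+ k))) (ι τ))
                    (cong₂ (λ p q → p * q - b * b * (a * (a ^ k * a ^ k)) * ι τ) (ladder-closed (1 ℕ.+ k)) (ladder-closed k))))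
                (cong (Γ *_) (trans (ladder-closed (1 ℕ.+ (k ℕ.+ k)))
                  (cong₂ (λ p q → Γ * (Λ * p) + Γ̄ * (Λ̄ * q)) (^-+ Λ k k) (^-+ Λ̄ k k)))))
              (trans (i₄ ((Γ * (Λ * x) + Γ̄ * (Λ̄ * y)) * (Γ * x + Γ̄ * y)) (b * b * (a * (a ^ k * a ^ k)) * ι τ)
                  (Γ * (Γ * (Λ * (x * x)) + Γ̄ * (Λ̄ * (y * y)))))
                (trans (cong₂ _-_ (i₃ Γ Γ̄ Λ Λ̄ x y) scale) final)))
            where
            aa-xy : a ^ k * a ^ k ≡ x * y
            aa-xy = trans (sym (^-* a a k)) (trans (cong (_^ k) (sym ΛΛ̄)) (^-* Λ Λ̄ k))
            scale : b * b * (a * (a ^ k * a ^ k)) * ι τ ≡ four * D * (a * (x * y)) * ι τ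
            scale = cong₂ (λ p q → p * (a * q) * ι τ) (trans bb (ι-* (+ 4) Δ)) aa-xy
            sum : Λ + Λ̄ ≡ a * ι τ
            sum = t₁
            D≡ : D ≡ ι τ * ι τ - four
            D≡ = cong (_- four) (ι-* τ τ)
            ΓΓ̄≡ : Γ * Γ̄ ≡ four * (ι τ * ι τ)
            ΓΓ̄≡ = trans ΓΓ̄ (trans (ι-* (+ 4) (τ ℤ.* τ)) (cong (four *_) (ι-* τ τ)))
            j₁ : ∀ e p q r → e + p - q - r ≡ e + (p - r - q)
            j₁ = RingSolver.solve-∀ ring
            j₂ : ∀ f t p z → f * (t * t) * (p * t) * z - f * (t * t - f) * (p * z) * t ≡ f * t * (f * p * z)
            j₂ = RingSolver.solve-∀ ring
            j₃ : ∀ f t v l x y → f * t * (v * (x * y)) - f * (t * t) * l * (y * y) ≡ f * t * (y * (v * (x - y) + (v - t * l) * y))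
            j₃ = RingSolver.solve-∀ ring
            i₆ : ∀ e t x y l̄ f p → e + f * (t * t) * (p * t) * (x * y) - f * (t * t) * l̄ * (y * y)
                   - f * (t * t - f) * (p * (x * y)) * t
               ≡ e + f * t * (y * (f * p * (x - y) + (f * p - t * l̄) * y))
            i₆ e t x y l̄ f p = trans (j₁ e _ _ _)
              (cong (λ z → e + z) (trans (cong (_- f * (t * t) * l̄ * (y * y)) (j₂ f t p (x * y))) (j₃ f t (f * p) l̄ x y)))
            final : Γ̄ * Γ̄ * (Λ̄ * (y * y)) + Γ * Γ̄ * (Λ + Λ̄) * (x * y) - Γ * Γ̄ * Λ̄ * (y * y)
                - four * D * (a * (x * y)) * ι τ
              ≡ Γ̄ * Γ̄ * (Λ̄ * (y * y)) + four * ι τ * (y * (eight * (x - y) + (eight - ι τ * Λ̄) * y))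
            final = trans (cong₂ (λ p q → Γ̄ * Γ̄ * (Λ̄ * (y * y)) + p * q * (x * y) - p * Λ̄ * (y * y) - four * D * (a * (x * y)) * ι τ) ΓΓ̄≡ sum)
              (trans (cong (λ d → Γ̄ * Γ̄ * (Λ̄ * (y * y)) + four * (ι τ * ι τ) * (a * ι τ) * (x * y) - four * (ι τ * ι τ) * Λ̄ * (y * y) - four * d * (a * (x * y)) * ι τ) D≡)
                (i₆ (Γ̄ * Γ̄ * (Λ̄ * (y * y))) (ι τ) x y Λ̄ four a))

      parity : ∀ n → (∃[ k ] n ≡ k ℕ.+ k) ⊎ (∃[ k ] n ≡ 1 ℕ.+ (k ℕ.+ k))
      parity zero = inj₁ (0 , refl)
      parity (suc n) with parity n
      ... | inj₁ (k , refl) = inj₂ (k , refl)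
      ... | inj₂ (k , refl) = inj₁ (suc k , cong suc (sym (ℕP.+-suc k k)))

      first-ratio : ∀ n → Γ * ι (ladder n) ≼ b * ι (T (n · u ⊞ 2 · w))
      first-ratio n with parity n
      ... | inj₁ (k , refl) = first-even k
      ... | inj₂ (k , refl) = first-odd k

      convex-step : ∀ t₀ t₁ t₂ → + 0 ℤ.< t₀ → + 0 ℤ.≤ t₁ → t₁ ℤ.* t₁ ℤ.≤ t₀ ℤ.* t₂ →
        Γ * ι t₀ ≼ b * ι t₁ → Γ * ι t₁ ≼ b * ι t₂
      convex-step t₀ t₁ t₂ 0<t₀ 0≤t₁ convex (le p) = le (N-cancel-ι (ιpos t₀ 0<t₀ refl)
        (N-resp (trans (cong (λ z → b * z + ι t₁ * (b * ι t₁ - Γ * ι t₀)) (cong₂ _-_ (ι-* t₀ t₂) (ι-* t₁ t₁)))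
            (i₁ b Γ (ι t₀) (ι t₁) (ι t₂)))
          (N-+ (N-* N-b (N-ι (0≤-diff convex))) (N-* (N-ι 0≤t₁) p))))
        where
        i₁ : ∀ b c x y z → b * (x * z - y * y) + y * (b * y - c * x) ≡ x * (b * z - c * y)
        i₁ = RingSolver.solve-∀ ring

      power-gap : ∀ n → ι (+ (2 ℕ.+ n)) * Λ̄ ^ n ≼ a * Λ ^ n
      power-gap zero = ≼-reflexive refl
      power-gap (suc n) = le (N-resp (i₁ a (ι (+ n)) Λ Λ̄ (Λ ^ n) (Λ̄ ^ n))
        (N-+ (N-* N-Λ̄ (_≼_.difference (power-gap n))) (N-+ (N-* gap (N-^ n N-Λ))
          (N-* N-Λ̄ (_≼_.difference (Λ̄^≼Λ^ n))))))
        where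
        i₁ : ∀ c n l m x y → m * (c * x - (c + n) * y) + ((c * l - (c + 1K) * m) * x + m * (x - y))
           ≡ c * (l * x) - (1K + (c + n)) * (m * y)
        i₁ = RingSolver.solve-∀ ring
        gap : N (a * Λ - (a + 1K) * Λ̄)
        gap = 1 # subst C₀ (cong₂ _,_ (j₁ τ) (j₂ τ))
          ( 0≤-* {+ 4} 0≤ℕ (0≤-+ (0≤-* (0≤-diff 3≤τ) (0≤-+ 0≤τ (0≤ℕ {3}))) (0≤ℕ {4}))
          , 0≤-* {+ 4} 0≤ℕ 0≤τ)
          where
          j₁ : ∀ τ → + 4 ℤ.* ((τ ℤ.- + 3) ℤ.* (τ ℤ.+ + 3) ℤ.+ + 4)
            ≡ (τ ℤ.* + 1 ℤ.+ + 1 ℤ.* + 0 ℤ.* (τ ℤ.* τ ℤ.- + 4))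
                ℤ.* ((+ 2 ℤ.* τ ℤ.+ + 0 ℤ.* + 1 ℤ.* (τ ℤ.* τ ℤ.- + 4)) ℤ.+ ℤ.- (+ 3 ℤ.* τ ℤ.+ + 0 ℤ.* -[1+ 0 ] ℤ.* (τ ℤ.* τ ℤ.- + 4)))
              ℤ.+ (τ ℤ.* + 0 ℤ.+ + 1 ℤ.* + 1)
                ℤ.* ((+ 2 ℤ.* + 1 ℤ.+ + 0 ℤ.* τ) ℤ.+ ℤ.- (+ 3 ℤ.* -[1+ 0 ] ℤ.+ + 0 ℤ.* τ)) ℤ.* (τ ℤ.* τ ℤ.- + 4)
          j₁ = ℤR.solve-∀
          j₂ : ∀ τ → + 4 ℤ.* τ
            ≡ (τ ℤ.* + 1 ℤ.+ + 1 ℤ.* + 0 ℤ.* (τ ℤ.* τ ℤ.- + 4))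
                ℤ.* ((+ 2 ℤ.* + 1 ℤ.+ + 0 ℤ.* τ) ℤ.+ ℤ.- (+ 3 ℤ.* -[1+ 0 ] ℤ.+ + 0 ℤ.* τ))
              ℤ.+ (τ ℤ.* + 0 ℤ.+ + 1 ℤ.* + 1)
                ℤ.* ((+ 2 ℤ.* τ ℤ.+ + 0 ℤ.* + 1 ℤ.* (τ ℤ.* τ ℤ.- + 4)) ℤ.+ ℤ.- (+ 3 ℤ.* τ ℤ.+ + 0 ℤ.* -[1+ 0 ] ℤ.* (τ ℤ.* τ ℤ.- + 4)))
          j₂ = ℤR.solve-∀

      ladder-upper : Γ̄ ≼ Γ → ∀ n → ι (+ n) * (b * (a ^ n * ι (ladder n))) ≼ ι (+ (2 ℕ.+ n)) * (Γ * Λ ^ n)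
      ladder-upper (le p) n = le (N-resp
        (trans (i₁ a (ι (+ n)) Γ Γ̄ (Λ ^ n) (Λ̄ ^ n))
          (cong (λ z → (a + ι (+ n)) * (Γ * Λ ^ n) - ι (+ n) * z) (sym (ladder-closed n))))
        (N-+ (N-* N-Γ (_≼_.difference (power-gap n)))
          (N-+ (N-* N-Γ (N-* N-a (N-^ n N-Λ̄))) (N-* (N-ι (0≤ℕ {n})) (N-* (N-^ n N-Λ̄) p)))))
        where
        i₁ : ∀ c n g h x y → g * (c * x - (c + n) * y) + (g * (c * y) + n * (y * (g - h)))
           ≡ (c + n) * (g * x) - n * (g * x + h * y)
        i₁ = RingSolver.solve-∀ ring

      ^-^ : ∀ x m n → (x ^ m) ^ n ≡ x ^ (n ℕ.* m)
      ^-^ x m zero = refl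
      ^-^ x m (suc n) = trans (cong (x ^ m *_) (^-^ x m n)) (sym (^-+ x m (n ℕ.* m)))

      ι-^ : ∀ c n → ι (c ℤ.^ n) ≡ ι c ^ n
      ι-^ c zero = refl
      ι-^ c (suc n) = trans (ι-* c (c ℤ.^ n)) (cong (ι c *_) (ι-^ c n))

      N-cancel-b^ : ∀ n {y} → N (b ^ n * y) → N y
      N-cancel-b^ zero {y} p = N-resp (*-identityˡ y) p
      N-cancel-b^ (suc n) {y} p = N-cancel-b^ n (N-cancel-b (N-resp (i₁ b (b ^ n) y) p))
        where
        i₁ : ∀ b p y → b * p * y ≡ b * (p * y)
        i₁ = RingSolver.solve-∀ ring

      δb : δ * b ≡ ι (+ 2 ℤ.* Δ)
      δb = cong₂ _,_ (i₁ Δ) refl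
        where
        i₁ : ∀ Δ → + 0 ℤ.+ + 2 ℤ.* Δ ≡ + 2 ℤ.* Δ
        i₁ = ℤR.solve-∀

      -- As n grows, (ladder n)^(j+d) is at most about (Γ / b)^d times the value of T on the right.
      ladder-power : Γ̄ ≼ Γ → ∀ e n j d → 1 ℕ.≤ j →
        Λ ^ e * ι ((+ n) ℤ.^ (j ℕ.+ d) ℤ.* (+ 2 ℤ.* Δ) ℤ.^ d ℤ.* ladder n ℤ.^ (j ℕ.+ d))
        ≼ ι ((+ (2 ℕ.+ n)) ℤ.^ (j ℕ.+ d) ℤ.* (+ 2) ℤ.^ e ℤ.* T ((e ℕ.+ (j ℕ.+ d) ℕ.* n) · u ⊞ j · w))
          * (δ * Γ) ^ d
      ladder-power Γ̄≼Γ e n j d 1≤j = le (N-resp final (N-* (N-^ d N-δ)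
          (N-cancel-b^ j (N-cancel-ι (ιPos-^ J (ιPos-^ n 2>0))
            (N-resp middle (N-+ (N-* (N-^ e N-Λ) (_≼_.difference step₁)) (N-* (N-* (N-^ J (N-ι 0≤ℕ)) (N-^ d N-Γ)) (_≼_.difference step₂))))))))
        where
        J = j ℕ.+ d
        n₂ = e ℕ.+ J ℕ.* n
        P = n₂ · u ⊞ j · w
        v x : K
        v = ι (+ n)
        x = ι (ladder n)
        v₂ : K
        v₂ = ι (+ (2 ℕ.+ n))
        step₁ : (v * (b * (a ^ n * x))) ^ J ≼ (v₂ * (Γ * Λ ^ n)) ^ J
        step₁ = ≼-^ J (N-* (N-ι (0≤ℕ {n})) (N-* N-b (N-* (N-^ n N-a) (N-ι (ℤP.<⇒≤ (posʳ (good-iterate n g)))))))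
          (ladder-upper Γ̄≼Γ n)
        step₂ : Λ ^ n₂ * Γ ^ j ≼ a ^ n₂ * b ^ j * ι (T P)
        step₂ = lower n₂ j 1≤j
        expand : ∀ v b p x → (v * (b * (p * x))) ^ J ≡ v ^ J * (b ^ j * b ^ d * (p ^ J * x ^ J))
        expand v b p x = trans (^-* v (b * (p * x)) J) (cong (v ^ J *_)
          (trans (^-* b (p * x) J) (cong₂ _*_ (^-+ b j d) (^-* p x J))))
        expand₂ : (v₂ * (Γ * Λ ^ n)) ^ J ≡ v₂ ^ J * (Γ ^ j * Γ ^ d * Λ ^ (J ℕ.* n))
        expand₂ = trans (^-* v₂ (Γ * Λ ^ n) J) (cong (v₂ ^ J *_)
          (trans (^-* Γ (Λ ^ n) J) (cong₂ _*_ (^-+ Γ j d) (^-^ Λ n J))))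
        i₁ : ∀ le ln g gd vj lhs x → le * (vj * (g * gd * ln) - lhs) + vj * gd * (x - le * ln * g)
           ≡ vj * gd * x - le * lhs
        i₁ = RingSolver.solve-∀ ring
        i₂ : ∀ c ae aj bj t → c * (ae * aj * bj * t) ≡ aj * (bj * (c * (ae * t)))
        i₂ = RingSolver.solve-∀ ring
        i₃ : ∀ le v bj b aj q → le * (v * (bj * b * (aj * q))) ≡ aj * (bj * (le * (v * (b * q))))
        i₃ = RingSolver.solve-∀ ring
        i₄ : ∀ aj bj x y → aj * (bj * x) - aj * (bj * y) ≡ aj * (bj * (x - y))
        i₄ = RingSolver.solve-∀ ring
        middle : Λ ^ e * ((v₂ * (Γ * Λ ^ n)) ^ J - (v * (b * (a ^ n * x))) ^ J)
            + v₂ ^ J * Γ ^ d * (a ^ n₂ * b ^ j * ι (T P) - Λ ^ n₂ * Γ ^ j)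
          ≡ (a ^ n) ^ J * (b ^ j * (v₂ ^ J * Γ ^ d * (a ^ e * ι (T P)) - Λ ^ e * (v ^ J * (b ^ d * x ^ J))))
        middle = trans
          (trans (cong₂ _+_ (cong₂ (λ p q → Λ ^ e * (p - q)) expand₂ (expand v b (a ^ n) x))
              (cong₂ (λ p q → v₂ ^ J * Γ ^ d * (p * b ^ j * ι (T P) - q * Γ ^ j))
                (trans (^-+ a e (J ℕ.* n)) (cong (a ^ e *_) (sym (^-^ a n J)))) (^-+ Λ e (J ℕ.* n))))
            (i₁ (Λ ^ e) (Λ ^ (J ℕ.* n)) (Γ ^ j) (Γ ^ d) (v₂ ^ J) (v ^ J * (b ^ j * b ^ d * ((a ^ n) ^ J * x ^ J)))
              (a ^ e * (a ^ n) ^ J * b ^ j * ι (T P))))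
          (trans (cong₂ _-_ (i₂ (v₂ ^ J * Γ ^ d) (a ^ e) ((a ^ n) ^ J) (b ^ j) (ι (T P)))
              (i₃ (Λ ^ e) (v ^ J) (b ^ j) (b ^ d) ((a ^ n) ^ J) (x ^ J)))
            (i₄ ((a ^ n) ^ J) (b ^ j) (v₂ ^ J * Γ ^ d * (a ^ e * ι (T P))) (Λ ^ e * (v ^ J * (b ^ d * x ^ J)))))
        i₅ : ∀ dd x y → dd * (x - y) ≡ dd * x - dd * y
        i₅ = RingSolver.solve-∀ ring
        i₆ : ∀ dd vj gd ae t → dd * (vj * gd * (ae * t)) ≡ vj * ae * t * (dd * gd)
        i₆ = RingSolver.solve-∀ ring
        i₇ : ∀ dd le v b q → dd * (le * (v * (b * q))) ≡ le * (v * (dd * b) * q)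
        i₇ = RingSolver.solve-∀ ring
        ι₃ : ∀ p q r → ι (p ℤ.* q ℤ.* r) ≡ ι p * ι q * ι r
        ι₃ p q r = trans (ι-* (p ℤ.* q) r) (cong (_* ι r) (ι-* p q))
        final : δ ^ d * (v₂ ^ J * Γ ^ d * (a ^ e * ι (T P)) - Λ ^ e * (v ^ J * (b ^ d * x ^ J)))
          ≡ ι ((+ (2 ℕ.+ n)) ℤ.^ J ℤ.* (+ 2) ℤ.^ e ℤ.* T P) * (δ * Γ) ^ d
            - Λ ^ e * ι ((+ n) ℤ.^ J ℤ.* (+ 2 ℤ.* Δ) ℤ.^ d ℤ.* ladder n ℤ.^ J)
        final = trans (trans (i₅ (δ ^ d) (v₂ ^ J * Γ ^ d * (a ^ e * ι (T P))) (Λ ^ e * (v ^ J * (b ^ d * x ^ J))))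
            (cong₂ _-_ (i₆ (δ ^ d) (v₂ ^ J) (Γ ^ d) (a ^ e) (ι (T P))) (i₇ (δ ^ d) (Λ ^ e) (v ^ J) (b ^ d) (x ^ J))))
          (cong₂ _-_
            (cong₂ _*_ (sym (trans (ι₃ ((+ (2 ℕ.+ n)) ℤ.^ J) ((+ 2) ℤ.^ e) (T P))
                (cong₂ (λ p q → p * q * ι (T P)) (ι-^ (+ (2 ℕ.+ n)) J) (ι-^ (+ 2) e))))
              (sym (^-* δ Γ d)))
            (cong (Λ ^ e *_) (sym (trans (ι₃ ((+ n) ℤ.^ J) ((+ 2 ℤ.* Δ) ℤ.^ d) (ladder n ℤ.^ J))
              (cong₂ _*_ (cong₂ _*_ (ι-^ (+ n) J)
                  (trans (ι-^ (+ 2 ℤ.* Δ) d) (trans (cong (_^ d) (sym δb)) (^-* δ b d))))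
                (ι-^ (ladder n) J))))))

      scaled-ratio : ∀ {t t′} → Γ * ι t ≼ b * ι t′ → δ * Γ * ι t ≼ ι (+ 2 ℤ.* Δ ℤ.* t′)
      scaled-ratio {t} {t′} (le p) = le (N-resp
        (trans (i₁ δ b Γ (ι t) (ι t′)) (cong (_- δ * Γ * ι t) (trans (cong (_* ι t′) δb) (sym (ι-* (+ 2 ℤ.* Δ) t′)))))
        (N-* N-δ p))
        where
        i₁ : ∀ d b c x y → d * (b * y - c * x) ≡ d * b * y - d * c * x
        i₁ = RingSolver.solve-∀ ring

  N-upper : ∀ {x y} → N (x , y) → + 0 ℤ.≤ y → + 0 ℤ.≤ x ⊎ (x ℤ.≤ + 0 × x ℤ.* x ℤ.≤ Δ ℤ.* (y ℤ.* y))
  N-upper {x} {y} p 0≤y with ℤP.≤-total (+ 0) x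
  ... | inj₁ 0≤x = inj₁ 0≤x
  ... | inj₂ x≤0 = inj₂ (x≤0 , ℤP.0≤i-j⇒j≤i (N⇒0≤ (N-resp (cong₂ _,_ (i₁ x y Δ) (i₂ x y))
          (N-* p (N-C₀ {ℤ.- x , y} (ℤP.neg-mono-≤ x≤0 , 0≤y))))))
    where
    i₁ : ∀ x y Δ → x ℤ.* ℤ.- x ℤ.+ y ℤ.* y ℤ.* Δ ≡ Δ ℤ.* (y ℤ.* y) ℤ.- x ℤ.* x
    i₁ = ℤR.solve-∀
    i₂ : ∀ x y → x ℤ.* y ℤ.+ y ℤ.* ℤ.- x ≡ + 0
    i₂ = ℤR.solve-∀

  N-lower : ∀ {x y} → N (x , y) → y ℤ.≤ + 0 → + 0 ℤ.≤ x × Δ ℤ.* (y ℤ.* y) ℤ.≤ x ℤ.* x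
  N-lower {x} {y} p y≤0 = 0≤x , ℤP.0≤i-j⇒j≤i (N⇒0≤ (N-resp (cong₂ _,_ (i₁ x y Δ) (i₂ x y))
      (N-* p (N-C₀ {x , ℤ.- y} (0≤x , ℤP.neg-mono-≤ y≤0)))))
    where
    i₁ : ∀ x y Δ → x ℤ.* x ℤ.+ y ℤ.* ℤ.- y ℤ.* Δ ≡ x ℤ.* x ℤ.- Δ ℤ.* (y ℤ.* y)
    i₁ = ℤR.solve-∀
    i₂ : ∀ x y → x ℤ.* ℤ.- y ℤ.+ y ℤ.* x ≡ + 0
    i₂ = ℤR.solve-∀
    0≤x : + 0 ℤ.≤ x
    0≤x = N⇒0≤ (N-resp (cong₂ _,_ (ℤP.+-identityʳ x) (ℤP.+-inverseʳ y))
      (N-+ p (N-C₀ {+ 0 , ℤ.- y} (ℤP.≤-refl , ℤP.neg-mono-≤ y≤0))))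

-- Log-convexity

module LogConvexity (T : Vec² → ℤ) (isTrace : IsTrace T) where
  open IsTrace isTrace
  open Integers
  open TraceFunction T isTrace

  Multiple : Vec² → Set
  Multiple P = ∃[ n ] ∃[ u ] ∃[ w ] Good u w × 1 ℕ.≤ n × P ≡ n · u

  primitive-part : ∀ f s t → s ℕ.+ t ℕ.≤ f → 1 ℕ.≤ s ℕ.+ t → ∀ {L R} → Good L R → Multiple (s · L ⊞ t · R)
  primitive-part f (suc s) zero _ _ {L} {R} g = suc s , L , R , g , ℕ.s≤s ℕ.z≤n , ⊞-0ʳ L (suc s) R
  primitive-part f zero (suc t) _ _ {L} {R} g = suc t , R , L , good-swap g , ℕ.s≤s ℕ.z≤n , ⊞-0ˡ L (suc t) R
  primitive-part (suc f) (suc s) (suc t) le₁ _ {L} {R} g = split (ℕP.≤-total (suc t) (suc s))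
    where
    split : suc t ℕ.≤ suc s ⊎ suc s ℕ.≤ suc t → Multiple (suc s · L ⊞ suc t · R)
    split (inj₁ t≤s) = subst Multiple
        (trans (·-⊞-left k (suc t) L R) (cong (λ z → z · L ⊞ suc t · R) k+t≡s))
        (primitive-part f k (suc t)
          (ℕP.≤-trans (ℕP.≤-reflexive k+t≡s) (ℕP.≤-trans (ℕP.m≤m+n (suc s) t) (subst (ℕ._≤ f) (ℕP.+-suc s t) (ℕP.≤-pred le₁))))
          (ℕP.≤-trans (ℕ.s≤s ℕ.z≤n) (ℕP.m≤n+m (suc t) k)) (good-add g))
      where
      k = proj₁ (ℕP.m≤n⇒∃[o]m+o≡n t≤s)
      k+t≡s : k ℕ.+ suc t ≡ suc s
      k+t≡s = trans (ℕP.+-comm k (suc t)) (proj₂ (ℕP.m≤n⇒∃[o]m+o≡n t≤s))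
    split (inj₂ s≤t) = subst Multiple
        (trans (·-⊞-right (suc s) k L R) (cong (λ z → suc s · L ⊞ z · R) s+k≡t))
        (primitive-part f (suc s) k
          (ℕP.≤-trans (ℕP.≤-reflexive s+k≡t) (ℕP.≤-trans (ℕP.m≤n+m (suc t) s) (ℕP.≤-pred le₁)))
          (ℕ.s≤s ℕ.z≤n) (subst (λ z → Good z R) (⊞-comm R L) (good-swap (good-add (good-swap g)))))
      where
      k = proj₁ (ℕP.m≤n⇒∃[o]m+o≡n s≤t)
      s+k≡t : suc s ℕ.+ k ≡ suc t
      s+k≡t = proj₂ (ℕP.m≤n⇒∃[o]m+o≡n s≤t)

  nonneg⇒ℕ : ∀ {i} → + 0 ℤ.≤ i → ∃[ k ] i ≡ + k
  nonneg⇒ℕ {+ k} _ = k , refl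

  pos⇒suc : ∀ {i} → + 0 ℤ.< i → ∃[ k ] i ≡ + suc k
  pos⇒suc {+ suc k} _ = k , refl
  pos⇒suc {+ zero} (ℤ.+<+ ())

  Convex : Vec² → Vec² → Set
  Convex Q v = T Q ℤ.* T Q ℤ.≤ T (Q ⊞ v) ℤ.* T (Q ⊟ v)

  -- In terms of a basis of which u is the first vector, w is chosen so far
  -- back that both Q + v and v - Q lie in the cone spanned by u and w.
  straddle : ∀ {u w} → Good u w → det u w ≡ + 1 → ∀ n v → + 0 ℤ.< det u v → Convex (n · u) v
  straddle {u} {w} g d n v 0<j with j , j≡ ← pos⇒suc 0<j =
      subst₂ (λ a b → T (n · u) ℤ.* T (n · u) ℤ.≤ T a ℤ.* b)
        (sym (trans (cong (n · u ⊞_) v≡) (i₁ u w′)))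
        (trans (sym (even (k · u ⊞ suc j · w′))) (cong T (sym (trans (cong (n · u ⊟_) v≡) (i₂ u w′)))))
        (core k n j)
    where
    open Quadratic (T u) (2≤T g) using (module Eigenbasis)
    i : ℤ
    i = det v w
    c : ℕ
    c = n ℕ.+ ℤ.∣ i ∣
    w′ : Vec²
    w′ = c · neg u ⊞ w
    g′ : Good u w′
    g′ = subst (λ z → Good z w′) (neg-neg u) (good-neg-swap (good-iterate c (good-neg-swap g)))
    open Eigenbasis T isTrace g′ refl (3≤T g) using (core)
    room : ∃[ k ] i ℤ.+ (+ 1 ℤ.+ + j) ℤ.* (+ n ℤ.+ + ℤ.∣ i ∣) ℤ.- + n ≡ + k
    room = nonneg⇒ℕ (subst (+ 0 ℤ.≤_) (j₁ i (+ j) (+ n) (+ ℤ.∣ i ∣))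
      (0≤-+ (0≤i+∣i∣ i) (0≤-* {+ j} {+ n ℤ.+ + ℤ.∣ i ∣} 0≤ℕ 0≤ℕ)))
      where
      j₁ : ∀ i j n m → i ℤ.+ m ℤ.+ j ℤ.* (n ℤ.+ m) ≡ i ℤ.+ (+ 1 ℤ.+ j) ℤ.* (n ℤ.+ m) ℤ.- n
      j₁ = ℤR.solve-∀
    k : ℕ
    k = proj₁ room
    coords : ∀ u v w → det u w ≡ + 1 → ∀ c j → det u v ≡ j →
      v ≡ ((det v w ℤ.+ j ℤ.* c) ℤ.* proj₁ u ℤ.+ j ℤ.* (c ℤ.* ℤ.- proj₁ u ℤ.+ proj₁ w)
          , (det v w ℤ.+ j ℤ.* c) ℤ.* proj₂ u ℤ.+ j ℤ.* (c ℤ.* ℤ.- proj₂ u ℤ.+ proj₂ w))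
    coords (u₁ , u₂) (v₁ , v₂) (w₁ , w₂) d c j refl = cong₂ _,_
      (trans (trans (sym (ℤP.*-identityʳ v₁)) (cong (v₁ ℤ.*_) (sym d))) (j₁ u₁ u₂ v₁ v₂ w₁ w₂ c))
      (trans (trans (sym (ℤP.*-identityʳ v₂)) (cong (v₂ ℤ.*_) (sym d))) (j₂ u₁ u₂ v₁ v₂ w₁ w₂ c))
      where
      j₁ : ∀ u₁ u₂ v₁ v₂ w₁ w₂ c → v₁ ℤ.* (u₁ ℤ.* w₂ ℤ.- u₂ ℤ.* w₁)
        ≡ ((v₁ ℤ.* w₂ ℤ.- v₂ ℤ.* w₁) ℤ.+ (u₁ ℤ.* v₂ ℤ.- u₂ ℤ.* v₁) ℤ.* c) ℤ.* u₁
          ℤ.+ (u₁ ℤ.* v₂ ℤ.- u₂ ℤ.* v₁) ℤ.* (c ℤ.* ℤ.- u₁ ℤ.+ w₁)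
      j₁ = ℤR.solve-∀
      j₂ : ∀ u₁ u₂ v₁ v₂ w₁ w₂ c → v₂ ℤ.* (u₁ ℤ.* w₂ ℤ.- u₂ ℤ.* w₁)
        ≡ ((v₁ ℤ.* w₂ ℤ.- v₂ ℤ.* w₁) ℤ.+ (u₁ ℤ.* v₂ ℤ.- u₂ ℤ.* v₁) ℤ.* c) ℤ.* u₂
          ℤ.+ (u₁ ℤ.* v₂ ℤ.- u₂ ℤ.* v₁) ℤ.* (c ℤ.* ℤ.- u₂ ℤ.+ w₂)
      j₂ = ℤR.solve-∀
    i+jc : i ℤ.+ + suc j ℤ.* + c ≡ + k ℤ.+ + n
    i+jc = trans (j₁ (i ℤ.+ + suc j ℤ.* + c) (+ n)) (cong (ℤ._+ + n) (proj₂ room))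
      where
      j₁ : ∀ x n → x ≡ x ℤ.- n ℤ.+ n
      j₁ = ℤR.solve-∀
    v≡ : v ≡ (n · u ⊞ k · u) ⊞ suc j · w′
    v≡ = trans (coords u v w d (+ c) (+ suc j) j≡)
      (cong₂ _,_ (component (proj₁ u) (proj₁ w′)) (component (proj₂ u) (proj₂ w′)))
      where
      j₁ : ∀ k n a → (k ℤ.+ n) ℤ.* a ≡ n ℤ.* a ℤ.+ k ℤ.* a
      j₁ = ℤR.solve-∀
      component : ∀ a y → (i ℤ.+ + suc j ℤ.* + c) ℤ.* a ℤ.+ + suc j ℤ.* y
                ≡ (+ n ℤ.* a ℤ.+ + k ℤ.* a) ℤ.+ + suc j ℤ.* y
      component a y = cong (ℤ._+ + suc j ℤ.* y) (trans (cong (ℤ._* a) i+jc) (j₁ (+ k) (+ n) a))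
    i₁ : ∀ u w → n · u ⊞ ((n · u ⊞ k · u) ⊞ suc j · w) ≡ (k ℕ.+ (n ℕ.+ n)) · u ⊞ suc j · w
    i₁ (a , b) (c , d) = cong₂ _,_ (j₁ (+ k) (+ n) (+ suc j) a c) (j₁ (+ k) (+ n) (+ suc j) b d)
      where
      j₁ : ∀ k n j a c → n ℤ.* a ℤ.+ ((n ℤ.* a ℤ.+ k ℤ.* a) ℤ.+ j ℤ.* c) ≡ (k ℤ.+ (n ℤ.+ n)) ℤ.* a ℤ.+ j ℤ.* c
      j₁ = ℤR.solve-∀
    i₂ : ∀ u w → n · u ⊟ ((n · u ⊞ k · u) ⊞ suc j · w) ≡ neg (k · u ⊞ suc j · w)
    i₂ (a , b) (c , d) = cong₂ _,_ (j₁ (+ k) (+ n) (+ suc j) a c) (j₁ (+ k) (+ n) (+ suc j) b d)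
      where
      j₁ : ∀ k n j a c → n ℤ.* a ℤ.- ((n ℤ.* a ℤ.+ k ℤ.* a) ℤ.+ j ℤ.* c) ≡ ℤ.- (k ℤ.* a ℤ.+ j ℤ.* c)
      j₁ = ℤR.solve-∀

  oriented : ∀ {u w} → Good u w → ∃[ w′ ] Good u w′ × det u w′ ≡ + 1
  oriented {u} {w} g with det u w in d | unimod g
  ... | + 1 | refl = w , g , d
  ... | -[1+ 0 ] | refl = neg w , good-neg g , trans (i₁ u w) (cong ℤ.-_ d)
    where
    j₁ : ∀ a b c d → a ℤ.* ℤ.- d ℤ.- b ℤ.* ℤ.- c ≡ ℤ.- (a ℤ.* d ℤ.- b ℤ.* c)
    j₁ = ℤR.solve-∀
    i₁ : ∀ u w → det u (neg w) ≡ ℤ.- det u w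
    i₁ (a , b) (c , d) = j₁ a b c d

  ℕ-vector : ∀ x y → (+ x , + y) ≡ x · (+ 1 , + 0) ⊞ y · (+ 0 , + 1)
  ℕ-vector x y = cong₂ _,_ (i₁ (+ x) (+ y)) (i₂ (+ x) (+ y))
    where
    i₁ : ∀ x y → x ≡ x ℤ.* + 1 ℤ.+ y ℤ.* + 0
    i₁ = ℤR.solve-∀
    i₂ : ∀ x y → y ≡ x ℤ.* + 0 ℤ.+ y ℤ.* + 1
    i₂ = ℤR.solve-∀

  det-· : ∀ n u v → det (n · u) v ≡ + n ℤ.* det u v
  det-· n (a , b) (c , d) = i₁ (+ n) a b c d
    where
    i₁ : ∀ n a b c d → n ℤ.* a ℤ.* d ℤ.- n ℤ.* b ℤ.* c ≡ n ℤ.* (a ℤ.* d ℤ.- b ℤ.* c)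
    i₁ = ℤR.solve-∀

  log-convex⁺ : ∀ x y v → 1 ℕ.≤ x ℕ.+ y → + 0 ℤ.< det (+ x , + y) v → Convex (+ x , + y) v
  log-convex⁺ x y v 1≤ 0<d
    with n , u , w , g , 1≤n , p ← primitive-part (x ℕ.+ y) x y ℕP.≤-refl 1≤ good-units
    with w′ , g′ , d ← oriented g =
    subst (λ Q → Convex Q v) (sym Q≡) (straddle g′ d n v
      (0<-cancel {+ n} 0≤ℕ (subst (+ 0 ℤ.<_) (trans (cong (λ z → det z v) Q≡) (det-· n u v)) 0<d)))
    where
    Q≡ : (+ x , + y) ≡ n · u
    Q≡ = trans (ℕ-vector x y) p

  log-convex : ∀ x y v → 1 ℕ.≤ x ℕ.+ y → det (+ x , + y) v ≢ + 0 → Convex (+ x , + y) v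
  log-convex x y v 1≤ d≢0 with ℤP.<-cmp (det (+ x , + y) v) (+ 0)
  ... | tri≈ _ p _ = ⊥-elim (d≢0 p)
  ... | tri> _ _ p = log-convex⁺ x y v 1≤ p
  ... | tri< p _ _ = subst (T Q ℤ.* T Q ℤ.≤_) (trans (ℤP.*-comm (T (Q ⊞ neg v)) (T (Q ⊟ neg v)))
        (cong (λ z → T z ℤ.* T (Q ⊟ v)) (⊟-neg Q v)))
        (log-convex⁺ x y (neg v) 1≤ (subst (+ 0 ℤ.<_) (sym (i₁ Q v)) (ℤP.neg-mono-< p)))
    where
    Q : Vec²
    Q = (+ x , + y)
    j₁ : ∀ a b c d → a ℤ.* ℤ.- d ℤ.- b ℤ.* ℤ.- c ≡ ℤ.- (a ℤ.* d ℤ.- b ℤ.* c)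
    j₁ = ℤR.solve-∀
    i₁ : ∀ u w → det u (neg w) ≡ ℤ.- det u w
    i₁ (a , b) (c , d) = j₁ a b c d

  T-positive : ∀ x y → 1 ℕ.≤ x ℕ.+ y → + 0 ℤ.< T (+ x , + y)
  T-positive x y 1≤ with n , u , w , g , 1≤n , p ← primitive-part (x ℕ.+ y) x y ℕP.≤-refl 1≤ good-units =
    subst (λ z → + 0 ℤ.< T z) (sym (trans (ℕ-vector x y) p)) (multiples-positive n 1≤n)
    where
    i₀ : ∀ x y → x ≡ x ℤ.+ y ℤ.- y
    i₀ = ℤR.solve-∀
    i₁ : ∀ τ x y → (τ ℤ.- + 1) ℤ.* y ℤ.+ (y ℤ.- x) ≡ τ ℤ.* y ℤ.- x
    i₁ = ℤR.solve-∀
    i₂ : ∀ τ x y → (τ ℤ.- + 2) ℤ.* y ℤ.+ (y ℤ.- x) ≡ τ ℤ.* y ℤ.- x ℤ.- y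
    i₂ = ℤR.solve-∀
    rec : ∀ n → T ((2 ℕ.+ n) · u) ≡ T u ℤ.* T ((1 ℕ.+ n) · u) ℤ.- T (n · u)
    rec n = trans (i₀ _ (T (n · u))) (cong (ℤ._- T (n · u)) (multiple u w (unimod g) n))
    T1 : T (1 · u) ≡ T u
    T1 = cong T (cong₂ _,_ (ℤP.*-identityˡ (proj₁ u)) (ℤP.*-identityˡ (proj₂ u)))
    both : ∀ n → + 0 ℤ.< T (suc n · u) × + 0 ℤ.≤ T (suc n · u) ℤ.- T (n · u)
    both zero = subst (+ 0 ℤ.<_) (sym T1) (posˡ g)
      , subst (+ 0 ℤ.≤_) (sym (trans (cong₂ ℤ._-_ T1 T-0) (ℤP.+-identityʳ (T u)))) (ℤP.<⇒≤ (posˡ g))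
    both (suc n) with p , q ← both n =
      subst (+ 0 ℤ.<_) (trans (i₁ (T u) (T (n · u)) (T (suc n · u))) (sym (rec n)))
        (ℤP.+-mono-<-≤ (0<-* (ℤP.<-≤-trans (ℤ.+<+ (ℕ.s≤s ℕ.z≤n)) (ℤP.+-monoˡ-≤ (-[1+ 0 ]) (3≤T g))) p) q)
      , subst (+ 0 ℤ.≤_) (trans (i₂ (T u) (T (n · u)) (T (suc n · u)))
            (cong (ℤ._- T (suc n · u)) (sym (rec n))))
          (0≤-+ (0≤-* (0≤-diff (2≤T g)) (ℤP.<⇒≤ p)) q)
    multiples-positive : ∀ n → 1 ℕ.≤ n → + 0 ℤ.< T (n · u)
    multiples-positive (suc n) _ = proj₁ (both n)

-- Rational numbers

ℚ-ring : ACR.AlmostCommutativeRing 0ℓ 0ℓ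
ℚ-ring = ACR.fromCommutativeRing ℚP.+-*-commutativeRing isZero
  where
  isZero : ∀ x → Maybe (0ℚ ≡ x)
  isZero x with 0ℚ ℚ.≟ x
  ... | yes p = just p
  ... | no _  = nothing

module Rationals where
  open import Data.Rational using (_+_; _*_; _-_; -_; _≤_; _<_)

  infixr 8 _^_
  _^_ : ℚ → ℕ → ℚ
  x ^ zero  = 1ℚ
  x ^ suc n = x * x ^ n

  <⇒≱ : ∀ {x y} → x < y → ¬ y ≤ x
  <⇒≱ p q = ℚP.<-irrefl refl (ℚP.<-≤-trans p q)

  0≤1 : 0ℚ ≤ 1ℚ
  0≤1 = ℚP.≤ᵇ⇒≤ {0ℚ} {1ℚ} _

  0<1 : 0ℚ < 1ℚ
  0<1 = *<* (ℤ.+<+ (ℕ.s≤s ℕ.z≤n))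

  ≤-by : ∀ {x y z} → 0ℚ ≤ z → y ≡ x + z → x ≤ y
  ≤-by {x} {_} {z} p refl = subst (_≤ x + z) (ℚP.+-identityʳ x) (ℚP.+-monoʳ-≤ x p)

  <-by : ∀ {x y z} → 0ℚ < z → y ≡ x + z → x < y
  <-by {x} {_} {z} p refl = subst (_< x + z) (ℚP.+-identityʳ x) (ℚP.+-monoʳ-< x p)

  0≤-diff : ∀ {x y} → x ≤ y → 0ℚ ≤ y - x
  0≤-diff {x} {y} p = subst (_≤ y - x) (ℚP.+-inverseʳ x) (ℚP.+-monoˡ-≤ (- x) p)

  0<-diff : ∀ {x y} → x < y → 0ℚ < y - x
  0<-diff {x} {y} p = subst (_< y - x) (ℚP.+-inverseʳ x) (ℚP.+-monoˡ-< (- x) p)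

  0≤-* : ∀ {x y} → 0ℚ ≤ x → 0ℚ ≤ y → 0ℚ ≤ x * y
  0≤-* {x} {y} p q = subst (_≤ x * y) (ℚP.*-zeroʳ x) (ℚP.*-monoˡ-≤-nonNeg x {{ℚ.nonNegative p}} q)

  0<-* : ∀ {x y} → 0ℚ < x → 0ℚ < y → 0ℚ < x * y
  0<-* {x} {y} p q = subst (_< x * y) (ℚP.*-zeroʳ x) (ℚP.*-monoʳ-<-pos x {{ℚ.positive p}} q)

  0≤-+ : ∀ {x y} → 0ℚ ≤ x → 0ℚ ≤ y → 0ℚ ≤ x + y
  0≤-+ = ℚP.+-mono-≤

  0<-+ : ∀ {x y} → 0ℚ < x → 0ℚ ≤ y → 0ℚ < x + y
  0<-+ = ℚP.+-mono-<-≤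

  ^-0≤ : ∀ {x} n → 0ℚ ≤ x → 0ℚ ≤ x ^ n
  ^-0≤ zero    p = 0≤1
  ^-0≤ (suc n) p = 0≤-* p (^-0≤ n p)

  ^-0< : ∀ {x} n → 0ℚ < x → 0ℚ < x ^ n
  ^-0< zero    p = 0<1
  ^-0< (suc n) p = 0<-* p (^-0< n p)

  *-mono-≤ : ∀ {x y z w} → 0ℚ ≤ x → 0ℚ ≤ z → x ≤ y → z ≤ w → x * z ≤ y * w
  *-mono-≤ {x} {y} {z} {w} 0≤x 0≤z p q = ≤-by
    (0≤-+ (0≤-* (0≤-diff p) 0≤z) (0≤-* (ℚP.≤-trans 0≤x p) (0≤-diff q))) (i₁ x y z w)
    where
    i₁ : ∀ x y z w → y * w ≡ x * z + ((y - x) * z + y * (w - z))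
    i₁ = RingSolver.solve-∀ ℚ-ring

  *-monoˡ : ∀ {x y} z → 0ℚ ≤ z → x ≤ y → z * x ≤ z * y
  *-monoˡ z 0≤z p = ℚP.*-monoˡ-≤-nonNeg z {{ℚ.nonNegative 0≤z}} p

  *-monoʳ : ∀ {x y} z → 0ℚ ≤ z → x ≤ y → x * z ≤ y * z
  *-monoʳ z 0≤z p = ℚP.*-monoʳ-≤-nonNeg z {{ℚ.nonNegative 0≤z}} p

  *-cancel-≤ : ∀ {x y} z → 0ℚ < z → z * x ≤ z * y → x ≤ y
  *-cancel-≤ z 0<z p = ℚP.*-cancelˡ-≤-pos z {{ℚ.positive 0<z}} p

  *-cancel-< : ∀ {x y} z → 0ℚ ≤ z → z * x < z * y → x < y
  *-cancel-< z 0≤z p = ℚP.*-cancelˡ-<-nonNeg z {{ℚ.nonNegative 0≤z}} p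

  ^-mono-≤ : ∀ {x y} n → 0ℚ ≤ x → x ≤ y → x ^ n ≤ y ^ n
  ^-mono-≤ zero    0≤x p = ℚP.≤-refl
  ^-mono-≤ (suc n) 0≤x p = *-mono-≤ 0≤x (^-0≤ n 0≤x) p (^-mono-≤ n 0≤x p)

  ^-+ : ∀ x m n → x ^ (m ℕ.+ n) ≡ x ^ m * x ^ n
  ^-+ x zero n = sym (ℚP.*-identityˡ (x ^ n))
  ^-+ x (suc m) n = trans (cong (x *_) (^-+ x m n)) (sym (ℚP.*-assoc x (x ^ m) (x ^ n)))

  ^-* : ∀ x y n → (x * y) ^ n ≡ x ^ n * y ^ n
  ^-* x y zero = refl
  ^-* x y (suc n) = trans (cong (x * y *_) (^-* x y n)) (i₁ x y (x ^ n) (y ^ n))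
    where
    i₁ : ∀ x y z w → x * y * (z * w) ≡ x * z * (y * w)
    i₁ = RingSolver.solve-∀ ℚ-ring

  ^-^ : ∀ x m n → (x ^ m) ^ n ≡ x ^ (n ℕ.* m)
  ^-^ x m zero = refl
  ^-^ x m (suc n) = trans (cong (x ^ m *_) (^-^ x m n)) (sym (^-+ x m (n ℕ.* m)))

  1^ : ∀ n → 1ℚ ^ n ≡ 1ℚ
  1^ zero = refl
  1^ (suc n) = trans (ℚP.*-identityˡ (1ℚ ^ n)) (1^ n)

  ^-≤1 : ∀ {x} n → 0ℚ ≤ x → x ≤ 1ℚ → x ^ n ≤ 1ℚ
  ^-≤1 {x} n 0≤x p = subst (x ^ n ≤_) (1^ n) (^-mono-≤ n 0≤x p)

  1≤^ : ∀ {x} n → 1ℚ ≤ x → 1ℚ ≤ x ^ n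
  1≤^ {x} n p = subst (_≤ x ^ n) (1^ n) (^-mono-≤ n 0≤1 p)

  ^-cancel-sq : ∀ {x y} → 0ℚ ≤ y → x * x ≤ y * y → x ≤ y
  ^-cancel-sq {x} {y} 0≤y p with x ℚ.≤? y
  ... | yes q = q
  ... | no ¬q = ⊥-elim (<⇒≱ (<-by (0<-+ (0<-* (0<-diff y<x) (0<-diff y<x)) (0≤-* 0≤y (0≤-diff (ℚP.<⇒≤ y<x))))
        (i₁ x y)) (ℚP.≤-trans p (≤-by (0≤-* 0≤y (0≤-diff (ℚP.<⇒≤ y<x))) (i₂ x y))))
    where
    y<x : y < x
    y<x = ℚP.≰⇒> ¬q
    i₁ : ∀ x y → x * x ≡ x * y + ((x - y) * (x - y) + y * (x - y))
    i₁ = RingSolver.solve-∀ ℚ-ring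
    i₂ : ∀ x y → x * y ≡ y * y + y * (x - y)
    i₂ = RingSolver.solve-∀ ℚ-ring

  fromℤ≡mkℚ : ∀ i → fromℤ i ≡ mkℚ i 0 (Coprimality.sym (Coprimality.1-coprimeTo ℤ.∣ i ∣))
  fromℤ≡mkℚ i = ℚP.↥p/↧p≡p (mkℚ i 0 _)

  fromℤ-mono-≤ : ∀ {i j} → i ℤ.≤ j → fromℤ i ≤ fromℤ j
  fromℤ-mono-≤ {i} {j} p = subst₂ _≤_ (sym (fromℤ≡mkℚ i)) (sym (fromℤ≡mkℚ j))
    (*≤* (ℤP.*-monoʳ-≤-nonNeg (+ 1) p))

  fromℤ-mono-< : ∀ {i j} → i ℤ.< j → fromℤ i < fromℤ j
  fromℤ-mono-< {i} {j} p = subst₂ _<_ (sym (fromℤ≡mkℚ i)) (sym (fromℤ≡mkℚ j))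
    (*<* (ℤP.*-monoʳ-<-pos (+ 1) p))

  fromℤ-cancel-≤ : ∀ {i j} → fromℤ i ≤ fromℤ j → i ℤ.≤ j
  fromℤ-cancel-≤ {i} {j} p with i ℤ.≤? j
  ... | yes q = q
  ... | no ¬q = ⊥-elim (<⇒≱ (fromℤ-mono-< (ℤP.≰⇒> ¬q)) p)

  fromℤ-cancel-< : ∀ {i j} → fromℤ i < fromℤ j → i ℤ.< j
  fromℤ-cancel-< {i} {j} p with i ℤ.<? j
  ... | yes q = q
  ... | no ¬q = ⊥-elim (<⇒≱ p (fromℤ-mono-≤ (ℤP.≮⇒≥ ¬q)))

  toℚᵘ-fromℤ : ∀ i → ℚ.toℚᵘ (fromℤ i) ≡ ℚᵘ.mkℚᵘ i 0
  toℚᵘ-fromℤ i = cong ℚ.toℚᵘ (fromℤ≡mkℚ i)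

  fromℤ-+ : ∀ i j → fromℤ (i ℤ.+ j) ≡ fromℤ i + fromℤ j
  fromℤ-+ i j = ℚP.toℚᵘ-injective (ℚᵘP.≃-trans (ℚᵘP.≃-reflexive (toℚᵘ-fromℤ (i ℤ.+ j)))
    (ℚᵘP.≃-trans (ℚᵘ.*≡* (cong (ℤ._* + 1) (cong₂ ℤ._+_ (sym (ℤP.*-identityʳ i)) (sym (ℤP.*-identityʳ j)))))
      (ℚᵘP.≃-trans (ℚᵘP.≃-reflexive (cong₂ ℚᵘ._+_ (sym (toℚᵘ-fromℤ i)) (sym (toℚᵘ-fromℤ j))))
        (ℚᵘP.≃-sym (ℚP.toℚᵘ-homo-+ (fromℤ i) (fromℤ j))))))

  fromℤ-* : ∀ i j → fromℤ (i ℤ.* j) ≡ fromℤ i * fromℤ j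
  fromℤ-* i j = ℚP.toℚᵘ-injective (ℚᵘP.≃-trans (ℚᵘP.≃-reflexive (toℚᵘ-fromℤ (i ℤ.* j)))
    (ℚᵘP.≃-trans (ℚᵘP.≃-reflexive (cong₂ ℚᵘ._*_ (sym (toℚᵘ-fromℤ i)) (sym (toℚᵘ-fromℤ j))))
        (ℚᵘP.≃-sym (ℚP.toℚᵘ-homo-* (fromℤ i) (fromℤ j)))))

  fromℤ-neg : ∀ i → fromℤ (ℤ.- i) ≡ - fromℤ i
  fromℤ-neg i = ℚP.toℚᵘ-injective (ℚᵘP.≃-trans (ℚᵘP.≃-reflexive (toℚᵘ-fromℤ (ℤ.- i)))
    (ℚᵘP.≃-trans (ℚᵘP.≃-reflexive (cong ℚᵘ.-_ (sym (toℚᵘ-fromℤ i))))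
        (ℚᵘP.≃-sym (ℚP.toℚᵘ-homo‿- (fromℤ i)))))

  fromℤ-^ : ∀ i n → fromℤ (i ℤ.^ n) ≡ fromℤ i ^ n
  fromℤ-^ i zero = refl
  fromℤ-^ i (suc n) = trans (fromℤ-* i (i ℤ.^ n)) (cong (fromℤ i *_) (fromℤ-^ i n))

  fromℕ : ℕ → ℚ
  fromℕ n = fromℤ (+ n)

  0≤fromℕ : ∀ n → 0ℚ ≤ fromℕ n
  0≤fromℕ n = fromℤ-mono-≤ {+ 0} {+ n} (ℤ.+≤+ ℕ.z≤n)

  0<fromℕ : ∀ n → 0ℚ < fromℕ (suc n)
  0<fromℕ n = fromℤ-mono-< {+ 0} {+ suc n} (ℤ.+<+ (ℕ.s≤s ℕ.z≤n))

  fromℕ-suc : ∀ n → fromℕ (suc n) ≡ 1ℚ + fromℕ n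
  fromℕ-suc n = fromℤ-+ (+ 1) (+ n)

  fromℕ-mono : ∀ {m n} → m ℕ.≤ n → fromℕ m ≤ fromℕ n
  fromℕ-mono p = fromℤ-mono-≤ (ℤ.+≤+ p)

  archimedes : ∀ x → ∃[ n ] x ≤ fromℕ n
  archimedes (mkℚ (+ a) d c) = a , subst (mkℚ (+ a) d c ≤_) (sym (fromℤ≡mkℚ (+ a)))
    (*≤* (subst₂ ℤ._≤_ (ℤP.pos-* a 1) (ℤP.pos-* a (suc d))
      (ℤ.+≤+ (ℕP.*-monoʳ-≤ a (ℕ.s≤s ℕ.z≤n)))))
  archimedes (mkℚ -[1+ a ] d c) = 0 , *≤* ℤ.-≤+

  recip : ∀ x → 0ℚ < x → ∃[ y ] (0ℚ < y × x * y ≡ 1ℚ)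
  recip x 0<x = y , ℚP.positive⁻¹ y {{ℚP.1/pos⇒pos x {{ℚ.positive 0<x}}}} , ℚP.*-inverseʳ x {{nz}}
    where
    nz : ℚ.NonZero x
    nz = ℚ.≢-nonZero {x} (λ x≡0 → ℚP.<-irrefl (sym x≡0) 0<x)
    y : ℚ
    y = (ℚ.1/ x) {{nz}}

  ⊘-* : ∀ x y → 0ℚ < y → (x ⊘ y) * y ≡ x
  ⊘-* x y 0<y with y ℚ.≟ 0ℚ
  ... | yes refl = ⊥-elim (ℚP.<-irrefl refl 0<y)
  ... | no y≢0 = trans (ℚP.*-assoc x _ y) (trans (cong (x *_) (ℚP.*-inverseˡ y {{ℚ.≢-nonZero y≢0}})) (ℚP.*-identityʳ x))

  ⊘-0≤ : ∀ {x y} → 0ℚ ≤ x → 0ℚ < y → 0ℚ ≤ x ⊘ y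
  ⊘-0≤ {x} {y} 0≤x 0<y = *-cancel-≤ y 0<y (subst₂ _≤_ (sym (ℚP.*-zeroʳ y))
    (trans (sym (⊘-* x y 0<y)) (ℚP.*-comm (x ⊘ y) y)) 0≤x)

  bernoulli : ∀ n x → 0ℚ ≤ 1ℚ + x → 1ℚ + fromℕ n * x ≤ (1ℚ + x) ^ n
  bernoulli zero x p = ℚP.≤-reflexive (i₁ x)
    where
    i₁ : ∀ x → 1ℚ + 0ℚ * x ≡ 1ℚ
    i₁ = RingSolver.solve-∀ ℚ-ring
  bernoulli (suc n) x p = ℚP.≤-trans
    (≤-by (0≤-* (0≤fromℕ n) (sq x)) (trans (i₁ x (fromℕ n)) (cong (λ z → 1ℚ + z * x + fromℕ n * (x * x)) (sym (fromℕ-suc n)))))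
    (*-monoˡ (1ℚ + x) p (bernoulli n x p))
    where
    i₁ : ∀ x n → (1ℚ + x) * (1ℚ + n * x) ≡ 1ℚ + (1ℚ + n) * x + n * (x * x)
    i₁ = RingSolver.solve-∀ ℚ-ring
    sq : ∀ x → 0ℚ ≤ x * x
    sq x with ℚP.≤-total 0ℚ x
    ... | inj₁ q = 0≤-* {x} {x} q q
    ... | inj₂ q = subst (0ℚ ≤_) (i₂ x) (0≤-* { - x} { - x} (ℚP.neg-antimono-≤ q) (ℚP.neg-antimono-≤ q))
      where
      i₂ : ∀ x → - x * - x ≡ x * x
      i₂ = RingSolver.solve-∀ ℚ-ring

  power-dominates : ∀ {x y} → 0ℚ < x → x < y → ∀ C → ∃[ M ] (∀ n → M ℕ.≤ n → C * x ^ n < y ^ n)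
  power-dominates {x} {y} 0<x x<y C with z , 0<z , xz ← recip x 0<x
      with v , 0<v , ev ← recip ((y - x) * z) (0<-* (0<-diff x<y) 0<z)
      with M , CM ← archimedes (C * v) = M , bound
    where
    e : ℚ
    e = (y - x) * z
    0<e : 0ℚ < e
    0<e = 0<-* (0<-diff x<y) 0<z
    y≡ : y ≡ x * (1ℚ + e)
    y≡ = trans (i₁ x y) (trans (cong (λ o → x + (y - x) * o) (sym xz)) (i₂ x y z))
      where
      i₁ : ∀ x y → y ≡ x + (y - x) * 1ℚ
      i₁ = RingSolver.solve-∀ ℚ-ring
      i₂ : ∀ x y z → x + (y - x) * (x * z) ≡ x * (1ℚ + (y - x) * z)
      i₂ = RingSolver.solve-∀ ℚ-ring
    bound : ∀ n → M ℕ.≤ n → C * x ^ n < y ^ n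
    bound n M≤n = subst (C * x ^ n <_) (trans (ℚP.*-comm ((1ℚ + e) ^ n) (x ^ n)) (trans (sym (^-* x (1ℚ + e) n)) (cong (_^ n) (sym y≡))))
      (ℚP.*-monoˡ-<-pos (x ^ n) {{ℚ.positive (^-0< n 0<x)}} (ℚP.<-≤-trans
        (ℚP.≤-<-trans (ℚP.≤-trans (ℚP.≤-reflexive (sym (trans (ℚP.*-assoc C v e) (trans (cong (C *_) (trans (ℚP.*-comm v e) ev)) (ℚP.*-identityʳ C)))))
            (*-monoʳ e (ℚP.<⇒≤ 0<e) (ℚP.≤-trans CM (fromℕ-mono M≤n))))
          (<-by 0<1 (ℚP.+-comm 1ℚ (fromℕ n * e))))
        (bernoulli n e (ℚP.<⇒≤ (0<-+ 0<1 (ℚP.<⇒≤ 0<e))))))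

-- Logarithms

module Logarithms where
  open import Data.Rational using (_+_; _*_; _-_; -_; _≤_; _<_)
  open Rationals

  -- α ≤ exp s and exp z ≤ β, where exp is approximated through r = 1 / N by
  -- (1 - s r)⁻ᴺ from above and by (1 + z r)ᴺ from below.
  Up Lo : ℚ → ℚ → Set
  Up α s = ∀ N r → fromℕ N * r ≡ 1ℚ → 0ℚ < r → s * r ≤ 1ℚ → α * (1ℚ - s * r) ^ N ≤ 1ℚ
  Lo β z = ∀ N r → fromℕ N * r ≡ 1ℚ → 0ℚ < r → (1ℚ + z * r) ^ N ≤ β

  private
    0≤sq : ∀ {x} → 0ℚ ≤ x → 0ℚ ≤ x * x
    0≤sq {x} p = 0≤-* {x} {x} p p

    conj-≤1 : ∀ x → 0ℚ ≤ x → x ≤ 1ℚ → ∀ N → (1ℚ + x) ^ N * (1ℚ - x) ^ N ≤ 1ℚ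
    conj-≤1 x 0≤x x≤1 N = ℚP.≤-trans (ℚP.≤-reflexive (sym (^-* (1ℚ + x) (1ℚ - x) N)))
      (^-≤1 N (0≤-* (0≤-+ 0≤1 0≤x) (0≤-diff x≤1)) (≤-by (0≤sq 0≤x) (i₁ x)))
      where
      i₁ : ∀ x → 1ℚ ≡ (1ℚ + x) * (1ℚ - x) + x * x
      i₁ = RingSolver.solve-∀ ℚ-ring

    N*xr : ∀ N r x → fromℕ N * r ≡ 1ℚ → fromℕ N * (x * r) ≡ x
    N*xr N r x p = trans (i₁ (fromℕ N) r x) (trans (cong (x *_) p) (ℚP.*-identityʳ x))
      where
      i₁ : ∀ n r x → n * (x * r) ≡ x * (n * r)
      i₁ = RingSolver.solve-∀ ℚ-ring

    r≤1 : ∀ N r → fromℕ N * r ≡ 1ℚ → 0ℚ < r → r ≤ 1ℚ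
    r≤1 zero r p 0<r with () ← trans (sym (ℚP.*-zeroˡ r)) p
    r≤1 (suc N) r p 0<r = ≤-by (0≤-* (0≤fromℕ N) (ℚP.<⇒≤ 0<r))
      (trans (sym p) (trans (cong (_* r) (fromℕ-suc N)) (i₁ (fromℕ N) r)))
      where
      i₁ : ∀ n r → (1ℚ + n) * r ≡ r + n * r
      i₁ = RingSolver.solve-∀ ℚ-ring

  Up-1+ : ∀ y → 0ℚ ≤ y → Up (1ℚ + y) y
  Up-1+ y 0≤y N r Nr 0<r yr≤1 = ℚP.≤-trans
    (*-monoʳ ((1ℚ - y * r) ^ N) (^-0≤ N (0≤-diff yr≤1))
      (subst (λ z → 1ℚ + z ≤ (1ℚ + y * r) ^ N) (N*xr N r y Nr) (bernoulli N (y * r) (0≤-+ 0≤1 0≤yr))))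
    (conj-≤1 (y * r) 0≤yr yr≤1 N)
    where
    0≤yr : 0ℚ ≤ y * r
    0≤yr = 0≤-* 0≤y (ℚP.<⇒≤ 0<r)

  Up-* : ∀ {α α′ s s′} → 0ℚ ≤ α → 0ℚ ≤ α′ → 0ℚ ≤ s → 0ℚ ≤ s′ → Up α s → Up α′ s′ → Up (α * α′) (s + s′)
  Up-* {α} {α′} {s} {s′} 0≤α 0≤α′ 0≤s 0≤s′ u u′ N r Nr 0<r le = ℚP.≤-trans
    (*-monoˡ (α * α′) (0≤-* 0≤α 0≤α′) (ℚP.≤-trans
      (^-mono-≤ N (0≤-diff le) (≤-by (0≤-* (0≤-* 0≤s 0≤r) (0≤-* 0≤s′ 0≤r)) (i₁ s s′ r)))
      (ℚP.≤-reflexive (^-* (1ℚ - s * r) (1ℚ - s′ * r) N))))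
    (ℚP.≤-trans (ℚP.≤-reflexive (i₂ α α′ ((1ℚ - s * r) ^ N) ((1ℚ - s′ * r) ^ N)))
      (*-mono-≤ {y = 1ℚ} {w = 1ℚ} (0≤-* 0≤α (^-0≤ N (0≤-diff sr≤1))) (0≤-* 0≤α′ (^-0≤ N (0≤-diff s′r≤1)))
        (u N r Nr 0<r sr≤1) (u′ N r Nr 0<r s′r≤1)))
    where
    0≤r : 0ℚ ≤ r
    0≤r = ℚP.<⇒≤ 0<r
    sr≤1 : s * r ≤ 1ℚ
    sr≤1 = ℚP.≤-trans (≤-by (0≤-* 0≤s′ 0≤r) (ℚP.*-distribʳ-+ r s s′)) le
    s′r≤1 : s′ * r ≤ 1ℚ
    s′r≤1 = ℚP.≤-trans (≤-by (0≤-* 0≤s 0≤r) (i₀ s s′ r)) le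
      where
      i₀ : ∀ s s′ r → (s + s′) * r ≡ s′ * r + s * r
      i₀ = RingSolver.solve-∀ ℚ-ring
    i₁ : ∀ s s′ r → (1ℚ - s * r) * (1ℚ - s′ * r) ≡ 1ℚ - (s + s′) * r + s * r * (s′ * r)
    i₁ = RingSolver.solve-∀ ℚ-ring
    i₂ : ∀ a b x y → a * b * (x * y) ≡ a * x * (b * y)
    i₂ = RingSolver.solve-∀ ℚ-ring

  Up-1 : Up 1ℚ 0ℚ
  Up-1 N r Nr 0<r _ = ℚP.≤-reflexive (trans (cong (λ z → 1ℚ * z ^ N) (i₁ r)) (trans (ℚP.*-identityˡ (1ℚ ^ N)) (1^ N)))
    where
    i₁ : ∀ r → 1ℚ - 0ℚ * r ≡ 1ℚ
    i₁ = RingSolver.solve-∀ ℚ-ring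

  Lo-1 : Lo 1ℚ 0ℚ
  Lo-1 N r Nr 0<r = ℚP.≤-reflexive (trans (cong (_^ N) (i₁ r)) (1^ N))
    where
    i₁ : ∀ r → 1ℚ + 0ℚ * r ≡ 1ℚ
    i₁ = RingSolver.solve-∀ ℚ-ring

  Lo-inverse : ∀ w z → 0ℚ ≤ z → z < 1ℚ → w * (1ℚ - z) ≡ 1ℚ → Lo w z
  Lo-inverse w z 0≤z z<1 wz N r Nr 0<r = *-cancel-≤ (1ℚ - z) (0<-diff z<1)
    (ℚP.≤-trans (*-monoʳ ((1ℚ + z * r) ^ N) (^-0≤ N (0≤-+ 0≤1 0≤zr))
        (subst (_≤ (1ℚ - z * r) ^ N) (trans (i₁ (fromℕ N) (z * r)) (cong (λ t → 1ℚ - t) (N*xr N r z Nr)))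
          (bernoulli N (- (z * r)) (0≤-diff zr≤1))))
      (ℚP.≤-trans (ℚP.≤-reflexive (ℚP.*-comm ((1ℚ - z * r) ^ N) ((1ℚ + z * r) ^ N)))
        (ℚP.≤-trans (conj-≤1 (z * r) 0≤zr zr≤1 N)
          (ℚP.≤-reflexive (trans (sym wz) (ℚP.*-comm w (1ℚ - z)))))))
    where
    0≤zr : 0ℚ ≤ z * r
    0≤zr = 0≤-* 0≤z (ℚP.<⇒≤ 0<r)
    zr≤1 : z * r ≤ 1ℚ
    zr≤1 = *-mono-≤ {y = 1ℚ} {w = 1ℚ} 0≤z (ℚP.<⇒≤ 0<r) (ℚP.<⇒≤ z<1) (r≤1 N r Nr 0<r)
    i₁ : ∀ n x → 1ℚ + n * - x ≡ 1ℚ - n * x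
    i₁ = RingSolver.solve-∀ ℚ-ring

  Lo-* : ∀ {β β′ z z′} → 0ℚ ≤ z → 0ℚ ≤ z′ → Lo β z → Lo β′ z′ → Lo (β * β′) (z + z′)
  Lo-* {β} {β′} {z} {z′} 0≤z 0≤z′ l l′ N r Nr 0<r = ℚP.≤-trans
    (^-mono-≤ N (0≤-+ 0≤1 (0≤-* (0≤-+ 0≤z 0≤z′) 0≤r)) (≤-by (0≤-* (0≤-* 0≤z 0≤r) (0≤-* 0≤z′ 0≤r)) (i₁ z z′ r)))
    (ℚP.≤-trans (ℚP.≤-reflexive (^-* (1ℚ + z * r) (1ℚ + z′ * r) N))
      (*-mono-≤ (^-0≤ N (0≤-+ 0≤1 (0≤-* 0≤z 0≤r))) (^-0≤ N (0≤-+ 0≤1 (0≤-* 0≤z′ 0≤r)))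
        (l N r Nr 0<r) (l′ N r Nr 0<r)))
    where
    0≤r : 0ℚ ≤ r
    0≤r = ℚP.<⇒≤ 0<r
    i₁ : ∀ s s′ r → (1ℚ + s * r) * (1ℚ + s′ * r) ≡ 1ℚ + (s + s′) * r + s * r * (s′ * r)
    i₁ = RingSolver.solve-∀ ℚ-ring

  Up-^ : ∀ {α s} → 0ℚ ≤ α → 0ℚ ≤ s → Up α s → ∀ n → Up (α ^ n) (fromℕ n * s)
  Up-^ {α} {s} 0≤α 0≤s u zero = subst (Up 1ℚ) (sym (ℚP.*-zeroˡ s)) Up-1
  Up-^ {α} {s} 0≤α 0≤s u (suc n) = subst (Up (α * α ^ n))
    (sym (trans (cong (_* s) (fromℕ-suc n)) (i₁ (fromℕ n) s)))
    (Up-* 0≤α (^-0≤ n 0≤α) 0≤s (0≤-* (0≤fromℕ n) 0≤s) u (Up-^ 0≤α 0≤s u n))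
    where
    i₁ : ∀ n s → (1ℚ + n) * s ≡ s + n * s
    i₁ = RingSolver.solve-∀ ℚ-ring

  Lo-^ : ∀ {β z} → 0ℚ ≤ z → Lo β z → ∀ n → Lo (β ^ n) (fromℕ n * z)
  Lo-^ {β} {z} 0≤z l zero = subst (Lo 1ℚ) (sym (ℚP.*-zeroˡ z)) Lo-1
  Lo-^ {β} {z} 0≤z l (suc n) = subst (Lo (β * β ^ n))
    (sym (trans (cong (_* z) (fromℕ-suc n)) (i₁ (fromℕ n) z)))
    (Lo-* 0≤z (0≤-* (0≤fromℕ n) 0≤z) l (Lo-^ 0≤z l n))
    where
    i₁ : ∀ n s → (1ℚ + n) * s ≡ s + n * s
    i₁ = RingSolver.solve-∀ ℚ-ring

  Up-Lo : ∀ {α β s z} → 0ℚ ≤ α → 0ℚ ≤ s → s < z → Up α s → Lo β z → α ≤ β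
  Up-Lo {α} {β} {s} {z} 0≤α 0≤s s<z u l =
    ℚP.≤-trans (ℚP.≤-reflexive (sym (ℚP.*-identityʳ α))) (ℚP.≤-trans
      (*-monoˡ α 0≤α (1≤^ (suc N) 1≤))
      (ℚP.≤-trans (ℚP.≤-reflexive (trans (cong (α *_) (^-* (1ℚ - s * r) (1ℚ + z * r) (suc N)))
          (sym (ℚP.*-assoc α ((1ℚ - s * r) ^ suc N) ((1ℚ + z * r) ^ suc N)))))
        (ℚP.≤-trans (*-monoʳ ((1ℚ + z * r) ^ suc N) (^-0≤ (suc N) (0≤-+ 0≤1 (0≤-* 0≤z 0≤r))) (u (suc N) r Nr 0<r sr≤1))
          (ℚP.≤-trans (ℚP.≤-reflexive (ℚP.*-identityˡ ((1ℚ + z * r) ^ suc N))) (l (suc N) r Nr 0<r)))))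
    where
    gap = recip (z - s) (0<-diff s<z)
    v : ℚ
    v = proj₁ gap
    0<v = proj₁ (proj₂ gap)
    ev = proj₂ (proj₂ gap)
    bound = archimedes (s * z * v + s)
    N : ℕ
    N = proj₁ bound
    big = proj₂ bound
    mesh = recip (fromℕ (suc N)) (0<fromℕ N)
    r : ℚ
    r = proj₁ mesh
    0<r = proj₁ (proj₂ mesh)
    Nr = proj₂ (proj₂ mesh)
    0≤r : 0ℚ ≤ r
    0≤r = ℚP.<⇒≤ 0<r
    0≤z : 0ℚ ≤ z
    0≤z = ℚP.≤-trans 0≤s (ℚP.<⇒≤ s<z)
    0≤szv : 0ℚ ≤ s * z * v
    0≤szv = 0≤-* (0≤-* 0≤s 0≤z) (ℚP.<⇒≤ 0<v)
    N≤ : fromℕ N ≤ fromℕ (suc N)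
    N≤ = fromℕ-mono (ℕP.n≤1+n N)
    sr≤1 : s * r ≤ 1ℚ
    sr≤1 = subst (s * r ≤_) Nr (*-monoʳ r 0≤r (ℚP.≤-trans (ℚP.≤-trans (≤-by {s} {s * z * v + s} {s * z * v} 0≤szv (ℚP.+-comm (s * z * v) s)) big) N≤))
    szr≤ : s * z * r ≤ z - s
    szr≤ = ℚP.≤-trans (ℚP.≤-reflexive (trans (i₁ (s * z) r) (trans (cong (λ o → s * z * r * o) (sym ev)) (i₂ (s * z) r (z - s) v))))
      (ℚP.≤-trans (*-monoˡ ((z - s) * r) (0≤-* (0≤-diff (ℚP.<⇒≤ s<z)) 0≤r)
          (ℚP.≤-trans (ℚP.≤-trans (≤-by 0≤s refl) big) N≤))
        (ℚP.≤-reflexive (trans (i₃ (z - s) r (fromℕ (suc N))) (trans (cong ((z - s) *_) Nr) (ℚP.*-identityʳ (z - s))))))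
      where
      i₁ : ∀ x r → x * r ≡ x * r * 1ℚ
      i₁ = RingSolver.solve-∀ ℚ-ring
      i₂ : ∀ x r e v → x * r * (e * v) ≡ e * r * (x * v)
      i₂ = RingSolver.solve-∀ ℚ-ring
      i₃ : ∀ e r n → e * r * n ≡ e * (n * r)
      i₃ = RingSolver.solve-∀ ℚ-ring
    1≤ : 1ℚ ≤ (1ℚ - s * r) * (1ℚ + z * r)
    1≤ = ≤-by (0≤-* 0≤r (0≤-diff szr≤)) (i₁ s z r)
      where
      i₁ : ∀ s z r → (1ℚ - s * r) * (1ℚ + z * r) ≡ 1ℚ + r * (z - s - s * z * r)
      i₁ = RingSolver.solve-∀ ℚ-ring

  -- The terms of the left Riemann sum of 1 / t over [1 , 1 + n h].
  term : ℚ → ℕ → ℚ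
  term h i = h ⊘ (1ℚ + fromℕ i * h)

  left right : ℚ → ℕ → ℚ
  left  h n = sumBelow n (term h)
  right h n = sumBelow n (λ i → term h (suc i))

  module Riemann (h : ℚ) (0≤h : 0ℚ ≤ h) where

    node : ℕ → ℚ
    node i = 1ℚ + fromℕ i * h

    0<node : ∀ i → 0ℚ < node i
    0<node i = 0<-+ 0<1 (0≤-* (0≤fromℕ i) 0≤h)

    term-node : ∀ i → term h i * node i ≡ h
    term-node i = ⊘-* h (node i) (0<node i)

    0≤term : ∀ i → 0ℚ ≤ term h i
    0≤term i = ⊘-0≤ 0≤h (0<node i)

    node-suc : ∀ i → node (suc i) ≡ node i + h
    node-suc i = trans (cong (λ n → 1ℚ + n * h) (fromℕ-suc i)) (i₁ (fromℕ i) h)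
      where
      i₁ : ∀ n h → 1ℚ + (1ℚ + n) * h ≡ 1ℚ + n * h + h
      i₁ = RingSolver.solve-∀ ℚ-ring

    node-step : ∀ i → node (suc i) ≡ node i * (1ℚ + term h i)
    node-step i = trans (node-suc i) (trans (cong (λ o → node i + o) (sym (term-node i))) (i₁ (node i) (term h i)))
      where
      i₁ : ∀ x t → x + t * x ≡ x * (1ℚ + t)
      i₁ = RingSolver.solve-∀ ℚ-ring

    node-0 : node 0 ≡ 1ℚ
    node-0 = i₁ h
      where
      i₁ : ∀ h → 1ℚ + 0ℚ * h ≡ 1ℚ
      i₁ = RingSolver.solve-∀ ℚ-ring

    0≤left : ∀ n → 0ℚ ≤ left h n
    0≤left zero = ℚP.≤-refl
    0≤left (suc n) = 0≤-+ (0≤left n) (0≤term n)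

    0≤right : ∀ n → 0ℚ ≤ right h n
    0≤right zero = ℚP.≤-refl
    0≤right (suc n) = 0≤-+ (0≤right n) (0≤term (suc n))

    Up-left : ∀ n → Up (node n) (left h n)
    Up-left zero = subst (λ x → Up x 0ℚ) (sym node-0) Up-1
    Up-left (suc n) = subst (λ x → Up x (left h (suc n))) (sym (node-step n))
      (Up-* (ℚP.<⇒≤ (0<node n)) (0≤-+ 0≤1 (0≤term n)) (0≤left n) (0≤term n) (Up-left n) (Up-1+ (term h n) (0≤term n)))

    Lo-right : ∀ n → Lo (node n) (right h n)
    Lo-right zero = subst (λ x → Lo x 0ℚ) (sym node-0) Lo-1
    Lo-right (suc n) = subst (λ x → Lo x (right h (suc n))) (sym (node-step n))
      (Lo-* (0≤right n) (0≤term (suc n)) (Lo-right n)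
        (Lo-inverse (1ℚ + term h n) (term h (suc n)) (0≤term (suc n)) small inverse))
      where
      z D : ℚ
      z = term h (suc n)
      D = node (suc n)
      D-z : D * (1ℚ - z) ≡ node n
      D-z = trans (i₁ D z) (trans (cong₂ _-_ (node-suc n) (term-node (suc n))) (i₂ (node n) h))
        where
        i₁ : ∀ D z → D * (1ℚ - z) ≡ D - z * D
        i₁ = RingSolver.solve-∀ ℚ-ring
        i₂ : ∀ x h → x + h - h ≡ x
        i₂ = RingSolver.solve-∀ ℚ-ring
      small : z < 1ℚ
      small = *-cancel-< D (ℚP.<⇒≤ (0<node (suc n))) (<-by (0<node n)
        (trans (i₁ D z) (cong (λ o → D * z + o) D-z)))
        where
        i₁ : ∀ D z → D * 1ℚ ≡ D * z + D * (1ℚ - z)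
        i₁ = RingSolver.solve-∀ ℚ-ring
      cancel : ∀ x y → node n * x ≡ node n * y → x ≡ y
      cancel x y p = ℚP.≤-antisym (*-cancel-≤ (node n) (0<node n) (ℚP.≤-reflexive p))
        (*-cancel-≤ (node n) (0<node n) (ℚP.≤-reflexive (sym p)))
      inverse : (1ℚ + term h n) * (1ℚ - z) ≡ 1ℚ
      inverse = cancel _ _ (trans (sym (ℚP.*-assoc (node n) (1ℚ + term h n) (1ℚ - z)))
        (trans (cong (_* (1ℚ - z)) (sym (node-step n))) (trans D-z (sym (ℚP.*-identityʳ (node n))))))

    right-left : ∀ n → right h n + h ≡ left h n + term h n
    right-left zero = cong (λ o → 0ℚ + o) (sym (trans (sym (ℚP.*-identityʳ (term h 0)))
      (trans (cong (term h 0 *_) (sym node-0)) (term-node 0))))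
    right-left (suc n) = trans (i₁ (right h n) (term h (suc n)) h) (cong (_+ term h (suc n)) (right-left n))
      where
      i₁ : ∀ x y z → x + y + z ≡ x + z + y
      i₁ = RingSolver.solve-∀ ℚ-ring

    left≤right : ∀ n → left h n ≤ right h n + h
    left≤right n = ≤-by (0≤term n) (right-left n)

    left-upper : ∀ n → left h n ≤ fromℕ n * h
    left-upper zero = ℚP.≤-reflexive (sym (ℚP.*-zeroˡ h))
    left-upper (suc n) = ℚP.≤-trans (ℚP.+-mono-≤ (left-upper n) term≤h)
      (ℚP.≤-reflexive (sym (trans (cong (_* h) (fromℕ-suc n)) (i₁ (fromℕ n) h))))
      where
      i₁ : ∀ n h → (1ℚ + n) * h ≡ n * h + h
      i₁ = RingSolver.solve-∀ ℚ-ring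
      i₂ : ∀ t n h → t * (1ℚ + n * h) ≡ t + t * (n * h)
      i₂ = RingSolver.solve-∀ ℚ-ring
      term≤h : term h n ≤ h
      term≤h = ≤-by (0≤-* (0≤term n) (0≤-* (0≤fromℕ n) 0≤h)) (trans (sym (term-node n)) (i₂ (term h n) (fromℕ n) h))

    left-lower : ∀ n k → k ℕ.≤ n → fromℕ k * h ≤ left h k * node n
    left-lower n zero _ = ℚP.≤-reflexive (trans (ℚP.*-zeroˡ h) (sym (ℚP.*-zeroˡ (node n))))
    left-lower n (suc k) k<n = ℚP.≤-trans
      (ℚP.≤-reflexive (trans (cong (_* h) (fromℕ-suc k)) (i₁ (fromℕ k) h)))
      (ℚP.≤-trans (ℚP.+-mono-≤ (left-lower n k (ℕP.<⇒≤ k<n)) h≤)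
        (ℚP.≤-reflexive (sym (ℚP.*-distribʳ-+ (node n) (left h k) (term h k)))))
      where
      i₁ : ∀ n h → (1ℚ + n) * h ≡ n * h + h
      i₁ = RingSolver.solve-∀ ℚ-ring
      h≤ : h ≤ term h k * node n
      h≤ = ℚP.≤-trans (ℚP.≤-reflexive (sym (term-node k)))
        (*-monoˡ (term h k) (0≤term k) (ℚP.+-monoʳ-≤ 1ℚ (*-monoʳ h 0≤h (fromℕ-mono (ℕP.<⇒≤ k<n)))))

  step : ℚ → ℕ → ℚ
  step x n = (x - 1ℚ) ⊘ fromℕ n

  lnSum : ℚ → ℕ → ℚ
  lnSum x n = left (step x n) n

  module LnSum (x : ℚ) (1≤x : 1ℚ ≤ x) (n : ℕ) (1≤n : 1 ℕ.≤ n) where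
    h : ℚ
    h = step x n

    0<n : 0ℚ < fromℕ n
    0<n = fromℤ-mono-< (ℤ.+<+ 1≤n)

    n*h : fromℕ n * h ≡ x - 1ℚ
    n*h = trans (ℚP.*-comm (fromℕ n) h) (⊘-* (x - 1ℚ) (fromℕ n) 0<n)

    open Riemann h (⊘-0≤ (0≤-diff 1≤x) 0<n) public

    node≡x : node n ≡ x
    node≡x = trans (cong (λ o → 1ℚ + o) n*h) (i₁ x)
      where
      i₁ : ∀ x → 1ℚ + (x - 1ℚ) ≡ x
      i₁ = RingSolver.solve-∀ ℚ-ring

    Up-ln : Up x (lnSum x n)
    Up-ln = subst (λ y → Up y (lnSum x n)) node≡x (Up-left n)

    Lo-ln : Lo x (right h n)
    Lo-ln = subst (λ y → Lo y (right h n)) node≡x (Lo-right n)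

    0≤ln : 0ℚ ≤ lnSum x n
    0≤ln = 0≤left n

    ln≤ : lnSum x n ≤ x - 1ℚ
    ln≤ = subst (lnSum x n ≤_) n*h (left-upper n)

    ≤ln : x - 1ℚ ≤ lnSum x n * x
    ≤ln = subst₂ _≤_ n*h (cong (lnSum x n *_) node≡x) (left-lower n n ℕP.≤-refl)

  module Compare (α β : ℚ) (1≤α : 1ℚ ≤ α) (1≤β : 1ℚ ≤ β) (n : ℕ) (1≤n : 1 ℕ.≤ n) (e f : ℕ) where
    private
      module A = LnSum α 1≤α n 1≤n
      module B = LnSum β 1≤β n 1≤n
      0≤α : 0ℚ ≤ α
      0≤α = ℚP.≤-trans 0≤1 1≤α
      0≤β : 0ℚ ≤ β
      0≤β = ℚP.≤-trans 0≤1 1≤β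

    sum⇒power : ∀ η → 0ℚ < η → fromℕ e * lnSum α n + (η + η) ≤ fromℕ f * lnSum β n →
      fromℕ f * step β n < η → α ^ e * (1ℚ + η) ≤ β ^ f
    sum⇒power η 0<η p q = Up-Lo (0≤-* (^-0≤ e 0≤α) (0≤-+ 0≤1 0≤η)) (0≤-+ 0≤eA 0≤η)
      (<-by (0<-+ (0<-diff q) (0≤-+ (0≤-diff p) (0≤-* (0≤fromℕ f) (0≤-diff (B.left≤right n)))))
        (i₁ (fromℕ e * lnSum α n) η (fromℕ f) (lnSum β n) (step β n) (right (step β n) n)))
      (Up-* (^-0≤ e 0≤α) (0≤-+ 0≤1 0≤η) 0≤eA 0≤η (Up-^ 0≤α A.0≤ln A.Up-ln e) (Up-1+ η 0≤η))
      (Lo-^ (B.0≤right n) B.Lo-ln f)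
      where
      0≤η : 0ℚ ≤ η
      0≤η = ℚP.<⇒≤ 0<η
      0≤eA : 0ℚ ≤ fromℕ e * lnSum α n
      0≤eA = 0≤-* (0≤fromℕ e) A.0≤ln
      i₁ : ∀ a η f b h r → f * r ≡ a + η + (η - f * h + (f * b - (a + (η + η)) + f * (r + h - b)))
      i₁ = RingSolver.solve-∀ ℚ-ring

    power⇒sum : ∀ η → 0ℚ < η → α ^ e * (1ℚ + η) < β ^ f →
      fromℕ e * lnSum α n + η ⊘ (1ℚ + η) ≤ fromℕ f * lnSum β n + fromℕ e * step α n
    power⇒sum η 0<η p = by-cases (fromℕ f * lnSum β n ℚ.<? fromℕ e * right (step α n) n + z)
      where
      z : ℚ
      z = η ⊘ (1ℚ + η)
      0<1+η : 0ℚ < 1ℚ + η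
      0<1+η = 0<-+ 0<1 (ℚP.<⇒≤ 0<η)
      0≤z : 0ℚ ≤ z
      0≤z = ⊘-0≤ (ℚP.<⇒≤ 0<η) 0<1+η
      inverse : (1ℚ + η) * (1ℚ - z) ≡ 1ℚ
      inverse = trans (i₁ η z) (trans (cong (λ t → 1ℚ + η - t) (⊘-* η (1ℚ + η) 0<1+η)) (i₂ η))
        where
        i₁ : ∀ η z → (1ℚ + η) * (1ℚ - z) ≡ 1ℚ + η - z * (1ℚ + η)
        i₁ = RingSolver.solve-∀ ℚ-ring
        i₂ : ∀ η → 1ℚ + η - η ≡ 1ℚ
        i₂ = RingSolver.solve-∀ ℚ-ring
      z<1 : z < 1ℚ
      z<1 = *-cancel-< (1ℚ + η) (ℚP.<⇒≤ 0<1+η) (<-by 0<1 (trans (i₁ (1ℚ + η) z) (cong (λ o → (1ℚ + η) * z + o) inverse)))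
        where
        i₁ : ∀ D z → D * 1ℚ ≡ D * z + D * (1ℚ - z)
        i₁ = RingSolver.solve-∀ ℚ-ring
      i₁ : ∀ e a z b r h → b + e * h ≡ e * a + z + (b - (e * r + z) + e * (r + h - a))
      i₁ = RingSolver.solve-∀ ℚ-ring
      by-cases : Dec (fromℕ f * lnSum β n < fromℕ e * right (step α n) n + z) →
        fromℕ e * lnSum α n + z ≤ fromℕ f * lnSum β n + fromℕ e * step α n
      by-cases (yes q) = ⊥-elim (<⇒≱ p (Up-Lo (^-0≤ f 0≤β) (0≤-* (0≤fromℕ f) B.0≤ln) q
          (Up-^ 0≤β B.0≤ln B.Up-ln f)
          (Lo-* (0≤-* (0≤fromℕ e) (A.0≤right n)) 0≤z (Lo-^ (A.0≤right n) A.Lo-ln e)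
            (Lo-inverse (1ℚ + η) z 0≤z z<1 inverse))))
      by-cases (no ¬q) = ≤-by (0≤-+ (0≤-diff (ℚP.≮⇒≥ ¬q)) (0≤-* (0≤fromℕ e) (0≤-diff (A.left≤right n))))
          (i₁ (fromℕ e) (lnSum α n) z (fromℕ f * lnSum β n) (right (step α n) n) (step α n))

  mesh : ∀ C η → 0ℚ ≤ C → 0ℚ < η → ∃[ N ] (1 ℕ.≤ N × (∀ n → N ℕ.≤ n → ∀ h → fromℕ n * h ≤ C → h < η))
  mesh C η 0≤C 0<η with v , 0<v , ηv ← recip η 0<η with N , big ← archimedes (C * v) =
    suc N , ℕ.s≤s ℕ.z≤n , λ n N<n h p → *-cancel-< (fromℕ n) (0≤fromℕ n) (ℚP.≤-<-trans p
      (ℚP.≤-<-trans (subst (_≤ fromℕ N * η) (trans (ℚP.*-assoc C v η)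
            (trans (cong (C *_) (trans (ℚP.*-comm v η) ηv)) (ℚP.*-identityʳ C)))
          (*-monoʳ η (ℚP.<⇒≤ 0<η) big))
        (ℚP.*-monoˡ-<-pos η {{ℚ.positive 0<η}} (fromℤ-mono-< (ℤ.+<+ N<n)))))

-- Rational consequences of inequalities in ℤ[δ]: for 0 ≤ t ≤ δ ≤ s the smaller
-- side may be evaluated at t and the larger side at s.
module Evaluation (τ : ℤ) (2≤τ : + 2 ℤ.≤ τ) where
  open Quadratic τ 2≤τ using (K; C₀; N; _≼_; le; Δ; ι; N-upper; N-lower; C₀-*; C₀-^; C₀-ι; 0≤Δ)
    renaming (_*_ to _*K_; _^_ to _^K_; _-_ to _-K_; -_ to -K_)
  open import Data.Rational using (_+_; _*_; _-_; -_; _≤_; _<_)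
  open Rationals

  ev : ℚ → K → ℚ
  ev s (x , y) = fromℤ x + fromℤ y * s

  record Bracket (t s : ℚ) : Set where
    field
      0≤t : 0ℚ ≤ t
      t²≤ : t * t ≤ fromℤ Δ
      0≤s : 0ℚ ≤ s
      ≤s² : fromℤ Δ ≤ s * s

    t≤s : t ≤ s
    t≤s = ^-cancel-sq 0≤s (ℚP.≤-trans t²≤ ≤s²)

  ev-* : ∀ s x y → ev s x * ev s y ≡ ev s (x *K y) + fromℤ (proj₂ x) * fromℤ (proj₂ y) * (s * s - fromℤ Δ)
  ev-* s (a , b) (c , d) = trans (i₁ (fromℤ a) (fromℤ b) (fromℤ c) (fromℤ d) s (fromℤ Δ))
    (cong₂ (λ p q → p + q * s + fromℤ b * fromℤ d * (s * s - fromℤ Δ))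
      (sym (trans (fromℤ-+ (a ℤ.* c) (b ℤ.* d ℤ.* Δ)) (cong₂ _+_ (fromℤ-* a c)
        (trans (fromℤ-* (b ℤ.* d) Δ) (cong (_* fromℤ Δ) (fromℤ-* b d))))))
      (sym (trans (fromℤ-+ (a ℤ.* d) (b ℤ.* c)) (cong₂ _+_ (fromℤ-* a d) (fromℤ-* b c)))))
    where
    i₁ : ∀ a b c d s Δ → (a + b * s) * (c + d * s)
       ≡ a * c + b * d * Δ + (a * d + b * c) * s + b * d * (s * s - Δ)
    i₁ = RingSolver.solve-∀ ℚ-ring

  0≤ev : ∀ {s x} → 0ℚ ≤ s → C₀ x → 0ℚ ≤ ev s x
  0≤ev 0≤s (p , q) = 0≤-+ (fromℤ-mono-≤ p) (0≤-* (fromℤ-mono-≤ q) 0≤s)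

  ev-upper-* : ∀ {s} → 0ℚ ≤ s → fromℤ Δ ≤ s * s → ∀ x y → C₀ x → C₀ y → ev s (x *K y) ≤ ev s x * ev s y
  ev-upper-* {s} 0≤s p x y (_ , q) (_ , r) = ≤-by
    (0≤-* (0≤-* (fromℤ-mono-≤ q) (fromℤ-mono-≤ r)) (0≤-diff p)) (ev-* s x y)

  ev-lower-* : ∀ {t} → t * t ≤ fromℤ Δ → ∀ x y → C₀ x → C₀ y → ev t x * ev t y ≤ ev t (x *K y)
  ev-lower-* {t} p x y (_ , q) (_ , r) = ≤-by
    (0≤-* (0≤-* (fromℤ-mono-≤ q) (fromℤ-mono-≤ r)) (0≤-diff p))
    (trans (i₁ (ev t (x *K y)) (fromℤ (proj₂ x) * fromℤ (proj₂ y)) (t * t) (fromℤ Δ))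
      (cong (λ z → z + fromℤ (proj₂ x) * fromℤ (proj₂ y) * (fromℤ Δ - t * t)) (sym (ev-* t x y))))
    where
    i₁ : ∀ e p q r → e ≡ e + p * (q - r) + p * (r - q)
    i₁ = RingSolver.solve-∀ ℚ-ring

  ev-1 : ∀ s → ev s (ι (+ 1)) ≡ 1ℚ
  ev-1 s = i₁ s
    where
    i₁ : ∀ s → 1ℚ + 0ℚ * s ≡ 1ℚ
    i₁ = RingSolver.solve-∀ ℚ-ring

  ev-ι : ∀ s c → ev s (ι c) ≡ fromℤ c
  ev-ι s c = i₁ (fromℤ c) s
    where
    i₁ : ∀ c s → c + 0ℚ * s ≡ c
    i₁ = RingSolver.solve-∀ ℚ-ring

  ev-upper-^ : ∀ {s} → 0ℚ ≤ s → fromℤ Δ ≤ s * s → ∀ x → C₀ x → ∀ n → ev s (x ^K n) ≤ ev s x ^ n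
  ev-upper-^ {s} 0≤s p x c zero = ℚP.≤-reflexive (ev-1 s)
  ev-upper-^ {s} 0≤s p x c (suc n) = ℚP.≤-trans (ev-upper-* 0≤s p x (x ^K n) c (C₀-^ n c))
    (*-monoˡ (ev s x) (0≤ev 0≤s c) (ev-upper-^ 0≤s p x c n))

  ev-lower-^ : ∀ {t} → 0ℚ ≤ t → t * t ≤ fromℤ Δ → ∀ x → C₀ x → ∀ n → ev t x ^ n ≤ ev t (x ^K n)
  ev-lower-^ {t} 0≤t p x c zero = ℚP.≤-reflexive (sym (ev-1 t))
  ev-lower-^ {t} 0≤t p x c (suc n) = ℚP.≤-trans
    (*-monoˡ (ev t x) (0≤ev 0≤t c) (ev-lower-^ 0≤t p x c n)) (ev-lower-* p x (x ^K n) c (C₀-^ n c))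

  private
    fromℤ-sq : ∀ x → fromℤ (x ℤ.* x) ≡ fromℤ x * fromℤ x
    fromℤ-sq x = fromℤ-* x x

    fromℤ-Δsq : ∀ y → fromℤ (Δ ℤ.* (y ℤ.* y)) ≡ fromℤ Δ * (fromℤ y * fromℤ y)
    fromℤ-Δsq y = trans (fromℤ-* Δ (y ℤ.* y)) (cong (fromℤ Δ *_) (fromℤ-* y y))

    0≤fy² : ∀ y → 0ℚ ≤ fromℤ y * fromℤ y
    0≤fy² y = subst (0ℚ ≤_) (fromℤ-* y y) (fromℤ-mono-≤ (Integers.0≤-square y))

  -- A nonnegative x + y δ stays nonnegative when δ is moved in the direction of the sign of y.
  ev-N : ∀ {t s} → Bracket t s → ∀ x y → N (x , y) → 0ℚ ≤ fromℤ x + fromℤ y * s ⊎ 0ℚ ≤ fromℤ x + fromℤ y * t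
  ev-N {t} {s} br x y n = by-sign (ℤP.≤-total (+ 0) y)
    where
    open Bracket br
    up : + 0 ℤ.≤ y → + 0 ℤ.≤ x ⊎ (x ℤ.≤ + 0 × x ℤ.* x ℤ.≤ Δ ℤ.* (y ℤ.* y)) → 0ℚ ≤ fromℤ x + fromℤ y * s
    up 0≤y (inj₁ 0≤x) = 0≤-+ (fromℤ-mono-≤ 0≤x) (0≤-* (fromℤ-mono-≤ 0≤y) 0≤s)
    up 0≤y (inj₂ (x≤0 , p)) = subst (0ℚ ≤_) (i₁ (fromℤ x) (fromℤ y * s)) (0≤-diff (^-cancel-sq { - fromℤ x} {fromℤ y * s}
      (0≤-* (fromℤ-mono-≤ 0≤y) 0≤s)
      (ℚP.≤-trans (ℚP.≤-reflexive (trans (i₂ (fromℤ x)) (sym (fromℤ-sq x))))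
        (ℚP.≤-trans (fromℤ-mono-≤ p) (ℚP.≤-trans (ℚP.≤-reflexive (fromℤ-Δsq y))
          (ℚP.≤-trans (*-monoʳ (fromℤ y * fromℤ y) (0≤fy² y) ≤s²) (ℚP.≤-reflexive (i₃ (fromℤ y) s))))))))
      where
      i₁ : ∀ x z → z - - x ≡ x + z
      i₁ = RingSolver.solve-∀ ℚ-ring
      i₂ : ∀ x → - x * - x ≡ x * x
      i₂ = RingSolver.solve-∀ ℚ-ring
      i₃ : ∀ y s → s * s * (y * y) ≡ y * s * (y * s)
      i₃ = RingSolver.solve-∀ ℚ-ring
    low : + 0 ℤ.≤ x × Δ ℤ.* (y ℤ.* y) ℤ.≤ x ℤ.* x → 0ℚ ≤ fromℤ x + fromℤ y * t
    low (0≤x , p) = subst (0ℚ ≤_) (i₁ (fromℤ x) (fromℤ y) t) (0≤-diff (^-cancel-sq { - fromℤ y * t} {fromℤ x} (fromℤ-mono-≤ 0≤x)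
      (ℚP.≤-trans (ℚP.≤-reflexive (i₃ (fromℤ y) t))
        (ℚP.≤-trans (*-monoʳ (fromℤ y * fromℤ y) (0≤fy² y) t²≤)
          (ℚP.≤-trans (ℚP.≤-reflexive (sym (fromℤ-Δsq y))) (ℚP.≤-trans (fromℤ-mono-≤ p) (ℚP.≤-reflexive (fromℤ-sq x))))))))
      where
      i₁ : ∀ x y t → x - - y * t ≡ x + y * t
      i₁ = RingSolver.solve-∀ ℚ-ring
      i₃ : ∀ y s → - y * s * (- y * s) ≡ s * s * (y * y)
      i₃ = RingSolver.solve-∀ ℚ-ring
    by-sign : + 0 ℤ.≤ y ⊎ y ℤ.≤ + 0 → 0ℚ ≤ fromℤ x + fromℤ y * s ⊎ 0ℚ ≤ fromℤ x + fromℤ y * t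
    by-sign (inj₁ 0≤y) = inj₁ (up 0≤y (N-upper n 0≤y))
    by-sign (inj₂ y≤0) = inj₂ (low (N-lower n y≤0))

  ev-≼ : ∀ {t s} → Bracket t s → ∀ x y → C₀ x → C₀ y → x ≼ y → ev t x ≤ ev s y
  ev-≼ {t} {s} br (a , b) (c , d) (_ , 0≤b) (_ , 0≤d) (le n) = by-cases (ev-N br (c ℤ.+ ℤ.- a) (d ℤ.+ ℤ.- b) n)
    where
    open Bracket br
    diff : ∀ c a → fromℤ (c ℤ.+ ℤ.- a) ≡ fromℤ c - fromℤ a
    diff c a = trans (fromℤ-+ c (ℤ.- a)) (cong (λ z → fromℤ c + z) (fromℤ-neg a))
    by-cases : 0ℚ ≤ fromℤ (c ℤ.+ ℤ.- a) + fromℤ (d ℤ.+ ℤ.- b) * s ⊎ 0ℚ ≤ fromℤ (c ℤ.+ ℤ.- a) + fromℤ (d ℤ.+ ℤ.- b) * t →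
      ev t (a , b) ≤ ev s (c , d)
    by-cases (inj₁ p) = ≤-by (0≤-+ p (0≤-* (fromℤ-mono-≤ 0≤b) (0≤-diff t≤s)))
      (trans (i₁ (fromℤ a) (fromℤ b) (fromℤ c) (fromℤ d) s t)
        (cong₂ (λ p q → fromℤ a + fromℤ b * t + (p + q * s + fromℤ b * (s - t))) (sym (diff c a)) (sym (diff d b))))
      where
      i₁ : ∀ a b c d s t → c + d * s ≡ a + b * t + (c - a + (d - b) * s + b * (s - t))
      i₁ = RingSolver.solve-∀ ℚ-ring
    by-cases (inj₂ p) = ≤-by (0≤-+ p (0≤-* (fromℤ-mono-≤ 0≤d) (0≤-diff t≤s)))
      (trans (i₁ (fromℤ a) (fromℤ b) (fromℤ c) (fromℤ d) s t)
        (cong₂ (λ p q → fromℤ a + fromℤ b * t + (p + q * t + fromℤ d * (s - t))) (sym (diff c a)) (sym (diff d b))))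
      where
      i₁ : ∀ a b c d s t → c + d * s ≡ a + b * t + (c - a + (d - b) * t + d * (s - t))
      i₁ = RingSolver.solve-∀ ℚ-ring

-- Growth rates

module Growth (T : Vec² → ℤ) (isTrace : IsTrace T) {u w : Vec²}
  (g : TraceFunction.Good T isTrace u w)
  (natural : ∀ n j → ∃[ x ] ∃[ y ] (n · u ⊞ j · w ≡ (+ x , + y) × n ℕ.+ j ℕ.≤ x ℕ.+ y))
  (0≤y₀ : + 0 ℤ.≤ + 2 ℤ.* T (u ⊞ w) ℤ.- T u ℤ.* T w)
  where

  open IsTrace isTrace
  open TraceFunction T isTrace
  open LogConvexity T isTrace
  open Quadratic (T u) (2≤T g) using (Δ; K; Λ; C₀-Λ; C₀; C₀-*; C₀-^; C₀-ι; C₀-δ; C₀-+; N-C₀; ι; δ; le; _≼_; 0≤Δ; module Eigenbasis)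
    renaming (_*_ to _*K_; _^_ to _^K_; _-_ to _-K_)
  open Eigenbasis T isTrace g refl (3≤T g) using (Γ; Γ̄; 0<Δ; ladder; first-ratio; convex-step; scaled-ratio; ladder-power)
  open Evaluation (T u) (2≤T g)

  t : ℕ → ℕ → ℤ
  t n j = T (n · u ⊞ j · w)

  t-positive : ∀ n j → 1 ℕ.≤ n ℕ.+ j → + 0 ℤ.< t n j
  t-positive n j 1≤ = subst (λ P → + 0 ℤ.< T P) (sym (proj₁ (proj₂ (proj₂ (natural n j)))))
    (T-positive _ _ (ℕP.≤-trans 1≤ (proj₂ (proj₂ (proj₂ (natural n j))))))

  private
    convex : ∀ n j v → 1 ℕ.≤ n ℕ.+ j → det (n · u ⊞ j · w) v ≢ + 0 → Convex (n · u ⊞ j · w) v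
    convex n j v 1≤ d≢0 = subst (λ P → Convex P v) (sym p)
      (log-convex _ _ v (ℕP.≤-trans 1≤ (proj₂ (proj₂ (proj₂ (natural n j))))) (subst (λ P → det P v ≢ + 0) p d≢0))
      where p = proj₁ (proj₂ (proj₂ (natural n j)))

    nonzero : ∀ n {d} → 1 ℕ.≤ n → ℤ.∣ d ∣ ≡ 1 → ∀ {e} → ℤ.∣ e ∣ ≡ n ℕ.* ℤ.∣ d ∣ → e ≢ + 0
    nonzero (suc n) {d} _ d≡1 {e} p refl with () ← trans p (trans (cong (suc n ℕ.*_) d≡1) (ℕP.*-identityʳ (suc n)))

    det-w : ∀ n j u w → det (n · u ⊞ j · w) w ≡ + n ℤ.* det u w
    det-w n j (a , b) (c , d) = i₁ (+ n) (+ j) a b c d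
      where
      i₁ : ∀ n j a b c d → (n ℤ.* a ℤ.+ j ℤ.* c) ℤ.* d ℤ.- (n ℤ.* b ℤ.+ j ℤ.* d) ℤ.* c ≡ n ℤ.* (a ℤ.* d ℤ.- b ℤ.* c)
      i₁ = ℤR.solve-∀

    det-u : ∀ n j u w → det (n · u ⊞ j · w) u ≡ + j ℤ.* det w u
    det-u n j (a , b) (c , d) = i₁ (+ n) (+ j) a b c d
      where
      i₁ : ∀ n j a b c d → (n ℤ.* a ℤ.+ j ℤ.* c) ℤ.* b ℤ.- (n ℤ.* b ℤ.+ j ℤ.* d) ℤ.* a ≡ j ℤ.* (c ℤ.* b ℤ.- d ℤ.* a)
      i₁ = ℤR.solve-∀

    next-w : ∀ n j u w → n · u ⊞ suc j · w ⊞ w ≡ n · u ⊞ (2 ℕ.+ j) · w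
    next-w n j (a , b) (c , d) = cong₂ _,_ (i₁ (+ n ℤ.* a) (+ j) c) (i₁ (+ n ℤ.* b) (+ j) d)
      where
      i₁ : ∀ x j c → x ℤ.+ (+ 1 ℤ.+ j) ℤ.* c ℤ.+ c ≡ x ℤ.+ (+ 2 ℤ.+ j) ℤ.* c
      i₁ = ℤR.solve-∀

    prev-w : ∀ n j u w → n · u ⊞ suc j · w ⊟ w ≡ n · u ⊞ j · w
    prev-w n j (a , b) (c , d) = cong₂ _,_ (i₁ (+ n ℤ.* a) (+ j) c) (i₁ (+ n ℤ.* b) (+ j) d)
      where
      i₁ : ∀ x j c → x ℤ.+ (+ 1 ℤ.+ j) ℤ.* c ℤ.- c ≡ x ℤ.+ j ℤ.* c
      i₁ = ℤR.solve-∀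

    next-u : ∀ n j u w → suc n · u ⊞ j · w ⊞ u ≡ (2 ℕ.+ n) · u ⊞ j · w
    next-u n j (a , b) (c , d) = cong₂ _,_ (i₁ (+ j ℤ.* c) (+ n) a) (i₁ (+ j ℤ.* d) (+ n) b)
      where
      i₁ : ∀ x n a → (+ 1 ℤ.+ n) ℤ.* a ℤ.+ x ℤ.+ a ≡ (+ 2 ℤ.+ n) ℤ.* a ℤ.+ x
      i₁ = ℤR.solve-∀

    prev-u : ∀ n j u w → suc n · u ⊞ j · w ⊟ u ≡ n · u ⊞ j · w
    prev-u n j (a , b) (c , d) = cong₂ _,_ (i₁ (+ j ℤ.* c) (+ n) a) (i₁ (+ j ℤ.* d) (+ n) b)
      where
      i₁ : ∀ x n a → (+ 1 ℤ.+ n) ℤ.* a ℤ.+ x ℤ.- a ≡ n ℤ.* a ℤ.+ x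
      i₁ = ℤR.solve-∀

  convex-w : ∀ n j → 1 ℕ.≤ n → t n (suc j) ℤ.* t n (suc j) ℤ.≤ t n j ℤ.* t n (2 ℕ.+ j)
  convex-w n j 1≤n = subst (t n (suc j) ℤ.* t n (suc j) ℤ.≤_)
    (trans (cong₂ (λ P Q → T P ℤ.* T Q) (next-w n j u w) (prev-w n j u w)) (ℤP.*-comm (t n (2 ℕ.+ j)) (t n j)))
    (convex n (suc j) w (ℕP.≤-trans 1≤n (ℕP.m≤m+n n (suc j)))
      (nonzero n {det u w} 1≤n (unimod g) (trans (cong ℤ.∣_∣ (det-w n (suc j) u w)) (ℤP.abs-* (+ n) (det u w)))))

  convex-u : ∀ n j → 1 ℕ.≤ j → t (suc n) j ℤ.* t (suc n) j ℤ.≤ t n j ℤ.* t (2 ℕ.+ n) j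
  convex-u n j 1≤j = subst (t (suc n) j ℤ.* t (suc n) j ℤ.≤_)
    (trans (cong₂ (λ P Q → T P ℤ.* T Q) (next-u n j u w) (prev-u n j u w)) (ℤP.*-comm (t (2 ℕ.+ n) j) (t n j)))
    (convex (suc n) j u (ℕ.s≤s ℕ.z≤n)
      (nonzero j {det w u} 1≤j (unimodular-swap u w (unimod g))
        (trans (cong ℤ.∣_∣ (det-u (suc n) j u w)) (ℤP.abs-* (+ j) (det w u)))))

  1·w : ∀ n → n · u ⊞ 1 · w ≡ n · u ⊞ w
  1·w n = cong (n · u ⊞_) (cong₂ _,_ (ℤP.*-identityˡ (proj₁ w)) (ℤP.*-identityˡ (proj₂ w)))

  ratio-w : ∀ n j → 1 ℕ.≤ n → δ *K Γ *K ι (t n (suc j)) ≼ ι (+ 2 ℤ.* Δ ℤ.* t n (2 ℕ.+ j))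
  ratio-w n j 1≤n = scaled-ratio (unscaled j)
    where
    open Eigenbasis T isTrace g refl (3≤T g) using (b)
    unscaled : ∀ j → Γ *K ι (t n (suc j)) ≼ b *K ι (t n (2 ℕ.+ j))
    unscaled zero = subst (λ P → Γ *K ι (T P) ≼ b *K ι (t n 2)) (sym (1·w n)) (first-ratio n)
    unscaled (suc j) = convex-step (t n (suc j)) (t n (2 ℕ.+ j)) (t n (3 ℕ.+ j))
      (t-positive n (suc j) (ℕP.≤-trans 1≤n (ℕP.m≤m+n n (suc j))))
      (ℤP.<⇒≤ (t-positive n (2 ℕ.+ j) (ℕP.≤-trans 1≤n (ℕP.m≤m+n n (2 ℕ.+ j)))))
      (convex-w n (suc j) 1≤n) (unscaled j)

  module Int where
    open Integers

    ladder-norm : ∀ n → let x = ladder n ; y = + 2 ℤ.* ladder (suc n) ℤ.- T u ℤ.* x in y ℤ.* y ℤ.≤ Δ ℤ.* (x ℤ.* x)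
    ladder-norm n = ℤP.0≤i-j⇒j≤i (subst (+ 0 ℤ.≤_) (trans (sym (En.norm))
        (trans (cong (λ z → ladder n ℤ.* ladder n ℤ.* Δ ℤ.- (+ 2 ℤ.* z ℤ.- T u ℤ.* ladder n) ℤ.* (+ 2 ℤ.* z ℤ.- T u ℤ.* ladder n)) next)
          (i₁ (ladder n) Δ _)))
      (0≤-* {+ 4} 0≤ℕ (0≤-square (T u))))
      where
      module En = Eigenbasis T isTrace (good-iterate n g) refl (3≤T g)
      j₁ : ∀ n a c → a ℤ.+ (n ℤ.* a ℤ.+ c) ≡ (+ 1 ℤ.+ n) ℤ.* a ℤ.+ c
      j₁ = ℤR.solve-∀
      next : T (u ⊞ (n · u ⊞ w)) ≡ ladder (suc n)
      next = cong T (cong₂ _,_ (j₁ (+ n) (proj₁ u) (proj₁ w)) (j₁ (+ n) (proj₂ u) (proj₂ w)))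
      i₁ : ∀ x Δ y → x ℤ.* x ℤ.* Δ ℤ.- y ≡ Δ ℤ.* (x ℤ.* x) ℤ.- y
      i₁ = ℤR.solve-∀

    multiple-bound : ∀ n j → t (suc j ℕ.* n) (suc j) ℤ.≤ ladder n ℤ.^ suc j
    multiple-bound n j = subst (λ P → T P ℤ.≤ ladder n ℤ.^ suc j) (shape u w) (bound j)
      where
      P = n · u ⊞ w
      0≤P : + 0 ℤ.≤ T P
      0≤P = ℤP.<⇒≤ (posʳ (good-iterate n g))
      shape : ∀ u w → suc j · (n · u ⊞ w) ≡ (suc j ℕ.* n) · u ⊞ suc j · w
      shape (a , b) (c , d) = cong₂ _,_ (component a c) (component b d)
        where
        i₁ : ∀ j n a c → j ℤ.* (n ℤ.* a ℤ.+ c) ≡ j ℤ.* n ℤ.* a ℤ.+ j ℤ.* c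
        i₁ = ℤR.solve-∀
        component : ∀ a c → + suc j ℤ.* (+ n ℤ.* a ℤ.+ c) ≡ + (suc j ℕ.* n) ℤ.* a ℤ.+ + suc j ℤ.* c
        component a c = trans (i₁ (+ suc j) (+ n) a c) (cong (λ z → z ℤ.* a ℤ.+ + suc j ℤ.* c) (sym (ℤP.pos-* (suc j) n)))
      0≤multiple : ∀ i → + 0 ℤ.≤ T (i · P)
      0≤multiple zero = ℤP.≤-reflexive (sym T-0)
      0≤multiple (suc i) = ℤP.<⇒≤ (subst (λ Q → + 0 ℤ.< T Q) (sym (shape′ u w))
        (t-positive (suc i ℕ.* n) (suc i) (ℕP.≤-trans (ℕ.s≤s ℕ.z≤n) (ℕP.m≤n+m (suc i) (suc i ℕ.* n)))))
        where
        i₁ : ∀ j n a c → j ℤ.* (n ℤ.* a ℤ.+ c) ≡ j ℤ.* n ℤ.* a ℤ.+ j ℤ.* c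
        i₁ = ℤR.solve-∀
        component : ∀ a c → + suc i ℤ.* (+ n ℤ.* a ℤ.+ c) ≡ + (suc i ℕ.* n) ℤ.* a ℤ.+ + suc i ℤ.* c
        component a c = trans (i₁ (+ suc i) (+ n) a c) (cong (λ z → z ℤ.* a ℤ.+ + suc i ℤ.* c) (sym (ℤP.pos-* (suc i) n)))
        shape′ : ∀ u w → suc i · (n · u ⊞ w) ≡ (suc i ℕ.* n) · u ⊞ suc i · w
        shape′ (a , b) (c , d) = cong₂ _,_ (component a c) (component b d)
      bound : ∀ i → T (suc i · P) ℤ.≤ T P ℤ.^ suc i
      bound zero = ℤP.≤-reflexive (trans (cong T (cong₂ _,_ (ℤP.*-identityˡ (proj₁ P)) (ℤP.*-identityˡ (proj₂ P))))
        (sym (ℤP.*-identityʳ (T P))))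
      bound (suc i) = ℤP.≤-trans
        (≤-by (0≤multiple i) (trans (sym (multiple P u (unimodular-swap u P (unimod (good-iterate n g))) i)) refl))
        (ℤP.*-monoˡ-≤-nonNeg (T P) {{ℤ.nonNegative 0≤P}} (bound i))

  open import Data.Rational using (_+_; _*_; _-_; -_; _≤_; _<_)
  open Rationals

  f : ℕ → ℕ → ℚ
  f n j = fromℤ (t n j)

  f-positive : ∀ n j → 1 ℕ.≤ n ℕ.+ j → 0ℚ < f n j
  f-positive n j p = fromℤ-mono-< (t-positive n j p)

  c : ℚ
  c = fromℤ (+ 2 ℤ.* Δ)

  0<c : 0ℚ < c
  0<c = fromℤ-mono-< (Integers.0<-* {+ 2} (ℤ.+<+ (ℕ.s≤s ℕ.z≤n)) 0<Δ)

  c⁻¹ : ℚ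
  c⁻¹ = proj₁ (recip c 0<c)

  -- The growth rates at a point s of ℚ in place of √Δ.
  γ λᵣ : ℚ → ℚ
  γ s  = ev s (δ *K Γ) * c⁻¹
  λᵣ s = ev s Λ * ½

  cγ : ∀ s → c * γ s ≡ ev s (δ *K Γ)
  cγ s = trans (i₁ c (ev s (δ *K Γ)) c⁻¹) (trans (cong (ev s (δ *K Γ) *_) (proj₂ (proj₂ (recip c 0<c)))) (ℚP.*-identityʳ _))
    where
    i₁ : ∀ c e d → c * (e * d) ≡ e * (c * d)
    i₁ = RingSolver.solve-∀ ℚ-ring

  2λ : ∀ s → fromℤ (+ 2) * λᵣ s ≡ ev s Λ
  2λ s = i₁ (ev s Λ)
    where
    i₁ : ∀ x → fromℤ (+ 2) * (x * ½) ≡ x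
    i₁ = RingSolver.solve-∀ ℚ-ring

  C₀-δΓ : C₀ (δ *K Γ)
  C₀-δΓ = C₀-* C₀-δ (0≤y₀ , ℤP.<⇒≤ (posʳ g))

  0≤c⁻¹ : 0ℚ ≤ c⁻¹
  0≤c⁻¹ = ℚP.<⇒≤ (proj₁ (proj₂ (recip c 0<c)))

  0≤γ : ∀ {s} → 0ℚ ≤ s → 0ℚ ≤ γ s
  0≤γ p = 0≤-* (0≤ev p C₀-δΓ) 0≤c⁻¹

  0<λ : ∀ {s} → 0ℚ ≤ s → 0ℚ < λᵣ s
  0<λ {s} p = 0<-* (0<-+ (fromℤ-mono-< (posˡ g)) (0≤-* (fromℤ-mono-≤ {+ 0} {+ 1} (ℤ.+≤+ ℕ.z≤n)) p)) (*<* (ℤ.+<+ (ℕ.s≤s ℕ.z≤n)))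

  0≤λ : ∀ {s} → 0ℚ ≤ s → 0ℚ ≤ λᵣ s
  0≤λ p = ℚP.<⇒≤ (0<λ p)

  module _ {t′ s : ℚ} (br : Bracket t′ s) where
    open Bracket br

    step-w : ∀ n j → 1 ℕ.≤ n → 1 ℕ.≤ j → γ t′ * f n j ≤ f n (suc j)
    step-w n (suc j) 1≤n _ = *-cancel-≤ c 0<c (ℚP.≤-trans
      (ℚP.≤-reflexive (trans (sym (ℚP.*-assoc c (γ t′) (f n (suc j)))) (cong₂ _*_ (cγ t′) (sym (ev-ι t′ (t n (suc j)))))))
      (ℚP.≤-trans (ev-lower-* t²≤ (δ *K Γ) (ι (t n (suc j))) C₀-δΓ (C₀-ι 0≤t₁))
        (ℚP.≤-trans (ev-≼ br (δ *K Γ *K ι (t n (suc j))) (ι (+ 2 ℤ.* Δ ℤ.* t n (2 ℕ.+ j)))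
            (C₀-* C₀-δΓ (C₀-ι 0≤t₁)) (C₀-ι (Integers.0≤-* (Integers.0≤-* {+ 2} (ℤ.+≤+ ℕ.z≤n) 0≤Δ) 0≤t₂)) (ratio-w n j 1≤n))
          (ℚP.≤-reflexive (trans (ev-ι s (+ 2 ℤ.* Δ ℤ.* t n (2 ℕ.+ j))) (fromℤ-* (+ 2 ℤ.* Δ) (t n (2 ℕ.+ j))))))))
      where
      0≤t₁ = ℤP.<⇒≤ (t-positive n (suc j) (ℕP.≤-trans 1≤n (ℕP.m≤m+n n (suc j))))
      0≤t₂ = ℤP.<⇒≤ (t-positive n (2 ℕ.+ j) (ℕP.≤-trans 1≤n (ℕP.m≤m+n n (2 ℕ.+ j))))

    steps-w : ∀ n j d → 1 ℕ.≤ n → 1 ℕ.≤ j → γ t′ ^ d * f n j ≤ f n (j ℕ.+ d)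
    steps-w n j zero 1≤n 1≤j = ℚP.≤-reflexive (trans (ℚP.*-identityˡ (f n j)) (cong (f n) (sym (ℕP.+-identityʳ j))))
    steps-w n j (suc d) 1≤n 1≤j = ℚP.≤-trans (ℚP.≤-reflexive (ℚP.*-assoc (γ t′) (γ t′ ^ d) (f n j)))
      (ℚP.≤-trans (*-monoˡ (γ t′) (0≤γ 0≤t) (steps-w n j d 1≤n 1≤j))
        (subst (λ k → γ t′ * f n (j ℕ.+ d) ≤ f n k) (sym (ℕP.+-suc j d))
          (step-w n (j ℕ.+ d) 1≤n (ℕP.≤-trans 1≤j (ℕP.m≤m+n j d)))))

    x : ℕ → ℚ
    x n = fromℤ (ladder n)

    0≤x : ∀ n → 0ℚ ≤ x n
    0≤x n = fromℤ-mono-≤ (ℤP.<⇒≤ (posʳ (good-iterate n g)))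

    ladder-step : ∀ n → x (suc n) ≤ λᵣ s * x n
    ladder-step n = *-cancel-≤ (fromℤ (+ 2)) (fromℤ-mono-< (ℤ.+<+ {0} {2} (ℕ.s≤s ℕ.z≤n))) (ℚP.≤-trans
      (≤-by (0≤-diff root) (trans (i₁ (fromℤ (+ 2)) (x (suc n)) (fromℤ (T u) * x n) (s * x n)) refl))
      (ℚP.≤-reflexive (trans (i₂ (fromℤ (T u)) s (x n)) (trans (cong (_* x n) (sym (2λ s))) (ℚP.*-assoc (fromℤ (+ 2)) (λᵣ s) (x n))))))
      where
      y : ℤ
      y = + 2 ℤ.* ladder (suc n) ℤ.- T u ℤ.* ladder n
      fy : fromℤ y ≡ fromℤ (+ 2) * x (suc n) - fromℤ (T u) * x n
      fy = trans (fromℤ-+ (+ 2 ℤ.* ladder (suc n)) (ℤ.- (T u ℤ.* ladder n)))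
        (cong₂ _+_ (fromℤ-* (+ 2) (ladder (suc n))) (trans (fromℤ-neg (T u ℤ.* ladder n)) (cong -_ (fromℤ-* (T u) (ladder n)))))
      root : fromℤ (+ 2) * x (suc n) - fromℤ (T u) * x n ≤ s * x n
      root = ^-cancel-sq (0≤-* 0≤s (0≤x n)) (subst₂ _≤_
        (trans (fromℤ-* y y) (cong₂ _*_ fy fy)) (i₃ s (x n))
        (ℚP.≤-trans (fromℤ-mono-≤ (Int.ladder-norm n)) (ℚP.≤-trans
          (ℚP.≤-reflexive (trans (fromℤ-* Δ (ladder n ℤ.* ladder n)) (cong (fromℤ Δ *_) (fromℤ-* (ladder n) (ladder n)))))
          (*-monoʳ (x n * x n) (0≤-* (0≤x n) (0≤x n)) ≤s²))))
        where
        i₃ : ∀ s x → s * s * (x * x) ≡ s * x * (s * x)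
        i₃ = RingSolver.solve-∀ ℚ-ring
      i₁ : ∀ c y a b → a + b ≡ c * y + (b - (c * y - a))
      i₁ = RingSolver.solve-∀ ℚ-ring
      i₂ : ∀ τ s x → τ * x + s * x ≡ (τ + 1ℚ * s) * x
      i₂ = RingSolver.solve-∀ ℚ-ring

    ladder-bound : ∀ n → x n ≤ λᵣ s ^ n * x 0
    ladder-bound zero = ℚP.≤-reflexive (sym (ℚP.*-identityˡ (x 0)))
    ladder-bound (suc n) = ℚP.≤-trans (ladder-step n) (ℚP.≤-trans (*-monoˡ (λᵣ s) (0≤λ 0≤s) (ladder-bound n))
      (ℚP.≤-reflexive (sym (ℚP.*-assoc (λᵣ s) (λᵣ s ^ n) (x 0)))))

    f-ladder : ∀ n j → 1 ℕ.≤ j → f (j ℕ.* n) j ≤ x n ^ j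
    f-ladder n (suc j) _ = ℚP.≤-trans (fromℤ-mono-≤ (Int.multiple-bound n j)) (ℚP.≤-reflexive (fromℤ-^ (ladder n) (suc j)))

    -- The ratios in the direction u increase, so a ratio above λ would make
    -- the values outgrow the ladder.
    step-u : ∀ n j → 1 ℕ.≤ j → f (suc n) j ≤ λᵣ s * f n j
    step-u n j 1≤j = by-cases (f (suc n) j ℚ.≤? λᵣ s * f n j)
      where
      p p′ : ℚ
      p  = f n j
      p′ = f (suc n) j
      0<p : 0ℚ < p
      0<p = f-positive n j (ℕP.≤-trans 1≤j (ℕP.m≤n+m j n))
      0≤p′ : 0ℚ ≤ p′
      0≤p′ = ℚP.<⇒≤ (f-positive (suc n) j (ℕ.s≤s ℕ.z≤n))
      ratios : ∀ N → p′ * f (N ℕ.+ n) j ≤ p * f (suc N ℕ.+ n) j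
      ratios zero = ℚP.≤-reflexive (ℚP.*-comm p′ p)
      ratios (suc N) = *-cancel-≤ (f (N ℕ.+ n) j) (f-positive (N ℕ.+ n) j (ℕP.≤-trans 1≤j (ℕP.m≤n+m j (N ℕ.+ n)))) (ℚP.≤-trans
        (ℚP.≤-reflexive (i₁ (f (N ℕ.+ n) j) p′ (f (suc N ℕ.+ n) j)))
        (ℚP.≤-trans (*-monoʳ (f (suc N ℕ.+ n) j) 0≤next (ratios N))
          (ℚP.≤-trans (ℚP.≤-reflexive (ℚP.*-assoc p (f (suc N ℕ.+ n) j) (f (suc N ℕ.+ n) j)))
            (ℚP.≤-trans (*-monoˡ p (ℚP.<⇒≤ 0<p) (subst₂ _≤_ (fromℤ-* (t (suc N ℕ.+ n) j) (t (suc N ℕ.+ n) j)) (fromℤ-* (t (N ℕ.+ n) j) (t (2 ℕ.+ N ℕ.+ n) j)) (fromℤ-mono-≤ (convex-u (N ℕ.+ n) j 1≤j))))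
              (ℚP.≤-reflexive (i₂ p (f (N ℕ.+ n) j) (f (2 ℕ.+ N ℕ.+ n) j)))))))
        where
        0≤next : 0ℚ ≤ f (suc N ℕ.+ n) j
        0≤next = ℚP.<⇒≤ (f-positive (suc N ℕ.+ n) j (ℕ.s≤s ℕ.z≤n))
        i₁ : ∀ a p b → a * (p * b) ≡ p * a * b
        i₁ = RingSolver.solve-∀ ℚ-ring
        i₂ : ∀ p a b → p * (a * b) ≡ a * (p * b)
        i₂ = RingSolver.solve-∀ ℚ-ring
      powers : ∀ N → p′ ^ N * p ≤ p ^ N * f (N ℕ.+ n) j
      powers zero = ℚP.≤-refl
      powers (suc N) = ℚP.≤-trans (ℚP.≤-reflexive (ℚP.*-assoc p′ (p′ ^ N) p)) (ℚP.≤-trans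
        (*-monoˡ p′ 0≤p′ (powers N)) (ℚP.≤-trans (ℚP.≤-reflexive (i₁ p′ (p ^ N) (f (N ℕ.+ n) j)))
          (ℚP.≤-trans (*-monoˡ (p ^ N) (^-0≤ N (ℚP.<⇒≤ 0<p)) (ratios N)) (ℚP.≤-reflexive (i₂ (p ^ N) p (f (suc N ℕ.+ n) j))))))
        where
        i₁ : ∀ a p b → a * (p * b) ≡ p * (a * b)
        i₁ = RingSolver.solve-∀ ℚ-ring
        i₂ : ∀ q p b → q * (p * b) ≡ p * q * b
        i₂ = RingSolver.solve-∀ ℚ-ring
      C : ℚ
      C = λᵣ s ^ n * x 0 ^ j
      upper : ∀ N n′ → N ℕ.+ n ≡ j ℕ.* n′ → f (N ℕ.+ n) j ≤ λᵣ s ^ N * C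
      upper N n′ eq = ℚP.≤-trans (ℚP.≤-reflexive (cong (λ k → f k j) eq)) (ℚP.≤-trans (f-ladder n′ j 1≤j)
        (ℚP.≤-trans (^-mono-≤ j (0≤x n′) (ladder-bound n′)) (ℚP.≤-reflexive (trans (^-* (λᵣ s ^ n′) (x 0) j)
          (trans (cong (_* x 0 ^ j) (trans (^-^ (λᵣ s) n′ j) (trans (cong (λᵣ s ^_) (sym eq)) (^-+ (λᵣ s) N n))))
            (ℚP.*-assoc (λᵣ s ^ N) (λᵣ s ^ n) (x 0 ^ j)))))))
      absurd : λᵣ s * p < p′ → ⊥
      absurd q = <⇒≱ (proj₂ dominated N M≤N) (*-cancel-≤ p 0<p (ℚP.≤-trans
          (ℚP.≤-reflexive (ℚP.*-comm p (p′ ^ N)))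
          (ℚP.≤-trans (powers N) (ℚP.≤-trans (*-monoˡ (p ^ N) (^-0≤ N (ℚP.<⇒≤ 0<p)) (upper N n′ N+n))
            (ℚP.≤-reflexive (trans (i₁ (p ^ N) (λᵣ s ^ N) C) (trans (cong₂ _*_ (sym (trans (sym (ℚP.*-assoc p v C)) (trans (cong (_* C) pv) (ℚP.*-identityˡ C)))) (sym (^-* (λᵣ s) p N)))
              (ℚP.*-assoc p (v * C) ((λᵣ s * p) ^ N)))))))))
        where
        v : ℚ
        v = proj₁ (recip p 0<p)
        pv : p * v ≡ 1ℚ
        pv = proj₂ (proj₂ (recip p 0<p))
        dominated = power-dominates (0<-* (0<λ 0≤s) 0<p) q (v * C)
        M n′ N : ℕ
        M = proj₁ dominated
        n′ = M ℕ.+ n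
        N = j ℕ.* n′ ℕ.∸ n
        n′≤ : n′ ℕ.≤ j ℕ.* n′
        n′≤ = subst (ℕ._≤ j ℕ.* n′) (ℕP.*-identityˡ n′) (ℕP.*-monoˡ-≤ n′ 1≤j)
        N+n : N ℕ.+ n ≡ j ℕ.* n′
        N+n = ℕP.m∸n+n≡m (ℕP.≤-trans (ℕP.m≤n+m n M) n′≤)
        M≤N : M ℕ.≤ N
        M≤N = ℕP.+-cancelʳ-≤ n M N (ℕP.≤-trans n′≤ (ℕP.≤-reflexive (sym N+n)))
        i₁ : ∀ a b C → a * (b * C) ≡ C * (b * a)
        i₁ = RingSolver.solve-∀ ℚ-ring
      by-cases : Dec (p′ ≤ λᵣ s * p) → p′ ≤ λᵣ s * p
      by-cases (yes q) = q
      by-cases (no ¬q) = ⊥-elim (absurd (ℚP.≰⇒> ¬q))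

    steps-u : ∀ n j e → 1 ℕ.≤ j → f (e ℕ.+ n) j ≤ λᵣ s ^ e * f n j
    steps-u n j zero 1≤j = ℚP.≤-reflexive (sym (ℚP.*-identityˡ (f n j)))
    steps-u n j (suc e) 1≤j = ℚP.≤-trans (step-u (e ℕ.+ n) j 1≤j) (ℚP.≤-trans
      (*-monoˡ (λᵣ s) (0≤λ 0≤s) (steps-u n j e 1≤j)) (ℚP.≤-reflexive (sym (ℚP.*-assoc (λᵣ s) (λᵣ s ^ e) (f n j)))))

    exchange : ∀ n j d e → 1 ℕ.≤ n → 1 ℕ.≤ j → γ t′ ^ d * f (e ℕ.+ n) j ≤ λᵣ s ^ e * f n (j ℕ.+ d)
    exchange n j d e 1≤n 1≤j = ℚP.≤-trans
      (steps-w (e ℕ.+ n) j d (ℕP.≤-trans 1≤n (ℕP.m≤n+m n e)) 1≤j)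
      (steps-u n (j ℕ.+ d) e (ℕP.≤-trans 1≤j (ℕP.m≤m+n j d)))

    private
      Γ̄≼Γ : Γ̄ ≼ Γ
      Γ̄≼Γ = le (N-C₀ {Γ -K Γ̄}
        ( Integers.0≤-+ 0≤y₀ (subst (+ 0 ℤ.≤_) (sym (ℤP.neg-involutive (proj₁ Γ))) 0≤y₀)
        , ℤP.≤-reflexive (sym (ℤP.+-inverseʳ (proj₂ Γ)))))

    ladder-ratio : ∀ e n j d → 1 ℕ.≤ j →
      λᵣ t′ ^ e * (fromℕ n ^ (j ℕ.+ d) * x n ^ (j ℕ.+ d))
      ≤ fromℕ (2 ℕ.+ n) ^ (j ℕ.+ d) * γ s ^ d * f (e ℕ.+ (j ℕ.+ d) ℕ.* n) j
    ladder-ratio e n j d 1≤j = *-cancel-≤ (fromℤ (+ 2) ^ e * c ^ d)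
      (0<-* (^-0< e (fromℤ-mono-< (ℤ.+<+ {0} {2} (ℕ.s≤s ℕ.z≤n)))) (^-0< d 0<c))
      (subst₂ _≤_ lhs rhs (ℚP.≤-trans
        (ℚP.≤-trans (*-monoʳ (ev t′ (ι c₁)) (0≤ev 0≤t (C₀-ι 0≤c₁)) (ev-lower-^ 0≤t t²≤ Λ C₀-Λ e))
          (ev-lower-* t²≤ (Λ ^K e) (ι c₁) (C₀-^ e C₀-Λ) (C₀-ι 0≤c₁)))
        (ℚP.≤-trans (ev-≼ br (Λ ^K e *K ι c₁) (ι c₂ *K (δ *K Γ) ^K d) (C₀-* (C₀-^ e C₀-Λ) (C₀-ι 0≤c₁))
            (C₀-* (C₀-ι 0≤c₂) (C₀-^ d C₀-δΓ)) (ladder-power Γ̄≼Γ e n j d 1≤j))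
          (ℚP.≤-trans (ev-upper-* 0≤s ≤s² (ι c₂) ((δ *K Γ) ^K d) (C₀-ι 0≤c₂) (C₀-^ d C₀-δΓ))
            (*-monoˡ (ev s (ι c₂)) (0≤ev 0≤s (C₀-ι 0≤c₂)) (ev-upper-^ 0≤s ≤s² (δ *K Γ) C₀-δΓ d))))))
      where
      J = j ℕ.+ d
      T₀ : ℤ
      T₀ = t (e ℕ.+ J ℕ.* n) j
      c₁ c₂ : ℤ
      c₁ = (+ n) ℤ.^ J ℤ.* (+ 2 ℤ.* Δ) ℤ.^ d ℤ.* ladder n ℤ.^ J
      c₂ = (+ (2 ℕ.+ n)) ℤ.^ J ℤ.* (+ 2) ℤ.^ e ℤ.* T₀
      0≤^ : ∀ {i} k → + 0 ℤ.≤ i → + 0 ℤ.≤ i ℤ.^ k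
      0≤^ zero p = ℤ.+≤+ ℕ.z≤n
      0≤^ {i} (suc k) p = Integers.0≤-* p (0≤^ k p)
      0≤c₁ : + 0 ℤ.≤ c₁
      0≤c₁ = Integers.0≤-* (Integers.0≤-* (0≤^ J (ℤ.+≤+ ℕ.z≤n)) (0≤^ d (Integers.0≤-* {+ 2} (ℤ.+≤+ ℕ.z≤n) 0≤Δ)))
        (0≤^ J (ℤP.<⇒≤ (posʳ (good-iterate n g))))
      0≤c₂ : + 0 ℤ.≤ c₂
      0≤c₂ = Integers.0≤-* (Integers.0≤-* (0≤^ J (ℤ.+≤+ ℕ.z≤n)) (0≤^ e (ℤ.+≤+ {0} {2} ℕ.z≤n)))
        (ℤP.<⇒≤ (t-positive (e ℕ.+ J ℕ.* n) j (ℕP.≤-trans 1≤j (ℕP.m≤n+m j _))))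
      i₁ : ∀ a l n c x → a * l * (n * c * x) ≡ a * c * (l * (n * x))
      i₁ = RingSolver.solve-∀ ℚ-ring
      i₂ : ∀ v a y c γ → v * a * y * (c * γ) ≡ a * c * (v * γ * y)
      i₂ = RingSolver.solve-∀ ℚ-ring
      lhs : ev t′ Λ ^ e * ev t′ (ι c₁) ≡ fromℤ (+ 2) ^ e * c ^ d * (λᵣ t′ ^ e * (fromℕ n ^ J * x n ^ J))
      lhs = trans (cong₂ _*_ (trans (cong (_^ e) (sym (2λ t′))) (^-* (fromℤ (+ 2)) (λᵣ t′) e))
          (trans (ev-ι t′ c₁) (trans (fromℤ-* ((+ n) ℤ.^ J ℤ.* (+ 2 ℤ.* Δ) ℤ.^ d) (ladder n ℤ.^ J))
            (cong₂ _*_ (trans (fromℤ-* ((+ n) ℤ.^ J) ((+ 2 ℤ.* Δ) ℤ.^ d)) (cong₂ _*_ (fromℤ-^ (+ n) J) (fromℤ-^ (+ 2 ℤ.* Δ) d)))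
              (fromℤ-^ (ladder n) J)))))
        (i₁ (fromℤ (+ 2) ^ e) (λᵣ t′ ^ e) (fromℕ n ^ J) (c ^ d) (x n ^ J))
      rhs : ev s (ι c₂) * ev s (δ *K Γ) ^ d
          ≡ fromℤ (+ 2) ^ e * c ^ d * (fromℕ (2 ℕ.+ n) ^ J * γ s ^ d * f (e ℕ.+ J ℕ.* n) j)
      rhs = trans (cong₂ _*_
          (trans (ev-ι s c₂) (trans (fromℤ-* ((+ (2 ℕ.+ n)) ℤ.^ J ℤ.* (+ 2) ℤ.^ e) T₀)
            (cong (_* fromℤ T₀) (trans (fromℤ-* ((+ (2 ℕ.+ n)) ℤ.^ J) ((+ 2) ℤ.^ e)) (cong₂ _*_ (fromℤ-^ (+ (2 ℕ.+ n)) J) (fromℤ-^ (+ 2) e))))))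
          (trans (cong (_^ d) (sym (cγ s))) (^-* c (γ s) d)))
        (i₂ (fromℕ (2 ℕ.+ n) ^ J) (fromℤ (+ 2) ^ e) (fromℤ T₀) (c ^ d) (γ s ^ d))

    exchange⁻ : ∀ r n j d e → 1 ℕ.≤ j →
      λᵣ t′ ^ (e ℕ.+ r) * (fromℕ n ^ (j ℕ.+ d) * f (r ℕ.+ (j ℕ.+ d) ℕ.* n) (j ℕ.+ d))
      ≤ λᵣ s ^ r * (fromℕ (2 ℕ.+ n) ^ (j ℕ.+ d) * γ s ^ d * f (e ℕ.+ r ℕ.+ (j ℕ.+ d) ℕ.* n) j)
    exchange⁻ r n j d e 1≤j = ℚP.≤-trans
      (*-monoˡ (λᵣ t′ ^ (e ℕ.+ r)) (^-0≤ (e ℕ.+ r) (0≤λ 0≤t)) (*-monoˡ (fromℕ n ^ J) (^-0≤ J (0≤fromℕ n))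
        (ℚP.≤-trans (steps-u (J ℕ.* n) J r 1≤J) (*-monoˡ (λᵣ s ^ r) (^-0≤ r (0≤λ 0≤s)) (f-ladder n J 1≤J)))))
      (ℚP.≤-trans (ℚP.≤-reflexive (i₁ (λᵣ t′ ^ (e ℕ.+ r)) (fromℕ n ^ J) (λᵣ s ^ r) (x n ^ J)))
        (*-monoˡ (λᵣ s ^ r) (^-0≤ r (0≤λ 0≤s)) (ladder-ratio (e ℕ.+ r) n j d 1≤j)))
      where
      J = j ℕ.+ d
      1≤J : 1 ℕ.≤ J
      1≤J = ℕP.≤-trans 1≤j (ℕP.m≤m+n j d)
      i₁ : ∀ a b l y → a * (b * (l * y)) ≡ l * (a * (b * y))
      i₁ = RingSolver.solve-∀ ℚ-ring

  separated : ∀ n j d e → 1 ℕ.≤ n → 1 ℕ.≤ j → t n (j ℕ.+ d) ℤ.< t (e ℕ.+ n) j →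
    ∃[ ε ] (0ℚ < ε × (∀ {t′ s} → Bracket t′ s → γ t′ ^ d * (1ℚ + ε) ≤ λᵣ s ^ e))
  separated n j d e 1≤n 1≤j p = ε , 0<ε , λ {t′} {s} br → *-cancel-≤ a 0<a (ℚP.≤-trans
      (ℚP.≤-reflexive (trans (i₁ a (γ t′ ^ d) ε) (cong (λ z → γ t′ ^ d * (a + z)) aε)))
      (ℚP.≤-trans (*-monoˡ (γ t′ ^ d) (^-0≤ d (0≤γ (Bracket.0≤t br))) a+1≤b)
        (ℚP.≤-trans (exchange br n j d e 1≤n 1≤j) (ℚP.≤-reflexive (ℚP.*-comm (λᵣ s ^ e) a)))))
    where
    a : ℚ
    a = f n (j ℕ.+ d)
    0<a : 0ℚ < a
    0<a = f-positive n (j ℕ.+ d) (ℕP.≤-trans 1≤n (ℕP.m≤m+n n (j ℕ.+ d)))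
    ε : ℚ
    ε = proj₁ (recip a 0<a)
    0<ε : 0ℚ < ε
    0<ε = proj₁ (proj₂ (recip a 0<a))
    aε : a * ε ≡ 1ℚ
    aε = proj₂ (proj₂ (recip a 0<a))
    i₁ : ∀ a g e → a * (g * (1ℚ + e)) ≡ g * (a + a * e)
    i₁ = RingSolver.solve-∀ ℚ-ring
    a+1≤b : a + 1ℚ ≤ f (e ℕ.+ n) j
    a+1≤b = ℚP.≤-trans (ℚP.≤-reflexive (trans (ℚP.+-comm a 1ℚ) (sym (fromℤ-+ (+ 1) (t n (j ℕ.+ d))))))
      (fromℤ-mono-≤ (ℤP.i<j⇒suc[i]≤j p))

  eventually : ∀ {t′ s} → Bracket t′ s → ∀ η → 0ℚ < η → s ≤ (1ℚ + η) * t′ → ∀ d e Jm →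
    (1ℚ + η) ^ (Jm ℕ.+ Jm) * γ s ^ d < λᵣ t′ ^ e →
    ∃[ M ] (∀ n j → M ℕ.≤ n → 1 ℕ.≤ j → j ℕ.+ d ℕ.≤ Jm → t n (j ℕ.+ d) ℤ.< t (e ℕ.+ n) j)
  eventually {t′} {s} br η 0<η s≤ d e Jm gap = Jm ℕ.* suc M₀ , main
    where
    open Bracket br
    v : ℚ
    v = proj₁ (recip η 0<η)
    0≤η : 0ℚ ≤ η
    0≤η = ℚP.<⇒≤ 0<η
    arch = archimedes (fromℕ 2 * v)
    M₀ : ℕ
    M₀ = proj₁ arch
    2≤ : ∀ n → M₀ ℕ.≤ n → fromℕ (2 ℕ.+ n) ≤ (1ℚ + η) * fromℕ n
    2≤ n p = ℚP.≤-trans (ℚP.≤-reflexive (trans (fromℤ-+ (+ 2) (+ n)) (ℚP.+-comm (fromℕ 2) (fromℕ n)))) (ℚP.≤-trans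
      (ℚP.+-monoʳ-≤ (fromℕ n) (ℚP.≤-trans (ℚP.≤-reflexive (sym (trans (i₂ (fromℕ 2) v η)
          (trans (cong (fromℕ 2 *_) (proj₂ (proj₂ (recip η 0<η)))) (ℚP.*-identityʳ (fromℕ 2))))))
        (*-monoˡ η 0≤η (ℚP.≤-trans (proj₂ arch) (fromℕ-mono p)))))
      (ℚP.≤-reflexive (i₁ (fromℕ n) η)))
      where
      i₁ : ∀ n η → n + η * n ≡ (1ℚ + η) * n
      i₁ = RingSolver.solve-∀ ℚ-ring
      i₂ : ∀ a v η → η * (a * v) ≡ a * (η * v)
      i₂ = RingSolver.solve-∀ ℚ-ring
    λ≤ : λᵣ s ≤ (1ℚ + η) * λᵣ t′
    λ≤ = ℚP.≤-trans (*-monoʳ ½ (ℚP.≤ᵇ⇒≤ {0ℚ} {½} _) (ℚP.≤-trans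
        (ℚP.+-monoʳ-≤ (fromℤ (T u)) (ℚP.≤-trans (ℚP.≤-reflexive (ℚP.*-identityˡ s)) s≤))
        (≤-by (0≤-* 0≤η (fromℤ-mono-≤ (ℤP.<⇒≤ (posˡ g)))) (i₁ (fromℤ (T u)) η t′))))
      (ℚP.≤-reflexive (ℚP.*-assoc (1ℚ + η) (ev t′ Λ) ½))
      where
      i₁ : ∀ τ η t → (1ℚ + η) * (τ + 1ℚ * t) ≡ τ + (1ℚ + η) * t + η * τ
      i₁ = RingSolver.solve-∀ ℚ-ring
    grow : ∀ r J n d → M₀ ℕ.≤ n → r ℕ.≤ Jm → J ℕ.≤ Jm → 0ℚ < fromℕ n →
      λᵣ s ^ r * (fromℕ (2 ℕ.+ n) ^ J * γ s ^ d) ≤ λᵣ t′ ^ r * fromℕ n ^ J * ((1ℚ + η) ^ (Jm ℕ.+ Jm) * γ s ^ d)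
    grow r J n d M≤n r≤ J≤ 0<n = ℚP.≤-trans
      (*-mono-≤ (^-0≤ r (0≤λ 0≤s)) (0≤-* (^-0≤ J (0≤fromℕ (2 ℕ.+ n))) (^-0≤ d (0≤γ 0≤s)))
        (ℚP.≤-trans (^-mono-≤ r (0≤λ 0≤s) λ≤) (ℚP.≤-trans (ℚP.≤-reflexive (^-* (1ℚ + η) (λᵣ t′) r))
          (*-monoʳ (λᵣ t′ ^ r) (^-0≤ r (0≤λ 0≤t)) (raise r r≤))))
        (*-monoʳ (γ s ^ d) (^-0≤ d (0≤γ 0≤s))
          (ℚP.≤-trans (^-mono-≤ J (0≤fromℕ (2 ℕ.+ n)) (2≤ n M≤n)) (ℚP.≤-trans (ℚP.≤-reflexive (^-* (1ℚ + η) (fromℕ n) J))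
            (*-monoʳ (fromℕ n ^ J) (^-0≤ J (0≤fromℕ n)) (raise J J≤))))))
      (ℚP.≤-reflexive (trans (i₁ ((1ℚ + η) ^ Jm) (λᵣ t′ ^ r) (fromℕ n ^ J) (γ s ^ d))
        (cong (λ z → λᵣ t′ ^ r * fromℕ n ^ J * (z * γ s ^ d)) (sym (^-+ (1ℚ + η) Jm Jm)))))
      where
      1≤1+η : 1ℚ ≤ 1ℚ + η
      1≤1+η = ≤-by 0≤η refl
      raise : ∀ k → k ℕ.≤ Jm → (1ℚ + η) ^ k ≤ (1ℚ + η) ^ Jm
      raise k k≤ = subst ((1ℚ + η) ^ k ≤_) (trans (sym (^-+ (1ℚ + η) k (Jm ℕ.∸ k))) (cong ((1ℚ + η) ^_) (ℕP.m+[n∸m]≡n k≤)))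
        (ℚP.≤-trans (ℚP.≤-reflexive (sym (ℚP.*-identityʳ ((1ℚ + η) ^ k))))
          (*-monoˡ ((1ℚ + η) ^ k) (^-0≤ k (ℚP.≤-trans 0≤1 1≤1+η)) (1≤^ (Jm ℕ.∸ k) 1≤1+η)))
      i₁ : ∀ e l n g → e * l * (e * n * g) ≡ l * n * (e * e * g)
      i₁ = RingSolver.solve-∀ ℚ-ring
    key : ∀ r n j → M₀ ℕ.≤ n → 1 ℕ.≤ n → 1 ℕ.≤ j → j ℕ.+ d ℕ.≤ Jm → r ℕ.≤ Jm →
      f (r ℕ.+ (j ℕ.+ d) ℕ.* n) (j ℕ.+ d) < f (e ℕ.+ (r ℕ.+ (j ℕ.+ d) ℕ.* n)) j
    key r n j M≤n 1≤n 1≤j J≤ r≤ = *-cancel-< Z (ℚP.<⇒≤ 0<Z) (ℚP.≤-<-trans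
      (ℚP.≤-trans (ℚP.≤-reflexive (sym (i₁ (λᵣ t′ ^ e) (λᵣ t′ ^ r) (fromℕ n ^ J) A)))
        (ℚP.≤-trans (ℚP.≤-reflexive (cong (_* (fromℕ n ^ J * A)) (sym (^-+ (λᵣ t′) e r)))) (ℚP.≤-trans (exchange⁻ br r n j d e 1≤j)
          (ℚP.≤-reflexive (trans (cong (λ k → λᵣ s ^ r * (fromℕ (2 ℕ.+ n) ^ J * γ s ^ d * f k j)) (ℕP.+-assoc e r (J ℕ.* n)))
            (i₂ (λᵣ s ^ r) (fromℕ (2 ℕ.+ n) ^ J) (γ s ^ d) B))))))
      (ℚP.≤-<-trans (*-monoʳ B (ℚP.<⇒≤ 0<B) (grow r J n d M≤n r≤ J≤ 0<n))
        (ℚP.*-monoˡ-<-pos B {{ℚ.positive 0<B}} (subst (λᵣ t′ ^ r * fromℕ n ^ J * ((1ℚ + η) ^ (Jm ℕ.+ Jm) * γ s ^ d) <_)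
          (i₃ (λᵣ t′ ^ r) (fromℕ n ^ J) (λᵣ t′ ^ e))
          (ℚP.*-monoʳ-<-pos (λᵣ t′ ^ r * fromℕ n ^ J) {{ℚ.positive 0<W}} gap)))))
      where
      J = j ℕ.+ d
      A B Z : ℚ
      A = f (r ℕ.+ J ℕ.* n) J
      B = f (e ℕ.+ (r ℕ.+ J ℕ.* n)) j
      Z = λᵣ t′ ^ e * (λᵣ t′ ^ r * fromℕ n ^ J)
      0<n : 0ℚ < fromℕ n
      0<n = fromℤ-mono-< (ℤ.+<+ 1≤n)
      0<W : 0ℚ < λᵣ t′ ^ r * fromℕ n ^ J
      0<W = 0<-* (^-0< r (0<λ 0≤t)) (^-0< J 0<n)
      0<Z : 0ℚ < Z
      0<Z = 0<-* (^-0< e (0<λ 0≤t)) 0<W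
      0<B : 0ℚ < B
      0<B = f-positive _ j (ℕP.≤-trans 1≤j (ℕP.m≤n+m j (e ℕ.+ (r ℕ.+ J ℕ.* n))))
      i₁ : ∀ a b n A → a * b * (n * A) ≡ a * (b * n) * A
      i₁ = RingSolver.solve-∀ ℚ-ring
      i₂ : ∀ l v g B → l * (v * g * B) ≡ l * (v * g) * B
      i₂ = RingSolver.solve-∀ ℚ-ring
      i₃ : ∀ b n a → b * n * a ≡ a * (b * n)
      i₃ = RingSolver.solve-∀ ℚ-ring
    main : ∀ n j → Jm ℕ.* suc M₀ ℕ.≤ n → 1 ℕ.≤ j → j ℕ.+ d ℕ.≤ Jm → t n (j ℕ.+ d) ℤ.< t (e ℕ.+ n) j
    main n (suc j) M≤n 1≤j J≤ = fromℤ-cancel-< (subst (λ k → f k J < f (e ℕ.+ k) (suc j)) (trans (cong (r ℕ.+_) (ℕP.*-comm J (n ℕD./ J))) (sym (ℕD.m≡m%n+[m/n]*n n J)))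
        (key r (n ℕD./ J) (suc j) (ℕP.≤-trans (ℕP.n≤1+n M₀) q≥) (ℕP.≤-trans (ℕ.s≤s ℕ.z≤n) q≥) 1≤j J≤
          (ℕP.≤-trans (ℕP.<⇒≤ (ℕD.m%n<n n J)) J≤)))
      where
      J = suc j ℕ.+ d
      r = n ℕD.% J
      q≥ : suc M₀ ℕ.≤ n ℕD./ J
      q≥ = ℕP.≤-trans (ℕP.≤-reflexive (sym (ℕD.m*n/n≡m (suc M₀) J)))
        (ℕD./-monoˡ-≤ J (ℕP.≤-trans (ℕP.≤-trans (ℕP.≤-reflexive (ℕP.*-comm (suc M₀) J)) (ℕP.*-monoˡ-≤ (suc M₀) J≤)) M≤n))

-- The thresholds

module Heron (a : ℚ) (1≤a : 1ℚ ℚ.≤ a) where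
  open import Data.Rational using (_+_; _*_; _-_; -_; _≤_; _<_)
  open Rationals
  open Logarithms using (mesh)

  σ ρ : ℕ → ℚ
  σ = √ a
  ρ n = a ⊘ σ n

  private
    0<a : 0ℚ < a
    0<a = ℚP.<-≤-trans 0<1 1≤a
    0<½ : 0ℚ < ½
    0<½ = *<* (ℤ.+<+ (ℕ.s≤s ℕ.z≤n))
    0≤½ : 0ℚ ≤ ½
    0≤½ = ℚP.<⇒≤ 0<½

  0<σ : ∀ n → 0ℚ < σ n
  0<σ zero = 0<a
  0<σ (suc n) = 0<-* (0<-+ (0<σ n) (⊘-0≤ (ℚP.<⇒≤ 0<a) (0<σ n))) 0<½

  ρσ : ∀ n → ρ n * σ n ≡ a
  ρσ n = ⊘-* a (σ n) (0<σ n)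

  0≤ρ : ∀ n → 0ℚ ≤ ρ n
  0≤ρ n = ⊘-0≤ (ℚP.<⇒≤ 0<a) (0<σ n)

  a≤σ² : ∀ n → a ≤ σ n * σ n
  a≤σ² zero = subst (_≤ a * a) (ℚP.*-identityʳ a) (*-monoˡ a (ℚP.<⇒≤ 0<a) 1≤a)
  a≤σ² (suc n) = ≤-by (0≤-sq ((σ n - ρ n) * ½)) (trans (i₁ (σ n) (ρ n))
      (cong (_+ (σ n - ρ n) * ½ * ((σ n - ρ n) * ½)) (ρσ n)))
    where
    i₁ : ∀ s r → (s + r) * ½ * ((s + r) * ½) ≡ r * s + (s - r) * ½ * ((s - r) * ½)
    i₁ = RingSolver.solve-∀ ℚ-ring
    i₂ : ∀ x → - x * - x ≡ x * x
    i₂ = RingSolver.solve-∀ ℚ-ring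
    0≤-sq : ∀ x → 0ℚ ≤ x * x
    0≤-sq x = by-sign (ℚP.≤-total 0ℚ x)
      where
      by-sign : 0ℚ ≤ x ⊎ x ≤ 0ℚ → 0ℚ ≤ x * x
      by-sign (inj₁ p) = 0≤-* {x} {x} p p
      by-sign (inj₂ p) = subst (0ℚ ≤_) (i₂ x) (0≤-* { - x} { - x} (ℚP.neg-antimono-≤ p) (ℚP.neg-antimono-≤ p))

  ρ≤σ : ∀ n → ρ n ≤ σ n
  ρ≤σ n = *-cancel-≤ (σ n) (0<σ n) (ℚP.≤-trans (ℚP.≤-reflexive (trans (ℚP.*-comm (σ n) (ρ n)) (ρσ n))) (a≤σ² n))

  ρ²≤a : ∀ n → ρ n * ρ n ≤ a
  ρ²≤a n = ℚP.≤-trans (*-monoˡ (ρ n) (0≤ρ n) (ρ≤σ n)) (ℚP.≤-reflexive (ρσ n))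

  σ-decreasing : ∀ n → σ (suc n) ≤ σ n
  σ-decreasing n = ≤-by (0≤-* (0≤-diff (ρ≤σ n)) 0≤½) (i₁ (σ n) (ρ n))
    where
    i₁ : ∀ s r → s ≡ (s + r) * ½ + (s - r) * ½
    i₁ = RingSolver.solve-∀ ℚ-ring

  σ≤a : ∀ n → σ n ≤ a
  σ≤a zero = ℚP.≤-refl
  σ≤a (suc n) = ℚP.≤-trans (σ-decreasing n) (σ≤a n)

  1≤ρ : ∀ n → 1ℚ ≤ ρ n
  1≤ρ n = *-cancel-≤ (σ n) (0<σ n) (subst₂ _≤_ (sym (ℚP.*-identityʳ (σ n)))
    (sym (trans (ℚP.*-comm (σ n) (ρ n)) (ρσ n))) (σ≤a n))

  ρ-increasing : ∀ n → ρ n ≤ ρ (suc n)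
  ρ-increasing n = *-cancel-≤ (σ (suc n)) (0<σ (suc n)) (ℚP.≤-trans
    (*-monoʳ (ρ n) (0≤ρ n) (σ-decreasing n))
    (ℚP.≤-reflexive (trans (ℚP.*-comm (σ n) (ρ n)) (trans (ρσ n) (sym (trans (ℚP.*-comm (σ (suc n)) (ρ (suc n))) (ρσ (suc n))))))))

  gap : ∀ n → (1ℚ + fromℕ n) * (σ n - ρ n) ≤ a
  gap zero = ℚP.≤-trans (≤-by (0≤ρ 0) (i₁ a (ρ 0))) ℚP.≤-refl
    where
    i₁ : ∀ a r → a ≡ (1ℚ + 0ℚ) * (a - r) + r
    i₁ = RingSolver.solve-∀ ℚ-ring
  gap (suc n) = ℚP.≤-trans (≤-by
      (0≤-+ (0≤-* (0≤-+ 0≤1 (0≤fromℕ (suc n))) (0≤-diff (ρ-increasing n))) (0≤-* (0≤-* (0≤fromℕ n) 0≤½) (0≤-diff (ρ≤σ n))))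
      (trans (i₁ (fromℕ n) (σ n) (ρ n) (ρ (suc n)))
        (cong (λ m → (1ℚ + m) * (σ (suc n) - ρ (suc n)) + ((1ℚ + m) * (ρ (suc n) - ρ n) + fromℕ n * ½ * (σ n - ρ n))) (sym (fromℕ-suc n)))))
    (gap n)
    where
    i₁ : ∀ n s r r′ → (1ℚ + n) * (s - r)
       ≡ (1ℚ + (1ℚ + n)) * ((s + r) * ½ - r′) + ((1ℚ + (1ℚ + n)) * (r′ - r) + n * ½ * (s - r))
    i₁ = RingSolver.solve-∀ ℚ-ring

  close : ∀ η → 0ℚ < η → ∃[ N ] (∀ n → N ℕ.≤ n → σ n ≤ (1ℚ + η) * ρ n)
  close η 0<η = proj₁ m , λ n N≤n → ≤-by
      (0≤-+ (0≤-diff (ℚP.<⇒≤ (proj₂ (proj₂ m) n N≤n (σ n - ρ n) (small n)))) (0≤-* (ℚP.<⇒≤ 0<η) (0≤-diff (1≤ρ n))))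
      (i₁ η (σ n) (ρ n))
    where
    m = mesh a η (ℚP.<⇒≤ 0<a) 0<η
    small : ∀ n → fromℕ n * (σ n - ρ n) ≤ a
    small n = ℚP.≤-trans (≤-by (0≤-diff (ρ≤σ n)) (i₂ (fromℕ n) (σ n - ρ n))) (gap n)
      where
      i₂ : ∀ n d → (1ℚ + n) * d ≡ n * d + d
      i₂ = RingSolver.solve-∀ ℚ-ring
    i₁ : ∀ η s r → (1ℚ + η) * r ≡ s + (η - (s - r) + η * (r - 1ℚ))
    i₁ = RingSolver.solve-∀ ℚ-ring

module Thresholds where
  open import Data.Rational using (_+_; _*_; _-_; -_; _≤_; _<_)
  open Rationals
  open Logarithms

  three : ℚ
  three = fromℕ 3

  Gap : (ℕ → ℚ) → (ℕ → ℚ) → Set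
  Gap x y = ∃[ ε ] (0ℚ < ε × ∃[ N ] (∀ n → N ℕ.≤ n → x n + ε ≤ y n))

  PowerGap : (ℕ → ℚ) → ℕ → (ℕ → ℚ) → ℕ → Set
  PowerGap α e β f = ∃[ ε ] (0ℚ < ε × ∃[ N ] (∀ n → N ℕ.≤ n → α n ^ e * (1ℚ + ε) ≤ β n ^ f))

  0<½ : 0ℚ < ½
  0<½ = *<* (ℤ.+<+ (ℕ.s≤s ℕ.z≤n))

  halves : ∀ x → x * ½ + x * ½ ≡ x
  halves = RingSolver.solve-∀ ℚ-ring

  module _ (α β : ℕ → ℚ) (1≤α : ∀ n → 1ℚ ≤ α n) (1≤β : ∀ n → 1ℚ ≤ β n)
           (α≤ : ∀ n → α n ≤ three) (β≤ : ∀ n → β n ≤ three) (e f : ℕ) where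

    private
      LnGap : Set
      LnGap = Gap (λ n → fromℕ e * lnSum (α n) n) (λ n → fromℕ f * lnSum (β n) n)

      steps-small : (x : ℕ → ℚ) (1≤x : ∀ n → 1ℚ ≤ x n) → (∀ n → x n ≤ three) → ∀ k n → 1 ℕ.≤ n →
        fromℕ n * (fromℕ k * step (x n) n) ≤ fromℕ k * three
      steps-small x 1≤x x≤ k n 1≤n = ℚP.≤-trans
        (ℚP.≤-reflexive (trans (i₁ (fromℕ n) (fromℕ k) (step (x n) n)) (cong (fromℕ k *_) (LnSum.n*h (x n) (1≤x n) n 1≤n))))
        (*-monoˡ (fromℕ k) (0≤fromℕ k) (ℚP.≤-trans (≤-by 0≤1 (i₂ (x n))) (x≤ n)))
        where
        i₁ : ∀ n k h → n * (k * h) ≡ k * (n * h)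
        i₁ = RingSolver.solve-∀ ℚ-ring
        i₂ : ∀ x → x ≡ x - 1ℚ + 1ℚ
        i₂ = RingSolver.solve-∀ ℚ-ring

      0≤3k : ∀ k → 0ℚ ≤ fromℕ k * three
      0≤3k k = 0≤-* (0≤fromℕ k) (0≤fromℕ 3)

    gap⇒power : LnGap → PowerGap α e β f
    gap⇒power (ε , 0<ε , N , p) = η , 0<η , N ℕ.⊔ proj₁ m , λ n N≤n →
      let N₁≤n = ℕP.≤-trans (ℕP.m≤m⊔n N (proj₁ m)) N≤n
          N₂≤n = ℕP.≤-trans (ℕP.m≤n⊔m N (proj₁ m)) N≤n
          1≤n = ℕP.≤-trans (proj₁ (proj₂ m)) N₂≤n
      in Compare.sum⇒power (α n) (β n) (1≤α n) (1≤β n) n 1≤n e f η 0<η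
           (subst (λ z → fromℕ e * lnSum (α n) n + z ≤ fromℕ f * lnSum (β n) n) (sym (halves ε)) (p n N₁≤n))
           (proj₂ (proj₂ m) n N₂≤n (fromℕ f * step (β n) n) (steps-small β 1≤β β≤ f n 1≤n))
      where
      η : ℚ
      η = ε * ½
      0<η : 0ℚ < η
      0<η = 0<-* 0<ε 0<½
      m = mesh (fromℕ f * three) η (0≤3k f) 0<η

    power⇒gap : PowerGap α e β f → LnGap
    power⇒gap (ε , 0<ε , N , p) = z * ½ , 0<-* 0<z 0<½ , N ℕ.⊔ proj₁ m , λ n N≤n →
      let N₁≤n = ℕP.≤-trans (ℕP.m≤m⊔n N (proj₁ m)) N≤n
          N₂≤n = ℕP.≤-trans (ℕP.m≤n⊔m N (proj₁ m)) N≤n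
          1≤n = ℕP.≤-trans (proj₁ (proj₂ m)) N₂≤n
          0<αe = ^-0< e (ℚP.<-≤-trans 0<1 (1≤α n))
      in ≤-by (0≤-+ (0≤-diff (Compare.power⇒sum (α n) (β n) (1≤α n) (1≤β n) n 1≤n e f η 0<η
             (ℚP.<-≤-trans (ℚP.*-monoʳ-<-pos (α n ^ e) {{ℚ.positive 0<αe}} (ℚP.+-monoʳ-< 1ℚ η<ε)) (p n N₁≤n))))
           (0≤-diff (ℚP.<⇒≤ (proj₂ (proj₂ m) n N₂≤n (fromℕ e * step (α n) n) (steps-small α 1≤α α≤ e n 1≤n)))))
         (i₁ (fromℕ e * lnSum (α n) n) z (fromℕ f * lnSum (β n) n) (fromℕ e * step (α n) n))
      where
      η z : ℚ
      η = ε * ½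
      z = η ⊘ (1ℚ + η)
      0<η : 0ℚ < η
      0<η = 0<-* 0<ε 0<½
      η<ε : η < ε
      η<ε = <-by 0<η (sym (halves ε))
      0<1+η : 0ℚ < 1ℚ + η
      0<1+η = 0<-+ 0<1 (ℚP.<⇒≤ 0<η)
      0<z : 0ℚ < z
      0<z = *-cancel-< (1ℚ + η) (ℚP.<⇒≤ 0<1+η) (subst₂ _<_ (sym (ℚP.*-zeroʳ (1ℚ + η)))
        (sym (trans (ℚP.*-comm (1ℚ + η) z) (⊘-* η (1ℚ + η) 0<1+η))) 0<η)
      m = mesh (fromℕ e * three) (z * ½) (0≤3k e) (0<-* 0<z 0<½)
      i₁ : ∀ a z b h → b ≡ a + z * ½ + (b + h - (a + z) + (z * ½ - h))
      i₁ = RingSolver.solve-∀ ℚ-ring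

  sixth : ℚ
  sixth = + 1 ℚ./ 6

  0<sixth : 0ℚ < sixth
  0<sixth = *<* (ℤ.+<+ (ℕ.s≤s ℕ.z≤n))

  lnSum-lower : ∀ x → (+ 3 ℚ./ 2) ≤ x → x ≤ three → ∀ n → 1 ℕ.≤ n → sixth ≤ lnSum x n
  lnSum-lower x p q n 1≤n = *-cancel-≤ three (0<fromℕ 2) (ℚP.≤-trans
    (≤-by (0≤-diff p) (i₁ x))
    (ℚP.≤-trans (L.≤ln) (ℚP.≤-trans (*-monoˡ (lnSum x n) L.0≤ln q) (ℚP.≤-reflexive (ℚP.*-comm (lnSum x n) three)))))
    where
    module L = LnSum x (ℚP.≤-trans (ℚP.≤ᵇ⇒≤ {1ℚ} {+ 3 ℚ./ 2} _) p) n 1≤n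
    i₁ : ∀ x → x - 1ℚ ≡ three * sixth + (x - (+ 3 ℚ./ 2))
    i₁ = RingSolver.solve-∀ ℚ-ring

  module Quotient (X Y : ℕ → ℚ) (sixth≤Y : ∀ n → 1 ℕ.≤ n → sixth ≤ Y n) (Y≤ : ∀ n → 1 ℕ.≤ n → Y n ≤ three)
                  (k : ℚ) (p q : ℕ) (1≤q : 1 ℕ.≤ q) (kq : k * fromℕ q ≡ - fromℕ p) where
    κ : ℝ
    κ n = - (X n ⊘ Y n)

    private
      0<q : 0ℚ < fromℕ q
      0<q = fromℤ-mono-< (ℤ.+<+ 1≤q)
      0<Y : ∀ n → 1 ℕ.≤ n → 0ℚ < Y n
      0<Y n 1≤n = ℚP.<-≤-trans 0<sixth (sixth≤Y n 1≤n)
      cleared : ∀ n → 1 ℕ.≤ n → κ n * (fromℕ q * Y n) ≡ - (fromℕ q * X n)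
      cleared n 1≤n = trans (i₁ (X n ⊘ Y n) (fromℕ q) (Y n)) (cong (λ z → - (fromℕ q * z)) (⊘-* (X n) (Y n) (0<Y n 1≤n)))
        where
        i₁ : ∀ x q y → - x * (q * y) ≡ - (q * (x * y))
        i₁ = RingSolver.solve-∀ ℚ-ring
      k-cleared : ∀ n → k * (fromℕ q * Y n) ≡ - (fromℕ p * Y n)
      k-cleared n = trans (sym (ℚP.*-assoc k (fromℕ q) (Y n))) (trans (cong (_* Y n) kq) (i₁ (fromℕ p) (Y n)))
        where
        i₁ : ∀ p y → - p * y ≡ - (p * y)
        i₁ = RingSolver.solve-∀ ℚ-ring
      0≤qY : ∀ n → 1 ℕ.≤ n → 0ℚ ≤ fromℕ q * Y n
      0≤qY n 1≤n = 0≤-* (0≤fromℕ q) (ℚP.<⇒≤ (0<Y n 1≤n))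

    private
      module Contradict (A B : ℕ → ℚ) (separation : Gap A B)
                        (weak : ∀ ε₁ → 0ℚ < ε₁ → ∃[ M ] (∀ n → M ℕ.≤ n → 1 ℕ.≤ n → B n ≤ A n + ε₁ * (fromℕ q * Y n))) where
        ε = proj₁ separation
        0<ε = proj₁ (proj₂ separation)
        N = proj₁ (proj₂ (proj₂ separation))
        gap = proj₂ (proj₂ (proj₂ separation))
        v : ℚ
        v = proj₁ (recip (fromℕ q * three) (0<-* 0<q (0<fromℕ 2)))
        0<v : 0ℚ < v
        0<v = proj₁ (proj₂ (recip (fromℕ q * three) (0<-* 0<q (0<fromℕ 2))))
        qv : fromℕ q * three * v ≡ 1ℚ
        qv = proj₂ (proj₂ (recip (fromℕ q * three) (0<-* 0<q (0<fromℕ 2))))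
        ε₁ : ℚ
        ε₁ = ε * ½ * v
        0<ε½ : 0ℚ < ε * ½
        0<ε½ = 0<-* 0<ε 0<½
        M = proj₁ (weak ε₁ (0<-* 0<ε½ 0<v))
        n : ℕ
        n = suc (N ℕ.⊔ M)
        1≤n : 1 ℕ.≤ n
        1≤n = ℕ.s≤s ℕ.z≤n
        N≤n : N ℕ.≤ n
        N≤n = ℕP.≤-trans (ℕP.m≤m⊔n N M) (ℕP.n≤1+n _)
        M≤n : M ℕ.≤ n
        M≤n = ℕP.≤-trans (ℕP.m≤n⊔m N M) (ℕP.n≤1+n _)
        small : ε₁ * (fromℕ q * Y n) ≤ ε * ½
        small = ℚP.≤-trans (*-monoˡ ε₁ (0≤-* (ℚP.<⇒≤ 0<ε½) (ℚP.<⇒≤ 0<v)) (*-monoˡ (fromℕ q) (0≤fromℕ q) (Y≤ n 1≤n)))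
          (ℚP.≤-reflexive (trans (i₁ (ε * ½) v (fromℕ q * three)) (trans (cong (ε * ½ *_) qv) (ℚP.*-identityʳ (ε * ½)))))
          where
          i₁ : ∀ e v q → e * v * q ≡ e * (q * v)
          i₁ = RingSolver.solve-∀ ℚ-ring
        absurd : ⊥
        absurd = <⇒≱ 0<ε½ (ℚP.≤-trans (≤-by
            (0≤-+ (0≤-diff (gap n N≤n)) (0≤-+ (0≤-diff (proj₂ (weak ε₁ (0<-* 0<ε½ 0<v)) n M≤n 1≤n)) (0≤-diff small)))
            (i₁ (A n) (B n) ε (ε₁ * (fromℕ q * Y n)))) ℚP.≤-refl)
          where
          i₁ : ∀ A B e w → 0ℚ ≡ e * ½ + (B - (A + e) + (A + w - B + (e * ½ - w)))
          i₁ = RingSolver.solve-∀ ℚ-ring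

    pY qX : ℕ → ℚ
    pY n = fromℕ p * Y n
    qX n = fromℕ q * X n

    κ≤k⇒ : κ ≤ʳ fromℚ k → ¬ Gap qX pY
    κ≤k⇒ h g = Contradict.absurd qX pY g λ ε₁ 0<ε₁ → proj₁ (h ε₁ 0<ε₁) , λ n M≤n 1≤n →
      ≤-by (0≤-diff (*-monoʳ (fromℕ q * Y n) (0≤qY n 1≤n) (proj₂ (h ε₁ 0<ε₁) n M≤n)))
        (trans (i₁ (qX n) (pY n) (ε₁ * (fromℕ q * Y n)))
          (cong₂ (λ x y → pY n + (x - y))
            (trans (cong (_+ ε₁ * (fromℕ q * Y n)) (sym (k-cleared n))) (sym (ℚP.*-distribʳ-+ (fromℕ q * Y n) k ε₁)))
            (sym (cleared n 1≤n))))
      where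
      i₁ : ∀ X P w → X + w ≡ P + (- P + w - - X)
      i₁ = RingSolver.solve-∀ ℚ-ring

    k≤κ⇒ : fromℚ k ≤ʳ κ → ¬ Gap pY qX
    k≤κ⇒ h g = Contradict.absurd pY qX g λ ε₁ 0<ε₁ → proj₁ (h ε₁ 0<ε₁) , λ n M≤n 1≤n →
      ≤-by (0≤-diff (*-monoʳ (fromℕ q * Y n) (0≤qY n 1≤n) (proj₂ (h ε₁ 0<ε₁) n M≤n)))
        (trans (i₁ (pY n) (qX n) (ε₁ * (fromℕ q * Y n)))
          (cong₂ (λ x y → qX n + (x - y))
            (trans (cong (_+ ε₁ * (fromℕ q * Y n)) (sym (cleared n 1≤n))) (sym (ℚP.*-distribʳ-+ (fromℕ q * Y n) (κ n) ε₁)))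
            (sym (k-cleared n))))
      where
      i₁ : ∀ X P w → X + w ≡ P + (- P + w - - X)
      i₁ = RingSolver.solve-∀ ℚ-ring

    private
      0<εqs : ∀ {ε} → 0ℚ < ε → 0ℚ < ε * (fromℕ q * sixth)
      0<εqs 0<ε = 0<-* 0<ε (0<-* 0<q 0<sixth)
      εqs≤ : ∀ {ε} → 0ℚ < ε → ∀ n → 1 ℕ.≤ n → ε * (fromℕ q * sixth) ≤ ε * (fromℕ q * Y n)
      εqs≤ {ε} 0<ε n 1≤n = *-monoˡ ε (ℚP.<⇒≤ 0<ε) (*-monoˡ (fromℕ q) (0≤fromℕ q) (sixth≤Y n 1≤n))

    k<κ⇒ : fromℚ k <ʳ κ → Gap qX pY
    k<κ⇒ (ε , 0<ε , N , h) = ε * (fromℕ q * sixth) , 0<εqs 0<ε , suc N , λ n N<n →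
      let 1≤n = ℕP.≤-trans (ℕ.s≤s ℕ.z≤n) N<n in
      ≤-by (0≤-+ (0≤-diff (εqs≤ 0<ε n 1≤n)) (0≤-diff (*-monoʳ (fromℕ q * Y n) (0≤qY n 1≤n) (h n (ℕP.≤-trans (ℕP.n≤1+n N) N<n)))))
        (trans (i₁ (qX n) (pY n) (ε * (fromℕ q * sixth)) (ε * (fromℕ q * Y n)))
          (cong₂ (λ x y → qX n + ε * (fromℕ q * sixth) + (ε * (fromℕ q * Y n) - ε * (fromℕ q * sixth) + (x - y)))
            (sym (cleared n 1≤n))
            (trans (cong (_+ ε * (fromℕ q * Y n)) (sym (k-cleared n))) (sym (ℚP.*-distribʳ-+ (fromℕ q * Y n) k ε)))))
      where
      i₁ : ∀ X P s w → P ≡ X + s + (w - s + (- X - (- P + w)))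
      i₁ = RingSolver.solve-∀ ℚ-ring

    κ<k⇒ : κ <ʳ fromℚ k → Gap pY qX
    κ<k⇒ (ε , 0<ε , N , h) = ε * (fromℕ q * sixth) , 0<εqs 0<ε , suc N , λ n N<n →
      let 1≤n = ℕP.≤-trans (ℕ.s≤s ℕ.z≤n) N<n in
      ≤-by (0≤-+ (0≤-diff (εqs≤ 0<ε n 1≤n)) (0≤-diff (*-monoʳ (fromℕ q * Y n) (0≤qY n 1≤n) (h n (ℕP.≤-trans (ℕP.n≤1+n N) N<n)))))
        (trans (i₁ (pY n) (qX n) (ε * (fromℕ q * sixth)) (ε * (fromℕ q * Y n)))
          (cong₂ (λ x y → pY n + ε * (fromℕ q * sixth) + (ε * (fromℕ q * Y n) - ε * (fromℕ q * sixth) + (x - y)))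
            (sym (k-cleared n))
            (trans (cong (_+ ε * (fromℕ q * Y n)) (sym (cleared n 1≤n))) (sym (ℚP.*-distribʳ-+ (fromℕ q * Y n) (κ n) ε)))))
      where
      i₁ : ∀ X P s w → P ≡ X + s + (w - s + (- X - (- P + w)))
      i₁ = RingSolver.solve-∀ ℚ-ring

  small-power : ∀ ε → 0ℚ < ε → ∀ n → ∃[ η ] (0ℚ < η × (1ℚ + η) ^ n < 1ℚ + ε)
  small-power ε 0<ε zero = 1ℚ , 0<1 , <-by 0<ε refl
  small-power ε 0<ε (suc n) = η , 0<η , ℚP.≤-<-trans
      (*-mono-≤ (0≤-+ 0≤1 (ℚP.<⇒≤ 0<η)) (^-0≤ n (0≤-+ 0≤1 (ℚP.<⇒≤ 0<η))) (ℚP.+-monoʳ-≤ 1ℚ (ℚP.p⊓q≤q η₀ (ε₁ * ½)))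
        (ℚP.≤-trans (^-mono-≤ n (0≤-+ 0≤1 (ℚP.<⇒≤ 0<η)) (ℚP.+-monoʳ-≤ 1ℚ (ℚP.p⊓q≤p η₀ (ε₁ * ½)))) (ℚP.<⇒≤ (proj₂ (proj₂ rest)))))
      below
    where
    ε₁ : ℚ
    ε₁ = 1ℚ ℚ.⊓ (ε * ½)
    0<ε₁ : 0ℚ < ε₁
    0<ε₁ = by (ℚP.⊓-sel 1ℚ (ε * ½))
      where
      by : ε₁ ≡ 1ℚ ⊎ ε₁ ≡ ε * ½ → 0ℚ < ε₁
      by (inj₁ p) = subst (0ℚ <_) (sym p) 0<1
      by (inj₂ p) = subst (0ℚ <_) (sym p) (0<-* 0<ε 0<½)
    rest = small-power (ε₁ * ½) (0<-* 0<ε₁ 0<½) n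
    η₀ η : ℚ
    η₀ = proj₁ rest
    η = η₀ ℚ.⊓ (ε₁ * ½)
    0<η : 0ℚ < η
    0<η = by (ℚP.⊓-sel η₀ (ε₁ * ½))
      where
      by : η ≡ η₀ ⊎ η ≡ ε₁ * ½ → 0ℚ < η
      by (inj₁ p) = subst (0ℚ <_) (sym p) (proj₁ (proj₂ rest))
      by (inj₂ p) = subst (0ℚ <_) (sym p) (0<-* 0<ε₁ 0<½)
    below : (1ℚ + ε₁ * ½) * (1ℚ + ε₁ * ½) < 1ℚ + ε
    below = <-by (0<-+ (0<-* (0<-* 0<ε₁ 0<½) 0<½) (0≤-+ (0≤-* (0≤-* (0≤-* (ℚP.<⇒≤ 0<ε₁) (ℚP.<⇒≤ 0<½)) (ℚP.<⇒≤ 0<½)) (0≤-diff (ℚP.p⊓q≤p 1ℚ (ε * ½))))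
        (0≤-+ (0≤-diff (ℚP.p⊓q≤q 1ℚ (ε * ½))) (0≤-+ (0≤-diff (ℚP.p⊓q≤q 1ℚ (ε * ½))) (0≤-* (ℚP.<⇒≤ 0<ε₁) (ℚP.<⇒≤ 0<½))))))
      (i₁ ε ε₁)
      where
      i₁ : ∀ e f → 1ℚ + e ≡ (1ℚ + f * ½) * (1ℚ + f * ½) + (f * ½ * ½ + (f * ½ * ½ * (1ℚ - f) + (e * ½ - f + (e * ½ - f + f * ½))))
      i₁ = RingSolver.solve-∀ ℚ-ring

module Rates (T : Vec² → ℤ) (isTrace : IsTrace T) where
  open import Data.Rational using (_+_; _*_; _-_; -_; _≤_; _<_)
  open Rationals
  open Thresholds
  open IsTrace isTrace
  open TraceFunction T isTrace

  private
    cancel : ∀ z {x y} → 0ℚ < z → z * x ≡ z * y → x ≡ y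
    cancel z 0<z p = ℚP.≤-antisym (*-cancel-≤ z 0<z (ℚP.≤-reflexive p)) (*-cancel-≤ z 0<z (ℚP.≤-reflexive (sym p)))

    16ths 10ths quarter third : ℚ
    16ths   = + 1 ℚ./ 16
    10ths   = + 1 ℚ./ 10
    quarter = + 1 ℚ./ 4
    third   = + 1 ℚ./ 3

    0≤16ths : 0ℚ ≤ 16ths
    0≤16ths = ℚP.≤ᵇ⇒≤ {0ℚ} {16ths} _
    0≤10ths : 0ℚ ≤ 10ths
    0≤10ths = ℚP.≤ᵇ⇒≤ {0ℚ} {10ths} _
    0≤quarter : 0ℚ ≤ quarter
    0≤quarter = ℚP.≤ᵇ⇒≤ {0ℚ} {quarter} _
    0≤third : 0ℚ ≤ third
    0≤third = ℚP.≤ᵇ⇒≤ {0ℚ} {third} _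
    0≤½ : 0ℚ ≤ ½
    0≤½ = ℚP.<⇒≤ 0<½

    predecessor : ∀ x → x ≡ x - 1ℚ + 1ℚ
    predecessor = RingSolver.solve-∀ ℚ-ring

  T-2-1 : T (+ 2 , + 1) ≡ + 15
  T-2-1 = trans (i₁ (T (+ 2 , + 1)) (T (+ 0 , -[1+ 0 ])))
    (trans (cong (ℤ._- T (+ 0 , -[1+ 0 ])) (farey (+ 1 , + 0) (+ 1 , + 1) refl))
      (cong₂ ℤ._-_ (cong₂ ℤ._*_ T-e₁ T-e₁₂) (trans (even (+ 0 , + 1)) T-e₂)))
    where
    i₁ : ∀ x y → x ≡ x ℤ.+ y ℤ.- y
    i₁ = ℤR.solve-∀

  module Diagonal where
    good : Good (+ 1 , + 1) (+ 1 , + 0)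
    good = good-swap (good-add good-units)

    natural : ∀ n j → ∃[ x ] ∃[ y ] (n · (+ 1 , + 1) ⊞ j · (+ 1 , + 0) ≡ (+ x , + y) × n ℕ.+ j ℕ.≤ x ℕ.+ y)
    natural n j = n ℕ.+ j , n , cong₂ _,_ (i₁ (+ n) (+ j)) (i₂ (+ n) (+ j)) , ℕP.m≤m+n (n ℕ.+ j) n
      where
      i₁ : ∀ n j → n ℤ.* + 1 ℤ.+ j ℤ.* + 1 ≡ n ℤ.+ j
      i₁ = ℤR.solve-∀
      i₂ : ∀ n j → n ℤ.* + 1 ℤ.+ j ℤ.* + 0 ≡ n
      i₂ = ℤR.solve-∀

    12≡y₀ : + 12 ≡ + 2 ℤ.* T (+ 2 , + 1) ℤ.- T (+ 1 , + 1) ℤ.* T (+ 1 , + 0)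
    12≡y₀ = sym (cong₂ ℤ._-_ (cong (+ 2 ℤ.*_) T-2-1) (cong₂ ℤ._*_ T-e₁₂ T-e₁))

    open Growth T isTrace good natural (subst (+ 0 ℤ.≤_) 12≡y₀ (ℤ.+≤+ ℕ.z≤n)) public
    open Evaluation (T (+ 1 , + 1)) (2≤T good) public using (Bracket)
    open Quadratic (T (+ 1 , + 1)) (2≤T good) using (Δ)

    Δ≡32 : Δ ≡ + 32
    Δ≡32 = cong (λ z → z ℤ.* z ℤ.- + 4) T-e₁₂

    γ≡ : ∀ s → γ s ≡ (fromℕ 24 + fromℕ 3 * s) * 16ths
    γ≡ s = cancel (fromℕ 64) (0<fromℕ 63) (trans (cong (_* γ s) (cong fromℤ (sym (cong (+ 2 ℤ.*_) Δ≡32))))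
      (trans (cγ s) (trans (cong₂ (λ x y → fromℤ x + fromℤ y * s) a≡ b≡) (i₁ s))))
      where
      i₀ : ∀ y x D → + 0 ℤ.* y ℤ.+ + 1 ℤ.* x ℤ.* D ≡ x ℤ.* D
      i₀ = ℤR.solve-∀
      i₂ : ∀ x y → + 0 ℤ.* x ℤ.+ + 1 ℤ.* y ≡ y
      i₂ = ℤR.solve-∀
      a≡ : + 0 ℤ.* (+ 2 ℤ.* T (+ 2 , + 1) ℤ.- T (+ 1 , + 1) ℤ.* T (+ 1 , + 0)) ℤ.+ + 1 ℤ.* T (+ 1 , + 0) ℤ.* Δ ≡ + 96
      a≡ = trans (i₀ (+ 2 ℤ.* T (+ 2 , + 1) ℤ.- T (+ 1 , + 1) ℤ.* T (+ 1 , + 0)) (T (+ 1 , + 0)) Δ) (cong₂ ℤ._*_ T-e₁ Δ≡32)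
      b≡ : + 0 ℤ.* T (+ 1 , + 0) ℤ.+ + 1 ℤ.* (+ 2 ℤ.* T (+ 2 , + 1) ℤ.- T (+ 1 , + 1) ℤ.* T (+ 1 , + 0)) ≡ + 12
      b≡ = trans (i₂ (T (+ 1 , + 0)) (+ 2 ℤ.* T (+ 2 , + 1) ℤ.- T (+ 1 , + 1) ℤ.* T (+ 1 , + 0))) (sym 12≡y₀)
      i₁ : ∀ s → fromℕ 96 + fromℕ 12 * s ≡ fromℕ 64 * ((fromℕ 24 + fromℕ 3 * s) * 16ths)
      i₁ = RingSolver.solve-∀ ℚ-ring

    λ≡ : ∀ s → λᵣ s ≡ (fromℕ 6 + 1ℚ * s) * ½
    λ≡ s = cong (λ z → (fromℤ z + 1ℚ * s) * ½) T-e₁₂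

    open Heron (fromℕ 2) (fromℕ-mono {1} {2} (ℕ.s≤s ℕ.z≤n))

    1≤σ : ∀ n → 1ℚ ≤ σ n
    1≤σ n = ℚP.≤-trans (1≤ρ n) (ρ≤σ n)

    s t′ : ℕ → ℚ
    s n  = fromℕ 4 * σ n
    t′ n = fromℕ 4 * ρ n

    bracket : ∀ n → Bracket (t′ n) (s n)
    bracket n = record
      { 0≤t = 0≤-* (0≤fromℕ 4) (0≤ρ n)
      ; t²≤ = ℚP.≤-trans (ℚP.≤-reflexive (i₁ (ρ n))) (ℚP.≤-trans (*-monoˡ (fromℕ 16) (0≤fromℕ 16) (ρ²≤a n)) (ℚP.≤-reflexive (cong fromℤ (sym Δ≡32))))
      ; 0≤s = 0≤-* (0≤fromℕ 4) (ℚP.<⇒≤ (0<σ n))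
      ; ≤s² = ℚP.≤-trans (ℚP.≤-reflexive (cong fromℤ Δ≡32)) (ℚP.≤-trans (*-monoˡ (fromℕ 16) (0≤fromℕ 16) (a≤σ² n)) (ℚP.≤-reflexive (sym (i₁ (σ n)))))
      }
      where
      i₁ : ∀ x → fromℕ 4 * x * (fromℕ 4 * x) ≡ fromℕ 16 * (x * x)
      i₁ = RingSolver.solve-∀ ℚ-ring

    s≤ : ∀ η n → σ n ≤ (1ℚ + η) * ρ n → s n ≤ (1ℚ + η) * t′ n
    s≤ η n p = ℚP.≤-trans (*-monoˡ (fromℕ 4) (0≤fromℕ 4) p) (ℚP.≤-reflexive (i₁ η (ρ n)))
      where
      i₁ : ∀ η r → fromℕ 4 * ((1ℚ + η) * r) ≡ (1ℚ + η) * (fromℕ 4 * r)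
      i₁ = RingSolver.solve-∀ ℚ-ring

    α β : ℕ → ℚ
    α = real 3 ⊗ (real 2 ⊕ √2) ⊘ʳ real 4
    β = real 2 ⊗ (real 2 ⊕ √2) ⊘ʳ real 3

    α≡ : ∀ n → α n ≡ fromℕ 3 * (fromℕ 2 + σ n) * quarter
    α≡ n = cancel (fromℕ 4) (0<fromℕ 3) (trans (ℚP.*-comm (fromℕ 4) (α n))
      (trans (⊘-* (fromℕ 3 * (fromℕ 2 + σ n)) (fromℕ 4) (0<fromℕ 3)) (i₁ (fromℕ 3 * (fromℕ 2 + σ n)))))
      where
      i₁ : ∀ x → x ≡ fromℕ 4 * (x * quarter)
      i₁ = RingSolver.solve-∀ ℚ-ring

    β≡ : ∀ n → β n ≡ fromℕ 2 * (fromℕ 2 + σ n) * third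
    β≡ n = cancel (fromℕ 3) (0<fromℕ 2) (trans (ℚP.*-comm (fromℕ 3) (β n))
      (trans (⊘-* (fromℕ 2 * (fromℕ 2 + σ n)) (fromℕ 3) (0<fromℕ 2)) (i₁ (fromℕ 2 * (fromℕ 2 + σ n)))))
      where
      i₁ : ∀ x → x ≡ fromℕ 3 * (x * third)
      i₁ = RingSolver.solve-∀ ℚ-ring

    α≡γ : ∀ n → α n ≡ γ (s n)
    α≡γ n = trans (α≡ n) (trans (i₁ (σ n)) (sym (γ≡ (s n))))
      where
      i₁ : ∀ x → fromℕ 3 * (fromℕ 2 + x) * quarter ≡ (fromℕ 24 + fromℕ 3 * (fromℕ 4 * x)) * 16ths
      i₁ = RingSolver.solve-∀ ℚ-ring

    1≤α : ∀ n → 1ℚ ≤ α n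
    1≤α n = subst (1ℚ ≤_) (sym (α≡ n)) (≤-by (0≤-+ (0≤-* (0≤-* (0≤fromℕ 3) (0≤-diff (1≤σ n))) 0≤quarter) (ℚP.≤ᵇ⇒≤ {0ℚ} {+ 5 ℚ./ 4} _)) (i₁ (σ n)))
      where
      i₁ : ∀ x → fromℕ 3 * (fromℕ 2 + x) * quarter ≡ 1ℚ + (fromℕ 3 * (x - 1ℚ) * quarter + (+ 5 ℚ./ 4))
      i₁ = RingSolver.solve-∀ ℚ-ring

    3/2≤β : ∀ n → + 3 ℚ./ 2 ≤ β n
    3/2≤β n = subst (+ 3 ℚ./ 2 ≤_) (sym (β≡ n)) (≤-by (0≤-+ (0≤-* (0≤-* (0≤fromℕ 2) (0≤-diff (1≤σ n))) 0≤third) 0≤½) (i₁ (σ n)))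
      where
      i₁ : ∀ x → fromℕ 2 * (fromℕ 2 + x) * third ≡ (+ 3 ℚ./ 2) + (fromℕ 2 * (x - 1ℚ) * third + ½)
      i₁ = RingSolver.solve-∀ ℚ-ring

    1≤β : ∀ n → 1ℚ ≤ β n
    1≤β n = ℚP.≤-trans (ℚP.≤ᵇ⇒≤ {1ℚ} {+ 3 ℚ./ 2} _) (3/2≤β n)

    α≤3 : ∀ n → α n ≤ three
    α≤3 n = subst (_≤ three) (sym (α≡ n)) (≤-by (0≤-* (0≤-* (0≤fromℕ 3) (0≤-diff (σ≤a n))) 0≤quarter) (i₁ (σ n)))
      where
      i₁ : ∀ x → three ≡ fromℕ 3 * (fromℕ 2 + x) * quarter + fromℕ 3 * (fromℕ 2 - x) * quarter
      i₁ = RingSolver.solve-∀ ℚ-ring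

    β≤3 : ∀ n → β n ≤ three
    β≤3 n = subst (_≤ three) (sym (β≡ n)) (≤-by (0≤-+ (0≤-* (0≤-* (0≤fromℕ 2) (0≤-diff (σ≤a n))) 0≤third) 0≤third) (i₁ (σ n)))
      where
      i₁ : ∀ x → three ≡ fromℕ 2 * (fromℕ 2 + x) * third + (fromℕ 2 * (fromℕ 2 - x) * third + third)
      i₁ = RingSolver.solve-∀ ℚ-ring

    private
      0<α : ∀ n → 0ℚ < α n
      0<α n = ℚP.<-≤-trans 0<1 (1≤α n)

      product : ∀ n → α n * β n ≡ (fromℕ 4 + fromℕ 4 * σ n + σ n * σ n) * ½
      product n = trans (cong₂ _*_ (α≡ n) (β≡ n)) (i₁ (σ n))
        where
        i₁ : ∀ x → fromℕ 3 * (fromℕ 2 + x) * quarter * (fromℕ 2 * (fromℕ 2 + x) * third) ≡ (fromℕ 4 + fromℕ 4 * x + x * x) * ½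
        i₁ = RingSolver.solve-∀ ℚ-ring

      λ≤αβ : ∀ n → λᵣ (s n) ≤ α n * β n
      λ≤αβ n = subst₂ _≤_ (sym (λ≡ (s n))) (sym (product n)) (≤-by (0≤-* (0≤-diff (a≤σ² n)) 0≤½) (i₁ (σ n)))
        where
        i₁ : ∀ x → (fromℕ 4 + fromℕ 4 * x + x * x) * ½ ≡ (fromℕ 6 + 1ℚ * (fromℕ 4 * x)) * ½ + (x * x - fromℕ 2) * ½
        i₁ = RingSolver.solve-∀ ℚ-ring

      αβ≤λ : ∀ η n → 0ℚ ≤ η → σ n ≤ (1ℚ + η) * ρ n → α n * β n ≤ (1ℚ + η) * λᵣ (t′ n)
      αβ≤λ η n 0≤η p = subst₂ _≤_ (sym (product n)) (cong ((1ℚ + η) *_) (sym (λ≡ (t′ n))))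
        (≤-by (0≤-+ (0≤-* (0≤fromℕ 2) (0≤-diff p)) (0≤-+ (0≤-* (0≤-* (0≤-diff p) (ℚP.<⇒≤ (0<σ n))) 0≤½) (0≤-* (0≤fromℕ 2) 0≤η)))
          (trans (i₁ η (σ n) (ρ n)) (cong (λ z → (fromℕ 4 + fromℕ 4 * σ n + σ n * σ n) * ½ + (fromℕ 2 * ((1ℚ + η) * ρ n - σ n) + (((1ℚ + η) * ρ n - σ n) * σ n * ½ + fromℕ 2 * η)) + (1ℚ + η) * (fromℕ 2 - z) * ½) (ρσ n)) ∙
            i₂ ((fromℕ 4 + fromℕ 4 * σ n + σ n * σ n) * ½ + (fromℕ 2 * ((1ℚ + η) * ρ n - σ n) + (((1ℚ + η) * ρ n - σ n) * σ n * ½ + fromℕ 2 * η))) η))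
        where
        _∙_ : ∀ {x y z : ℚ} → x ≡ y → y ≡ z → x ≡ z
        _∙_ = trans
        i₁ : ∀ η x r → (1ℚ + η) * ((fromℕ 6 + 1ℚ * (fromℕ 4 * r)) * ½)
           ≡ (fromℕ 4 + fromℕ 4 * x + x * x) * ½ + (fromℕ 2 * ((1ℚ + η) * r - x) + (((1ℚ + η) * r - x) * x * ½ + fromℕ 2 * η))
             + (1ℚ + η) * (fromℕ 2 - r * x) * ½
        i₁ = RingSolver.solve-∀ ℚ-ring
        i₂ : ∀ y η → y + (1ℚ + η) * (fromℕ 2 - fromℕ 2) * ½ ≡ y
        i₂ = RingSolver.solve-∀ ℚ-ring

      γ-close : ∀ η n → 0ℚ ≤ η → σ n ≤ (1ℚ + η) * ρ n → α n ≤ (1ℚ + η) * γ (t′ n)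
      γ-close η n 0≤η p = subst₂ _≤_ (sym (α≡ n)) (cong ((1ℚ + η) *_) (sym (γ≡ (t′ n))))
        (≤-by (0≤-+ (0≤-* (0≤-* (0≤fromℕ 3) (0≤-diff p)) 0≤quarter) (0≤-* (0≤-* (0≤fromℕ 24) 0≤16ths) 0≤η)) (i₁ η (σ n) (ρ n)))
        where
        i₁ : ∀ η x r → (1ℚ + η) * ((fromℕ 24 + fromℕ 3 * (fromℕ 4 * r)) * 16ths)
           ≡ fromℕ 3 * (fromℕ 2 + x) * quarter + (fromℕ 3 * ((1ℚ + η) * r - x) * quarter + fromℕ 24 * 16ths * η)
        i₁ = RingSolver.solve-∀ ℚ-ring

    separated⇒powers : ∀ p q ε → 0ℚ < ε → (∀ {t s} → Bracket t s → γ t ^ (p ℕ.+ q) * (1ℚ + ε) ≤ λᵣ s ^ p) →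
      PowerGap α q β p
    separated⇒powers p q ε 0<ε sep = η , 0<η , proj₁ near , λ n N≤n → bound n (proj₂ near n N≤n)
      where
      K = p ℕ.+ q
      small = small-power ε 0<ε (suc K)
      η : ℚ
      η = proj₁ small
      0<η = proj₁ (proj₂ small)
      0≤η : 0ℚ ≤ η
      0≤η = ℚP.<⇒≤ 0<η
      0<1+η : 0ℚ < 1ℚ + η
      0<1+η = 0<-+ 0<1 0≤η
      near = close η 0<η
      bound : ∀ n → σ n ≤ (1ℚ + η) * ρ n → α n ^ q * (1ℚ + η) ≤ β n ^ p
      bound n c = *-cancel-≤ (α n ^ p * (1ℚ + η) ^ K) (0<-* (^-0< p (0<α n)) (^-0< K 0<1+η)) (ℚP.≤-trans
        (ℚP.≤-reflexive (trans (i₁ (α n ^ p) ((1ℚ + η) ^ K) (α n ^ q) (1ℚ + η)) (cong (_* (1ℚ + η) ^ suc K) (sym (^-+ (α n) p q)))))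
        (ℚP.≤-trans (*-monoˡ (α n ^ K) (^-0≤ K (ℚP.<⇒≤ (0<α n))) (ℚP.<⇒≤ (proj₂ (proj₂ small))))
          (ℚP.≤-trans (*-monoʳ (1ℚ + ε) (0≤-+ 0≤1 (ℚP.<⇒≤ 0<ε))
              (ℚP.≤-trans (^-mono-≤ K (ℚP.<⇒≤ (0<α n)) (γ-close η n 0≤η c)) (ℚP.≤-reflexive (^-* (1ℚ + η) (γ (t′ n)) K))))
            (ℚP.≤-trans (ℚP.≤-reflexive (ℚP.*-assoc ((1ℚ + η) ^ K) (γ (t′ n) ^ K) (1ℚ + ε)))
              (ℚP.≤-trans (*-monoˡ ((1ℚ + η) ^ K) (^-0≤ K (ℚP.<⇒≤ 0<1+η)) (ℚP.≤-trans (sep (bracket n))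
                  (^-mono-≤ p (0≤λ (Bracket.0≤s (bracket n))) (λ≤αβ n))))
                (ℚP.≤-reflexive (trans (cong ((1ℚ + η) ^ K *_) (^-* (α n) (β n) p)) (i₂ ((1ℚ + η) ^ K) (α n ^ p) (β n ^ p)))))))))
        where
        i₁ : ∀ a e q x → a * e * (q * x) ≡ a * q * (x * e)
        i₁ = RingSolver.solve-∀ ℚ-ring
        i₂ : ∀ e a b → e * (a * b) ≡ a * e * b
        i₂ = RingSolver.solve-∀ ℚ-ring

    powers⇒eventually : ∀ p q → PowerGap α q β p → ∀ Jm →
      ∃[ M ] (∀ n j → M ℕ.≤ n → 1 ℕ.≤ j → j ℕ.+ (p ℕ.+ q) ℕ.≤ Jm → t n (j ℕ.+ (p ℕ.+ q)) ℤ.< t (p ℕ.+ n) j)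
    powers⇒eventually p q (ε , 0<ε , N , gap) Jm = eventually (bracket n) η 0<η (s≤ η n σ≤ρ) K p Jm
      (*-cancel-< ((1ℚ + η) ^ p) (^-0≤ p (ℚP.<⇒≤ 0<1+η)) (ℚP.<-≤-trans
        (subst₂ _<_ lhs refl (ℚP.*-monoʳ-<-pos (α n ^ K) {{ℚ.positive (^-0< K (0<α n))}} (proj₂ (proj₂ small))))
        (ℚP.≤-trans (ℚP.≤-reflexive (trans (cong (_* (1ℚ + ε)) (^-+ (α n) p q)) (ℚP.*-assoc (α n ^ p) (α n ^ q) (1ℚ + ε))))
          (ℚP.≤-trans (*-monoˡ (α n ^ p) (^-0≤ p (ℚP.<⇒≤ (0<α n))) (gap n (ℕP.m≤m⊔n N (proj₁ near))))
            (ℚP.≤-trans (ℚP.≤-reflexive (sym (^-* (α n) (β n) p)))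
              (ℚP.≤-trans (^-mono-≤ p (0≤-* (ℚP.<⇒≤ (0<α n)) (ℚP.≤-trans 0≤1 (1≤β n))) (αβ≤λ η n 0≤η σ≤ρ))
                (ℚP.≤-reflexive (^-* (1ℚ + η) (λᵣ (t′ n)) p))))))))
      where
      K = p ℕ.+ q
      small = small-power ε 0<ε (p ℕ.+ (Jm ℕ.+ Jm))
      η : ℚ
      η = proj₁ small
      0<η = proj₁ (proj₂ small)
      0≤η : 0ℚ ≤ η
      0≤η = ℚP.<⇒≤ 0<η
      0<1+η : 0ℚ < 1ℚ + η
      0<1+η = 0<-+ 0<1 0≤η
      near = close η 0<η
      n : ℕ
      n = N ℕ.⊔ proj₁ near
      σ≤ρ : σ n ≤ (1ℚ + η) * ρ n
      σ≤ρ = proj₂ near n (ℕP.m≤n⊔m N (proj₁ near))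
      i₁ : ∀ a e f → a * (e * f) ≡ e * (f * a)
      i₁ = RingSolver.solve-∀ ℚ-ring
      lhs : α n ^ K * (1ℚ + η) ^ (p ℕ.+ (Jm ℕ.+ Jm)) ≡ (1ℚ + η) ^ p * ((1ℚ + η) ^ (Jm ℕ.+ Jm) * γ (s n) ^ K)
      lhs = trans (cong (α n ^ K *_) (^-+ (1ℚ + η) p (Jm ℕ.+ Jm)))
        (trans (i₁ (α n ^ K) ((1ℚ + η) ^ p) ((1ℚ + η) ^ (Jm ℕ.+ Jm))) (cong (λ z → (1ℚ + η) ^ p * ((1ℚ + η) ^ (Jm ℕ.+ Jm) * z ^ K)) (α≡γ n)))

    1≤γ : ∀ n → 1ℚ ≤ γ (t′ n)
    1≤γ n = subst (1ℚ ≤_) (sym (γ≡ (t′ n))) (≤-by (0≤-+ (0≤-* (0≤-* (0≤fromℕ 3) (Bracket.0≤t (bracket n))) 0≤16ths) 0≤½) (i₁ (t′ n)))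
      where
      i₁ : ∀ s → (fromℕ 24 + fromℕ 3 * s) * 16ths ≡ 1ℚ + (fromℕ 3 * s * 16ths + ½)
      i₁ = RingSolver.solve-∀ ℚ-ring

    grow : ∀ n j → 1 ℕ.≤ n → 1 ℕ.≤ j → t n j ℤ.≤ t n (suc j)
    grow n j 1≤n 1≤j = fromℤ-cancel-≤ (ℚP.≤-trans (ℚP.≤-reflexive (sym (ℚP.*-identityˡ (f n j))))
      (ℚP.≤-trans (*-monoʳ (f n j) (ℚP.<⇒≤ (f-positive n j (ℕP.≤-trans 1≤n (ℕP.m≤m+n n j)))) (1≤γ 0)) (step-w (bracket 0) n j 1≤n 1≤j)))

    κ₁≤0 : ∀ n → 1 ℕ.≤ n → κ₁ n ≤ 0ℚ
    κ₁≤0 n 1≤n = ℚP.neg-antimono-≤ {0ℚ} (⊘-0≤ (Logarithms.LnSum.0≤ln (α n) (1≤α n) n 1≤n)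
      (ℚP.<-≤-trans 0<sixth (lnSum-lower (β n) (3/2≤β n) (β≤3 n) n 1≤n)))

    negative : ∀ k → fromℚ k <ʳ κ₁ → k < 0ℚ
    negative k (ε , 0<ε , N , h) = ℚP.<-≤-trans (<-by 0<ε refl) (ℚP.≤-trans (h (suc N) (ℕP.n≤1+n N)) (κ₁≤0 (suc N) (ℕ.s≤s ℕ.z≤n)))

    module _ (k : ℚ) (p q : ℕ) (1≤q : 1 ℕ.≤ q) (kq : k * fromℕ q ≡ - fromℕ p) where
      open Logarithms using (lnSum; module LnSum)
      private
        module Qt = Quotient (λ n → lnSum (α n) n) (λ n → lnSum (β n) n)
          (λ n 1≤n → lnSum-lower (β n) (3/2≤β n) (β≤3 n) n 1≤n)
          (λ n 1≤n → ℚP.≤-trans (LnSum.ln≤ (β n) (1≤β n) n 1≤n) (ℚP.≤-trans (≤-by 0≤1 (predecessor (β n))) (β≤3 n)))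
          k p q 1≤q kq

      increase : κ₁ ≤ʳ fromℚ k → ∀ n j → 1 ℕ.≤ n → 1 ℕ.≤ j → t (p ℕ.+ n) j ℤ.≤ t n (j ℕ.+ (p ℕ.+ q))
      increase h n j 1≤n 1≤j = ℤP.≮⇒≥ λ lt → let (ε , 0<ε , sep) = separated n j (p ℕ.+ q) p 1≤n 1≤j lt in
        Qt.κ≤k⇒ h (power⇒gap α β 1≤α 1≤β α≤3 β≤3 q p (separated⇒powers p q ε 0<ε sep))

      eventually-decrease : fromℚ k <ʳ κ₁ → ∀ Jm →
        ∃[ M ] (∀ n j → M ℕ.≤ n → 1 ℕ.≤ j → j ℕ.+ (p ℕ.+ q) ℕ.≤ Jm → t n (j ℕ.+ (p ℕ.+ q)) ℤ.< t (p ℕ.+ n) j)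
      eventually-decrease h = powers⇒eventually p q (gap⇒power α β 1≤α 1≤β α≤3 β≤3 q p (Qt.k<κ⇒ h))

  module Axis where
    good : Good (+ 1 , + 0) (+ 0 , + 1)
    good = good-units

    natural : ∀ n j → ∃[ x ] ∃[ y ] (n · (+ 1 , + 0) ⊞ j · (+ 0 , + 1) ≡ (+ x , + y) × n ℕ.+ j ℕ.≤ x ℕ.+ y)
    natural n j = n , j , cong₂ _,_ (i₁ (+ n) (+ j)) (i₂ (+ n) (+ j)) , ℕP.≤-refl
      where
      i₁ : ∀ n j → n ℤ.* + 1 ℤ.+ j ℤ.* + 0 ≡ n
      i₁ = ℤR.solve-∀
      i₂ : ∀ n j → n ℤ.* + 0 ℤ.+ j ℤ.* + 1 ≡ j
      i₂ = ℤR.solve-∀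

    3≡y₀ : + 3 ≡ + 2 ℤ.* T (+ 1 , + 1) ℤ.- T (+ 1 , + 0) ℤ.* T (+ 0 , + 1)
    3≡y₀ = sym (cong₂ ℤ._-_ (cong (+ 2 ℤ.*_) T-e₁₂) (cong₂ ℤ._*_ T-e₁ T-e₂))

    open Growth T isTrace good natural (subst (+ 0 ℤ.≤_) 3≡y₀ (ℤ.+≤+ ℕ.z≤n)) public
    open Evaluation (T (+ 1 , + 0)) (2≤T good) public using (Bracket)
    open Quadratic (T (+ 1 , + 0)) (2≤T good) using (Δ)

    Δ≡5 : Δ ≡ + 5
    Δ≡5 = cong (λ z → z ℤ.* z ℤ.- + 4) T-e₁

    γ≡ : ∀ s → γ s ≡ (fromℕ 15 + fromℕ 3 * s) * 10ths
    γ≡ s = cancel (fromℕ 10) (0<fromℕ 9) (trans (cong (_* γ s) (cong fromℤ (sym (cong (+ 2 ℤ.*_) Δ≡5))))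
      (trans (cγ s) (trans (cong₂ (λ x y → fromℤ x + fromℤ y * s) a≡ b≡) (i₁ s))))
      where
      i₀ : ∀ y x D → + 0 ℤ.* y ℤ.+ + 1 ℤ.* x ℤ.* D ≡ x ℤ.* D
      i₀ = ℤR.solve-∀
      i₂ : ∀ x y → + 0 ℤ.* x ℤ.+ + 1 ℤ.* y ≡ y
      i₂ = ℤR.solve-∀
      y₀ : ℤ
      y₀ = + 2 ℤ.* T (+ 1 , + 1) ℤ.- T (+ 1 , + 0) ℤ.* T (+ 0 , + 1)
      a≡ : + 0 ℤ.* y₀ ℤ.+ + 1 ℤ.* T (+ 0 , + 1) ℤ.* Δ ≡ + 15
      a≡ = trans (i₀ y₀ (T (+ 0 , + 1)) Δ) (cong₂ ℤ._*_ T-e₂ Δ≡5)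
      b≡ : + 0 ℤ.* T (+ 0 , + 1) ℤ.+ + 1 ℤ.* y₀ ≡ + 3
      b≡ = trans (i₂ (T (+ 0 , + 1)) y₀) (sym 3≡y₀)
      i₁ : ∀ s → fromℕ 15 + fromℕ 3 * s ≡ fromℕ 10 * ((fromℕ 15 + fromℕ 3 * s) * 10ths)
      i₁ = RingSolver.solve-∀ ℚ-ring

    λ≡ : ∀ s → λᵣ s ≡ (fromℕ 3 + 1ℚ * s) * ½
    λ≡ s = cong (λ z → (fromℤ z + 1ℚ * s) * ½) T-e₁

    open Heron (fromℕ 5) (fromℕ-mono {1} {5} (ℕ.s≤s ℕ.z≤n))

    bracket : ∀ n → Bracket (ρ n) (σ n)
    bracket n = record
      { 0≤t = 0≤ρ n
      ; t²≤ = ℚP.≤-trans (ρ²≤a n) (ℚP.≤-reflexive (cong fromℤ (sym Δ≡5)))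
      ; 0≤s = ℚP.<⇒≤ (0<σ n)
      ; ≤s² = ℚP.≤-trans (ℚP.≤-reflexive (cong fromℤ Δ≡5)) (a≤σ² n)
      }

    φ α : ℕ → ℚ
    φ = (real 1 ⊕ √5) ⊘ʳ real 2
    α = real 3 ⊗ (real 1 ⊕ √5) ⊘ʳ (real 2 ⊗ √5)

    φ≡ : ∀ n → φ n ≡ (1ℚ + σ n) * ½
    φ≡ n = cancel (fromℕ 2) (0<fromℕ 1) (trans (ℚP.*-comm (fromℕ 2) (φ n))
      (trans (⊘-* (1ℚ + σ n) (fromℕ 2) (0<fromℕ 1)) (i₁ (1ℚ + σ n))))
      where
      i₁ : ∀ x → x ≡ fromℕ 2 * (x * ½)
      i₁ = RingSolver.solve-∀ ℚ-ring

    α≡ : ∀ n → α n ≡ (fromℕ 15 + fromℕ 3 * ρ n) * 10ths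
    α≡ n = cancel (fromℕ 2 * σ n) 0<2σ (trans (ℚP.*-comm (fromℕ 2 * σ n) (α n))
      (trans (⊘-* (fromℕ 3 * (1ℚ + σ n)) (fromℕ 2 * σ n) 0<2σ)
        (trans (trans (i₁ (σ n)) (cong (λ z → fromℕ 3 * σ n + fromℕ 6 * 10ths * z) (sym (ρσ n)))) (i₂ (σ n) (ρ n)))))
      where
      0<2σ : 0ℚ < fromℕ 2 * σ n
      0<2σ = 0<-* (0<fromℕ 1) (0<σ n)
      i₁ : ∀ x → fromℕ 3 * (1ℚ + x) ≡ fromℕ 3 * x + fromℕ 6 * 10ths * fromℕ 5
      i₁ = RingSolver.solve-∀ ℚ-ring
      i₂ : ∀ x r → fromℕ 3 * x + fromℕ 6 * 10ths * (r * x) ≡ fromℕ 2 * x * ((fromℕ 15 + fromℕ 3 * r) * 10ths)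
      i₂ = RingSolver.solve-∀ ℚ-ring

    α≡γ : ∀ n → α n ≡ γ (ρ n)
    α≡γ n = trans (α≡ n) (sym (γ≡ (ρ n)))

    ρ≤3 : ∀ n → ρ n ≤ fromℕ 3
    ρ≤3 n = ^-cancel-sq (0≤fromℕ 3) (ℚP.≤-trans (ρ²≤a n) (ℚP.≤-trans (fromℕ-mono {5} {9} (ℕP.m≤m+n 5 4)) (ℚP.≤-reflexive (fromℤ-* (+ 3) (+ 3)))))

    3/2≤α : ∀ n → + 3 ℚ./ 2 ≤ α n
    3/2≤α n = subst (+ 3 ℚ./ 2 ≤_) (sym (α≡ n)) (≤-by (0≤-* (0≤-* (0≤fromℕ 3) (0≤ρ n)) 0≤10ths) (i₁ (ρ n)))
      where
      i₁ : ∀ x → (fromℕ 15 + fromℕ 3 * x) * 10ths ≡ (+ 3 ℚ./ 2) + fromℕ 3 * x * 10ths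
      i₁ = RingSolver.solve-∀ ℚ-ring

    1≤α : ∀ n → 1ℚ ≤ α n
    1≤α n = ℚP.≤-trans (ℚP.≤ᵇ⇒≤ {1ℚ} {+ 3 ℚ./ 2} _) (3/2≤α n)

    α≤3 : ∀ n → α n ≤ three
    α≤3 n = subst (_≤ three) (sym (α≡ n)) (≤-by (0≤-+ (0≤-* (0≤-* (0≤fromℕ 3) (0≤-diff (ρ≤3 n))) 0≤10ths) (0≤-* (0≤fromℕ 6) 0≤10ths)) (i₁ (ρ n)))
      where
      i₁ : ∀ x → three ≡ (fromℕ 15 + fromℕ 3 * x) * 10ths + (fromℕ 3 * (fromℕ 3 - x) * 10ths + fromℕ 6 * 10ths)
      i₁ = RingSolver.solve-∀ ℚ-ring

    1≤φ : ∀ n → 1ℚ ≤ φ n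
    1≤φ n = subst (1ℚ ≤_) (sym (φ≡ n)) (≤-by (0≤-* (0≤-diff (ℚP.≤-trans (1≤ρ n) (ρ≤σ n))) 0≤½) (i₁ (σ n)))
      where
      i₁ : ∀ x → (1ℚ + x) * ½ ≡ 1ℚ + (x - 1ℚ) * ½
      i₁ = RingSolver.solve-∀ ℚ-ring

    φ≤3 : ∀ n → φ n ≤ three
    φ≤3 n = subst (_≤ three) (sym (φ≡ n)) (≤-by (0≤-* (0≤-diff (σ≤a n)) 0≤½) (i₁ (σ n)))
      where
      i₁ : ∀ x → three ≡ (1ℚ + x) * ½ + (fromℕ 5 - x) * ½
      i₁ = RingSolver.solve-∀ ℚ-ring

    private
      square : ∀ n → φ n * φ n ≡ (1ℚ + fromℕ 2 * σ n + σ n * σ n) * quarter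
      square n = trans (cong₂ _*_ (φ≡ n) (φ≡ n)) (i₁ (σ n))
        where
        i₁ : ∀ x → (1ℚ + x) * ½ * ((1ℚ + x) * ½) ≡ (1ℚ + fromℕ 2 * x + x * x) * quarter
        i₁ = RingSolver.solve-∀ ℚ-ring

      λ≤φ² : ∀ n → λᵣ (σ n) ≤ φ n * φ n
      λ≤φ² n = subst₂ _≤_ (sym (λ≡ (σ n))) (sym (square n)) (≤-by (0≤-* (0≤-diff (a≤σ² n)) 0≤quarter) (i₁ (σ n)))
        where
        i₁ : ∀ x → (1ℚ + fromℕ 2 * x + x * x) * quarter ≡ (fromℕ 3 + 1ℚ * x) * ½ + (x * x - fromℕ 5) * quarter
        i₁ = RingSolver.solve-∀ ℚ-ring

      φ²≤λ : ∀ η n → 0ℚ ≤ η → σ n ≤ (1ℚ + η) * ρ n → φ n * φ n ≤ (1ℚ + η) * λᵣ (ρ n)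
      φ²≤λ η n 0≤η p = subst₂ _≤_ (sym (square n)) (cong ((1ℚ + η) *_) (sym (λ≡ (ρ n))))
        (≤-by (0≤-+ (0≤-* (0≤-diff p) 0≤½) (0≤-+ (0≤-* (0≤-* (0≤-diff p) (ℚP.<⇒≤ (0<σ n))) 0≤quarter) (0≤-* 0≤quarter 0≤η)))
          (trans (i₁ η (σ n) (ρ n)) (trans (cong (λ z → rest + (1ℚ + η) * (fromℕ 5 - z) * quarter) (ρσ n)) (i₂ rest η))))
        where
        rest : ℚ
        rest = (1ℚ + fromℕ 2 * σ n + σ n * σ n) * quarter + (((1ℚ + η) * ρ n - σ n) * ½ + (((1ℚ + η) * ρ n - σ n) * σ n * quarter + quarter * η))
        i₁ : ∀ η x r → (1ℚ + η) * ((fromℕ 3 + 1ℚ * r) * ½)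
           ≡ (1ℚ + fromℕ 2 * x + x * x) * quarter + (((1ℚ + η) * r - x) * ½ + (((1ℚ + η) * r - x) * x * quarter + quarter * η))
             + (1ℚ + η) * (fromℕ 5 - r * x) * quarter
        i₁ = RingSolver.solve-∀ ℚ-ring
        i₂ : ∀ y η → y + (1ℚ + η) * (fromℕ 5 - fromℕ 5) * quarter ≡ y
        i₂ = RingSolver.solve-∀ ℚ-ring

      γ-close : ∀ η n → 0ℚ ≤ η → σ n ≤ (1ℚ + η) * ρ n → γ (σ n) ≤ (1ℚ + η) * α n
      γ-close η n 0≤η p = subst₂ _≤_ (sym (γ≡ (σ n))) (cong ((1ℚ + η) *_) (sym (α≡ n)))
        (≤-by (0≤-+ (0≤-* (0≤-* (0≤fromℕ 3) (0≤-diff p)) 0≤10ths) (0≤-* (0≤-* (0≤fromℕ 15) 0≤10ths) 0≤η)) (i₁ η (σ n) (ρ n)))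
        where
        i₁ : ∀ η x r → (1ℚ + η) * ((fromℕ 15 + fromℕ 3 * r) * 10ths)
           ≡ (fromℕ 15 + fromℕ 3 * x) * 10ths + (fromℕ 3 * ((1ℚ + η) * r - x) * 10ths + fromℕ 15 * 10ths * η)
        i₁ = RingSolver.solve-∀ ℚ-ring

      φ-power : ∀ n q → (φ n * φ n) ^ q ≡ φ n ^ (q ℕ.+ q)
      φ-power n q = trans (^-* (φ n) (φ n) q) (sym (^-+ (φ n) q q))

    separated⇒powers : ∀ p q ε → 0ℚ < ε → (∀ {t s} → Bracket t s → γ t ^ p * (1ℚ + ε) ≤ λᵣ s ^ q) →
      PowerGap α p φ (q ℕ.+ q)
    separated⇒powers p q ε 0<ε sep = ε , 0<ε , 0 , λ n _ → ℚP.≤-trans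
      (ℚP.≤-reflexive (cong (λ z → z ^ p * (1ℚ + ε)) (α≡γ n)))
      (ℚP.≤-trans (sep (bracket n)) (ℚP.≤-trans (^-mono-≤ q (0≤λ (Bracket.0≤s (bracket n))) (λ≤φ² n)) (ℚP.≤-reflexive (φ-power n q))))

    powers⇒eventually : ∀ p q → PowerGap α p φ (q ℕ.+ q) → ∀ Jm →
      ∃[ M ] (∀ n j → M ℕ.≤ n → 1 ℕ.≤ j → j ℕ.+ p ℕ.≤ Jm → t n (j ℕ.+ p) ℤ.< t (q ℕ.+ n) j)
    powers⇒eventually p q (ε , 0<ε , N , gap) Jm = eventually (bracket n) η 0<η σ≤ρ p q Jm
      (*-cancel-< ((1ℚ + η) ^ q) (^-0≤ q (ℚP.<⇒≤ 0<1+η)) (ℚP.≤-<-trans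
        (*-monoˡ ((1ℚ + η) ^ q) (^-0≤ q (ℚP.<⇒≤ 0<1+η)) (*-monoˡ ((1ℚ + η) ^ (Jm ℕ.+ Jm)) (^-0≤ (Jm ℕ.+ Jm) (ℚP.<⇒≤ 0<1+η))
          (ℚP.≤-trans (^-mono-≤ p (0≤γ (Bracket.0≤s (bracket n))) (γ-close η n 0≤η σ≤ρ)) (ℚP.≤-reflexive (^-* (1ℚ + η) (α n) p)))))
        (ℚP.<-≤-trans
          (subst₂ _<_ lhs refl (ℚP.*-monoʳ-<-pos (α n ^ p) {{ℚ.positive (^-0< p 0<α)}} (proj₂ (proj₂ small))))
          (ℚP.≤-trans (gap n (ℕP.m≤m⊔n N (proj₁ near))) (ℚP.≤-trans (ℚP.≤-reflexive (sym (φ-power n q)))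
            (ℚP.≤-trans (^-mono-≤ q (0≤-* (ℚP.≤-trans 0≤1 (1≤φ n)) (ℚP.≤-trans 0≤1 (1≤φ n))) (φ²≤λ η n 0≤η σ≤ρ))
              (ℚP.≤-reflexive (^-* (1ℚ + η) (λᵣ (ρ n)) q))))))))
      where
      small = small-power ε 0<ε (q ℕ.+ ((Jm ℕ.+ Jm) ℕ.+ p))
      η : ℚ
      η = proj₁ small
      0<η = proj₁ (proj₂ small)
      0≤η : 0ℚ ≤ η
      0≤η = ℚP.<⇒≤ 0<η
      0<1+η : 0ℚ < 1ℚ + η
      0<1+η = 0<-+ 0<1 0≤η
      near = close η 0<η
      n : ℕ
      n = N ℕ.⊔ proj₁ near
      σ≤ρ : σ n ≤ (1ℚ + η) * ρ n
      σ≤ρ = proj₂ near n (ℕP.m≤n⊔m N (proj₁ near))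
      0<α : 0ℚ < α n
      0<α = ℚP.<-≤-trans 0<1 (1≤α n)
      i₁ : ∀ a e f g → a * (e * (f * g)) ≡ e * (f * (g * a))
      i₁ = RingSolver.solve-∀ ℚ-ring
      lhs : α n ^ p * (1ℚ + η) ^ (q ℕ.+ ((Jm ℕ.+ Jm) ℕ.+ p)) ≡ (1ℚ + η) ^ q * ((1ℚ + η) ^ (Jm ℕ.+ Jm) * ((1ℚ + η) ^ p * α n ^ p))
      lhs = trans (cong (α n ^ p *_) (trans (^-+ (1ℚ + η) q ((Jm ℕ.+ Jm) ℕ.+ p)) (cong ((1ℚ + η) ^ q *_) (^-+ (1ℚ + η) (Jm ℕ.+ Jm) p))))
        (i₁ (α n ^ p) ((1ℚ + η) ^ q) ((1ℚ + η) ^ (Jm ℕ.+ Jm)) ((1ℚ + η) ^ p))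

    1≤γ : ∀ n → 1ℚ ≤ γ (ρ n)
    1≤γ n = subst (1ℚ ≤_) (α≡γ n) (1≤α n)

    grow : ∀ n j → 1 ℕ.≤ n → 1 ℕ.≤ j → t n j ℤ.≤ t n (suc j)
    grow n j 1≤n 1≤j = fromℤ-cancel-≤ (ℚP.≤-trans (ℚP.≤-reflexive (sym (ℚP.*-identityˡ (f n j))))
      (ℚP.≤-trans (*-monoʳ (f n j) (ℚP.<⇒≤ (f-positive n j (ℕP.≤-trans 1≤n (ℕP.m≤m+n n j)))) (1≤γ 0)) (step-w (bracket 0) n j 1≤n 1≤j)))

    κ₂≤0 : ∀ n → 1 ℕ.≤ n → κ₂ n ≤ 0ℚ
    κ₂≤0 n 1≤n = ℚP.neg-antimono-≤ {0ℚ} (⊘-0≤ (0≤-* (0≤fromℕ 2) (Logarithms.LnSum.0≤ln (φ n) (1≤φ n) n 1≤n))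
      (ℚP.<-≤-trans 0<sixth (lnSum-lower (α n) (3/2≤α n) (α≤3 n) n 1≤n)))

    nonpositive : ∀ k → fromℚ k ≤ʳ κ₂ → k ≤ 0ℚ
    nonpositive k h = ℚP.≮⇒≥ λ 0<k → let (N , below) = h (k * ½) (0<-* 0<k 0<½) in
      <⇒≱ (0<-* 0<k 0<½) (≤-by (0≤-+ (0≤-diff (below (suc N) (ℕP.n≤1+n N))) (0≤-diff (κ₂≤0 (suc N) (ℕ.s≤s ℕ.z≤n))))
        (i₁ k (κ₂ (suc N))))
      where
      i₁ : ∀ k x → 0ℚ ≡ k * ½ + (x + k * ½ - k + (0ℚ - x))
      i₁ = RingSolver.solve-∀ ℚ-ring

    module _ (k : ℚ) (p q : ℕ) (1≤q : 1 ℕ.≤ q) (kq : k * fromℕ q ≡ - fromℕ p) where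
      open Logarithms using (lnSum; module LnSum)
      private
        module Qt = Quotient (λ n → fromℕ 2 * lnSum (φ n) n) (λ n → lnSum (α n) n)
          (λ n 1≤n → lnSum-lower (α n) (3/2≤α n) (α≤3 n) n 1≤n)
          (λ n 1≤n → ℚP.≤-trans (LnSum.ln≤ (α n) (1≤α n) n 1≤n) (ℚP.≤-trans (≤-by 0≤1 (predecessor (α n))) (α≤3 n)))
          k p q 1≤q kq
        double : ∀ n → fromℕ (q ℕ.+ q) * lnSum (φ n) n ≡ fromℕ q * (fromℕ 2 * lnSum (φ n) n)
        double n = trans (cong (_* lnSum (φ n) n) (fromℤ-+ (+ q) (+ q))) (i₁ (fromℕ q) (lnSum (φ n) n))
          where
          i₁ : ∀ q x → (q + q) * x ≡ q * (fromℕ 2 * x)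
          i₁ = RingSolver.solve-∀ ℚ-ring
        transport : ∀ {x} → Gap x (λ n → fromℕ (q ℕ.+ q) * lnSum (φ n) n) → Gap x Qt.qX
        transport {x} (ε , 0<ε , N , h) = ε , 0<ε , N , λ n N≤n → subst (x n + ε ≤_) (double n) (h n N≤n)
        transport⁻ : ∀ {x} → Gap x Qt.qX → Gap x (λ n → fromℕ (q ℕ.+ q) * lnSum (φ n) n)
        transport⁻ {x} (ε , 0<ε , N , h) = ε , 0<ε , N , λ n N≤n → subst (x n + ε ≤_) (sym (double n)) (h n N≤n)

      decrease : fromℚ k ≤ʳ κ₂ → ∀ n j → 1 ℕ.≤ n → 1 ℕ.≤ j → t (q ℕ.+ n) j ℤ.≤ t n (j ℕ.+ p)
      decrease h n j 1≤n 1≤j = ℤP.≮⇒≥ λ lt → let (ε , 0<ε , sep) = separated n j p q 1≤n 1≤j lt in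
        Qt.k≤κ⇒ h (transport {Qt.pY} (power⇒gap α φ 1≤α 1≤φ α≤3 φ≤3 p (q ℕ.+ q) (separated⇒powers p q ε 0<ε sep)))

      eventually-increase : κ₂ <ʳ fromℚ k → ∀ Jm →
        ∃[ M ] (∀ n j → M ℕ.≤ n → 1 ℕ.≤ j → j ℕ.+ p ℕ.≤ Jm → t n (j ℕ.+ p) ℤ.< t (q ℕ.+ n) j)
      eventually-increase h = powers⇒eventually p q (gap⇒power α φ 1≤α 1≤φ α≤3 φ≤3 p (q ℕ.+ q) (transport⁻ {Qt.pY} (Qt.κ<k⇒ h)))

-- Points on lines

module Walk (p q : ℕ) (1≤p : 1 ℕ.≤ p) (1≤q : 1 ℕ.≤ q) (On : Point → Set)
  (steps : ∀ x y x′ y′ → On (x , y) → On (x′ , y′) → x ℕ.≤ x′ → ∃[ i ] (x′ ≡ x ℕ.+ q ℕ.* i × y ≡ y′ ℕ.+ p ℕ.* i))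
  (next : ∀ x y → On (x , y ℕ.+ p) → On (x ℕ.+ q , y))
  (previous : ∀ x y → On (x ℕ.+ q , y) → On (x , y ℕ.+ p))
  where

  NoneBetween : ℕ → ℕ → Set
  NoneBetween x x′ = ∀ R → InD R × On R → proj₁ R ℕ.≤ x ⊎ x′ ℕ.≤ proj₁ R

  none⇒step : ∀ x y x′ y′ → InD (x , y) → On (x , y) → InD (x′ , y′) → On (x′ , y′) → x ℕ.< x′ → NoneBetween x x′ →
    x′ ≡ x ℕ.+ q × y ≡ y′ ℕ.+ p
  none⇒step x y x′ y′ dP P dQ Q x<x′ none with steps x y x′ y′ P Q (ℕP.<⇒≤ x<x′)
  ... | zero , refl , refl = ⊥-elim (ℕP.<-irrefl (sym (trans (cong (x ℕ.+_) (ℕP.*-zeroʳ q)) (ℕP.+-identityʳ x))) x<x′)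
  ... | suc zero , refl , refl = cong (x ℕ.+_) (ℕP.*-identityʳ q) , cong (y′ ℕ.+_) (ℕP.*-identityʳ p)
  ... | suc (suc i) , refl , refl = ⊥-elim (excluded (none (x ℕ.+ q , y″) (inD , on)))
    where
    y″ : ℕ
    y″ = y′ ℕ.+ p ℕ.* suc i
    y≡ : y′ ℕ.+ p ℕ.* suc (suc i) ≡ y″ ℕ.+ p
    y≡ = i₁ y′ p i
      where
      i₁ : ∀ y p i → y ℕ.+ p ℕ.* suc (suc i) ≡ y ℕ.+ p ℕ.* suc i ℕ.+ p
      i₁ = ℕR.solve-∀
    on : On (x ℕ.+ q , y″)
    on = next x y″ (subst (λ z → On (x , z)) y≡ P)
    inD : InD (x ℕ.+ q , y″)
    inD = ℕP.≤-trans (proj₁ dQ) (ℕP.m≤m+n y′ _) ,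
      ℕP.<-≤-trans (ℕP.≤-<-trans (ℕP.m≤m+n y″ p) (subst (ℕ._< x) y≡ (proj₂ dP))) (ℕP.m≤m+n x q)
    x+q<x′ : x ℕ.+ q ℕ.< x ℕ.+ q ℕ.* suc (suc i)
    x+q<x′ = ℕP.+-monoʳ-< x (subst (ℕ._< q ℕ.* suc (suc i)) (ℕP.*-identityʳ q)
      (ℕP.*-monoʳ-< q {{ℕ.>-nonZero 1≤q}} (ℕ.s≤s (ℕ.s≤s ℕ.z≤n))))
    excluded : x ℕ.+ q ℕ.≤ x ⊎ x ℕ.+ q ℕ.* suc (suc i) ℕ.≤ x ℕ.+ q → ⊥
    excluded (inj₁ le) = ℕP.<⇒≱ (subst (ℕ._< x ℕ.+ q) (ℕP.+-identityʳ x) (ℕP.+-monoʳ-< x 1≤q)) le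
    excluded (inj₂ le) = ℕP.<⇒≱ x+q<x′ le

  step⇒none : ∀ x y → On (x , y ℕ.+ p) → NoneBetween x (x ℕ.+ q)
  step⇒none x y on (x′ , y′) (_ , on′) with ℕP.<-≤-connex x x′
  ... | inj₂ x′≤x = inj₁ x′≤x
  ... | inj₁ x<x′ with steps x (y ℕ.+ p) x′ y′ on on′ (ℕP.<⇒≤ x<x′)
  ...   | zero , refl , _ = ⊥-elim (ℕP.<-irrefl (sym (trans (cong (x ℕ.+_) (ℕP.*-zeroʳ q)) (ℕP.+-identityʳ x))) x<x′)
  ...   | suc i , refl , _ = inj₂ (ℕP.+-monoʳ-≤ x (ℕP.m≤m*n q (suc i)))

  last-point : ∀ f x y → y ℕ.≤ f → InD (x , y) → On (x , y) →
    ∃[ x′ ] ∃[ y′ ] (InD (x′ , y′) × On (x′ , y′) × y′ ℕ.≤ p)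
  last-point zero x y y≤f d P = x , y , d , P , ℕP.≤-trans y≤f ℕ.z≤n
  last-point (suc f) x y y≤f d P with ℕP.≤-<-connex y p
  ... | inj₁ y≤p = x , y , d , P , y≤p
  ... | inj₂ p<y with ℕP.m≤n⇒∃[o]m+o≡n p<y
  ...   | o , refl = last-point f (x ℕ.+ q) (suc o)
          (ℕP.≤-pred (ℕP.≤-trans (ℕ.s≤s (ℕP.+-monoˡ-≤ o 1≤p)) y≤f))
          (ℕ.s≤s ℕ.z≤n , ℕP.<-≤-trans (ℕP.≤-<-trans (ℕ.s≤s (ℕP.m≤n+m o p)) (proj₂ d)) (ℕP.m≤m+n x q))
          (next x (suc o) (subst (λ z → On (x , z)) (cong suc (ℕP.+-comm p o)) P))

  first-point : ∀ f x y → x ℕ.≤ f → InD (x , y) → On (x , y) →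
    ∃[ x′ ] ∃[ y′ ] (InD (x′ , y′) × On (x′ , y′) × x′ ℕ.≤ y′ ℕ.+ (p ℕ.+ q))
  first-point zero x y x≤f d P = x , y , d , P , ℕP.≤-trans x≤f ℕ.z≤n
  first-point (suc f) x y x≤f d P with ℕP.≤-<-connex x (y ℕ.+ (p ℕ.+ q))
  ... | inj₁ x≤ = x , y , d , P , x≤
  ... | inj₂ lt with ℕP.m≤n⇒∃[o]m+o≡n lt
  ...   | o , refl = first-point f (suc (y ℕ.+ p ℕ.+ o)) (y ℕ.+ p)
          (ℕP.≤-trans (ℕP.≤-trans (ℕP.m<m+n _ 1≤q) (ℕP.≤-reflexive (i₁ y p o q))) (ℕP.≤-pred x≤f))
          (ℕP.≤-trans (proj₁ d) (ℕP.m≤m+n y p) , ℕ.s≤s (ℕP.m≤m+n (y ℕ.+ p) o))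
          (previous (suc (y ℕ.+ p ℕ.+ o)) y (subst (λ z → On (z , y)) (sym (cong suc (i₁ y p o q))) P))
    where
    i₁ : ∀ y p o q → y ℕ.+ p ℕ.+ o ℕ.+ q ≡ y ℕ.+ (p ℕ.+ q) ℕ.+ o
    i₁ = ℕR.solve-∀

module Lines where
  open import Data.Rational using (_+_; _*_; _-_; -_; _≤_)
  open Rationals

  fromℕ-+ : ∀ m n → fromℕ (m ℕ.+ n) ≡ fromℕ m + fromℕ n
  fromℕ-+ m n = fromℤ-+ (+ m) (+ n)

  fromℕ-* : ∀ m n → fromℕ (m ℕ.* n) ≡ fromℕ m * fromℕ n
  fromℕ-* m n = trans (cong fromℤ (ℤP.pos-* m n)) (fromℤ-* (+ m) (+ n))

  fromℕ-injective : ∀ {m n} → fromℕ m ≡ fromℕ n → m ≡ n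
  fromℕ-injective p = ℤP.+-injective (ℤP.≤-antisym (fromℤ-cancel-≤ (ℚP.≤-reflexive p)) (fromℤ-cancel-≤ (ℚP.≤-reflexive (sym p))))

  Slope : ℚ → ℕ → ℕ → Set
  Slope k dx dy = k * fromℕ dx ≡ - fromℕ dy

  slope : ∀ k b x y dx dy → OnLine k b (x , y ℕ.+ dy) → OnLine k b (x ℕ.+ dx , y) → Slope k dx dy
  slope k b x y dx dy p q = trans (i₁ k (fromℕ x) (fromℕ dx) b) (trans
      (cong₂ _-_ (trans (cong (λ z → k * z + b) (sym (fromℕ-+ x dx))) (sym q)) (sym p))
      (trans (cong (λ z → fromℕ y - z) (fromℕ-+ y dy)) (i₂ (fromℕ y) (fromℕ dy))))
    where
    i₁ : ∀ k x d b → k * d ≡ k * (x + d) + b - (k * x + b)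
    i₁ = RingSolver.solve-∀ ℚ-ring
    i₂ : ∀ y d → y - (y + d) ≡ - d
    i₂ = RingSolver.solve-∀ ℚ-ring

  forward : ∀ k b x y dx dy → Slope k dx dy → OnLine k b (x , y ℕ.+ dy) → OnLine k b (x ℕ.+ dx , y)
  forward k b x y dx dy s p = trans (i₁ (fromℕ y) (fromℕ dy)) (trans
      (cong₂ (λ u v → u + v) (trans (sym (fromℕ-+ y dy)) p) (sym s))
      (trans (i₂ k (fromℕ x) (fromℕ dx) b) (cong (λ z → k * z + b) (sym (fromℕ-+ x dx)))))
    where
    i₁ : ∀ y d → y ≡ y + d + - d
    i₁ = RingSolver.solve-∀ ℚ-ring
    i₂ : ∀ k x d b → k * x + b + k * d ≡ k * (x + d) + b
    i₂ = RingSolver.solve-∀ ℚ-ring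

  backward : ∀ k b x y dx dy → Slope k dx dy → OnLine k b (x ℕ.+ dx , y) → OnLine k b (x , y ℕ.+ dy)
  backward k b x y dx dy s p = trans (fromℕ-+ y dy) (trans
      (cong₂ (λ u v → u + v) (trans p (cong (λ z → k * z + b) (fromℕ-+ x dx))) (i₁ (fromℕ dy)))
      (trans (cong (λ z → k * (fromℕ x + fromℕ dx) + b + - z) (sym s)) (i₂ k (fromℕ x) (fromℕ dx) b)))
    where
    i₁ : ∀ d → d ≡ - - d
    i₁ = RingSolver.solve-∀ ℚ-ring
    i₂ : ∀ k x d b → k * (x + d) + b + - (k * d) ≡ k * x + b
    i₂ = RingSolver.solve-∀ ℚ-ring

  negative-slope : ∀ k → k < 0ℚ → ∃[ p ] ∃[ q ] (1 ℕ.≤ p × 1 ℕ.≤ q × Coprime q p × Slope k q p)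
  negative-slope (mkℚ (+ n) d c) k<0 = ⊥-elim (<⇒≱ k<0 (ℚP.nonNegative⁻¹ (mkℚ (+ n) d c)))
  negative-slope k@(mkℚ -[1+ n ] d c) k<0 = suc n , suc d , ℕ.s≤s ℕ.z≤n , ℕ.s≤s ℕ.z≤n ,
    Coprimality.sym (Coprimality.recompute c) ,
    trans (ℚP.toℚᵘ-injective (ℚᵘP.≃-trans (ℚP.toℚᵘ-homo-* k (fromℕ (suc d)))
      (ℚᵘP.≃-trans (ℚᵘP.*-congˡ (ℚᵘP.≃-reflexive (toℚᵘ-fromℤ (+ suc d))))
        (ℚᵘP.≃-trans (ℚᵘ.*≡* (i₁ -[1+ n ] (+ suc d))) (ℚᵘP.≃-reflexive (sym (toℚᵘ-fromℤ -[1+ n ]))))))) (fromℤ-neg (+ suc n))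
    where
    i₁ : ∀ a b → a ℤ.* b ℤ.* + 1 ≡ a ℤ.* (b ℤ.* + 1)
    i₁ = ℤR.solve-∀

  descends : ∀ k b → k < 0ℚ → ∀ x y x′ y′ → OnLine k b (x , y) → OnLine k b (x′ , y′) → x ℕ.≤ x′ → y′ ℕ.≤ y
  descends k b k<0 x y x′ y′ p q x≤ = ℤP.drop‿+≤+ (fromℤ-cancel-≤ {+ y′} {+ y} (subst₂ _≤_ (sym q) (sym p)
    (ℚP.+-monoˡ-≤ b (ℚP.*-monoˡ-≤-nonPos k {{ℚ.nonPositive (ℚP.<⇒≤ k<0)}} (fromℕ-mono x≤)))))

  module NegativeSlope (k : ℚ) (k<0 : k < 0ℚ) (p q : ℕ) (1≤p : 1 ℕ.≤ p) (1≤q : 1 ℕ.≤ q)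
                       (coprime : Coprime q p) (kq : Slope k q p) where

    private
      commensurable : ∀ {dx dy} → Slope k dx dy → q ℕ.* dy ≡ p ℕ.* dx
      commensurable {dx} {dy} s = fromℕ-injective (trans (fromℕ-* q dy) (trans (i₁ (fromℕ q) (fromℕ dy))
        (trans (cong (λ z → - (fromℕ q * z)) (sym s)) (trans (i₂ k (fromℕ q) (fromℕ dx))
          (trans (cong (λ z → - (z * fromℕ dx)) kq) (trans (i₃ (fromℕ p) (fromℕ dx)) (sym (fromℕ-* p dx))))))))
        where
        i₁ : ∀ q d → q * d ≡ - (q * - d)
        i₁ = RingSolver.solve-∀ ℚ-ring
        i₂ : ∀ k q d → - (q * (k * d)) ≡ - (k * q * d)
        i₂ = RingSolver.solve-∀ ℚ-ring
        i₃ : ∀ p d → - (- p * d) ≡ p * d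
        i₃ = RingSolver.solve-∀ ℚ-ring

      multiple-step : ∀ {dx dy} → q ℕ.* dy ≡ p ℕ.* dx → ∃[ i ] (dx ≡ q ℕ.* i × dy ≡ p ℕ.* i)
      multiple-step {dx} {dy} eq with Coprimality.coprime-divisor coprime (divides dy (trans (sym eq) (ℕP.*-comm q dy)))
      ... | divides i refl = i , ℕP.*-comm i q , ℕP.*-cancelˡ-≡ dy (p ℕ.* i) q {{ℕ.>-nonZero 1≤q}} (trans eq (i₁ p i q))
        where
        i₁ : ∀ p i q → p ℕ.* (i ℕ.* q) ≡ q ℕ.* (p ℕ.* i)
        i₁ = ℕR.solve-∀

    steps : ∀ b x y x′ y′ → OnLine k b (x , y) → OnLine k b (x′ , y′) → x ℕ.≤ x′ →
      ∃[ i ] (x′ ≡ x ℕ.+ q ℕ.* i × y ≡ y′ ℕ.+ p ℕ.* i)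
    steps b x y x′ y′ P R x≤ = proj₁ m , trans (sym (proj₂ dx)) (cong (x ℕ.+_) (proj₁ (proj₂ m)))
                             , trans (sym (proj₂ dy)) (cong (y′ ℕ.+_) (proj₂ (proj₂ m)))
      where
      dx = ℕP.m≤n⇒∃[o]m+o≡n x≤
      dy = ℕP.m≤n⇒∃[o]m+o≡n (descends k b k<0 x y x′ y′ P R x≤)
      m = multiple-step (commensurable (slope k b x y′ (proj₁ dx) (proj₁ dy)
        (subst (λ z → OnLine k b (x , z)) (sym (proj₂ dy)) P) (subst (λ z → OnLine k b (z , y′)) (sym (proj₂ dx)) R)))

    next-on-line : ∀ b x y → OnLine k b (x , y ℕ.+ p) → OnLine k b (x ℕ.+ q , y)
    next-on-line b x y = forward k b x y q p kq

    previous-on-line : ∀ b x y → OnLine k b (x ℕ.+ q , y) → OnLine k b (x , y ℕ.+ p)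
    previous-on-line b x y = backward k b x y q p kq

module Profile (p q : ℕ) (1≤p : 1 ℕ.≤ p) (v : ℕ → ℕ → ℤ)
  (positive : ∀ x y → 1 ℕ.≤ y → + 0 ℤ.< v x y)
  (convex : ∀ x y → 1 ℕ.≤ y → v (x ℕ.+ q) (y ℕ.+ p) ℤ.* v (x ℕ.+ q) (y ℕ.+ p)
                             ℤ.≤ v x (y ℕ.+ p ℕ.+ p) ℤ.* v (x ℕ.+ q ℕ.+ q) y)
  where

  private
    grow : ∀ {a b c} → + 0 ℤ.< b → + 0 ℤ.< c → b ℤ.* b ℤ.≤ a ℤ.* c → a ℤ.≤ b → b ℤ.≤ c
    grow {a} {b} {c} 0<b 0<c p a≤b = ℤP.*-cancelˡ-≤-pos b c b {{ℤ.positive 0<b}}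
      (ℤP.≤-trans p (ℤP.*-monoʳ-≤-nonNeg c {{ℤ.nonNegative (ℤP.<⇒≤ 0<c)}} a≤b))

    swapped : ∀ a b c → b ℤ.* b ℤ.≤ a ℤ.* c → b ℤ.* b ℤ.≤ c ℤ.* a
    swapped a b c p = subst (b ℤ.* b ℤ.≤_) (ℤP.*-comm a c) p

    positive-up : ∀ x y z → 1 ℕ.≤ y → + 0 ℤ.< v x (y ℕ.+ z)
    positive-up x y z 1≤y = positive x (y ℕ.+ z) (ℕP.≤-trans 1≤y (ℕP.m≤m+n y z))

  rise : ∀ i x y → 1 ℕ.≤ y →
    v x (y ℕ.+ p ℕ.+ p ℕ.* i) ℤ.≤ v (x ℕ.+ q) (y ℕ.+ p ℕ.* i) →
    v (x ℕ.+ q ℕ.* i) (y ℕ.+ p) ℤ.≤ v (x ℕ.+ q ℕ.* i ℕ.+ q) y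
  rise zero x y 1≤y h rewrite ℕP.*-zeroʳ p | ℕP.*-zeroʳ q | ℕP.+-identityʳ (y ℕ.+ p) | ℕP.+-identityʳ x | ℕP.+-identityʳ y = h
  rise (suc i) x y 1≤y h = subst (λ z → v z (y ℕ.+ p) ℤ.≤ v (z ℕ.+ q) y) (i₁ x q i)
    (rise i (x ℕ.+ q) y 1≤y (subst (λ z → v (x ℕ.+ q) z ℤ.≤ v (x ℕ.+ q ℕ.+ q) (y ℕ.+ p ℕ.* i)) (i₂ y p i)
      (grow {v x (y ℕ.+ p ℕ.* i ℕ.+ p ℕ.+ p)} (positive-up _ (y ℕ.+ p ℕ.* i) p 1≤y′) (positive _ _ 1≤y′) (convex x (y ℕ.+ p ℕ.* i) 1≤y′)
        (subst₂ (λ a b → v x a ℤ.≤ v (x ℕ.+ q) b) (i₃ y p i) (i₄ y p i) h))))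
    where
    1≤y′ : 1 ℕ.≤ y ℕ.+ p ℕ.* i
    1≤y′ = ℕP.≤-trans 1≤y (ℕP.m≤m+n y _)
    i₁ : ∀ x q i → x ℕ.+ q ℕ.+ q ℕ.* i ≡ x ℕ.+ q ℕ.* suc i
    i₁ = ℕR.solve-∀
    i₂ : ∀ y p i → y ℕ.+ p ℕ.* i ℕ.+ p ≡ y ℕ.+ p ℕ.+ p ℕ.* i
    i₂ = ℕR.solve-∀
    i₃ : ∀ y p i → y ℕ.+ p ℕ.+ p ℕ.* suc i ≡ y ℕ.+ p ℕ.* i ℕ.+ p ℕ.+ p
    i₃ = ℕR.solve-∀
    i₄ : ∀ y p i → y ℕ.+ p ℕ.* suc i ≡ y ℕ.+ p ℕ.* i ℕ.+ p
    i₄ = ℕR.solve-∀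

  fall : ∀ i x y → 1 ℕ.≤ y →
    v (x ℕ.+ q ℕ.* i ℕ.+ q) y ℤ.≤ v (x ℕ.+ q ℕ.* i) (y ℕ.+ p) →
    v (x ℕ.+ q) (y ℕ.+ p ℕ.* i) ℤ.≤ v x (y ℕ.+ p ℕ.+ p ℕ.* i)
  fall zero x y 1≤y h rewrite ℕP.*-zeroʳ p | ℕP.*-zeroʳ q | ℕP.+-identityʳ (y ℕ.+ p) | ℕP.+-identityʳ x | ℕP.+-identityʳ y = h
  fall (suc i) x y 1≤y h = subst₂ (λ a b → v (x ℕ.+ q) a ℤ.≤ v x b) (i₂ y p i) (i₃ y p i)
    (fall i x (y ℕ.+ p) (ℕP.≤-trans 1≤y (ℕP.m≤m+n y p))
      (grow {v (x ℕ.+ q ℕ.* i ℕ.+ q ℕ.+ q) y} (positive-up _ y p 1≤y) (positive _ _ (ℕP.≤-trans 1≤y (ℕP.≤-trans (ℕP.m≤m+n y p) (ℕP.m≤m+n (y ℕ.+ p) p))))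
        (swapped (v (x ℕ.+ q ℕ.* i) (y ℕ.+ p ℕ.+ p)) (v (x ℕ.+ q ℕ.* i ℕ.+ q) (y ℕ.+ p)) (v (x ℕ.+ q ℕ.* i ℕ.+ q ℕ.+ q) y) (convex (x ℕ.+ q ℕ.* i) y 1≤y))
        (subst (λ a → v (a ℕ.+ q) y ℤ.≤ v a (y ℕ.+ p)) (i₁ x q i) h)))
    where
    i₁ : ∀ x q i → x ℕ.+ q ℕ.* suc i ≡ x ℕ.+ q ℕ.* i ℕ.+ q
    i₁ = ℕR.solve-∀
    i₂ : ∀ y p i → y ℕ.+ p ℕ.+ p ℕ.* i ≡ y ℕ.+ p ℕ.* suc i
    i₂ = ℕR.solve-∀
    i₃ : ∀ y p i → y ℕ.+ p ℕ.+ p ℕ.+ p ℕ.* i ≡ y ℕ.+ p ℕ.+ p ℕ.* suc i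
    i₃ = ℕR.solve-∀

  module Minimum (On : Point → Set)
    (steps : ∀ x y x′ y′ → On (x , y) → On (x′ , y′) → x ℕ.≤ x′ → ∃[ i ] (x′ ≡ x ℕ.+ q ℕ.* i × y ≡ y′ ℕ.+ p ℕ.* i))
    (next : ∀ x y → On (x , y ℕ.+ p) → On (x ℕ.+ q , y))
    (previous : ∀ x y → On (x ℕ.+ q , y) → On (x , y ℕ.+ p))
    where

    LocalMin : ℕ → ℕ → Set
    LocalMin x y = (∀ y′ → y ≡ y′ ℕ.+ p → 1 ℕ.≤ y′ → v x y ℤ.≤ v (x ℕ.+ q) y′)
                 × (∀ x′ → x ≡ x′ ℕ.+ q → y ℕ.+ p ℕ.< x′ → v x y ℤ.≤ v x′ (y ℕ.+ p))

    private
      smaller-next : ∀ x y → (∃[ y′ ] (y ≡ y′ ℕ.+ p × 1 ℕ.≤ y′ × v (x ℕ.+ q) y′ ℤ.< v x y))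
                           ⊎ (∀ y′ → y ≡ y′ ℕ.+ p → 1 ℕ.≤ y′ → v x y ℤ.≤ v (x ℕ.+ q) y′)
      smaller-next x y with ℕP.≤-<-connex y p
      ... | inj₁ y≤p = inj₂ λ { y′ refl 1≤y′ → ⊥-elim (ℕP.<⇒≱ (ℕP.m<n+m p 1≤y′) y≤p) }
      ... | inj₂ p<y with ℕP.m≤n⇒∃[o]m+o≡n (ℕP.<⇒≤ p<y)
      ...   | y′ , refl with v (x ℕ.+ q) y′ ℤ.<? v x (p ℕ.+ y′)
      ...     | yes lt = inj₁ (y′ , ℕP.+-comm p y′ , ℕP.+-cancelˡ-< p 0 y′ (subst (ℕ._< p ℕ.+ y′) (sym (ℕP.+-identityʳ p)) p<y) , lt)
      ...     | no ¬lt = inj₂ λ y″ eq _ → subst (λ z → v x (p ℕ.+ y′) ℤ.≤ v (x ℕ.+ q) z)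
                  (ℕP.+-cancelʳ-≡ p y′ y″ (trans (ℕP.+-comm y′ p) eq)) (ℤP.≮⇒≥ ¬lt)

      smaller-previous : ∀ x y → (∃[ x′ ] (x ≡ x′ ℕ.+ q × y ℕ.+ p ℕ.< x′ × v x′ (y ℕ.+ p) ℤ.< v x y))
                               ⊎ (∀ x′ → x ≡ x′ ℕ.+ q → y ℕ.+ p ℕ.< x′ → v x y ℤ.≤ v x′ (y ℕ.+ p))
      smaller-previous x y with ℕP.≤-<-connex x q
      ... | inj₁ x≤q = inj₂ λ { x′ refl lt → ⊥-elim (ℕP.<⇒≱ (ℕP.m<n+m q (ℕP.≤-trans (ℕ.s≤s ℕ.z≤n) lt)) x≤q) }
      ... | inj₂ q<x with ℕP.m≤n⇒∃[o]m+o≡n (ℕP.<⇒≤ q<x)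
      ...   | x′ , refl with ℕP.≤-<-connex x′ (y ℕ.+ p)
      ...     | inj₁ x′≤ = inj₂ λ x″ eq lt → ⊥-elim (ℕP.<⇒≱ lt (subst (ℕ._≤ y ℕ.+ p) (ℕP.+-cancelʳ-≡ q x′ x″ (trans (ℕP.+-comm x′ q) eq)) x′≤))
      ...     | inj₂ <x′ with v x′ (y ℕ.+ p) ℤ.<? v (q ℕ.+ x′) y
      ...       | yes lt = inj₁ (x′ , ℕP.+-comm q x′ , <x′ , lt)
      ...       | no ¬lt = inj₂ λ x″ eq _ → subst (λ z → v (q ℕ.+ x′) y ℤ.≤ v z (y ℕ.+ p))
                    (ℕP.+-cancelʳ-≡ q x′ x″ (trans (ℕP.+-comm x′ q) eq)) (ℤP.≮⇒≥ ¬lt)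

      below : ∀ {i j f} → i ℤ.< j → j ℤ.≤ + suc f → i ℤ.≤ + f
      below i<j j≤ = ℤP.i<j⇒i≤pred[j] (ℤP.<-≤-trans i<j j≤)

    local-min : ∀ f x y → v x y ℤ.≤ + f → InD (x , y) → On (x , y) →
      ∃[ x′ ] ∃[ y′ ] (InD (x′ , y′) × On (x′ , y′) × LocalMin x′ y′)
    local-min zero x y v≤ d on = ⊥-elim (ℤP.<⇒≱ (positive x y (proj₁ d)) v≤)
    local-min (suc f) x y v≤ d on with smaller-next x y | smaller-previous x y
    ... | inj₂ n | inj₂ b = x , y , d , on , n , b
    ... | inj₁ (y′ , refl , 1≤y′ , lt) | _ = local-min f (x ℕ.+ q) y′ (below lt v≤)
          (1≤y′ , ℕP.≤-trans (ℕP.≤-<-trans (ℕP.m≤m+n y′ p) (proj₂ d)) (ℕP.m≤m+n x q)) (next x y′ on)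
    ... | inj₂ _ | inj₁ (x′ , refl , y+p<x′ , lt) = local-min f x′ (y ℕ.+ p) (below lt v≤)
          (ℕP.≤-trans (proj₁ d) (ℕP.m≤m+n y p) , y+p<x′) (previous x′ y on)

    module Unimodal {X Y : ℕ} (D : InD (X , Y)) (onT : On (X , Y)) (lm : LocalMin X Y) where

      decreasing : ∀ x y → 1 ℕ.≤ y → y ℕ.+ p ℕ.< x → On (x , y ℕ.+ p) → x ℕ.< X → v (x ℕ.+ q) y ℤ.≤ v x (y ℕ.+ p)
      decreasing x y 1≤y lt on x<X with steps x (y ℕ.+ p) X Y on onT (ℕP.<⇒≤ x<X)
      ... | zero , refl , _ = ⊥-elim (ℕP.<-irrefl (sym (trans (cong (x ℕ.+_) (ℕP.*-zeroʳ q)) (ℕP.+-identityʳ x))) x<X)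
      ... | suc i , refl , eq = subst₂ (λ a b → v (x ℕ.+ q) a ℤ.≤ v x b) (sym y≡) (trans (i₃ Y p i) (cong (ℕ._+ p) (sym y≡)))
          (fall i x Y (proj₁ D) (subst (λ z → v z Y ℤ.≤ v (x ℕ.+ q ℕ.* i) (Y ℕ.+ p)) (i₁ x q i)
            (proj₂ lm (x ℕ.+ q ℕ.* i) (i₁ x q i) (ℕP.<-≤-trans
              (ℕP.≤-<-trans (ℕP.≤-trans (ℕP.+-monoˡ-≤ p (ℕP.m≤m+n Y (p ℕ.* i))) (ℕP.≤-reflexive (cong (ℕ._+ p) (sym y≡)))) lt)
              (ℕP.m≤m+n x (q ℕ.* i))))))
        where
        i₁ : ∀ x q i → x ℕ.+ q ℕ.* suc i ≡ x ℕ.+ q ℕ.* i ℕ.+ q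
        i₁ = ℕR.solve-∀
        i₂ : ∀ y p i → y ℕ.+ p ℕ.* suc i ≡ y ℕ.+ p ℕ.* i ℕ.+ p
        i₂ = ℕR.solve-∀
        i₃ : ∀ y p i → y ℕ.+ p ℕ.+ p ℕ.* i ≡ y ℕ.+ p ℕ.* i ℕ.+ p
        i₃ = ℕR.solve-∀
        y≡ : y ≡ Y ℕ.+ p ℕ.* i
        y≡ = ℕP.+-cancelʳ-≡ p y (Y ℕ.+ p ℕ.* i) (trans eq (i₂ Y p i))

      increasing : ∀ x y → 1 ℕ.≤ y → On (x , y ℕ.+ p) → X ℕ.≤ x → v x (y ℕ.+ p) ℤ.≤ v (x ℕ.+ q) y
      increasing x y 1≤y on X≤x with steps X Y x (y ℕ.+ p) onT on X≤x
      ... | i , refl , eq = rise i X y 1≤y (subst (λ z → v X z ℤ.≤ v (X ℕ.+ q) (y ℕ.+ p ℕ.* i)) eq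
            (proj₁ lm (y ℕ.+ p ℕ.* i) (trans eq (i₁ y p i)) (ℕP.≤-trans 1≤y (ℕP.m≤m+n y _))))
        where
        i₁ : ∀ y p i → y ℕ.+ p ℕ.+ p ℕ.* i ≡ y ℕ.+ p ℕ.* i ℕ.+ p
        i₁ = ℕR.solve-∀

module Generalized (m : ℕ → ℕ → ℤ) (M : IsMarkov m) where
  open import Data.Rational using (_+_; _*_; _-_; -_; _≤_)
  open Rationals
  open Lines

  T : Vec² → ℤ
  T = trace m M

  open LogConvexity T (trace-isTrace m M)
  module Dg = Rates.Diagonal T (trace-isTrace m M)
  module Ax = Rates.Axis T (trace-isTrace m M)

  v : ℕ → ℕ → ℤ
  v x y = T (+ x , + y)

  v-positive : ∀ x y → 1 ℕ.≤ y → + 0 ℤ.< v x y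
  v-positive x y 1≤y = T-positive x y (ℕP.≤-trans 1≤y (ℕP.m≤n+m y x))

  m-positive : ∀ x y → 1 ℕ.≤ y → + 0 ℤ.< m x y
  m-positive x y 1≤y = Integers.0<-cancel {+ 3} {m x y} (ℤ.+≤+ ℕ.z≤n) (v-positive x y 1≤y)

  value : Point → ℤ
  value (x , y) = m x y

  v≤⇒m≤ : ∀ x y x′ y′ → v x y ℤ.≤ v x′ y′ → m x y ℤ.≤ m x′ y′
  v≤⇒m≤ x y x′ y′ = ℤP.*-cancelˡ-≤-pos (m x y) (m x′ y′) (+ 3)

  m≤⇒v≤ : ∀ x y x′ y′ → m x y ℤ.≤ m x′ y′ → v x y ℤ.≤ v x′ y′
  m≤⇒v≤ x y x′ y′ = ℤP.*-monoˡ-≤-nonNeg (+ 3)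

  v<⇒m< : ∀ x y x′ y′ → v x y ℤ.< v x′ y′ → m x y ℤ.< m x′ y′
  v<⇒m< x y x′ y′ = ℤP.*-cancelˡ-<-nonNeg (+ 3)

  diagonal : ∀ n j → Dg.t n j ≡ v (n ℕ.+ j) n
  diagonal n j = cong T (proj₁ (proj₂ (proj₂ (Dg.natural n j))))

  axis : ∀ n j → Ax.t n j ≡ v n j
  axis n j = cong T (proj₁ (proj₂ (proj₂ (Ax.natural n j))))

  v-convex : ∀ p q → 1 ℕ.≤ q → ∀ x y → 1 ℕ.≤ y →
    v (x ℕ.+ q) (y ℕ.+ p) ℤ.* v (x ℕ.+ q) (y ℕ.+ p) ℤ.≤ v x (y ℕ.+ p ℕ.+ p) ℤ.* v (x ℕ.+ q ℕ.+ q) y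
  v-convex p q 1≤q x y 1≤y = subst (v (x ℕ.+ q) (y ℕ.+ p) ℤ.* v (x ℕ.+ q) (y ℕ.+ p) ℤ.≤_)
    (trans (ℤP.*-comm (T (Q ⊞ step)) (T (Q ⊟ step)))
      (cong₂ (λ A B → T A ℤ.* T B) (cong₂ _,_ (i₁ (+ x) (+ q)) (i₂ (+ y) (+ p))) (cong₂ _,_ (refl {x = + (x ℕ.+ q ℕ.+ q)}) (i₃ (+ y) (+ p)))))
    (log-convex (x ℕ.+ q) (y ℕ.+ p) step (ℕP.≤-trans 1≤q (ℕP.≤-trans (ℕP.m≤n+m q x) (ℕP.m≤m+n _ _))) nonzero)
    where
    Q step : Vec²
    Q = (+ (x ℕ.+ q) , + (y ℕ.+ p))
    step = (+ q , ℤ.- (+ p))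
    i₁ : ∀ x q → x ℤ.+ q ℤ.- q ≡ x
    i₁ = ℤR.solve-∀
    i₂ : ∀ y p → y ℤ.+ p ℤ.- ℤ.- p ≡ y ℤ.+ p ℤ.+ p
    i₂ = ℤR.solve-∀
    i₃ : ∀ y p → y ℤ.+ p ℤ.+ ℤ.- p ≡ y
    i₃ = ℤR.solve-∀
    i₄ : ∀ X Y p q → X ℤ.* ℤ.- p ℤ.- Y ℤ.* q ≡ ℤ.- (Y ℤ.* q ℤ.+ X ℤ.* p)
    i₄ = ℤR.solve-∀
    nonzero : det Q step ≢ + 0
    nonzero eq = ℤP.<-irrefl refl (subst (+ 0 ℤ.<_) zero≡
      (ℤP.+-mono-<-≤ (Integers.0<-* {+ (y ℕ.+ p)} {+ q} (ℤ.+<+ (ℕP.≤-trans 1≤y (ℕP.m≤m+n y p))) (ℤ.+<+ 1≤q))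
        (Integers.0≤-* {+ (x ℕ.+ q)} {+ p} (ℤ.+≤+ ℕ.z≤n) (ℤ.+≤+ ℕ.z≤n))))
      where
      zero≡ : + (y ℕ.+ p) ℤ.* + q ℤ.+ + (x ℕ.+ q) ℤ.* + p ≡ + 0
      zero≡ = ℤP.neg-injective (trans (sym (i₄ (+ (x ℕ.+ q)) (+ (y ℕ.+ p)) (+ p) (+ q))) eq)

  right-mono : ∀ d x y → 1 ℕ.≤ y → y ℕ.< x → v x y ℤ.≤ v (x ℕ.+ d) y
  right-mono zero x y 1≤y y<x = ℤP.≤-reflexive (cong (λ z → v z y) (sym (ℕP.+-identityʳ x)))
  right-mono (suc d) x y 1≤y y<x = ℤP.≤-trans (one (ℕP.m≤n⇒∃[o]m+o≡n y<x))
    (ℤP.≤-trans (right-mono d (suc x) y 1≤y (ℕP.m≤n⇒m≤1+n y<x)) (ℤP.≤-reflexive (cong (λ z → v z y) (sym (ℕP.+-suc x d)))))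
    where
    one : ∃[ o ] suc y ℕ.+ o ≡ x → v x y ℤ.≤ v (suc x) y
    one (o , refl) = subst₂ ℤ._≤_ (trans (diagonal y (suc o)) (cong (λ z → v z y) (ℕP.+-suc y o)))
      (trans (diagonal y (2 ℕ.+ o)) (cong (λ z → v z y) (trans (ℕP.+-suc y (suc o)) (cong suc (ℕP.+-suc y o)))))
      (Dg.grow y (suc o) 1≤y (ℕ.s≤s ℕ.z≤n))

  up-mono : ∀ d x y → 1 ℕ.≤ x → 1 ℕ.≤ y → v x y ℤ.≤ v x (y ℕ.+ d)
  up-mono zero x y 1≤x 1≤y = ℤP.≤-reflexive (cong (v x) (sym (ℕP.+-identityʳ y)))
  up-mono (suc d) x y 1≤x 1≤y = ℤP.≤-trans (subst₂ ℤ._≤_ (axis x y) (axis x (suc y)) (Ax.grow x y 1≤x 1≤y))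
    (ℤP.≤-trans (up-mono d x (suc y) 1≤x (ℕ.s≤s ℕ.z≤n)) (ℤP.≤-reflexive (cong (v x) (sym (ℕP.+-suc y d)))))

  module Ratio (P Q : Point) (0<P : + 0 ℤ.< value P) where
    private
      a b r : ℚ
      a = fromℤ (value P)
      b = fromℤ (value Q)
      r = ratio m P Q
      0<a : 0ℚ < a
      0<a = fromℤ-mono-< 0<P
      ar : a * r ≡ b
      ar = trans (ℚP.*-comm a r) (⊘-* b a 0<a)

    1≤ratio : value P ℤ.≤ value Q → 1ℚ ≤ r
    1≤ratio p = *-cancel-≤ a 0<a (subst₂ _≤_ (sym (ℚP.*-identityʳ a)) (sym ar) (fromℤ-mono-≤ p))

    ratio≤1 : value Q ℤ.≤ value P → r ≤ 1ℚ
    ratio≤1 p = *-cancel-≤ a 0<a (subst₂ _≤_ (sym ar) (sym (ℚP.*-identityʳ a)) (fromℤ-mono-≤ p))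

    ratio<1 : value Q ℤ.< value P → r < 1ℚ
    ratio<1 p = *-cancel-< a (ℚP.<⇒≤ 0<a) (subst₂ _<_ (sym ar) (sym (ℚP.*-identityʳ a)) (fromℤ-mono-< p))

    1<ratio : value P ℤ.< value Q → 1ℚ < r
    1<ratio p = *-cancel-< a (ℚP.<⇒≤ 0<a) (subst₂ _<_ (sym (ℚP.*-identityʳ a)) (sym ar) (fromℤ-mono-< p))

  increase-step : ∀ k → κ₁ ≤ʳ fromℚ k → ∀ b x y x′ y′ → InD (x , y) → OnLine k b (x , y) → InD (x′ , y′) → OnLine k b (x′ , y′) →
    x ℕ.< x′ → v x y ℤ.≤ v x′ y′
  increase-step k h b x y x′ y′ d on d′ on′ x<x′ =
    by-slope (ℕP.m≤n⇒∃[o]m+o≡n x<x′) (ℕP.m≤n⇒∃[o]m+o≡n (proj₂ d)) (ℕP.≤-total y′ y)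
    where
    by-slope : ∃[ o ] suc x ℕ.+ o ≡ x′ → ∃[ j ] suc y ℕ.+ j ≡ x → y′ ℕ.≤ y ⊎ y ℕ.≤ y′ → v x y ℤ.≤ v x′ y′
    by-slope (o , ex) (j , ej) (inj₁ y′≤y) = subst₂ ℤ._≤_
      (trans (diagonal (dy ℕ.+ y′) (suc j)) (cong₂ v x≡ y≡))
      (trans (diagonal y′ (suc j ℕ.+ (dy ℕ.+ suc o))) (cong (λ z → v z y′) x′≡))
      (Dg.increase k dy (suc o) (ℕ.s≤s ℕ.z≤n) s h y′ (suc j) (proj₁ d′) (ℕ.s≤s ℕ.z≤n))
      where
      dy = proj₁ (ℕP.m≤n⇒∃[o]m+o≡n y′≤y)
      y≡ : dy ℕ.+ y′ ≡ y
      y≡ = trans (ℕP.+-comm dy y′) (proj₂ (ℕP.m≤n⇒∃[o]m+o≡n y′≤y))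
      x≡ : dy ℕ.+ y′ ℕ.+ suc j ≡ x
      x≡ = trans (cong (ℕ._+ suc j) y≡) (trans (ℕP.+-suc y j) ej)
      xo : x ℕ.+ suc o ≡ x′
      xo = trans (ℕP.+-suc x o) ex
      i₁ : ∀ y j d o → y ℕ.+ (j ℕ.+ (d ℕ.+ o)) ≡ d ℕ.+ y ℕ.+ j ℕ.+ o
      i₁ = ℕR.solve-∀
      x′≡ : y′ ℕ.+ (suc j ℕ.+ (dy ℕ.+ suc o)) ≡ x′
      x′≡ = trans (i₁ y′ (suc j) dy (suc o)) (trans (cong (ℕ._+ suc o) x≡) xo)
      s : Slope k (suc o) dy
      s = slope k b x y′ (suc o) dy
        (subst (λ z → OnLine k b (x , z)) (sym (trans (ℕP.+-comm y′ dy) y≡)) on)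
        (subst (λ z → OnLine k b (z , y′)) (sym xo) on′)
    by-slope (o , ex) _ (inj₂ y≤y′) = ℤP.≤-trans (right-mono (suc o) x y (proj₁ d) (proj₂ d))
      (ℤP.≤-trans (ℤP.≤-reflexive (cong (λ z → v z y) xo))
        (ℤP.≤-trans (up-mono (proj₁ dy) x′ y (ℕP.≤-trans (ℕ.s≤s ℕ.z≤n) x<x′) (proj₁ d)) (ℤP.≤-reflexive (cong (v x′) (proj₂ dy)))))
      where
      dy = ℕP.m≤n⇒∃[o]m+o≡n y≤y′
      xo : x ℕ.+ suc o ≡ x′
      xo = trans (ℕP.+-suc x o) ex

  decrease-step : ∀ k → fromℚ k ≤ʳ κ₂ → ∀ b x y x′ y′ → InD (x , y) → OnLine k b (x , y) → InD (x′ , y′) → OnLine k b (x′ , y′) →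
    x ℕ.< x′ → v x′ y′ ℤ.≤ v x y
  decrease-step k h b x y x′ y′ d on d′ on′ x<x′ = subst₂ ℤ._≤_
      (trans (axis (suc o ℕ.+ x) y′) (cong (λ z → v z y′) (trans (ℕP.+-comm (suc o) x) xo)))
      (trans (axis x (y′ ℕ.+ dy)) (cong (v x) y≡))
      (Ax.decrease k dy (suc o) (ℕ.s≤s ℕ.z≤n) s h x y′ (ℕP.≤-trans (ℕ.s≤s ℕ.z≤n) (proj₂ d)) (proj₁ d′))
    where
    o = proj₁ (ℕP.m≤n⇒∃[o]m+o≡n x<x′)
    xo : x ℕ.+ suc o ≡ x′
    xo = trans (ℕP.+-suc x o) (proj₂ (ℕP.m≤n⇒∃[o]m+o≡n x<x′))
    y′≤y : y′ ℕ.≤ y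
    y′≤y = ℤP.drop‿+≤+ (fromℤ-cancel-≤ {+ y′} {+ y} (subst₂ _≤_ (sym on′) (sym on)
      (ℚP.+-monoˡ-≤ b (ℚP.*-monoˡ-≤-nonPos k {{ℚ.nonPositive (Ax.nonpositive k h)}} (fromℕ-mono (ℕP.<⇒≤ x<x′))))))
    dy = proj₁ (ℕP.m≤n⇒∃[o]m+o≡n y′≤y)
    y≡ : y′ ℕ.+ dy ≡ y
    y≡ = proj₂ (ℕP.m≤n⇒∃[o]m+o≡n y′≤y)
    s : Slope k (suc o) dy
    s = slope k b x y′ (suc o) dy (subst (λ z → OnLine k b (x , z)) (sym y≡) on) (subst (λ z → OnLine k b (z , y′)) (sym xo) on′)

  module NegativeLine (k : ℚ) (k<0 : k < 0ℚ) (p q : ℕ) (1≤p : 1 ℕ.≤ p) (1≤q : 1 ℕ.≤ q)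
                      (coprime : Coprime q p) (kq : Slope k q p) where
    open NegativeSlope k k<0 p q 1≤p 1≤q coprime kq

    module OnLineOf (b : ℚ) where
      open Walk p q 1≤p 1≤q (OnLine k b) (steps b) (next-on-line b) (previous-on-line b) public

      step : ∀ {x y x′ y′} → Consecutive k b (x , y) (x′ , y′) → x′ ≡ x ℕ.+ q × y ≡ y′ ℕ.+ p
      step {x} {y} {x′} {y′} c = none⇒step x y x′ y′ (proj₁ left) (proj₂ left) (proj₁ right) (proj₂ right) ordered noneBetween
        where open Consecutive c

      consecutive : ∀ x y → 1 ℕ.≤ y → y ℕ.+ p ℕ.< x → OnLine k b (x , y ℕ.+ p) →
        Consecutive k b (x , y ℕ.+ p) (x ℕ.+ q , y)
      consecutive x y 1≤y y+p<x on = record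
        { left = (ℕP.≤-trans 1≤y (ℕP.m≤m+n y p) , y+p<x) , on
        ; right = (1≤y , ℕP.<-≤-trans (ℕP.≤-<-trans (ℕP.m≤m+n y p) y+p<x) (ℕP.m≤m+n x q)) , next-on-line b x y on
        ; ordered = ℕP.m<m+n x 1≤q
        ; noneBetween = step⇒none x y on }

    open Profile p q 1≤p v v-positive (v-convex p q 1≤q)

    module FarFromOrigin
      (M₁ : ℕ) (falls : ∀ n j → M₁ ℕ.≤ n → 1 ℕ.≤ j → j ℕ.+ (p ℕ.+ q) ℕ.≤ (p ℕ.+ q) ℕ.+ (p ℕ.+ q) →
        Dg.t n (j ℕ.+ (p ℕ.+ q)) ℤ.< Dg.t (p ℕ.+ n) j)
      (M₂ : ℕ) (rises : ∀ n j → M₂ ℕ.≤ n → 1 ℕ.≤ j → j ℕ.+ p ℕ.≤ p ℕ.+ p → Ax.t n (j ℕ.+ p) ℤ.< Ax.t (q ℕ.+ n) j) where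
      B : ℕ
      B = (suc M₁ ℕ.+ p ℕ.+ (p ℕ.+ q)) ℕ.+ (q ℕ.+ (M₂ ℕ.+ suc (p ℕ.+ p)))
      intercept : ℕ → ℕ → ℚ
      intercept x y = fromℕ y - k * fromℕ x
      exceptions : List ℚ
      exceptions = cartesianProductWith intercept (upTo B) (upTo B)
      far : ∀ b → b ∉ exceptions → ∀ x y → InD (x , y) → OnLine k b (x , y) → B ℕ.≤ x
      far b b∉ x y d on = ℕP.≮⇒≥ λ x<B → b∉ (subst (λ z → z ∈ exceptions) (b≡ (fromℕ y) (k * fromℕ x) b on)
        (∈-cartesianProductWith⁺ intercept (∈-upTo⁺ x<B) (∈-upTo⁺ (ℕP.<-trans (proj₂ d) x<B))))
        where
        i₁ : ∀ w b → w + b - w ≡ b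
        i₁ = RingSolver.solve-∀ ℚ-ring
        b≡ : ∀ u w b → u ≡ w + b → u - w ≡ b
        b≡ u w b refl = i₁ w b
      refute : ∀ b → MeetsD k b → b ∉ exceptions → ¬ MonotonicAlong m k b
      refute b ((x , y) , d , on) b∉ = λ
        { (inj₁ inc) → first-drop (first-point x x y ℕP.≤-refl d on) inc
        ; (inj₂ dec) → last-rise (last-point y x y ℕP.≤-refl d on) dec }
        where
        open OnLineOf b
        first-drop : ∃[ x ] ∃[ y ] (InD (x , y) × OnLine k b (x , y) × x ℕ.≤ y ℕ.+ (p ℕ.+ q)) → ¬ IncreaseAlong m k b
        first-drop (x , y , d , on , x≤) inc = at (ℕP.m≤n⇒∃[o]m+o≡n (ℕP.≤-trans room y≥)) (ℕP.m≤n⇒∃[o]m+o≡n (proj₂ d))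
          where
          y≥ : suc M₁ ℕ.+ p ℕ.≤ y
          y≥ = ℕP.+-cancelʳ-≤ (p ℕ.+ q) _ y (ℕP.≤-trans (ℕP.≤-trans (ℕP.m≤m+n _ _) (far b b∉ x y d on)) x≤)
          room : p ℕ.+ suc M₁ ℕ.≤ suc M₁ ℕ.+ p
          room = ℕP.≤-reflexive (ℕP.+-comm p (suc M₁))
          at : ∃[ o ] p ℕ.+ suc M₁ ℕ.+ o ≡ y → ∃[ j ] suc y ℕ.+ j ≡ x → ⊥
          at (o , eo) (j , ej) = <⇒≱ (Ratio.ratio<1 (x , y₀ ℕ.+ p) (x ℕ.+ q , y₀) (m-positive x (y₀ ℕ.+ p) (ℕ.s≤s ℕ.z≤n)) smaller)
              (inc _ _ (consecutive x y₀ (ℕ.s≤s ℕ.z≤n) (subst (ℕ._< x) y≡ (proj₂ d)) (subst (λ z → OnLine k b (x , z)) y≡ on)))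
            where
            y₀ : ℕ
            y₀ = suc M₁ ℕ.+ o
            y≡ : y ≡ y₀ ℕ.+ p
            y≡ = trans (sym eo) (trans (ℕP.+-assoc p (suc M₁) o) (ℕP.+-comm p y₀))
            x≡ : p ℕ.+ y₀ ℕ.+ suc j ≡ x
            x≡ = trans (cong (ℕ._+ suc j) (trans (ℕP.+-comm p y₀) (sym y≡))) (trans (ℕP.+-suc y j) ej)
            j≤ : suc j ℕ.≤ p ℕ.+ q
            j≤ = ℕP.+-cancelˡ-≤ y (suc j) (p ℕ.+ q) (ℕP.≤-trans (ℕP.≤-reflexive (trans (ℕP.+-suc y j) ej)) x≤)
            i₁ : ∀ y j p q → y ℕ.+ (j ℕ.+ (p ℕ.+ q)) ≡ p ℕ.+ y ℕ.+ j ℕ.+ q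
            i₁ = ℕR.solve-∀
            smaller : m (x ℕ.+ q) y₀ ℤ.< m x (y₀ ℕ.+ p)
            smaller = v<⇒m< (x ℕ.+ q) y₀ x (y₀ ℕ.+ p) (subst₂ ℤ._<_
              (trans (diagonal y₀ (suc j ℕ.+ (p ℕ.+ q))) (cong (λ z → v z y₀) (trans (i₁ y₀ (suc j) p q) (cong (ℕ._+ q) x≡))))
              (trans (diagonal (p ℕ.+ y₀) (suc j)) (cong₂ v x≡ (ℕP.+-comm p y₀)))
              (falls y₀ (suc j) (ℕP.≤-trans (ℕP.n≤1+n _) (ℕP.m≤m+n (suc M₁) o)) (ℕ.s≤s ℕ.z≤n) (ℕP.+-monoˡ-≤ (p ℕ.+ q) j≤)))
        last-rise : ∃[ x ] ∃[ y ] (InD (x , y) × OnLine k b (x , y) × y ℕ.≤ p) → ¬ DecreaseAlong m k b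
        last-rise (x , y , d , on , y≤p) dec = at (ℕP.m≤n⇒∃[o]m+o≡n x≥)
          where
          x≥ : q ℕ.+ (M₂ ℕ.+ suc (p ℕ.+ p)) ℕ.≤ x
          x≥ = ℕP.≤-trans (ℕP.m≤n+m (q ℕ.+ (M₂ ℕ.+ suc (p ℕ.+ p))) (suc M₁ ℕ.+ p ℕ.+ (p ℕ.+ q))) (far b b∉ x y d on)
          at : ∃[ o ] q ℕ.+ (M₂ ℕ.+ suc (p ℕ.+ p)) ℕ.+ o ≡ x → ⊥
          at (o , eo) = <⇒≱ (Ratio.1<ratio (x₀ , y ℕ.+ p) (x₀ ℕ.+ q , y) (m-positive x₀ (y ℕ.+ p) (ℕP.≤-trans (proj₁ d) (ℕP.m≤m+n y p))) larger)
              (dec _ _ (consecutive x₀ y (proj₁ d) inside (previous-on-line b x₀ y (subst (λ z → OnLine k b (z , y)) x≡ on))))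
            where
            x₀ : ℕ
            x₀ = M₂ ℕ.+ suc (p ℕ.+ p) ℕ.+ o
            x≡ : x ≡ x₀ ℕ.+ q
            x≡ = trans (sym eo) (trans (ℕP.+-assoc q (M₂ ℕ.+ suc (p ℕ.+ p)) o) (ℕP.+-comm q x₀))
            inside : y ℕ.+ p ℕ.< x₀
            inside = ℕP.≤-trans (ℕ.s≤s (ℕP.+-monoˡ-≤ p y≤p)) (ℕP.≤-trans (ℕP.m≤n+m (suc (p ℕ.+ p)) M₂) (ℕP.m≤m+n _ o))
            larger : m x₀ (y ℕ.+ p) ℤ.< m (x₀ ℕ.+ q) y
            larger = v<⇒m< x₀ (y ℕ.+ p) (x₀ ℕ.+ q) y (subst₂ ℤ._<_ (axis x₀ (y ℕ.+ p))
              (trans (axis (q ℕ.+ x₀) y) (cong (λ z → v z y) (ℕP.+-comm q x₀)))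
              (rises x₀ y (ℕP.≤-trans (ℕP.m≤m+n M₂ _) (ℕP.m≤m+n _ o)) (proj₁ d) (ℕP.+-monoˡ-≤ p y≤p)))

    not-monotonic : κ₂ <ʳ fromℚ k → fromℚ k <ʳ κ₁ →
      Σ (List ℚ) λ exceptions → (b : ℚ) → MeetsD k b → b ∉ exceptions → ¬ MonotonicAlong m k b
    not-monotonic h₂ h₁ = _ , FarFromOrigin.refute (proj₁ D₁) (proj₂ D₁) (proj₁ D₂) (proj₂ D₂)
      where
      D₁ = Dg.eventually-decrease k p q 1≤q kq h₁ ((p ℕ.+ q) ℕ.+ (p ℕ.+ q))
      D₂ = Ax.eventually-increase k p q 1≤q kq h₂ (p ℕ.+ p)

    unimodal : ∀ b → MeetsD k b → FirstDecreaseThenIncrease m k b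
    unimodal b ((x , y) , d , on) = profile (local-min ℤ.∣ v x y ∣ x y bound d on)
      where
      open OnLineOf b
      open Minimum (OnLine k b) (steps b) (next-on-line b) (previous-on-line b)
      bound : v x y ℤ.≤ + ℤ.∣ v x y ∣
      bound = ℤP.≤-reflexive (sym (ℤP.0≤i⇒+∣i∣≡i (ℤP.<⇒≤ (v-positive x y (proj₁ d)))))
      profile : ∃[ X ] ∃[ Y ] (InD (X , Y) × OnLine k b (X , Y) × LocalMin X Y) → FirstDecreaseThenIncrease m k b
      profile (X , Y , D , onT , lm) = (X , Y) , (D , onT) , λ { (x , y) (x′ , y′) c → sides x y x′ y′ c (step c) }
        where
        open Unimodal D onT lm
        sides : ∀ x y x′ y′ → Consecutive k b (x , y) (x′ , y′) → x′ ≡ x ℕ.+ q × y ≡ y′ ℕ.+ p →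
          (x ℕ.< X → m x′ y′ ℤ.≤ m x y) × (X ℕ.≤ x → m x y ℤ.≤ m x′ y′)
        sides x y x′ y′ c (refl , refl) =
          (λ lt → v≤⇒m≤ (x ℕ.+ q) y′ x (y′ ℕ.+ p) (decreasing x y′ (proj₁ (proj₁ right)) (proj₂ (proj₁ left)) (proj₂ left) lt)) ,
          (λ X≤ → v≤⇒m≤ x (y′ ℕ.+ p) (x ℕ.+ q) y′ (increasing x y′ (proj₁ (proj₁ right)) (proj₂ left) X≤))
          where open Consecutive c

    increase-from-first : ∀ b P P′ → FirstTwo k b P P′ → value P ℤ.≤ value P′ → IncreaseAlong m k b
    increase-from-first b (x , y) (x′ , y′) ((_ , first) , c) h (X , Y) (X′ , Y′) C =
      at (step c) (step C) (steps b x y X Y (proj₂ at-end.left) (proj₂ here.left) (first (X , Y) here.left))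
      where
      open OnLineOf b
      module at-end = Consecutive c
      module here = Consecutive C
      at : x′ ≡ x ℕ.+ q × y ≡ y′ ℕ.+ p → X′ ≡ X ℕ.+ q × Y ≡ Y′ ℕ.+ p → ∃[ i ] (X ≡ x ℕ.+ q ℕ.* i × y ≡ Y ℕ.+ p ℕ.* i) →
        1ℚ ≤ ratio m (X , Y) (X′ , Y′)
      at (ex , ey) (eX , eY) (i , ei , ej) = Ratio.1≤ratio (X , Y) (X′ , Y′) (m-positive X Y (proj₁ (proj₁ here.left)))
        (v≤⇒m≤ X Y X′ Y′ (subst₂ ℤ._≤_ (cong₂ v (sym ei) (sym eY)) (cong (λ z → v z Y′) (trans (cong (ℕ._+ q) (sym ei)) (sym eX)))
          (rise i x Y′ (proj₁ (proj₁ here.right)) (subst₂ ℤ._≤_ (cong (v x) y≡) (cong₂ v ex y′≡)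
            (m≤⇒v≤ x y x′ y′ h)))))
        where
        y≡ : y ≡ Y′ ℕ.+ p ℕ.+ p ℕ.* i
        y≡ = trans ej (cong (ℕ._+ p ℕ.* i) eY)
        i₁ : ∀ y p i → y ℕ.+ p ℕ.+ p ℕ.* i ≡ y ℕ.+ p ℕ.* i ℕ.+ p
        i₁ = ℕR.solve-∀
        y′≡ : y′ ≡ Y′ ℕ.+ p ℕ.* i
        y′≡ = ℕP.+-cancelʳ-≡ p y′ (Y′ ℕ.+ p ℕ.* i) (trans (sym ey) (trans y≡ (i₁ Y′ p i)))

    decrease-to-last : ∀ b Q Q′ → LastTwo k b Q Q′ → value Q′ ℤ.≤ value Q → DecreaseAlong m k b
    decrease-to-last b (x , y) (x′ , y′) (c , (_ , last)) h (X , Y) (X′ , Y′) C =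
      at (step c) (step C) (steps b X′ Y′ x′ y′ (proj₂ here.right) (proj₂ at-end.right) (last (X′ , Y′) here.right))
      where
      open OnLineOf b
      module at-end = Consecutive c
      module here = Consecutive C
      at : x′ ≡ x ℕ.+ q × y ≡ y′ ℕ.+ p → X′ ≡ X ℕ.+ q × Y ≡ Y′ ℕ.+ p → ∃[ i ] (x′ ≡ X′ ℕ.+ q ℕ.* i × Y′ ≡ y′ ℕ.+ p ℕ.* i) →
        ratio m (X , Y) (X′ , Y′) ≤ 1ℚ
      at (ex , ey) (eX , eY) (i , ei , ej) = Ratio.ratio≤1 (X , Y) (X′ , Y′) (m-positive X Y (proj₁ (proj₁ here.left)))
        (v≤⇒m≤ X′ Y′ X Y (subst₂ ℤ._≤_ (cong₂ v (sym eX) (sym ej)) (cong (v X) Y≡)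
          (fall i X y′ (proj₁ (proj₁ at-end.right)) (subst₂ ℤ._≤_ (cong (λ z → v z y′) (trans ex (cong (ℕ._+ q) x≡))) (cong₂ v x≡ ey)
            (m≤⇒v≤ x′ y′ x y h)))))
        where
        i₁ : ∀ x q i → x ℕ.+ q ℕ.+ q ℕ.* i ≡ x ℕ.+ q ℕ.* i ℕ.+ q
        i₁ = ℕR.solve-∀
        x≡ : x ≡ X ℕ.+ q ℕ.* i
        x≡ = ℕP.+-cancelʳ-≡ q x (X ℕ.+ q ℕ.* i) (trans (sym ex) (trans ei (trans (cong (ℕ._+ q ℕ.* i) eX) (i₁ X q i))))
        i₂ : ∀ y p i → y ℕ.+ p ℕ.+ p ℕ.* i ≡ y ℕ.+ p ℕ.* i ℕ.+ p
        i₂ = ℕR.solve-∀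
        Y≡ : y′ ℕ.+ p ℕ.+ p ℕ.* i ≡ Y
        Y≡ = trans (i₂ y′ p i) (trans (cong (ℕ._+ p) (sym ej)) (sym eY))

    characterization : ∀ b P P′ Q Q′ → FirstTwo k b P P′ → LastTwo k b Q Q′ →
      (¬ MonotonicAlong m k b) ⇔ (ratio m P P′ < 1ℚ × 1ℚ < ratio m Q Q′)
    characterization b P P′ Q Q′ first last = mk⇔
      (λ ¬mono → Ratio.ratio<1 P P′ (pos P (Consecutive.left (proj₂ first)))
                   (ℤP.≰⇒> λ le → ¬mono (inj₁ (increase-from-first b P P′ first le)))
               , Ratio.1<ratio Q Q′ (pos Q (Consecutive.left (proj₁ last)))
                   (ℤP.≰⇒> λ le → ¬mono (inj₂ (decrease-to-last b Q Q′ last le))))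
      (λ { (r<1 , 1<r) (inj₁ inc) → <⇒≱ r<1 (inc P P′ (proj₂ first))
         ; (r<1 , 1<r) (inj₂ dec) → <⇒≱ 1<r (dec Q Q′ (proj₁ last)) })
      where
      pos : ∀ P → InD∩l k b P → + 0 ℤ.< value P
      pos (x , y) d = m-positive x y (proj₁ (proj₁ d))

  monotone-nonneg : ∀ k → ¬ k < 0ℚ → ∀ b → IncreaseAlong m k b
  monotone-nonneg k k≮0 b (x , y) (x′ , y′) c = Ratio.1≤ratio (x , y) (x′ , y′) (m-positive x y (proj₁ (proj₁ left)))
    (v≤⇒m≤ x y x′ y′ (ℤP.≤-trans (right-mono (proj₁ dx) x y (proj₁ (proj₁ left)) (proj₂ (proj₁ left)))
      (ℤP.≤-trans (ℤP.≤-reflexive (cong (λ z → v z y) (proj₂ dx)))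
        (ℤP.≤-trans (up-mono (proj₁ dy) x′ y (ℕP.≤-trans (ℕ.s≤s ℕ.z≤n) ordered) (proj₁ (proj₁ left))) (ℤP.≤-reflexive (cong (v x′) (proj₂ dy)))))))
    where
    open Consecutive c
    dx = ℕP.m≤n⇒∃[o]m+o≡n (ℕP.<⇒≤ ordered)
    y≤y′ : y ℕ.≤ y′
    y≤y′ = ℤP.drop‿+≤+ (fromℤ-cancel-≤ {+ y} {+ y′} (subst₂ _≤_ (sym (proj₂ left)) (sym (proj₂ right))
      (ℚP.+-monoˡ-≤ b (*-monoˡ k (ℚP.≮⇒≥ k≮0) (fromℕ-mono (ℕP.<⇒≤ ordered))))))
    dy = ℕP.m≤n⇒∃[o]m+o≡n y≤y′

  module AtSlope (k : ℚ) (k<0 : k < 0ℚ) where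
    private
      s = negative-slope k k<0
    open NegativeLine k k<0 (proj₁ s) (proj₁ (proj₂ s)) (proj₁ (proj₂ (proj₂ s))) (proj₁ (proj₂ (proj₂ (proj₂ s))))
      (proj₁ (proj₂ (proj₂ (proj₂ (proj₂ s))))) (proj₂ (proj₂ (proj₂ (proj₂ (proj₂ s))))) public

theorem1p1 : (m : ℕ → ℕ → ℤ) → IsMarkov m →
    ((k : ℚ) → κ₁ ≤ʳ fromℚ k →
    (b : ℚ) → MeetsD k b → IncreaseAlong m k b)
    × ((k : ℚ) → fromℚ k ≤ʳ κ₂ →
    (b : ℚ) → MeetsD k b → DecreaseAlong m k b)
    × ((k : ℚ) → κ₂ <ʳ fromℚ k → fromℚ k <ʳ κ₁ →
    Σ (List ℚ) λ exceptions →
    (b : ℚ) → MeetsD k b → b ∉ exceptions → ¬ MonotonicAlong m k b)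
    × ((k b : ℚ) → MeetsD k b → ¬ MonotonicAlong m k b →
    FirstDecreaseThenIncrease m k b)
    × ((k b : ℚ) → k < 0ℚ → MeetsDTwice k b →
    (P P′ Q Q′ : Point) → FirstTwo k b P P′ → LastTwo k b Q Q′ →
    (¬ MonotonicAlong m k b) ⇔ (ratio m P P′ < 1ℚ × 1ℚ < ratio m Q Q′))
theorem1p1 m M =
    (λ { k h b _ (x , y) (x′ , y′) c → let open Consecutive c in
         Ratio.1≤ratio (x , y) (x′ , y′) (m-positive x y (proj₁ (proj₁ left)))
           (v≤⇒m≤ x y x′ y′ (increase-step k h b x y x′ y′ (proj₁ left) (proj₂ left) (proj₁ right) (proj₂ right) ordered)) })
  , (λ { k h b _ (x , y) (x′ , y′) c → let open Consecutive c in
         Ratio.ratio≤1 (x , y) (x′ , y′) (m-positive x y (proj₁ (proj₁ left)))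
           (v≤⇒m≤ x′ y′ x y (decrease-step k h b x y x′ y′ (proj₁ left) (proj₂ left) (proj₁ right) (proj₂ right) ordered)) })
  , (λ k h₂ h₁ → AtSlope.not-monotonic k (Dg.negative k h₁) h₂ h₁)
  , (λ k b meets ¬mono → by-sign k b meets ¬mono (k ℚ.<? 0ℚ))
  , (λ k b k<0 _ P P′ Q Q′ → AtSlope.characterization k k<0 b P P′ Q Q′)
  where
  open Generalized m M
  by-sign : ∀ k b → MeetsD k b → ¬ MonotonicAlong m k b → Dec (k < 0ℚ) → FirstDecreaseThenIncrease m k b
  by-sign k b meets ¬mono (yes k<0) = AtSlope.unimodal k k<0 b meets
  by-sign k b meets ¬mono (no k≮0) = ⊥-elim (¬mono (inj₁ (monotone-nonneg k k≮0 b)))
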